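{- Let $n\geqslant 3$, let $q=p^h$ be a prime power, and let $c$ be a code word of $C_{n-1}(n,q)$ with $\mathrm{wt}(c)\leqslant B_{n,q}$. Then there is an $(n-3)$-dimensional subspace $\kappa$ of $\mathrm{PG}(n,q)$ such that $c$ can be written as an $\mathbb{F}_p$-linear combination of incidence vectors of hyperplanes of $\mathrm{PG}(n,q)$ that all contain $\kappa$.
   Context: $q=p^h$ with $p$ prime and $h\geqslant 1$. $\mathrm{PG}(n,q)$ is the $n$-dimensional Desarguesian projective space over $\mathbb{F}_q$. $\mathcal{V}(n,q)$ is the $\mathbb{F}_p$-vector space of functions from the point set of $\mathrm{PG}(n,q)$ to $\mathbb{F}_p$. A hyperplane $H$ is identified with its incidence vector, i.e. the function that is $1$ on points of $H$ and $0$ elsewhere. $C_{n-1}(n,q)$ is the subspace of $\mathcal{V}(n,q)$ spanned by the incidence vectors of all hyperplanes. For $v\in\mathcal{V}(n,q)$, $\mathrm{supp}(v)$ is the set of points $P$ with $v(P)\neq 0$, and $\mathrm{wt}(v)=|\mathrm{supp}(v)|$. The bound $B_{n,q}$ is defined by: $B_{n,q}=2q^{n-1}$ if $q<7$ or $q\in\{8,9,16,25,27,49\}$; $B_{n,q}=(3q-\sqrt{6q}-\tfrac12)q^{n-2}$ if $q\in\{7,11,13,17\}$; $B_{n,q}=(3q-\sqrt{6q}+\tfrac92)q^{n-2}$ if $q\in\{19,121\}$; $B_{n,q}=(4q-4\sqrt{q}-\tfrac{25}{2})q^{n-2}$ if $q\in\{29,31,32\}$; and $B_{n,q}=(4q-\sqrt{8q}-\tfrac{33}{2})q^{n-2}$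 for all other prime powers $q$. -}

module Defs where

open import Level using (0ℓ)
open import Algebra.Bundles using (CommutativeRing)
open import Data.Nat as ℕ using (ℕ; zero; suc; _∸_; _^_; _<ᵇ_; _≡ᵇ_; _%_)
open import Data.Integer as ℤ using (ℤ; +_; -[1+_])
open import Data.Bool as B using (Bool; true; false; not; _∨_; if_then_else_)
open import Data.Fin using (Fin; zero; suc)
open import Data.List using (List; []; _∷_; map; concatMap; filter; length; foldr; allFin)
open import Data.Bool.ListAction using (any)
open import Data.List.Relation.Unary.All using (All)
open import Data.Product using (Σ; _×_; _,_; proj₁; proj₂)
open import Relation.Nullary using (¬_; ¬?; yes; no)
open import Relation.Nullary.Decidable using (does)
open import Relation.Binary using (Decidable)
open import Relation.Binary.PropositionalEquality using (_≡_)

-- Finite fields of order q (all such fields are isomorphic, so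
-- "the" field F_q is represented by an arbitrary one).

record FiniteField (q : ℕ) : Set₁ where
  field
    commRing : CommutativeRing 0ℓ 0ℓ
  open CommutativeRing commRing public
  field
    _≟_       : Decidable _≈_
    1≉0       : ¬ (1# ≈ 0#)
    inverse   : ∀ x → ¬ (x ≈ 0#) → Σ Carrier λ y → (x * y) ≈ 1#
    enum      : Fin q → Carrier
    enum-inj  : ∀ i j → enum i ≈ enum j → i ≡ j
    enum-surj : ∀ x → Σ (Fin q) λ i → enum i ≈ x

module PG {q : ℕ} (F : FiniteField q) where
  open FiniteField F using (Carrier; _≈_; _+_; _*_; 0#; 1#; _≟_; enum)

  Vect : ℕ → Set
  Vect k = Fin k → Carrier

  cons : ∀ {k} → Carrier → Vect k → Vect (suc k)
  cons a v zero    = a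
  cons a v (suc i) = v i

  sumF : ∀ k → (Fin k → Carrier) → Carrier
  sumF zero    f = 0#
  sumF (suc k) f = f zero + sumF k (λ i → f (suc i))

  dot : ∀ {k} → Vect k → Vect k → Carrier
  dot {k} a x = sumF k (λ i → a i * x i)

  isZero : Carrier → Bool
  isZero x = does (x ≟ 0#)

  allVecs : ∀ k → List (Vect k)
  allVecs zero    = (λ ()) ∷ []
  allVecs (suc k) =
    concatMap (λ a → map (cons a) (allVecs k)) (map enum (allFin q))

  -- a vector is normalized iff it is nonzero and its first nonzero
  -- coordinate equals 1; normalized vectors of F^(n+1) are exactly one
  -- representative of each point of PG(n,q).
  normalized : ∀ {k} → Vect k → Bool
  normalized {zero}  x = false
  normalized {suc k} x =
    if isZero (x zero) then normalized (λ i → x (suc i)) else does (x zero ≟ 1#)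

  points : (n : ℕ) → List (Vect (suc n))
  points n = filter (λ x → normalized x B.≟ true) (allVecs (suc n))

  NonZeroVec : ∀ {k} → Vect k → Set
  NonZeroVec {k} a = ¬ (∀ i → a i ≈ 0#)

  -- hyperplane with (nonzero) dual coordinates a: value of its incidence
  -- vector at a point x (as a natural number 0/1, to be read in F_p)
  incidence : ∀ {k} → Vect k → Vect k → ℕ
  incidence a x = if isZero (dot a x) then 1 else 0

  -- an F_p-linear combination of hyperplanes: list of (coefficient, dual vector)
  Combination : ℕ → Set
  Combination n = List (ℕ × Vect (suc n))

  AllHyperplanes : ∀ {n} → Combination n → Set
  AllHyperplanes L = All (λ t → NonZeroVec (proj₂ t)) L

  eval : ∀ {n} → (p : ℕ) → .{{_ : ℕ.NonZero p}} → Combination n → Vect (suc n) → ℕ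
  eval p L x = foldr (λ t s → proj₁ t ℕ.* incidence (proj₂ t) x ℕ.+ s) 0 L % p

  wt : ∀ n → (p : ℕ) → .{{_ : ℕ.NonZero p}} → Combination n → ℕ
  wt n p L = length (filter (λ x → ¬? (eval p L x ℕ.≟ 0)) (points n))

  LinIndep : ∀ {m k} → (Fin m → Vect k) → Set
  LinIndep {m} {k} v =
    ∀ (λs : Fin m → Carrier) → (∀ i → sumF m (λ j → λs j * v j i) ≈ 0#) → ∀ j → λs j ≈ 0#

elemℕ : ℕ → List ℕ → Bool
elemℕ q xs = any (λ y → q ≡ᵇ y) xs

-- W ≤ (α q - √(β q) + g/2) q^(n-2), equivalently with
-- R = (2αq + g) q^(n-2) - 2W :  R ≥ 0  and  4βq (q^(n-2))² ≤ R².
SqrtBound : (α β : ℕ) (g : ℤ) (n q W : ℕ) → Set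
SqrtBound α β g n q W =
  (+ 0 ℤ.≤ R) × (+ (4 ℕ.* β ℕ.* q ℕ.* Q ℕ.* Q) ℤ.≤ R ℤ.* R)
  where
    Q = q ^ (n ∸ 2)
    R = (+ (2 ℕ.* α ℕ.* q) ℤ.+ g) ℤ.* + Q ℤ.- + (2 ℕ.* W)

WithinBound : (n q W : ℕ) → Set
WithinBound n q W =
  if (q <ᵇ 7) ∨ elemℕ q (8 ∷ 9 ∷ 16 ∷ 25 ∷ 27 ∷ 49 ∷ [])
    then W ℕ.≤ 2 ℕ.* q ^ (n ∸ 1)
  else if elemℕ q (7 ∷ 11 ∷ 13 ∷ 17 ∷ [])
    then SqrtBound 3 6 (ℤ.- (+ 1)) n q W
  else if elemℕ q (19 ∷ 121 ∷ [])
    then SqrtBound 3 6 (+ 9) n q W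
  else if elemℕ q (29 ∷ 31 ∷ 32 ∷ [])
    then SqrtBound 4 16 (ℤ.- (+ 25)) n q W
  else SqrtBound 4 8 (ℤ.- (+ 33)) n q W

-- A code word is viewed as a function c on F^(n+1) that does not change under nonzero scaling. If s of the q values on a line
-- are nonzero, polynomial moments along the q parallels of the line in any plane through it show that these carry at least
-- s (q + 1 - s) nonzero values altogether. So when the weight is small, every line meets the support in at most k or at least
-- q - k points, with k ≤ 3. A set with this property that is not too sparse in a subspace is dense there, hence the support has
-- a dense hyperplane section through each of its points; four of them would exceed the weight, so the support lies on at most
-- three hyperplanes. For weights below (2q + 1) q^(n-2) and for small q two hyperplanes suffice, because the restrictions of c
-- to affine charts are polynomials of low degree. A word supported on at most three hyperplanes is invariant under
-- translation by the common kernel of three linear forms (for q = 2 every word is). It therefore factors through a quotient of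
-- dimension three, and pulling the hyperplanes of a combination back along the projection gives hyperplanes through κ.

module Submission where

open import Defs
open import Level using (0ℓ)
open import Algebra.Bundles using (CommutativeRing; CommutativeMonoid; RawRing)
open import Algebra.Morphism.Structures using (IsRingMonomorphism)
import Algebra.Morphism.RingMonomorphism as RingMonomorphism
import Algebra.Properties.CommutativeMonoid.Sum
import Algebra.Solver.Ring
import Algebra.Solver.Ring.AlmostCommutativeRing as ACR
open import Algebra.Structures using (IsCommutativeMonoid; IsCommutativeRing)
open import Data.Bool as Bool using (Bool; true; false; if_then_else_)
open import Data.Empty using (⊥; ⊥-elim)
open import Data.Fin using (Fin; zero; suc; _≟_; toℕ; fromℕ<)
import Data.Fin.Permutation as Perm
import Data.Fin.Properties as Finₚ
open import Data.Integer as ℤ using (ℤ; -[1+_]) renaming (+_ to pos)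
import Data.Integer.Properties as ℤₚ
open import Data.List as List using (List; []; _∷_; length; foldr; map; concatMap; replicate; _++_; allFin; filter; take; upTo; tabulate)
open import Data.List.Membership.Propositional using (_∈_)
open import Data.List.Membership.Propositional.Properties using (∈-allFin; ∈-filter⁺; ∈-filter⁻; ∈-upTo⁺)
import Data.List.Properties as Lₚ
open import Data.List.Relation.Unary.All as All using (All; []; _∷_)
import Data.List.Relation.Unary.All.Properties as Allₚ
open import Data.List.Relation.Unary.AllPairs using ([]; _∷_)
open import Data.List.Relation.Unary.Any using (here; there)
open import Data.List.Relation.Unary.Unique.Propositional using (Unique)
import Data.List.Relation.Unary.Unique.Propositional.Properties as Uniqueₚ
open import Data.Maybe using (Maybe; just; nothing)
open import Data.Nat as ℕ using (ℕ; zero; suc; _≤_; _<_; z≤n; s≤s; _∸_; _⊓_; NonZero; _<ᵇ_; _≤ᵇ_; _≡ᵇ_)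
open import Data.Nat.Coprimality using (coprime-Bézout; prime⇒coprime)
open import Data.Nat.DivMod using (_/_; _%_; m≡m%n+[m/n]*n; m%n<n; m<n*o⇒m/o<n; m<n⇒m%n≡m)
open import Data.Nat.Divisibility using (_∣_; divides)
open import Data.Nat.GCD using (module Bézout)
open import Data.Nat.Primality using (Prime; prime?; prime⇒nonTrivial; prime⇒nonZero; prime⇒irreducible; euclidsLemma)
import Data.Nat.Properties as ℕₚ
open import Data.Nat.Tactic.RingSolver using (solve-∀)
open import Data.Product using (∃; Σ; _×_; _,_; proj₁; proj₂)
open import Data.Sum using (_⊎_; inj₁; inj₂)
open import Data.Vec as Vec using (Vec; []; _∷_; head; tail; lookup)
import Data.Vec.Properties as Vecₚ
open import Function using (_∘_)
open import Relation.Binary using (tri<; tri≈; tri>)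
open import Relation.Binary.PropositionalEquality
open import Relation.Nullary using (¬_; Dec; yes; no; ¬?; does)
open import Relation.Nullary.Decidable using (True; toWitness; map′; _×-dec_)
open import Relation.Unary using (Decidable)

-- The value of a word at the zero vector is the sum of its coefficients, and on every affine line
-- the values together with the value at the direction add up to this constant. That law of lines
-- makes words on few hyperplanes rigid. The obstacle is a pencil of three hyperplanes: the word may
-- vary along their common subspace, by an additive function. Over a prime field additive means
-- linear, and the kernel of this function supplies the third form. Over other fields a nonzero
-- additive function would make the word vanish at exactly q / p points of some affine line, and the
-- gap in the line intersections forbids that number. The dense sections are reached through a chain
-- of subspaces, from a point up to a hyperplane. A step may lose density, and self-improvement
-- restores it to θ / q. Here θ has to be large for four sections to exceed the weight, yet small
-- enough to be restored, which is why small orders come with individual numbers and large ones with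
-- θ = q - 7.

-- Finite fields carried by `Fin q`, with a ring solver

-- The elements are the indices themselves and equality is propositional, so that sums over the
-- field are sums over `Fin q`; an arbitrary `FiniteField` is transported here by `Transfer`.
record FinField (q : ℕ) : Set where
  infixl 6 _+_
  infixl 7 _*_
  infix 8 -_
  field
    _+_ _*_ : Fin q → Fin q → Fin q
    -_ : Fin q → Fin q
    0# 1# : Fin q
    isCommutativeRing : IsCommutativeRing _≡_ _+_ _*_ -_ 0# 1#
    1≢0 : 1# ≢ 0#
    inv : (x : Fin q) → x ≢ 0# → ∃ λ y → x * y ≡ 1#

  F : Set
  F = Fin q

  commutativeRing : CommutativeRing 0ℓ 0ℓ
  commutativeRing = record { isCommutativeRing = isCommutativeRing }

  open CommutativeRing commutativeRing public
    using (+-assoc; +-comm; +-identityˡ; +-identityʳ; -‿inverseˡ; -‿inverseʳ;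
           *-assoc; *-comm; *-identityˡ; *-identityʳ; distribˡ; distribʳ; zeroˡ; zeroʳ;
           +-commutativeMonoid; ring)

  open import Algebra.Properties.Ring ring public
    using (-‿distribˡ-*; -‿distribʳ-*; -0#≈0#; -‿+-comm; -‿involutive)

  infixl 6 _-_
  _-_ : F → F → F
  x - y = x + - y

  ⟦_⟧ : ℕ → F
  ⟦ zero ⟧ = 0#
  ⟦ suc n ⟧ = 1# + ⟦ n ⟧

  ⟦⟧-+ : ∀ m n → ⟦ m ℕ.+ n ⟧ ≡ ⟦ m ⟧ + ⟦ n ⟧
  ⟦⟧-+ zero n = sym (+-identityˡ _)
  ⟦⟧-+ (suc m) n = trans (cong (_+_ 1#) (⟦⟧-+ m n)) (sym (+-assoc _ _ _))

  ⟦⟧-* : ∀ m n → ⟦ m ℕ.* n ⟧ ≡ ⟦ m ⟧ * ⟦ n ⟧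
  ⟦⟧-* zero n = sym (zeroˡ _)
  ⟦⟧-* (suc m) n = begin
    ⟦ n ℕ.+ m ℕ.* n ⟧          ≡⟨ ⟦⟧-+ n (m ℕ.* n) ⟩
    ⟦ n ⟧ + ⟦ m ℕ.* n ⟧        ≡⟨ cong₂ _+_ (sym (*-identityˡ _)) (⟦⟧-* m n) ⟩
    1# * ⟦ n ⟧ + ⟦ m ⟧ * ⟦ n ⟧ ≡⟨ distribʳ _ _ _ ⟨
    (1# + ⟦ m ⟧) * ⟦ n ⟧       ∎
    where open ≡-Reasoning

  private
    ⟦_⟧ℤ : ℤ → F
    ⟦ pos n ⟧ℤ = ⟦ n ⟧
    ⟦ -[1+ n ] ⟧ℤ = - ⟦ suc n ⟧

    open ≡-Reasoning

    swap₂ : ∀ a b c → (a + b) + c ≡ (a + c) + b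
    swap₂ a b c = trans (+-assoc a b c) (trans (cong (a +_) (+-comm b c)) (sym (+-assoc a c b)))

    cancel₁ : ∀ a b → (1# + a) + - (1# + b) ≡ a + - b
    cancel₁ a b = begin
      (1# + a) + - (1# + b)     ≡⟨ cong ((1# + a) +_) (sym (-‿+-comm 1# b)) ⟩
      (1# + a) + (- 1# + - b)   ≡⟨ +-assoc (1# + a) (- 1#) (- b) ⟨
      ((1# + a) + - 1#) + - b   ≡⟨ cong (_+ - b) (swap₂ 1# a (- 1#)) ⟩
      ((1# + - 1#) + a) + - b   ≡⟨ cong (λ z → (z + a) + - b) (-‿inverseʳ 1#) ⟩
      (0# + a) + - b            ≡⟨ cong (_+ - b) (+-identityˡ a) ⟩
      a + - b                   ∎

    ⊖-homo : ∀ m n → ⟦ m ℤ.⊖ n ⟧ℤ ≡ ⟦ m ⟧ + - ⟦ n ⟧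
    ⊖-homo m zero = trans (sym (+-identityʳ _)) (cong (⟦ m ⟧ +_) (sym -0#≈0#))
    ⊖-homo zero (suc n) = sym (+-identityˡ _)
    ⊖-homo (suc m) (suc n) = begin
      ⟦ suc m ℤ.⊖ suc n ⟧ℤ      ≡⟨ cong ⟦_⟧ℤ (ℤₚ.[1+m]⊖[1+n]≡m⊖n m n) ⟩
      ⟦ m ℤ.⊖ n ⟧ℤ              ≡⟨ ⊖-homo m n ⟩
      ⟦ m ⟧ + - ⟦ n ⟧           ≡⟨ cancel₁ ⟦ m ⟧ ⟦ n ⟧ ⟨
      ⟦ suc m ⟧ + - ⟦ suc n ⟧   ∎

    neg-homo : ∀ i → ⟦ ℤ.- i ⟧ℤ ≡ - ⟦ i ⟧ℤ
    neg-homo (pos zero) = sym -0#≈0#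
    neg-homo (pos (suc n)) = refl
    neg-homo -[1+ n ] = sym (-‿involutive _)

    +-homoℤ : ∀ i j → ⟦ i ℤ.+ j ⟧ℤ ≡ ⟦ i ⟧ℤ + ⟦ j ⟧ℤ
    +-homoℤ (pos m) (pos n) = ⟦⟧-+ m n
    +-homoℤ (pos m) -[1+ n ] = ⊖-homo m (suc n)
    +-homoℤ -[1+ m ] (pos n) = trans (⊖-homo n (suc m)) (+-comm _ _)
    +-homoℤ -[1+ m ] -[1+ n ] = begin
      - ⟦ suc (suc (m ℕ.+ n)) ⟧    ≡⟨ cong (λ z → - ⟦ z ⟧) (cong suc (sym (ℕₚ.+-suc m n))) ⟩
      - ⟦ suc m ℕ.+ suc n ⟧        ≡⟨ cong -_ (⟦⟧-+ (suc m) (suc n)) ⟩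
      - (⟦ suc m ⟧ + ⟦ suc n ⟧)    ≡⟨ -‿+-comm _ _ ⟨
      - ⟦ suc m ⟧ + - ⟦ suc n ⟧    ∎

    *-homo-+ : ∀ m j → ⟦ pos m ℤ.* j ⟧ℤ ≡ ⟦ m ⟧ * ⟦ j ⟧ℤ
    *-homo-+ m (pos n) = trans (cong ⟦_⟧ℤ (sym (ℤₚ.pos-* m n))) (⟦⟧-* m n)
    *-homo-+ m -[1+ n ] = begin
      ⟦ pos m ℤ.* -[1+ n ] ⟧ℤ        ≡⟨ cong ⟦_⟧ℤ (sym (ℤₚ.neg-distribʳ-* (pos m) (pos (suc n)))) ⟩
      ⟦ ℤ.- (pos m ℤ.* pos (suc n)) ⟧ℤ   ≡⟨ neg-homo (pos m ℤ.* pos (suc n)) ⟩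
      - ⟦ pos m ℤ.* pos (suc n) ⟧ℤ       ≡⟨ cong -_ (*-homo-+ m (pos (suc n))) ⟩
      - (⟦ m ⟧ * ⟦ suc n ⟧)        ≡⟨ -‿distribʳ-* _ _ ⟩
      ⟦ m ⟧ * - ⟦ suc n ⟧          ∎

    *-homoℤ : ∀ i j → ⟦ i ℤ.* j ⟧ℤ ≡ ⟦ i ⟧ℤ * ⟦ j ⟧ℤ
    *-homoℤ (pos m) j = *-homo-+ m j
    *-homoℤ -[1+ m ] j = begin
      ⟦ -[1+ m ] ℤ.* j ⟧ℤ        ≡⟨ cong ⟦_⟧ℤ (sym (ℤₚ.neg-distribˡ-* (pos (suc m)) j)) ⟩
      ⟦ ℤ.- (pos (suc m) ℤ.* j) ⟧ℤ   ≡⟨ neg-homo (pos (suc m) ℤ.* j) ⟩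
      - ⟦ pos (suc m) ℤ.* j ⟧ℤ       ≡⟨ cong -_ (*-homo-+ (suc m) j) ⟩
      - (⟦ suc m ⟧ * ⟦ j ⟧ℤ)     ≡⟨ -‿distribˡ-* _ _ ⟩
      - ⟦ suc m ⟧ * ⟦ j ⟧ℤ       ∎

    almost : ACR.AlmostCommutativeRing 0ℓ 0ℓ
    almost = ACR.fromCommutativeRing commutativeRing

    -- Agrees with ⟦_⟧ℤ, but sends 1 to 1# on the nose, so that the solver reads constants as written.
    val : ℤ → F
    val (pos 0) = 0#
    val (pos 1) = 1#
    val (pos (suc (suc n))) = ⟦ suc (suc n) ⟧
    val -[1+ 0 ] = - 1#
    val -[1+ suc n ] = - ⟦ suc (suc n) ⟧

    val≡ : ∀ i → val i ≡ ⟦ i ⟧ℤ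
    val≡ (pos 0) = refl
    val≡ (pos 1) = sym (+-identityʳ 1#)
    val≡ (pos (suc (suc n))) = refl
    val≡ -[1+ 0 ] = cong -_ (sym (+-identityʳ 1#))
    val≡ -[1+ suc n ] = refl

    morphism : ℤ.+-*-rawRing ACR.-Raw-AlmostCommutative⟶ almost
    morphism = record
      { ⟦_⟧ = val
      ; +-homo = λ i j → trans (val≡ (i ℤ.+ j)) (trans (+-homoℤ i j) (sym (cong₂ _+_ (val≡ i) (val≡ j))))
      ; *-homo = λ i j → trans (val≡ (i ℤ.* j)) (trans (*-homoℤ i j) (sym (cong₂ _*_ (val≡ i) (val≡ j))))
      ; -‿homo = λ i → trans (val≡ (ℤ.- i)) (trans (neg-homo i) (cong -_ (sym (val≡ i))))
      ; 0-homo = refl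
      ; 1-homo = refl
      }

    dec : ∀ i j → Maybe (val i ≡ val j)
    dec i j with i ℤ.≟ j
    ... | yes eq = just (cong val eq)
    ... | no _ = nothing

  open Algebra.Solver.Ring ℤ.+-*-rawRing almost morphism dec public
    using (Polynomial; solve; _:=_; _:+_; _:*_; :-_; _:-_; con)

  :1 :0 : ∀ {n} → Polynomial n
  :1 = con (pos 1)
  :0 = con (pos 0)

-- Finite sums over indices and over vectors

module Summation {A : Set} {_∙_ : A → A → A} {ε : A} (isCM : IsCommutativeMonoid _≡_ _∙_ ε) where

  private
    M : CommutativeMonoid 0ℓ 0ℓ
    M = record { isCommutativeMonoid = isCM }
    module M = CommutativeMonoid M
    module S = Algebra.Properties.CommutativeMonoid.Sum M

  -- Sums stay folded and are handled through the equations below, since unfolding them would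
  -- produce nested additions over `Fin q`.
  opaque
    ∑ : ∀ {n} → (Fin n → A) → A
    ∑ = S.sum

    ∑-nil : (f : Fin 0 → A) → ∑ f ≡ ε
    ∑-nil f = refl

    ∑-suc : ∀ {n} (f : Fin (suc n) → A) → ∑ f ≡ f zero ∙ ∑ (λ i → f (suc i))
    ∑-suc f = refl

    ∑-cong : ∀ {n} {f g : Fin n → A} → (∀ i → f i ≡ g i) → ∑ f ≡ ∑ g
    ∑-cong = S.sum-cong-≗

    ∑-ε : ∀ n → ∑ {n} (λ _ → ε) ≡ ε
    ∑-ε zero = refl
    ∑-ε (suc n) = trans (M.identityˡ _) (∑-ε n)

    ∑-∙ : ∀ {n} (f g : Fin n → A) → ∑ (λ i → f i ∙ g i) ≡ ∑ f ∙ ∑ g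
    ∑-∙ = S.∑-distrib-+

    ∑-comm : ∀ {m n} (f : Fin m → Fin n → A) → ∑ (λ i → ∑ (f i)) ≡ ∑ (λ j → ∑ (λ i → f i j))
    ∑-comm = S.∑-comm

    ∑-bij : ∀ {n} (φ ψ : Fin n → Fin n) → (∀ i → φ (ψ i) ≡ i) → (∀ i → ψ (φ i) ≡ i) →
            (f : Fin n → A) → ∑ (λ i → f (φ i)) ≡ ∑ f
    ∑-bij φ ψ φψ ψφ f = sym (S.sum-permute f (Perm.permutation φ ψ
      φψ ψφ))

    ∑-single : ∀ {n} (a : Fin n) {f : Fin n → A} → (∀ i → i ≢ a → f i ≡ ε) → ∑ f ≡ f a
    ∑-single {suc n} zero {f} h =
      trans (cong (f zero ∙_) (trans (∑-cong (λ i → h (suc i) λ ())) (∑-ε n))) (M.identityʳ _)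
    ∑-single {suc n} (suc a) {f} h =
      trans (cong₂ _∙_ (h zero λ ()) (∑-single a (λ i i≢a → h (suc i) (λ e → i≢a (Finₚ.suc-injective e)))))
            (M.identityˡ _)

  ∑-double : ∀ {n} {a b : Fin n} (f : Fin n → A) → a ≢ b → (∀ i → i ≢ a → i ≢ b → f i ≡ ε) → ∑ f ≡ f a ∙ f b
  ∑-double {n} {a} {b} f a≢b off = trans (∑-cong split) (trans (∑-∙ (only a) (only b)) (cong₂ _∙_
      (trans (∑-single a (λ i i≢a → only-≢ a i i≢a)) (only-≡ a))
      (trans (∑-single b (λ i i≢b → only-≢ b i i≢b)) (only-≡ b))))
    where
    only : Fin n → Fin n → A
    only c i with i ≟ c
    ... | yes _ = f i
    ... | no _ = ε
    only-≢ : ∀ c i → i ≢ c → only c i ≡ ε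
    only-≢ c i h with i ≟ c
    ... | yes e = ⊥-elim (h e)
    ... | no _ = refl
    only-≡ : ∀ c → only c c ≡ f c
    only-≡ c with c ≟ c
    ... | yes _ = refl
    ... | no h = ⊥-elim (h refl)
    split : ∀ i → f i ≡ only a i ∙ only b i
    split i with i ≟ a | i ≟ b
    ... | yes refl | yes e = ⊥-elim (a≢b e)
    ... | yes _ | no _ = sym (M.identityʳ _)
    ... | no _ | yes _ = sym (M.identityˡ _)
    ... | no h | no h′ = trans (off i h h′) (sym (M.identityˡ ε))

  module _ {q : ℕ} where

    opaque
      ΣV : ∀ {m} → (Vec (Fin q) m → A) → A
      ΣV {zero} f = f []
      ΣV {suc m} f = ∑ (λ a → ΣV (λ v → f (a ∷ v)))

      ΣV-[] : (f : Vec (Fin q) 0 → A) → ΣV f ≡ f []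
      ΣV-[] f = refl

      ΣV-∷ : ∀ {m} (f : Vec (Fin q) (suc m) → A) → ΣV f ≡ ∑ (λ a → ΣV (λ v → f (a ∷ v)))
      ΣV-∷ f = refl

      ΣV-cong : ∀ {m} {f g : Vec (Fin q) m → A} → (∀ v → f v ≡ g v) → ΣV f ≡ ΣV g
      ΣV-cong {zero} h = h []
      ΣV-cong {suc m} h = ∑-cong (λ a → ΣV-cong (λ v → h (a ∷ v)))

      ΣV-ε : ∀ m → ΣV {m} (λ _ → ε) ≡ ε
      ΣV-ε zero = refl
      ΣV-ε (suc m) = trans (∑-cong (λ _ → ΣV-ε m)) (∑-ε q)

      ΣV-zero : ∀ {m} {f : Vec (Fin q) m → A} → (∀ v → f v ≡ ε) → ΣV f ≡ ε
      ΣV-zero {m} h = trans (ΣV-cong h) (ΣV-ε m)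

      ΣV-∙ : ∀ {m} (f g : Vec (Fin q) m → A) → ΣV (λ v → f v ∙ g v) ≡ ΣV f ∙ ΣV g
      ΣV-∙ {zero} f g = refl
      ΣV-∙ {suc m} f g = trans (∑-cong (λ a → ΣV-∙ (λ v → f (a ∷ v)) (λ v → g (a ∷ v)))) (∑-∙ _ _)

      ΣV-single : ∀ {m} (w : Vec (Fin q) m) {f : Vec (Fin q) m → A} → (∀ v → v ≢ w → f v ≡ ε) → ΣV f ≡ f w
      ΣV-single [] h = refl
      ΣV-single (a ∷ w) h = trans (∑-single a (λ b b≢a → ΣV-zero (λ v → h (b ∷ v) (λ e → b≢a (cong head e)))))
        (ΣV-single w (λ v v≢w → h (a ∷ v) (λ e → v≢w (cong tail e))))

      ∑-ΣV : ∀ {n m} (f : Fin n → Vec (Fin q) m → A) → ∑ (λ i → ΣV (f i)) ≡ ΣV (λ v → ∑ (λ i → f i v))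
      ∑-ΣV {m = zero} f = refl
      ∑-ΣV {m = suc m} f = trans (∑-comm _) (∑-cong (λ a → ∑-ΣV (λ i v → f i (a ∷ v))))

      ΣV-comm : ∀ {k m} (f : Vec (Fin q) k → Vec (Fin q) m → A) →
                ΣV (λ x → ΣV (f x)) ≡ ΣV (λ y → ΣV (λ x → f x y))
      ΣV-comm {zero} f = refl
      ΣV-comm {suc k} f = trans (∑-cong (λ a → ΣV-comm (λ x → f (a ∷ x)))) (∑-ΣV (λ a y → ΣV (λ x → f (a ∷ x) y)))

module ℕSum = Summation ℕₚ.+-0-isCommutativeMonoid

open ℕSum using (∑; ∑-nil; ∑-suc; ∑-cong; ∑-∙; ∑-comm; ∑-ΣV; ΣV; ΣV-[]; ΣV-∷; ΣV-cong; ΣV-∙; ΣV-comm; ΣV-single; ΣV-zero)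

∑-mono : ∀ {n} {f g : Fin n → ℕ} → (∀ i → f i ≤ g i) → ∑ f ≤ ∑ g
∑-mono {zero} h = ℕₚ.≤-reflexive (trans (∑-nil _) (sym (∑-nil _)))
∑-mono {suc n} {f} {g} h = subst₂ _≤_ (sym (∑-suc f)) (sym (∑-suc g)) (ℕₚ.+-mono-≤ (h zero) (∑-mono (λ i → h (suc i))))

∑-const : ∀ n c → ∑ {n} (λ _ → c) ≡ n ℕ.* c
∑-const zero c = ∑-nil _
∑-const (suc n) c = trans (∑-suc _) (cong (c ℕ.+_) (∑-const n c))

∑-*ˡ : ∀ {n} c (f : Fin n → ℕ) → ∑ (λ i → c ℕ.* f i) ≡ c ℕ.* ∑ f
∑-*ˡ {zero} c f = trans (∑-nil _) (trans (sym (ℕₚ.*-zeroʳ c)) (cong (c ℕ.*_) (sym (∑-nil f))))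
∑-*ˡ {suc n} c f = trans (∑-suc _) (trans (cong (c ℕ.* f zero ℕ.+_) (∑-*ˡ c (λ i → f (suc i))))
  (trans (sym (ℕₚ.*-distribˡ-+ c _ _)) (cong (c ℕ.*_) (sym (∑-suc f)))))

∑-term : ∀ {n} (f : Fin n → ℕ) i → f i ≤ ∑ f
∑-term {suc n} f zero = subst (f zero ≤_) (sym (∑-suc f)) (ℕₚ.m≤m+n _ _)
∑-term {suc n} f (suc i) = subst (f (suc i) ≤_) (sym (∑-suc f))
  (ℕₚ.≤-trans (∑-term (λ j → f (suc j)) i) (ℕₚ.m≤n+m _ _))

-- `B` is added on the left to avoid the truncated difference n - 1. The lemma serves sums over
-- scalars in which 0 is exceptional and all nonzero scalars contribute alike.
∑-two : ∀ {n} (a : Fin n) (g : Fin n → ℕ) {A B} → g a ≡ A → (∀ i → i ≢ a → g i ≡ B) → ∑ g ℕ.+ B ≡ A ℕ.+ n ℕ.* B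
∑-two {n} a g {A} {B} ga gi = begin
  ∑ g ℕ.+ B                          ≡⟨ cong (∑ g ℕ.+_) (sym (trans (ℕSum.∑-single a (off B)) (at B))) ⟩
  ∑ g ℕ.+ ∑ (only B)                 ≡⟨ ℕSum.∑-∙ g (only B) ⟨
  ∑ (λ i → g i ℕ.+ only B i)         ≡⟨ ∑-cong pointwise ⟩
  ∑ (λ i → only A i ℕ.+ B)           ≡⟨ ℕSum.∑-∙ (only A) (λ _ → B) ⟩
  ∑ (only A) ℕ.+ ∑ {n} (λ _ → B)     ≡⟨ cong₂ ℕ._+_ (trans (ℕSum.∑-single a (off A)) (at A)) (∑-const n B) ⟩
  A ℕ.+ n ℕ.* B                      ∎
  where
  open ≡-Reasoning
  only : ℕ → Fin n → ℕ
  only c i with i ≟ a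
  ... | yes _ = c
  ... | no _ = 0
  off : ∀ c i → i ≢ a → only c i ≡ 0
  off c i n with i ≟ a
  ... | yes e = ⊥-elim (n e)
  ... | no _ = refl
  at : ∀ c → only c a ≡ c
  at c with a ≟ a
  ... | yes _ = refl
  ... | no n = ⊥-elim (n refl)
  pointwise : ∀ i → g i ℕ.+ only B i ≡ only A i ℕ.+ B
  pointwise i with i ≟ a
  ... | yes refl = cong (ℕ._+ B) ga
  ... | no n = trans (ℕₚ.+-identityʳ _) (gi i n)

module _ {q : ℕ} where

  opaque
    unfolding Summation.ΣV

    ΣV-mono : ∀ {m} {f g : Vec (Fin q) m → ℕ} → (∀ v → f v ≤ g v) → ΣV f ≤ ΣV g
    ΣV-mono {zero} h = h []
    ΣV-mono {suc m} h = ∑-mono (λ a → ΣV-mono (λ v → h (a ∷ v)))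

    ΣV-const : ∀ m c → ΣV {q} {m} (λ _ → c) ≡ q ℕ.^ m ℕ.* c
    ΣV-const zero c = sym (ℕₚ.*-identityˡ c)
    ΣV-const (suc m) c = trans (∑-cong (λ _ → ΣV-const m c))
      (trans (∑-const q _) (sym (ℕₚ.*-assoc q (q ℕ.^ m) c)))

    ΣV-*ˡ : ∀ {m} c (f : Vec (Fin q) m → ℕ) → ΣV (λ v → c ℕ.* f v) ≡ c ℕ.* ΣV f
    ΣV-*ˡ {zero} c f = refl
    ΣV-*ˡ {suc m} c f = trans (∑-cong (λ a → ΣV-*ˡ c (λ v → f (a ∷ v)))) (∑-*ˡ c _)

    ΣV-term : ∀ {m} (f : Vec (Fin q) m → ℕ) v → f v ≤ ΣV f
    ΣV-term {zero} f [] = ℕₚ.≤-refl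
    ΣV-term {suc m} f (a ∷ v) =
      ℕₚ.≤-trans (ΣV-term (λ v → f (a ∷ v)) v) (∑-term (λ b → ΣV (λ v → f (b ∷ v))) a)

  anyV? : ∀ {m} {P : Vec (Fin q) m → Set} → (∀ v → Dec (P v)) → Dec (∃ P)
  anyV? {zero} P? = map′ (λ p → [] , p) (λ { ([] , p) → p }) (P? [])
  anyV? {suc m} P? = map′ (λ { (a , v , p) → (a ∷ v) , p }) (λ { ((a ∷ v) , p) → a , v , p })
    (Finₚ.any? (λ a → anyV? (λ v → P? (a ∷ v))))

  findV : ∀ {m} {P : Vec (Fin q) m → Set} → (∀ v → Dec (P v)) → ∃ P ⊎ (∀ v → ¬ P v)
  findV P? with anyV? P?
  ... | yes p = inj₁ p
  ... | no ¬p = inj₂ (λ v pv → ¬p (v , pv))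

-- Vectors, linear combinations and the dot product

module Vectors {q : ℕ} (𝔽 : FinField q) where
  open FinField 𝔽 public

  module FSum = Summation (CommutativeMonoid.isCommutativeMonoid +-commutativeMonoid)
  open FSum public using () renaming
    (∑ to ∑F; ∑-nil to ∑F-nil; ∑-suc to ∑F-suc; ∑-cong to ∑F-cong; ∑-ε to ∑F-0; ∑-∙ to ∑F-+; ∑-comm to ∑F-comm; ∑-bij to ∑F-bij; ∑-single to ∑F-single; ∑-double to ∑F-double;
     ΣV to ΣF; ΣV-[] to ΣF-[]; ΣV-∷ to ΣF-∷; ΣV-cong to ΣF-cong; ΣV-ε to ΣF-0; ΣV-zero to ΣF-zero; ΣV-∙ to ΣF-+; ∑-ΣV to ∑F-ΣF; ΣV-comm to ΣF-comm)

  ∑F-*ˡ : ∀ {n} c (f : Fin n → F) → ∑F (λ i → c * f i) ≡ c * ∑F f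
  ∑F-*ˡ {zero} c f = trans (∑F-nil _) (trans (sym (zeroʳ c)) (cong (c *_) (sym (∑F-nil f))))
  ∑F-*ˡ {suc n} c f = trans (∑F-suc _) (trans (cong (c * f zero +_) (∑F-*ˡ c (λ i → f (suc i))))
    (trans (sym (distribˡ c _ _)) (cong (c *_) (sym (∑F-suc f)))))

  ∑F-*ʳ : ∀ {n} c (f : Fin n → F) → ∑F (λ i → f i * c) ≡ ∑F f * c
  ∑F-*ʳ c f = trans (∑F-cong (λ i → *-comm (f i) c)) (trans (∑F-*ˡ c f) (*-comm c _))

  opaque
    unfolding Summation.ΣV

    ΣF-*ˡ : ∀ {m} c (f : Vec F m → F) → ΣF (λ v → c * f v) ≡ c * ΣF f
    ΣF-*ˡ {zero} c f = refl
    ΣF-*ˡ {suc m} c f = trans (∑F-cong (λ a → ΣF-*ˡ c (λ v → f (a ∷ v)))) (∑F-*ˡ c _)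

  ∑F-const : ∀ n c → ∑F {n} (λ _ → c) ≡ ⟦ n ⟧ * c
  ∑F-const zero c = trans (∑F-nil _) (sym (zeroˡ c))
  ∑F-const (suc n) c = trans (∑F-suc _) (trans (cong₂ _+_ (sym (*-identityˡ c)) (∑F-const n c)) (sym (distribʳ c _ _)))

  -- Totalised with value 0 at 0, which makes inversion an involution of the whole field; `reflect`
  -- reindexes a sum by it.
  _⁻¹ : F → F
  x ⁻¹ with x ≟ 0#
  ... | yes _ = 0#
  ... | no x≢0 = proj₁ (inv x x≢0)

  ⁻¹-inverseʳ : ∀ {x} → x ≢ 0# → x * x ⁻¹ ≡ 1#
  ⁻¹-inverseʳ {x} x≢0 with x ≟ 0#
  ... | yes x≡0 = ⊥-elim (x≢0 x≡0)
  ... | no n = proj₂ (inv x n)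

  ⁻¹-inverseˡ : ∀ {x} → x ≢ 0# → x ⁻¹ * x ≡ 1#
  ⁻¹-inverseˡ x≢0 = trans (*-comm _ _) (⁻¹-inverseʳ x≢0)

  *-cancelˡ : ∀ {x} → x ≢ 0# → ∀ {y z} → x * y ≡ x * z → y ≡ z
  *-cancelˡ {x} x≢0 {y} {z} e = begin
    y                ≡⟨ *-identityˡ y ⟨
    1# * y           ≡⟨ cong (_* y) (⁻¹-inverseˡ x≢0) ⟨
    x ⁻¹ * x * y     ≡⟨ *-assoc _ _ _ ⟩
    x ⁻¹ * (x * y)   ≡⟨ cong (x ⁻¹ *_) e ⟩
    x ⁻¹ * (x * z)   ≡⟨ *-assoc _ _ _ ⟨
    x ⁻¹ * x * z     ≡⟨ cong (_* z) (⁻¹-inverseˡ x≢0) ⟩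
    1# * z           ≡⟨ *-identityˡ z ⟩
    z                ∎
    where open ≡-Reasoning

  *-zero-cases : ∀ {x y} → x * y ≡ 0# → x ≡ 0# ⊎ y ≡ 0#
  *-zero-cases {x} {y} e with x ≟ 0#
  ... | yes x≡0 = inj₁ x≡0
  ... | no x≢0 = inj₂ (*-cancelˡ x≢0 (trans e (sym (zeroʳ x))))

  *-≢0 : ∀ {x y} → x ≢ 0# → y ≢ 0# → x * y ≢ 0#
  *-≢0 x≢0 y≢0 e with *-zero-cases e
  ... | inj₁ x≡0 = x≢0 x≡0
  ... | inj₂ y≡0 = y≢0 y≡0

  ⁻¹-≢0 : ∀ {x} → x ≢ 0# → x ⁻¹ ≢ 0#
  ⁻¹-≢0 {x} x≢0 e = 1≢0 (trans (sym (⁻¹-inverseʳ x≢0)) (trans (cong (x *_) e) (zeroʳ x)))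

  x-y≡0⇒x≡y : ∀ {x y} → x - y ≡ 0# → x ≡ y
  x-y≡0⇒x≡y {x} {y} e = begin
    x              ≡⟨ solve 2 (λ x y → x := (x :- y) :+ y) refl x y ⟩
    (x - y) + y    ≡⟨ cong (_+ y) e ⟩
    0# + y         ≡⟨ +-identityˡ y ⟩
    y              ∎
    where open ≡-Reasoning

  +-cancelˡ : ∀ x {y z} → x + y ≡ x + z → y ≡ z
  +-cancelˡ x {y} {z} e = begin
    y              ≡⟨ solve 2 (λ x y → y := :- x :+ (x :+ y)) refl x y ⟩
    - x + (x + y)  ≡⟨ cong (- x +_) e ⟩
    - x + (x + z)  ≡⟨ solve 2 (λ x y → :- x :+ (x :+ y) := y) refl x z ⟩
    z              ∎
    where open ≡-Reasoning

  ∑F-shift : ∀ b (f : F → F) → ∑F (λ a → f (a + b)) ≡ ∑F f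
  ∑F-shift b f = ∑F-bij (_+ b) (_- b)
    (λ a → solve 2 (λ a b → a :- b :+ b := a) refl a b)
    (λ a → solve 2 (λ a b → a :+ b :- b := a) refl a b) f

  ∑-shift : ∀ b (f : F → ℕ) → ∑ (λ a → f (a + b)) ≡ ∑ f
  ∑-shift b f = ℕSum.∑-bij (_+ b) (_- b)
    (λ a → solve 2 (λ a b → a :- b :+ b := a) refl a b)
    (λ a → solve 2 (λ a b → a :+ b :- b := a) refl a b) f

  module _ {r : F} (r≢0 : r ≢ 0#) where
    private
      rr⁻¹ : ∀ a → r * (r ⁻¹ * a) ≡ a
      rr⁻¹ a = trans (sym (*-assoc r (r ⁻¹) a)) (trans (cong (_* a) (⁻¹-inverseʳ r≢0)) (*-identityˡ a))
      r⁻¹r : ∀ a → r ⁻¹ * (r * a) ≡ a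
      r⁻¹r a = trans (sym (*-assoc (r ⁻¹) r a)) (trans (cong (_* a) (⁻¹-inverseˡ r≢0)) (*-identityˡ a))

    ∑F-scale : ∀ (f : F → F) → ∑F (λ a → f (r * a)) ≡ ∑F f
    ∑F-scale = ∑F-bij (r *_) (r ⁻¹ *_) rr⁻¹ r⁻¹r

    ∑-scale : ∀ (f : F → ℕ) → ∑ (λ a → f (r * a)) ≡ ∑ f
    ∑-scale = ℕSum.∑-bij (r *_) (r ⁻¹ *_) rr⁻¹ r⁻¹r

  infixl 6 _⊕_
  infixr 7 _·_

  _⊕_ : ∀ {n} → Vec F n → Vec F n → Vec F n
  [] ⊕ [] = []
  (a ∷ x) ⊕ (b ∷ y) = (a + b) ∷ (x ⊕ y)

  _·_ : ∀ {n} → F → Vec F n → Vec F n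
  r · [] = []
  r · (a ∷ x) = (r * a) ∷ (r · x)

  𝟎 : ∀ {n} → Vec F n
  𝟎 {zero} = []
  𝟎 {suc n} = 0# ∷ 𝟎

  dot : ∀ {n} → Vec F n → Vec F n → F
  dot [] [] = 0#
  dot (a ∷ x) (b ∷ y) = a * b + dot x y

  ⊕-assoc : ∀ {n} (x y z : Vec F n) → (x ⊕ y) ⊕ z ≡ x ⊕ (y ⊕ z)
  ⊕-assoc [] [] [] = refl
  ⊕-assoc (a ∷ x) (b ∷ y) (c ∷ z) = cong₂ _∷_ (+-assoc a b c) (⊕-assoc x y z)

  ⊕-comm : ∀ {n} (x y : Vec F n) → x ⊕ y ≡ y ⊕ x
  ⊕-comm [] [] = refl
  ⊕-comm (a ∷ x) (b ∷ y) = cong₂ _∷_ (+-comm a b) (⊕-comm x y)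

  ⊕-identityʳ : ∀ {n} (x : Vec F n) → x ⊕ 𝟎 ≡ x
  ⊕-identityʳ [] = refl
  ⊕-identityʳ (a ∷ x) = cong₂ _∷_ (+-identityʳ a) (⊕-identityʳ x)

  ⊕-identityˡ : ∀ {n} (x : Vec F n) → 𝟎 ⊕ x ≡ x
  ⊕-identityˡ x = trans (⊕-comm 𝟎 x) (⊕-identityʳ x)

  ·-zeroˡ : ∀ {n} (x : Vec F n) → 0# · x ≡ 𝟎
  ·-zeroˡ [] = refl
  ·-zeroˡ (a ∷ x) = cong₂ _∷_ (zeroˡ a) (·-zeroˡ x)

  ·-zeroʳ : ∀ {n} r → r · 𝟎 {n} ≡ 𝟎
  ·-zeroʳ {zero} r = refl
  ·-zeroʳ {suc n} r = cong₂ _∷_ (zeroʳ r) (·-zeroʳ r)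

  ·-identity : ∀ {n} (x : Vec F n) → 1# · x ≡ x
  ·-identity [] = refl
  ·-identity (a ∷ x) = cong₂ _∷_ (*-identityˡ a) (·-identity x)

  ·-assoc : ∀ {n} r s (x : Vec F n) → r · (s · x) ≡ (r * s) · x
  ·-assoc r s [] = refl
  ·-assoc r s (a ∷ x) = cong₂ _∷_ (sym (*-assoc r s a)) (·-assoc r s x)

  ·-distribʳ : ∀ {n} r s (x : Vec F n) → (r + s) · x ≡ r · x ⊕ s · x
  ·-distribʳ r s [] = refl
  ·-distribʳ r s (a ∷ x) = cong₂ _∷_ (distribʳ a r s) (·-distribʳ r s x)

  ·-distribˡ : ∀ {n} r (x y : Vec F n) → r · (x ⊕ y) ≡ r · x ⊕ r · y
  ·-distribˡ r [] [] = refl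
  ·-distribˡ r (a ∷ x) (b ∷ y) = cong₂ _∷_ (distribˡ r a b) (·-distribˡ r x y)

  ⊖-cancelʳ : ∀ {n} (x y : Vec F n) → (x ⊕ (- 1#) · y) ⊕ y ≡ x
  ⊖-cancelʳ [] [] = refl
  ⊖-cancelʳ (a ∷ x) (b ∷ y) =
    cong₂ _∷_ (solve 2 (λ a b → a :+ (:- :1) :* b :+ b := a) refl a b) (⊖-cancelʳ x y)

  ⊖-cancelʳ′ : ∀ {n} (x y : Vec F n) → (x ⊕ y) ⊕ (- 1#) · y ≡ x
  ⊖-cancelʳ′ [] [] = refl
  ⊖-cancelʳ′ (a ∷ x) (b ∷ y) =
    cong₂ _∷_ (solve 2 (λ a b → a :+ b :+ (:- :1) :* b := a) refl a b) (⊖-cancelʳ′ x y)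

  dot-⊕ʳ : ∀ {n} (a x y : Vec F n) → dot a (x ⊕ y) ≡ dot a x + dot a y
  dot-⊕ʳ [] [] [] = sym (+-identityˡ 0#)
  dot-⊕ʳ (a ∷ as) (x ∷ xs) (y ∷ ys) = trans (cong (a * (x + y) +_) (dot-⊕ʳ as xs ys))
    (solve 5 (λ a x y u v → a :* (x :+ y) :+ (u :+ v) := (a :* x :+ u) :+ (a :* y :+ v)) refl a x y _ _)

  dot-·ʳ : ∀ {n} (a : Vec F n) r x → dot a (r · x) ≡ r * dot a x
  dot-·ʳ [] r [] = sym (zeroʳ r)
  dot-·ʳ (a ∷ as) r (x ∷ xs) = trans (cong (a * (r * x) +_) (dot-·ʳ as r xs))
    (solve 4 (λ a r x u → a :* (r :* x) :+ r :* u := r :* (a :* x :+ u)) refl a r x _)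

  dot-comm : ∀ {n} (x y : Vec F n) → dot x y ≡ dot y x
  dot-comm [] [] = refl
  dot-comm (a ∷ x) (b ∷ y) = cong₂ _+_ (*-comm a b) (dot-comm x y)

  dot-⊕ˡ : ∀ {n} (x y a : Vec F n) → dot (x ⊕ y) a ≡ dot x a + dot y a
  dot-⊕ˡ x y a = trans (dot-comm (x ⊕ y) a) (trans (dot-⊕ʳ a x y) (cong₂ _+_ (dot-comm a x) (dot-comm a y)))

  dot-·ˡ : ∀ {n} r (x a : Vec F n) → dot (r · x) a ≡ r * dot x a
  dot-·ˡ r x a = trans (dot-comm (r · x) a) (trans (dot-·ʳ a r x) (cong (r *_) (dot-comm a x)))

  dot-𝟎ʳ : ∀ {n} (a : Vec F n) → dot a 𝟎 ≡ 0#
  dot-𝟎ʳ [] = refl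
  dot-𝟎ʳ (a ∷ as) = trans (cong₂ _+_ (zeroʳ a) (dot-𝟎ʳ as)) (+-identityˡ 0#)

  dot-𝟎ˡ : ∀ {n} (a : Vec F n) → dot 𝟎 a ≡ 0#
  dot-𝟎ˡ a = trans (dot-comm 𝟎 a) (dot-𝟎ʳ a)

  _≟V_ : ∀ {n} (x y : Vec F n) → Dec (x ≡ y)
  _≟V_ = Vecₚ.≡-dec _≟_

  opaque
    unfolding Summation.ΣV

    ΣV-shift : ∀ {m} (y : Vec F m) (f : Vec F m → ℕ) → ΣV (λ x → f (x ⊕ y)) ≡ ΣV f
    ΣV-shift [] f = refl
    ΣV-shift (b ∷ y) f = trans (∑-cong (λ a → ΣV-shift y (λ x → f ((a + b) ∷ x))))
      (∑-shift b (λ a → ΣV (λ x → f (a ∷ x))))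

    ΣF-scale : ∀ {m r} → r ≢ 0# → (f : Vec F m → F) → ΣF (λ x → f (r · x)) ≡ ΣF f
    ΣF-scale {zero} r≢0 f = refl
    ΣF-scale {suc m} {r} r≢0 f = trans (∑F-cong (λ a → ΣF-scale r≢0 (λ x → f ((r * a) ∷ x))))
      (∑F-scale r≢0 (λ a → ΣF (λ x → f (a ∷ x))))

    ΣV-scale : ∀ {m r} → r ≢ 0# → (f : Vec F m → ℕ) → ΣV (λ x → f (r · x)) ≡ ΣV f
    ΣV-scale {zero} r≢0 f = refl
    ΣV-scale {suc m} {r} r≢0 f = trans (∑-cong (λ a → ΣV-scale r≢0 (λ x → f ((r * a) ∷ x))))
      (∑-scale r≢0 (λ a → ΣV (λ x → f (a ∷ x))))

  comb : ∀ {m n} → Vec F m → Vec (Vec F n) m → Vec F n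
  comb [] [] = 𝟎
  comb (t ∷ ts) (u ∷ us) = t · u ⊕ comb ts us

  comb-⊕ : ∀ {m n} (s t : Vec F m) (us : Vec (Vec F n) m) → comb (s ⊕ t) us ≡ comb s us ⊕ comb t us
  comb-⊕ [] [] [] = sym (⊕-identityˡ 𝟎)
  comb-⊕ (s ∷ ss) (t ∷ ts) (u ∷ us) = trans (cong₂ _⊕_ (·-distribʳ s t u) (comb-⊕ ss ts us)) (lem _ _ _ _)
    where
    lem : ∀ {n} (a b c d : Vec F n) → (a ⊕ b) ⊕ (c ⊕ d) ≡ (a ⊕ c) ⊕ (b ⊕ d)
    lem [] [] [] [] = refl
    lem (a ∷ as) (b ∷ bs) (c ∷ cs) (d ∷ ds) = cong₂ _∷_
      (solve 4 (λ a b c d → (a :+ b) :+ (c :+ d) := (a :+ c) :+ (b :+ d)) refl a b c d) (lem as bs cs ds)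

  comb-· : ∀ {m n} r (t : Vec F m) (us : Vec (Vec F n) m) → comb (r · t) us ≡ r · comb t us
  comb-· r [] [] = sym (·-zeroʳ r)
  comb-· r (t ∷ ts) (u ∷ us) = trans (cong₂ _⊕_ (sym (·-assoc r t u)) (comb-· r ts us)) (sym (·-distribˡ r _ _))

  comb-𝟎 : ∀ {m n} (us : Vec (Vec F n) m) → comb 𝟎 us ≡ 𝟎
  comb-𝟎 [] = refl
  comb-𝟎 (u ∷ us) = trans (cong₂ _⊕_ (·-zeroˡ u) (comb-𝟎 us)) (⊕-identityˡ 𝟎)

  dots : ∀ {m n} → Vec F n → Vec (Vec F n) m → Vec F m
  dots a [] = []
  dots a (u ∷ us) = dot a u ∷ dots a us

  dot-comb : ∀ {m n} (a : Vec F n) (t : Vec F m) us → dot a (comb t us) ≡ dot (dots a us) t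
  dot-comb a [] [] = dot-𝟎ʳ a
  dot-comb a (t ∷ ts) (u ∷ us) = trans (dot-⊕ʳ a (t · u) (comb ts us))
    (cong₂ _+_ (trans (dot-·ʳ a t u) (*-comm t _)) (dot-comb a ts us))

  nz : F → ℕ
  nz a with a ≟ 0#
  ... | yes _ = 0
  ... | no _ = 1

  nz-0 : ∀ {a} → a ≡ 0# → nz a ≡ 0
  nz-0 {a} e with a ≟ 0#
  ... | yes _ = refl
  ... | no n = ⊥-elim (n e)

  nz-1 : ∀ {a} → a ≢ 0# → nz a ≡ 1
  nz-1 {a} e with a ≟ 0#
  ... | yes p = ⊥-elim (e p)
  ... | no n = refl

  nz≤1 : ∀ a → nz a ≤ 1
  nz≤1 a with a ≟ 0#
  ... | yes _ = z≤n
  ... | no _ = s≤s z≤n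

-- Power sums, polynomial degree, and code words on lines and affine charts

module Codes {q : ℕ} (𝔽 : FinField q) where
  open Vectors 𝔽 public

  q≢0 : q ≢ 0
  q≢0 refl with 0#
  ... | ()

  q-1 : ℕ
  q-1 = q ∸ 1

  q≡1+q-1 : q ≡ suc q-1
  q≡1+q-1 = lem q q≢0
    where
    lem : ∀ n → n ≢ 0 → n ≡ suc (n ∸ 1)
    lem zero h = ⊥-elim (h refl)
    lem (suc n) h = refl

  0<q-1 : 0 < q-1
  0<q-1 = lem q 0# 1# 1≢0
    where
    lem : ∀ n (a b : Fin n) → b ≢ a → 0 < n ∸ 1
    lem (suc zero) zero zero h = ⊥-elim (h refl)
    lem (suc (suc n)) a b h = s≤s z≤n

  -- Translation by 1 permutes the field, yet changes the sum of all its elements by `q` ones.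
  ⟦q⟧≡0 : ⟦ q ⟧ ≡ 0#
  ⟦q⟧≡0 = +-cancelˡ (∑F {q} (λ a → a)) (begin
    ∑F {q} (λ a → a) + ⟦ q ⟧              ≡⟨ cong (∑F {q} (λ a → a) +_) (trans (∑F-const q 1#) (*-identityʳ _)) ⟨
    ∑F {q} (λ a → a) + ∑F {q} (λ _ → 1#)  ≡⟨ ∑F-+ {q} _ _ ⟨
    ∑F {q} (λ a → a + 1#)                 ≡⟨ ∑F-shift 1# (λ a → a) ⟩
    ∑F {q} (λ a → a)                      ≡⟨ +-identityʳ _ ⟨
    ∑F {q} (λ a → a) + 0#                 ∎)
    where open ≡-Reasoning

  ∑F-constant : ∀ c → ∑F {q} (λ _ → c) ≡ 0#
  ∑F-constant c = trans (∑F-const q c) (trans (cong (_* c) ⟦q⟧≡0) (zeroˡ c))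

  infixr 8 _^_
  _^_ : F → ℕ → F
  x ^ zero = 1#
  x ^ suc n = x * x ^ n

  ^-+ : ∀ x m n → x ^ (m ℕ.+ n) ≡ x ^ m * x ^ n
  ^-+ x zero n = sym (*-identityˡ _)
  ^-+ x (suc m) n = trans (cong (x *_) (^-+ x m n)) (sym (*-assoc _ _ _))

  *-^ : ∀ x y n → (x * y) ^ n ≡ x ^ n * y ^ n
  *-^ x y zero = sym (*-identityˡ _)
  *-^ x y (suc n) = trans (cong (x * y *_) (*-^ x y n))
    (solve 4 (λ x y a b → x :* y :* (a :* b) := x :* a :* (y :* b)) refl x y _ _)

  1^ : ∀ n → 1# ^ n ≡ 1#
  1^ zero = refl
  1^ (suc n) = trans (*-identityˡ _) (1^ n)

  ^-* : ∀ x m n → x ^ (m ℕ.* n) ≡ (x ^ n) ^ m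
  ^-* x zero n = refl
  ^-* x (suc m) n = trans (^-+ x n (m ℕ.* n)) (cong (x ^ n *_) (^-* x m n))

  0^ : ∀ {n} → 0 < n → 0# ^ n ≡ 0#
  0^ {suc n} _ = zeroˡ _

  private
    module Π = Summation (CommutativeRing.*-isCommutativeMonoid commutativeRing)

    Π-const : ∀ n x → Π.∑ {n} (λ _ → x) ≡ x ^ n
    Π-const zero x = Π.∑-nil _
    Π-const (suc n) x = trans (Π.∑-suc _) (cong (x *_) (Π-const n x))

    Π≢0 : ∀ {n} (f : Fin n → F) → (∀ i → f i ≢ 0#) → Π.∑ f ≢ 0#
    Π≢0 {zero} f h e = 1≢0 (trans (sym (Π.∑-nil f)) e)
    Π≢0 {suc n} f h e = *-≢0 (h zero) (Π≢0 (λ i → f (suc i)) (λ i → h (suc i))) (trans (sym (Π.∑-suc f)) e)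

    except : ∀ {n} → Fin n → F → Fin n → F
    except a x i with i ≟ a
    ... | yes _ = 1#
    ... | no _ = x

    except-suc : ∀ {n} (a : Fin n) x i → except (suc a) x (suc i) ≡ except a x i
    except-suc a x i with i ≟ a
    ... | yes _ = refl
    ... | no _ = refl

    Π-except : ∀ {n} (a : Fin n) x → Π.∑ (except a x) ≡ x ^ (n ∸ 1)
    Π-except {suc n} zero x = trans (Π.∑-suc _) (trans (*-identityˡ _) (Π-const n x))
    Π-except {suc (suc n)} (suc a) x = trans (Π.∑-suc _)
      (cong (x *_) (trans (Π.∑-cong (except-suc a x)) (Π-except a x)))

    unit : F → F
    unit a with a ≟ 0#
    ... | yes _ = 1#
    ... | no _ = a

    unit≢0 : ∀ a → unit a ≢ 0#
    unit≢0 a with a ≟ 0#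
    ... | yes _ = 1≢0
    ... | no n = n

    unit-* : ∀ {x} → x ≢ 0# → ∀ a → unit (x * a) ≡ except 0# x a * unit a
    unit-* {x} x≢0 a with a ≟ 0# | x * a ≟ 0#
    ... | yes a≡0 | yes _ = sym (*-identityˡ _)
    ... | yes a≡0 | no n = ⊥-elim (n (trans (cong (x *_) a≡0) (zeroʳ x)))
    ... | no n | yes e = ⊥-elim (*-≢0 x≢0 n e)
    ... | no _ | no _ = refl

    Π-scale : ∀ {x} → x ≢ 0# → (f : F → F) → Π.∑ (λ a → f (x * a)) ≡ Π.∑ f
    Π-scale {x} x≢0 = Π.∑-bij (x *_) (x ⁻¹ *_)
      (λ a → trans (sym (*-assoc _ _ a)) (trans (cong (_* a) (⁻¹-inverseʳ x≢0)) (*-identityˡ a)))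
      (λ a → trans (sym (*-assoc _ _ a)) (trans (cong (_* a) (⁻¹-inverseˡ x≢0)) (*-identityˡ a)))

  -- Multiplication by `x` permutes the field. In the product of all elements 0 is replaced by 1
  -- through `unit`, and `except` records that this one factor is not scaled.
  fermat : ∀ {x} → x ≢ 0# → x ^ q-1 ≡ 1#
  fermat {x} x≢0 = *-cancelˡ (Π≢0 unit unit≢0) (begin
    Π.∑ unit * x ^ q-1                     ≡⟨ *-comm _ _ ⟩
    x ^ q-1 * Π.∑ unit                     ≡⟨ cong (_* Π.∑ unit) (Π-except 0# x) ⟨
    Π.∑ (except 0# x) * Π.∑ unit           ≡⟨ Π.∑-∙ (except 0# x) unit ⟨
    Π.∑ (λ a → except 0# x a * unit a)     ≡⟨ Π.∑-cong (unit-* x≢0) ⟨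
    Π.∑ (λ a → unit (x * a))               ≡⟨ Π-scale x≢0 unit ⟩
    Π.∑ unit                               ≡⟨ *-identityʳ _ ⟨
    Π.∑ unit * 1#                          ∎)
    where open ≡-Reasoning

  -- Coefficient lists, constant coefficient first.

  ev : ∀ {n} → Vec F n → F → F
  ev [] x = 0#
  ev (c ∷ p) x = c + x * ev p x

  private
    -- Synthetic division by x - r: the entries are the intermediate values of Horner's scheme at
    -- `r`.
    quot : ∀ {n} → F → Vec F (suc n) → Vec F n
    quot r (c ∷ []) = []
    quot r (c ∷ d ∷ p) = ev (d ∷ p) r ∷ quot r (d ∷ p)

    ev-quot : ∀ {n} r (p : Vec F (suc n)) x → ev p x ≡ (x - r) * ev (quot r p) x + ev p r
    ev-quot r (c ∷ []) x = solve 3 (λ c x r → c :+ x :* :0 := (x :- r) :* :0 :+ (c :+ r :* :0)) refl c x r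
    ev-quot r (c ∷ d ∷ p) x = trans (cong (λ z → c + x * z) (ev-quot r (d ∷ p) x))
      (solve 5 (λ c x r u w → c :+ x :* ((x :- r) :* u :+ w) := (x :- r) :* (w :+ x :* u) :+ (c :+ r :* w)) refl
        c x r (ev (quot r (d ∷ p)) x) (ev (d ∷ p) r))

    quot-𝟎 : ∀ {n} r (p : Vec F (suc n)) → quot r p ≡ 𝟎 → ev p r ≡ 0# → p ≡ 𝟎
    quot-𝟎 r (c ∷ []) _ e = cong (_∷ []) (trans (solve 2 (λ c r → c := c :+ r :* :0) refl c r) e)
    quot-𝟎 r (c ∷ d ∷ p) h e = cong₂ _∷_ c≡0 rest
      where
      rest : d ∷ p ≡ 𝟎
      rest = quot-𝟎 r (d ∷ p) (cong tail h) (cong head h)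
      c≡0 : c ≡ 0#
      c≡0 = trans (trans (solve 2 (λ c r → c := c :+ r :* :0) refl c r) (cong (λ z → c + r * z) (sym (cong head h)))) e

  vanishing⇒𝟎 : ∀ {n} (p : Vec F n) (xs : List F) → Unique xs → All (λ x → ev p x ≡ 0#) xs →
                n ≤ length xs → p ≡ 𝟎
  vanishing⇒𝟎 [] xs u a h = refl
  vanishing⇒𝟎 {suc n} p (r ∷ xs) (r∉ ∷ u) (e ∷ es) (s≤s h) =
    quot-𝟎 r p (vanishing⇒𝟎 (quot r p) xs u (roots xs r∉ es) h) e
    where
    roots : ∀ ys → All (r ≢_) ys → All (λ x → ev p x ≡ 0#) ys → All (λ x → ev (quot r p) x ≡ 0#) ys
    roots [] _ _ = []
    roots (y ∷ ys) (r≢y ∷ ns) (z ∷ zs) = root ∷ roots ys ns zs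
      where
      prod0 : (y - r) * ev (quot r p) y ≡ 0#
      prod0 = trans (sym (+-identityʳ _)) (trans (cong ((y - r) * ev (quot r p) y +_) (sym e)) (trans (sym (ev-quot r p y)) z))
      root : ev (quot r p) y ≡ 0#
      root with *-zero-cases prod0
      ... | inj₁ y-r≡0 = ⊥-elim (r≢y (sym (x-y≡0⇒x≡y y-r≡0)))
      ... | inj₂ h = h

  private
    mono : ∀ n → Vec F (suc n)
    mono zero = 1# ∷ []
    mono (suc n) = 0# ∷ mono n

    ev-mono : ∀ n x → ev (mono n) x ≡ x ^ n
    ev-mono zero x = solve 1 (λ x → :1 :+ x :* :0 := :1) refl x
    ev-mono (suc n) x = trans (+-identityˡ _) (cong (x *_) (ev-mono n x))

  nonzeros : List F
  nonzeros = filter (λ a → ¬? (a ≟ 0#)) (allFin q)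

  length-allFin : ∀ n → length (allFin n) ≡ n
  length-allFin n = Lₚ.length-tabulate (λ i → i)

  remove : F → List F → List F
  remove a = filter (λ i → ¬? (i ≟ a))

  length-remove : ∀ {a} xs → Unique xs → a ∈ xs → length xs ≡ suc (length (remove a xs))
  length-remove {a} (x ∷ xs) (x∉ ∷ u) (here refl) =
    cong suc (cong length (sym (trans (Lₚ.filter-reject (λ i → ¬? (i ≟ a)) (λ h → h refl))
      (Lₚ.filter-all (λ i → ¬? (i ≟ a)) (All.map (λ a≢y y≡a → a≢y (sym y≡a)) x∉)))))
  length-remove {a} (x ∷ xs) (x∉ ∷ u) (there a∈) = trans (cong suc (length-remove xs u a∈))
    (cong suc (cong length (sym (Lₚ.filter-accept (λ i → ¬? (i ≟ a)) (λ x≡a → All.lookup x∉ a∈ x≡a)))))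

  length-nonzeros : length nonzeros ≡ q-1
  length-nonzeros = sym (cong (_∸ 1) (trans (sym (length-allFin q)) (length-remove (allFin q) (Uniqueₚ.allFin⁺ q) (∈-allFin 0#))))

  private
    -- Otherwise x^m - 1 would have q - 1 roots, more than its degree.
    nonunit : ∀ m → 0 < m → m < q-1 → ∃ λ g → g ≢ 0# × g ^ m ≢ 1#
    nonunit (suc m) _ m<q-1 with Finₚ.any? {P = λ g → g ≢ 0# × g ^ suc m ≢ 1#}
                                  (λ g → ¬? (g ≟ 0#) ×-dec ¬? (g ^ suc m ≟ 1#))
    ... | yes p = p
    ... | no ¬p = ⊥-elim (1≢0 1≡0)
      where
      p : Vec F (suc (suc m))
      p = (- 1#) ∷ mono m
      root : ∀ {x} → x ≢ 0# → ev p x ≡ 0#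
      root {x} x≢0 with x ^ suc m ≟ 1#
      ... | no n = ⊥-elim (¬p (x , x≢0 , n))
      ... | yes e = trans (cong (- 1# +_) (trans (cong (x *_) (ev-mono m x)) e)) (-‿inverseˡ 1#)
      p≡0 : p ≡ 𝟎
      p≡0 = vanishing⇒𝟎 p nonzeros (Uniqueₚ.filter⁺ _ (Uniqueₚ.allFin⁺ q))
        (All.map root (Allₚ.all-filter (λ a → ¬? (a ≟ 0#)) (allFin q)))
        (ℕₚ.≤-trans m<q-1 (ℕₚ.≤-reflexive (sym length-nonzeros)))
      1≡0 : 1# ≡ 0#
      1≡0 = trans (sym (-‿involutive 1#)) (trans (cong -_ (cong head p≡0)) -0#≈0#)

  -- Substituting g x for x multiplies the sum by g^m, and some `g` has g^m different from 1. For m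
  -- = 0 the sum is `q`, which is zero in the field.
  powerSum : ∀ m → m < q-1 → ∑F {q} (λ x → x ^ m) ≡ 0#
  powerSum zero _ = ∑F-constant 1#
  powerSum (suc m) h with nonunit (suc m) (s≤s z≤n) h
  ... | g , g≢0 , gᵐ≢1 with *-zero-cases {g ^ suc m - 1#} {∑F (λ x → x ^ suc m)} eq
    where
    S = ∑F {q} (λ x → x ^ suc m)
    gS : g ^ suc m * S ≡ S
    gS = trans (sym (∑F-*ˡ {q} _ _)) (trans (∑F-cong {q} (λ x → sym (*-^ g x (suc m)))) (∑F-scale g≢0 (λ x → x ^ suc m)))
    eq : (g ^ suc m - 1#) * S ≡ 0#
    eq = trans (solve 2 (λ a s → (a :- :1) :* s := a :* s :- s) refl (g ^ suc m) S)
      (trans (cong (_- S) gS) (-‿inverseʳ S))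
  ... | inj₁ e = ⊥-elim (gᵐ≢1 (x-y≡0⇒x≡y e))
  ... | inj₂ e = e

  -- An affine function of t is a linear form evaluated at 1# ∷ t.

  prod : ∀ {n} → List (Vec F n) → Vec F n → F
  prod [] y = 1#
  prod (a ∷ A) y = dot a y * prod A y

  prod-++ : ∀ {n} (A B : List (Vec F n)) y → prod (A ++ B) y ≡ prod A y * prod B y
  prod-++ [] B y = sym (*-identityˡ _)
  prod-++ (a ∷ A) B y = trans (cong (dot a y *_) (prod-++ A B y)) (sym (*-assoc _ _ _))

  prod-· : ∀ {n} (A : List (Vec F n)) r y → prod A (r · y) ≡ r ^ length A * prod A y
  prod-· [] r y = sym (*-identityˡ _)
  prod-· (a ∷ A) r y = trans (cong₂ _*_ (dot-·ʳ a r y) (prod-· A r y))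
    (solve 4 (λ r d w p → r :* d :* (w :* p) := r :* w :* (d :* p)) refl r _ _ _)

  prod-replicate : ∀ {n} k (a y : Vec F n) → prod (replicate k a) y ≡ dot a y ^ k
  prod-replicate zero a y = refl
  prod-replicate (suc k) a y = cong (dot a y *_) (prod-replicate k a y)

  prod-0∷ : ∀ {n} (A : List (Vec F n)) r y → prod (map (0# ∷_) A) (r ∷ y) ≡ prod A y
  prod-0∷ [] r y = refl
  prod-0∷ (a ∷ A) r y = cong₂ _*_ (trans (cong (_+ dot a y) (zeroˡ r)) (+-identityˡ _)) (prod-0∷ A r y)

  prod-tail : ∀ {n} (A : List (Vec F (suc n))) y → prod A (0# ∷ y) ≡ prod (map tail A) y
  prod-tail [] y = refl
  prod-tail ((b ∷ a) ∷ A) y = cong₂ _*_ (trans (cong (_+ dot a y) (zeroʳ b)) (+-identityˡ _)) (prod-tail A y)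

  -- A monomial of degree below m (q - 1) has some exponent below q - 1, and the power sum in that
  -- variable vanishes. The product is not expanded into monomials; one coordinate is treated at a
  -- time.
  Σ-prod : ∀ m (A : List (Vec F (suc m))) → length A < m ℕ.* q-1 → ΣF {m = m} (λ t → prod A (1# ∷ t)) ≡ 0#

  private
    -- Each factor of `A` is a multiple of the first coordinate x plus an affine function of the
    -- others. The first part raises the exponent `e` of x, the second joins `B`. Once `A` is used
    -- up, either e < q - 1 and the power sum vanishes, or `B` is short enough for the induction on
    -- `m`.
    Σ-prod-mixed : ∀ m e (A : List (Vec F (suc (suc m)))) (B : List (Vec F (suc m))) →
      e ℕ.+ (length A ℕ.+ length B) < suc m ℕ.* q-1 →
      ∑F {q} (λ x → ΣF (λ t → x ^ e * prod B (1# ∷ t) * prod A (1# ∷ x ∷ t))) ≡ 0#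
    Σ-prod-mixed m e [] B h with e ℕₚ.<? q-1
    ... | yes e<q-1 = begin
      ∑F {q} (λ x → ΣF (λ t → x ^ e * prod B (1# ∷ t) * 1#))
        ≡⟨ ∑F-cong {q} (λ x → trans (ΣF-cong (λ t → *-identityʳ _)) (ΣF-*ˡ _ _)) ⟩
      ∑F {q} (λ x → x ^ e * ΣF (λ t → prod B (1# ∷ t)))  ≡⟨ ∑F-*ʳ {q} _ _ ⟩
      ∑F {q} (λ x → x ^ e) * ΣF (λ t → prod B (1# ∷ t))  ≡⟨ cong (_* _) (powerSum e e<q-1) ⟩
      0# * ΣF (λ t → prod B (1# ∷ t))                ≡⟨ zeroˡ _ ⟩
      0#                                             ∎
      where open ≡-Reasoning
    ... | no e≥q-1 = begin
      ∑F {q} (λ x → ΣF (λ t → x ^ e * prod B (1# ∷ t) * 1#))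
        ≡⟨ ∑F-cong {q} (λ x → trans (ΣF-cong (λ t → *-identityʳ _)) (ΣF-*ˡ _ _)) ⟩
      ∑F {q} (λ x → x ^ e * ΣF (λ t → prod B (1# ∷ t)))
        ≡⟨ ∑F-cong {q} (λ x → trans (cong (x ^ e *_) (Σ-prod m B short)) (zeroʳ _)) ⟩
      ∑F {q} (λ x → 0#)                              ≡⟨ ∑F-0 q ⟩
      0#                                             ∎
      where
      open ≡-Reasoning
      short : length B < m ℕ.* q-1
      short = ℕₚ.+-cancelˡ-< q-1 _ _ (ℕₚ.≤-<-trans (ℕₚ.+-monoˡ-≤ (length B) (ℕₚ.≮⇒≥ e≥q-1)) h)
    Σ-prod-mixed m e ((b ∷ a₀ ∷ a) ∷ A) B h = begin
      ∑F {q} (λ x → ΣF (λ t → x ^ e * prod B (1# ∷ t) * ((b * 1# + (a₀ * x + dot a t)) * prod A (1# ∷ x ∷ t))))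
        ≡⟨ ∑F-cong {q} (λ x → trans (ΣF-cong (λ t → expand (x ^ e) (prod B (1# ∷ t)) b a₀ x (dot a t) (prod A (1# ∷ x ∷ t))))
             (trans (ΣF-+ _ _) (cong (_+ _) (ΣF-*ˡ a₀ _)))) ⟩
      ∑F {q} (λ x → a₀ * ΣF (λ t → x ^ suc e * prod B (1# ∷ t) * prod A (1# ∷ x ∷ t))
            + ΣF (λ t → x ^ e * prod ((b ∷ a) ∷ B) (1# ∷ t) * prod A (1# ∷ x ∷ t)))
        ≡⟨ trans (∑F-+ {q} _ _) (cong (_+ _) (∑F-*ˡ {q} a₀ _)) ⟩
      a₀ * ∑F {q} (λ x → ΣF (λ t → x ^ suc e * prod B (1# ∷ t) * prod A (1# ∷ x ∷ t)))
        + ∑F {q} (λ x → ΣF (λ t → x ^ e * prod ((b ∷ a) ∷ B) (1# ∷ t) * prod A (1# ∷ x ∷ t)))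
        ≡⟨ cong₂ (λ u w → a₀ * u + w) (Σ-prod-mixed m (suc e) A B h₁) (Σ-prod-mixed m e A ((b ∷ a) ∷ B) h₂) ⟩
      a₀ * 0# + 0#  ≡⟨ trans (+-identityʳ _) (zeroʳ a₀) ⟩
      0# ∎
      where
      open ≡-Reasoning
      expand : ∀ p w b a₀ x d r → p * w * ((b * 1# + (a₀ * x + d)) * r)
                 ≡ a₀ * (x * p * w * r) + p * ((b * 1# + d) * w) * r
      expand = solve 7 (λ p w b a₀ x d r → p :* w :* ((b :* :1 :+ (a₀ :* x :+ d)) :* r)
                 := a₀ :* (x :* p :* w :* r) :+ p :* ((b :* :1 :+ d) :* w) :* r) refl
      h₁ : suc e ℕ.+ (length A ℕ.+ length B) < suc m ℕ.* q-1
      h₁ = subst (_< suc m ℕ.* q-1) (ℕₚ.+-suc e _) h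
      h₂ : e ℕ.+ (length A ℕ.+ suc (length B)) < suc m ℕ.* q-1
      h₂ = subst (_< suc m ℕ.* q-1) (cong (e ℕ.+_) (sym (ℕₚ.+-suc (length A) (length B)))) h

  Σ-prod (suc m) A h = trans (ΣF-∷ _) (trans
    (∑F-cong {q} (λ x → ΣF-cong (λ t → sym (trans (cong (_* prod A (1# ∷ x ∷ t)) (*-identityˡ 1#)) (*-identityˡ _)))))
    (Σ-prod-mixed m 0 A [] (subst (_< suc m ℕ.* q-1) (sym (ℕₚ.+-identityʳ (length A))) h)))

  δ : F → F
  δ x with x ≟ 0#
  ... | yes _ = 1#
  ... | no _ = 0#

  δ-0 : ∀ {x} → x ≡ 0# → δ x ≡ 1#
  δ-0 {x} e with x ≟ 0#
  ... | yes _ = refl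
  ... | no n = ⊥-elim (n e)

  δ-≢0 : ∀ {x} → x ≢ 0# → δ x ≡ 0#
  δ-≢0 {x} n with x ≟ 0#
  ... | yes e = ⊥-elim (n e)
  ... | no _ = refl

  δ-* : ∀ {r} → r ≢ 0# → ∀ x → δ (r * x) ≡ δ x
  δ-* {r} r≢0 x with x ≟ 0#
  ... | yes e = δ-0 (trans (cong (r *_) e) (zeroʳ r))
  ... | no n = δ-≢0 (*-≢0 r≢0 n)

  δ-pow : ∀ x → δ x ≡ 1# - x ^ q-1
  δ-pow x with x ≟ 0#
  ... | yes refl = trans (solve 0 (:1 := :1 :- :0) refl) (cong (λ z → 1# - z) (sym (0^ 0<q-1)))
  ... | no n = trans (sym (-‿inverseʳ 1#)) (cong (λ z → 1# - z) (sym (fermat n)))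

  Combination : ℕ → Set
  Combination n = List (F × Vec F n)

  -- At `𝟎` every term contributes, so the value there is the sum of the coefficients. This value is
  -- an invariant of the word: it is the sum over any projective line.
  code : ∀ {n} → Combination n → Vec F n → F
  code [] x = 0#
  code ((α , a) ∷ L) x = α * δ (dot a x) + code L x

  code-· : ∀ {n} (L : Combination n) {r} → r ≢ 0# → ∀ x → code L (r · x) ≡ code L x
  code-· [] r≢0 x = refl
  code-· ((α , a) ∷ L) {r} r≢0 x = cong₂ _+_ (cong (α *_) (trans (cong δ (dot-·ʳ a r x)) (δ-* r≢0 (dot a x)))) (code-· L r≢0 x)

  -- A line crossing the hyperplane meets it once and its direction is off the hyperplane. A
  -- parallel line meets it in 0 or q points, both 0 in the field, and its direction lies on the
  -- hyperplane.
  δ-line : ∀ α β → ∑F {q} (λ t → δ (α + t * β)) + δ β ≡ 1#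
  δ-line α β with β ≟ 0#
  ... | yes refl = trans (cong (_+ 1#) (trans (∑F-cong {q} (λ t → cong δ (trans (cong (α +_) (zeroʳ t)) (+-identityʳ α))))
        (∑F-constant (δ α)))) (+-identityˡ 1#)
  ... | no β≢0 = trans (+-identityʳ _) (trans (∑F-single t₀ off) (δ-0 at))
    where
    t₀ = - α * β ⁻¹
    at : α + t₀ * β ≡ 0#
    at = trans (solve 3 (λ a i b → a :+ :- a :* i :* b := a :- a :* (i :* b)) refl α (β ⁻¹) β)
      (trans (cong (λ z → α - α * z) (⁻¹-inverseˡ β≢0)) (solve 1 (λ a → a :- a :* :1 := :0) refl α))
    off : ∀ t → t ≢ t₀ → δ (α + t * β) ≡ 0#
    off t t≢ = δ-≢0 (λ e → t≢ (*-cancelˡ β≢0 (trans (*-comm β t) (trans (+-cancelˡ α (trans e (sym at))) (*-comm t₀ β)))))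

  line-sum : ∀ {n} (L : Combination n) x y → ∑F {q} (λ t → code L (x ⊕ t · y)) + code L y ≡ code L 𝟎
  line-sum [] x y = trans (+-identityʳ _) (∑F-0 q)
  line-sum ((α , a) ∷ L) x y = begin
    ∑F {q} (λ t → α * δ (dot a (x ⊕ t · y)) + code L (x ⊕ t · y)) + (α * δ (dot a y) + code L y)
      ≡⟨ cong (_+ _) (trans (∑F-+ {q} _ _) (cong (_+ _) (∑F-*ˡ {q} α _))) ⟩
    (α * ∑F {q} (λ t → δ (dot a (x ⊕ t · y))) + ∑F {q} (λ t → code L (x ⊕ t · y))) + (α * δ (dot a y) + code L y)
      ≡⟨ solve 5 (λ α s u d v → (α :* s :+ u) :+ (α :* d :+ v) := α :* (s :+ d) :+ (u :+ v)) refl α _ _ _ _ ⟩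
    α * (∑F {q} (λ t → δ (dot a (x ⊕ t · y))) + δ (dot a y)) + (∑F {q} (λ t → code L (x ⊕ t · y)) + code L y)
      ≡⟨ cong₂ (λ u v → α * u + v) (trans (cong (_+ _) (∑F-cong {q} (λ t → cong δ (trans (dot-⊕ʳ a x (t · y)) (cong (dot a x +_) (dot-·ʳ a t y))))))
           (δ-line (dot a x) (dot a y))) (line-sum L x y) ⟩
    α * 1# + code L 𝟎
      ≡⟨ cong (λ z → α * z + code L 𝟎) (sym (δ-0 (dot-𝟎ʳ a))) ⟩
    α * δ (dot a 𝟎) + code L 𝟎 ∎
    where open ≡-Reasoning

  private
    -- By `δ-pow` the function `δ` is 1 minus a product of q - 1 linear factors, hence the
    -- additional q - 1 in the degree condition.
    Σ-δ-prod : ∀ m (a : Vec F (suc m)) (A : List (Vec F (suc m))) → length A ℕ.+ q-1 < m ℕ.* q-1 →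
      ΣF {m = m} (λ t → δ (dot a (1# ∷ t)) * prod A (1# ∷ t)) ≡ 0#
    Σ-δ-prod m a A h = begin
      ΣF {m = m} (λ t → δ (dot a (1# ∷ t)) * prod A (1# ∷ t))
        ≡⟨ ΣF-cong (λ t → trans (cong (_* prod A (1# ∷ t)) (δ-pow _))
             (trans (solve 2 (λ w p → (:1 :- w) :* p := p :+ (:- :1) :* (w :* p)) refl _ _)
                (cong (λ z → prod A (1# ∷ t) + - 1# * z) (trans (cong (_* prod A (1# ∷ t)) (sym (prod-replicate q-1 a _)))
                   (sym (prod-++ (replicate q-1 a) A _)))))) ⟩
      ΣF {m = m} (λ t → prod A (1# ∷ t) + - 1# * prod (replicate q-1 a ++ A) (1# ∷ t))
        ≡⟨ trans (ΣF-+ _ _) (cong (_ +_) (ΣF-*ˡ _ _)) ⟩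
      ΣF {m = m} (λ t → prod A (1# ∷ t)) + - 1# * ΣF {m = m} (λ t → prod (replicate q-1 a ++ A) (1# ∷ t))
        ≡⟨ cong₂ (λ u v → u + - 1# * v) (Σ-prod m A (ℕₚ.≤-<-trans (ℕₚ.m≤m+n _ _) h)) (Σ-prod m (replicate q-1 a ++ A) long) ⟩
      0# + - 1# * 0#   ≡⟨ solve 0 (:0 :+ (:- :1) :* :0 := :0) refl ⟩
      0#               ∎
      where
      open ≡-Reasoning
      long : length (replicate q-1 a ++ A) < m ℕ.* q-1
      long = subst (_< m ℕ.* q-1) (sym (trans (Lₚ.length-++ (replicate q-1 a))
        (trans (cong (ℕ._+ length A) (Lₚ.length-replicate q-1)) (ℕₚ.+-comm q-1 _)))) h

  dot-affine : ∀ {m n} (a v : Vec F n) (t : Vec F m) us →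
    dot a (v ⊕ comb t us) ≡ dot (dot a v ∷ dots a us) (1# ∷ t)
  dot-affine a v t us = trans (dot-⊕ʳ a v (comb t us)) (cong₂ _+_ (sym (*-identityʳ _)) (dot-comb a t us))

  -- Dual form of the fact that a word restricted to an affine subspace is a polynomial of degree at
  -- most q - 1.
  Σ-code-affine : ∀ {m n} (L : Combination n) v (us : Vec (Vec F n) m) (A : List (Vec F (suc m))) →
    length A ℕ.+ q-1 < m ℕ.* q-1 → ΣF (λ t → code L (v ⊕ comb t us) * prod A (1# ∷ t)) ≡ 0#
  Σ-code-affine [] v us A h = ΣF-zero (λ t → zeroˡ _)
  Σ-code-affine {m} ((α , a) ∷ L) v us A h = begin
    ΣF (λ t → (α * δ (dot a (v ⊕ comb t us)) + code L (v ⊕ comb t us)) * prod A (1# ∷ t))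
      ≡⟨ ΣF-cong (λ t → trans (solve 4 (λ α d c p → (α :* d :+ c) :* p := α :* (d :* p) :+ c :* p) refl α _ _ _)
           (cong (λ z → α * (δ z * prod A (1# ∷ t)) + code L (v ⊕ comb t us) * prod A (1# ∷ t)) (dot-affine a v t us))) ⟩
    ΣF (λ t → α * (δ (dot (dot a v ∷ dots a us) (1# ∷ t)) * prod A (1# ∷ t)) + code L (v ⊕ comb t us) * prod A (1# ∷ t))
      ≡⟨ trans (ΣF-+ _ _) (cong (_+ _) (ΣF-*ˡ α _)) ⟩
    α * ΣF (λ t → δ (dot (dot a v ∷ dots a us) (1# ∷ t)) * prod A (1# ∷ t)) + ΣF (λ t → code L (v ⊕ comb t us) * prod A (1# ∷ t))
      ≡⟨ cong₂ (λ u w → α * u + w) (Σ-δ-prod m (dot a v ∷ dots a us) A h) (Σ-code-affine L v us A h) ⟩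
    α * 0# + 0#  ≡⟨ trans (+-identityʳ _) (zeroʳ α) ⟩
    0#           ∎
    where open ≡-Reasoning

  Σ-code-linear : ∀ {m n} (L : Combination n) (us : Vec (Vec F n) m) (A : List (Vec F m)) →
    length A ℕ.+ q-1 < m ℕ.* q-1 → ΣF (λ t → code L (comb t us) * prod A t) ≡ 0#
  Σ-code-linear {m} L us A h = trans
    (ΣF-cong (λ t → cong₂ _*_ (cong (code L) (sym (⊕-identityˡ _))) (sym (prod-0∷ A 1# t))))
    (Σ-code-affine L 𝟎 us (map (0# ∷_) A) (subst (λ k → k ℕ.+ q-1 < m ℕ.* q-1) (sym (Lₚ.length-map _ A)) h))

  -- In the borderline degree the sum over an affine chart is the sum over its hyperplane at infinity.
  Σ-code-infinity : ∀ {m n} (L : Combination n) v (us : Vec (Vec F n) (suc m)) (A : List (Vec F (suc (suc m)))) →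
    length A ≡ m ℕ.* q-1 →
    ΣF (λ t → code L (v ⊕ comb t us) * prod A (1# ∷ t)) ≡ ΣF (λ t → code L (comb t us) * prod (map tail A) t)
  Σ-code-infinity {m} L v us A h = sym (x-y≡0⇒x≡y (begin
    R₀ - T                       ≡⟨ solve 2 (λ r t → r :- t := :0 :+ (r :- t)) refl R₀ T ⟩
    0# + (R₀ - T)                ≡⟨ cong₂ _+_ (sym (∑F-constant T)) (sym (trans (∑F-single 0# off) at)) ⟩
    ∑F {q} (λ _ → T) + ∑F {q} (λ r → δ r * (R₀ - T))  ≡⟨ ∑F-+ {q} _ _ ⟨
    ∑F {q} (λ r → T + δ r * (R₀ - T)) ≡⟨ ∑F-cong {q} slice ⟨
    ∑F {q} (λ r → ΣF (λ t → code L (comb (r ∷ t) (v ∷ us)) * prod A (r ∷ t))) ≡⟨ ΣF-∷ _ ⟨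
    ΣF (λ s → code L (comb s (v ∷ us)) * prod A s) ≡⟨ Σ-code-linear L (v ∷ us) A small ⟩
    0# ∎))
    where
    open ≡-Reasoning
    T = ΣF (λ t → code L (v ⊕ comb t us) * prod A (1# ∷ t))
    R₀ = ΣF (λ t → code L (comb t us) * prod (map tail A) t)
    off : ∀ r → r ≢ 0# → δ r * (R₀ - T) ≡ 0#
    off r r≢0 = trans (cong (_* (R₀ - T)) (δ-≢0 r≢0)) (zeroˡ _)
    at : δ 0# * (R₀ - T) ≡ R₀ - T
    at = trans (cong (_* (R₀ - T)) (δ-0 refl)) (*-identityˡ _)
    small : length A ℕ.+ q-1 < suc (suc m) ℕ.* q-1
    small = subst (λ k → k ℕ.+ q-1 < suc (suc m) ℕ.* q-1) (sym h)
      (ℕₚ.≤-<-trans (ℕₚ.≤-reflexive (ℕₚ.+-comm (m ℕ.* q-1) q-1)) (ℕₚ.m<n+m (suc m ℕ.* q-1) 0<q-1))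
    -- For r ≠ 0 the slice is the chart scaled by `r`. The scalar r^(m (q - 1)) pulled out of `A` is
    -- 1 by Fermat, so all these slices equal `T`.
    slice : ∀ r → ΣF (λ t → code L (comb (r ∷ t) (v ∷ us)) * prod A (r ∷ t)) ≡ T + δ r * (R₀ - T)
    slice r with r ≟ 0#
    ... | yes refl = trans (ΣF-cong (λ t → cong₂ _*_ (cong (code L) (trans (cong (_⊕ comb t us) (·-zeroˡ v)) (⊕-identityˡ _))) (prod-tail A t)))
                       (solve 2 (λ r t → r := t :+ :1 :* (r :- t)) refl R₀ T)
    ... | no r≢0 = begin
      ΣF (λ t → code L (r · v ⊕ comb t us) * prod A (r ∷ t))
        ≡⟨ ΣF-scale r≢0 (λ t → code L (r · v ⊕ comb t us) * prod A (r ∷ t)) ⟨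
      ΣF (λ t → code L (r · v ⊕ comb (r · t) us) * prod A (r ∷ r · t))
        ≡⟨ ΣF-cong (λ t → cong₂ _*_ (trans (cong (code L) (trans (cong (r · v ⊕_) (comb-· r t us)) (sym (·-distribˡ r v _)))) (code-· L r≢0 _))
             (trans (cong (λ z → prod A (z ∷ r · t)) (sym (*-identityʳ r))) (trans (prod-· A r (1# ∷ t))
                (trans (cong (_* prod A (1# ∷ t)) rᵏ) (*-identityˡ _))))) ⟩
      T                   ≡⟨ solve 2 (λ r t → t := t :+ :0 :* (r :- t)) refl R₀ T ⟩
      T + 0# * (R₀ - T)   ∎
      where
      rᵏ : r ^ length A ≡ 1#
      rᵏ = trans (cong (r ^_) h) (trans (^-* r m q-1) (trans (cong (_^ m) (fermat r≢0)) (1^ m)))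

-- Linear algebra, and cones from periodic words

module LinearAlgebra {q : ℕ} (𝔽 : FinField q) where
  open Codes 𝔽 public

  record IsFunctional {n} (f : Vec F n → F) : Set where
    field
      +-homo : ∀ x y → f (x ⊕ y) ≡ f x + f y
      ·-homo : ∀ r x → f (r · x) ≡ r * f x

  record IsLinear {m n} (f : Vec F m → Vec F n) : Set where
    field
      ⊕-homo : ∀ x y → f (x ⊕ y) ≡ f x ⊕ f y
      ·-homo : ∀ r x → f (r · x) ≡ r · f x

    𝟎-homo : f 𝟎 ≡ 𝟎
    𝟎-homo = trans (cong f (sym (·-zeroˡ 𝟎))) (trans (·-homo 0# 𝟎) (·-zeroˡ _))

  dot-linear : ∀ {m n} {f : Vec F m → Vec F n} → IsLinear f → ∀ a → IsFunctional (λ x → dot a (f x))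
  dot-linear lin a = record
    { +-homo = λ x y → trans (cong (dot a) (⊕-homo x y)) (dot-⊕ʳ a _ _)
    ; ·-homo = λ r x → trans (cong (dot a) (·-homo r x)) (dot-·ʳ a r _) }
    where open IsLinear lin

  ∘-linear : ∀ {k m n} {f : Vec F m → Vec F n} {g : Vec F k → Vec F m} →
             IsLinear f → IsLinear g → IsLinear (λ x → f (g x))
  ∘-linear {f = f} lf lg = record
    { ⊕-homo = λ x y → trans (cong f (IsLinear.⊕-homo lg x y)) (IsLinear.⊕-homo lf _ _)
    ; ·-homo = λ r x → trans (cong f (IsLinear.·-homo lg r x)) (IsLinear.·-homo lf r _) }

  private
    split : ∀ {n} a (x : Vec F n) → a ∷ x ≡ a · (1# ∷ 𝟎) ⊕ (0# ∷ x)
    split a x = cong₂ _∷_ (solve 1 (λ a → a := a :* :1 :+ :0) refl a)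
      (sym (trans (cong (_⊕ x) (·-zeroʳ a)) (⊕-identityˡ x)))

    0∷-⊕ : ∀ {n} (x y : Vec F n) → 0# ∷ (x ⊕ y) ≡ (0# ∷ x) ⊕ (0# ∷ y)
    0∷-⊕ x y = cong (_∷ x ⊕ y) (sym (+-identityˡ 0#))

    0∷-· : ∀ {n} r (x : Vec F n) → 0# ∷ (r · x) ≡ r · (0# ∷ x)
    0∷-· r x = cong (_∷ r · x) (sym (zeroʳ r))

  rep : ∀ {n} → (Vec F n → F) → Vec F n
  rep {zero} f = []
  rep {suc n} f = f (1# ∷ 𝟎) ∷ rep (λ x → f (0# ∷ x))

  dot-rep : ∀ {n} {f : Vec F n → F} → IsFunctional f → ∀ x → dot (rep f) x ≡ f x
  dot-rep {f = f} lin [] = sym (trans (·-homo 0# []) (zeroˡ _)) where open IsFunctional lin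
  dot-rep {f = f} lin (a ∷ x) = begin
    f (1# ∷ 𝟎) * a + dot (rep (λ y → f (0# ∷ y))) x
      ≡⟨ cong₂ _+_ (*-comm _ a) (dot-rep (record
           { +-homo = λ x y → trans (cong f (0∷-⊕ x y)) (+-homo _ _)
           ; ·-homo = λ r x → trans (cong f (0∷-· r x)) (·-homo r _) }) x) ⟩
    a * f (1# ∷ 𝟎) + f (0# ∷ x)   ≡⟨ cong (_+ f (0# ∷ x)) (·-homo a _) ⟨
    f (a · (1# ∷ 𝟎)) + f (0# ∷ x) ≡⟨ +-homo _ _ ⟨
    f (a · (1# ∷ 𝟎) ⊕ (0# ∷ x))   ≡⟨ cong f (split a x) ⟨
    f (a ∷ x)                     ∎
    where
    open ≡-Reasoning
    open IsFunctional lin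

  columns : ∀ {m n} → (Vec F m → Vec F n) → Vec (Vec F n) m
  columns {zero} f = []
  columns {suc m} f = f (1# ∷ 𝟎) ∷ columns (λ x → f (0# ∷ x))

  comb-columns : ∀ {m n} {f : Vec F m → Vec F n} → IsLinear f → ∀ x → comb x (columns f) ≡ f x
  comb-columns {f = f} lin [] = sym (IsLinear.𝟎-homo lin)
  comb-columns {f = f} lin (a ∷ x) = begin
    a · f (1# ∷ 𝟎) ⊕ comb x (columns (λ y → f (0# ∷ y)))
      ≡⟨ cong₂ _⊕_ (sym (·-homo a _)) (comb-columns (record
           { ⊕-homo = λ x y → trans (cong f (0∷-⊕ x y)) (⊕-homo _ _)
           ; ·-homo = λ r x → trans (cong f (0∷-· r x)) (·-homo r _) }) x) ⟩
    f (a · (1# ∷ 𝟎)) ⊕ f (0# ∷ x) ≡⟨ ⊕-homo _ _ ⟨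
    f (a · (1# ∷ 𝟎) ⊕ (0# ∷ x))   ≡⟨ cong f (split a x) ⟨
    f (a ∷ x)                     ∎
    where
    open ≡-Reasoning
    open IsLinear lin

  -- Coordinates on the kernel of a linear form l; μ also vanishes there but, unlike l, is never zero.
  record Kernel {n} (l : Vec F (suc n)) : Set where
    field
      ι : Vec F n → Vec F (suc n)
      ρ : Vec F (suc n) → Vec F n
      ι-linear : IsLinear ι
      ρ-linear : IsLinear ρ
      ρι : ∀ y → ρ (ι y) ≡ y
      lι : ∀ y → dot l (ι y) ≡ 0#
      μ : Vec F (suc n)
      μ≢𝟎 : μ ≢ 𝟎
      μι : ∀ y → dot μ (ι y) ≡ 0#

  private
    pivot : ∀ {n} a (l : Vec F n) → a ≢ 0# → Kernel (a ∷ l)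
    pivot a l a≢0 = record
      { ι = λ y → (- (a ⁻¹ * dot l y)) ∷ y
      ; ρ = tail
      ; ι-linear = record
        { ⊕-homo = λ x y → cong (_∷ x ⊕ y) (trans (cong (λ z → - (a ⁻¹ * z)) (dot-⊕ʳ l x y))
            (solve 3 (λ i u w → :- (i :* (u :+ w)) := :- (i :* u) :+ :- (i :* w)) refl (a ⁻¹) _ _))
        ; ·-homo = λ r x → cong (_∷ r · x) (trans (cong (λ z → - (a ⁻¹ * z)) (dot-·ʳ l r x))
            (solve 3 (λ i r u → :- (i :* (r :* u)) := r :* :- (i :* u)) refl (a ⁻¹) r _)) }
      ; ρ-linear = record { ⊕-homo = λ { (a ∷ x) (b ∷ y) → refl } ; ·-homo = λ { r (a ∷ x) → refl } }
      ; ρι = λ y → refl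
      ; lι = zero-at
      ; μ = a ∷ l
      ; μ≢𝟎 = λ e → a≢0 (cong head e)
      ; μι = zero-at }
      where
      zero-at : ∀ y → a * (- (a ⁻¹ * dot l y)) + dot l y ≡ 0#
      zero-at y = trans (solve 3 (λ a i u → a :* :- (i :* u) :+ u := u :- a :* i :* u) refl a (a ⁻¹) _)
        (trans (cong (λ z → dot l y - z * dot l y) (⁻¹-inverseʳ a≢0)) (solve 1 (λ u → u :- :1 :* u := :0) refl _))

  kernel : ∀ {n} (l : Vec F (suc n)) → Kernel l
  kernel {n} (a ∷ l) with a ≟ 0#
  ... | no a≢0 = pivot a l a≢0
  -- For the zero form a proper subspace is chosen all the same: the dimension has to drop by one at
  -- every step, and `μ` has to be nonzero.
  kernel {zero} (a ∷ []) | yes refl = record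
    { ι = λ _ → 0# ∷ [] ; ρ = λ _ → []
    ; ι-linear = record { ⊕-homo = λ x y → cong (_∷ []) (sym (+-identityˡ 0#)) ; ·-homo = λ r x → cong (_∷ []) (sym (zeroʳ r)) }
    ; ρ-linear = record { ⊕-homo = λ x y → refl ; ·-homo = λ r x → refl }
    ; ρι = λ { [] → refl }
    ; lι = λ y → trans (+-identityʳ _) (zeroˡ _)
    ; μ = 1# ∷ [] ; μ≢𝟎 = λ e → 1≢0 (cong head e) ; μι = λ y → trans (+-identityʳ _) (zeroʳ _) }
  kernel {suc n} (a ∷ l) | yes refl = record
    { ι = λ { (b ∷ y) → b ∷ ι y }
    ; ρ = λ { (b ∷ y) → b ∷ ρ y }
    ; ι-linear = record
      { ⊕-homo = λ { (b ∷ x) (c ∷ y) → cong (b + c ∷_) (IsLinear.⊕-homo ι-linear x y) }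
      ; ·-homo = λ { r (b ∷ x) → cong (r * b ∷_) (IsLinear.·-homo ι-linear r x) } }
    ; ρ-linear = record
      { ⊕-homo = λ { (b ∷ x) (c ∷ y) → cong (b + c ∷_) (IsLinear.⊕-homo ρ-linear x y) }
      ; ·-homo = λ { r (b ∷ x) → cong (r * b ∷_) (IsLinear.·-homo ρ-linear r x) } }
    ; ρι = λ { (b ∷ y) → cong (b ∷_) (ρι y) }
    ; lι = λ { (b ∷ y) → trans (cong₂ _+_ (zeroˡ b) (lι y)) (+-identityˡ 0#) }
    ; μ = 0# ∷ μ
    ; μ≢𝟎 = λ e → μ≢𝟎 (cong tail e)
    ; μι = λ { (b ∷ y) → trans (cong₂ _+_ (zeroˡ b) (μι y)) (+-identityˡ 0#) } }
    where open Kernel (kernel l)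

  -- Elimination: the remaining equations are rewritten in coordinates of the kernel of the first
  -- one.
  solution : ∀ {n} (E : List (Vec F n)) → length E < n → ∃ λ v → v ≢ 𝟎 × All (λ e → dot e v ≡ 0#) E
  solution {suc n} [] h = (1# ∷ 𝟎) , (λ e → 1≢0 (cong head e)) , []
  solution {suc n} (e ∷ E) (s≤s h) =
    ι y , (λ ιy≡𝟎 → y≢𝟎 (trans (sym (ρι y)) (trans (cong ρ ιy≡𝟎) (IsLinear.𝟎-homo ρ-linear)))) ,
    lι y ∷ pull E (proj₂ (proj₂ rec))
    where
    open Kernel (kernel e)
    E′ = map (λ a → rep (λ x → dot a (ι x))) E
    rec = solution E′ (subst (_< n) (sym (Lₚ.length-map _ E)) h)
    y = proj₁ rec
    y≢𝟎 = proj₁ (proj₂ rec)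
    pull : ∀ A → All (λ a → dot a y ≡ 0#) (map (λ a → rep (λ x → dot a (ι x))) A) → All (λ a → dot a (ι y) ≡ 0#) A
    pull [] [] = []
    pull (a ∷ A) (p ∷ ps) = trans (sym (dot-rep (dot-linear ι-linear a) y)) p ∷ pull A ps

  Indep : ∀ {m n} → Vec (Vec F n) m → Set
  Indep us = ∀ t → comb t us ≡ 𝟎 → t ≡ 𝟎

  InSpan : ∀ {m n} → Vec F n → Vec (Vec F n) m → Set
  InSpan v us = ∃ λ t → comb t us ≡ v

  inSpan? : ∀ {m n} (v : Vec F n) (us : Vec (Vec F n) m) → Dec (InSpan v us)
  inSpan? v us = anyV? (λ t → comb t us ≟V v)

  indep-[] : ∀ {n} → Indep {0} {n} []
  indep-[] [] _ = refl

  indep-∷ : ∀ {m n} {v : Vec F n} {us : Vec (Vec F n) m} → Indep us → ¬ InSpan v us → Indep (v ∷ us)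
  indep-∷ {v = v} {us} ind v∉ (a ∷ t) e with a ≟ 0#
  ... | yes refl = cong (0# ∷_) (ind t (trans (sym (trans (cong (_⊕ comb t us) (·-zeroˡ v)) (⊕-identityˡ _))) e))
  ... | no a≢0 = ⊥-elim (v∉ ((- (a ⁻¹)) · t , trans (comb-· (- (a ⁻¹)) t us) (lem v (comb t us) e)))
    where
    coord : ∀ v w → a * v + w ≡ 0# → - (a ⁻¹) * w ≡ v
    coord v w e = begin
      - (a ⁻¹) * w                            ≡⟨ solve 4 (λ i w a v → :- i :* w := i :* a :* v :- i :* (a :* v :+ w)) refl (a ⁻¹) w a v ⟩
      a ⁻¹ * a * v - a ⁻¹ * (a * v + w)       ≡⟨ cong₂ (λ x y → x * v - a ⁻¹ * y) (⁻¹-inverseˡ a≢0) e ⟩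
      1# * v - a ⁻¹ * 0#                      ≡⟨ solve 2 (λ v i → :1 :* v :- i :* :0 := v) refl v (a ⁻¹) ⟩
      v                                       ∎
      where open ≡-Reasoning
    lem : ∀ {n} (v w : Vec F n) → a · v ⊕ w ≡ 𝟎 → (- (a ⁻¹)) · w ≡ v
    lem [] [] _ = refl
    lem (x ∷ v) (y ∷ w) e = cong₂ _∷_ (coord x y (cong head e)) (lem v w (cong tail e))

  private
    rows : ∀ {m} n → Vec (Vec F n) m → List (Vec F m)
    rows zero us = []
    rows (suc n) us = Vec.map head us ∷ rows n (Vec.map tail us)

    length-rows : ∀ {m} n (us : Vec (Vec F n) m) → length (rows n us) ≡ n
    length-rows zero us = refl
    length-rows (suc n) us = cong suc (length-rows n (Vec.map tail us))

    comb-rows : ∀ {m n} (t : Vec F m) (us : Vec (Vec F (suc n)) m) →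
      comb t us ≡ dot (Vec.map head us) t ∷ comb t (Vec.map tail us)
    comb-rows [] [] = refl
    comb-rows (a ∷ t) ((b ∷ u) ∷ us) rewrite comb-rows t us = cong₂ _∷_ (cong (_+ dot (Vec.map head us) t) (*-comm a b)) refl

    rows-𝟎 : ∀ {m} n (t : Vec F m) (us : Vec (Vec F n) m) → All (λ r → dot r t ≡ 0#) (rows n us) → comb t us ≡ 𝟎
    rows-𝟎 zero t us h with comb t us
    ... | [] = refl
    rows-𝟎 (suc n) t us (h ∷ hs) = trans (comb-rows t us) (cong₂ _∷_ h (rows-𝟎 n t (Vec.map tail us) hs))

  indep-bound : ∀ {m n} {us : Vec (Vec F n) m} → Indep us → m ≤ n
  indep-bound {m} {n} {us} ind with m ℕₚ.≤? n
  ... | yes h = h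
  ... | no h with solution (rows n us) (subst (_< m) (sym (length-rows n us)) (ℕₚ.≰⇒> h))
  ... | t , t≢𝟎 , eqs = ⊥-elim (t≢𝟎 (ind t (rows-𝟎 n t us eqs)))

  annihilator : ∀ {m n} (us : Vec (Vec F n) m) → m < n → ∃ λ a → a ≢ 𝟎 × dots a us ≡ 𝟎
  annihilator {m} {n} us h with solution (Vec.toList us) (subst (_< n) (sym (len us)) h)
    where
    len : ∀ {k} (ws : Vec (Vec F n) k) → length (Vec.toList ws) ≡ k
    len [] = refl
    len (w ∷ ws) = cong suc (len ws)
  ... | a , a≢𝟎 , eqs = a , a≢𝟎 , lem us eqs
    where
    lem : ∀ {k} (ws : Vec (Vec F n) k) → All (λ e → dot e a ≡ 0#) (Vec.toList ws) → dots a ws ≡ 𝟎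
    lem [] [] = refl
    lem (w ∷ ws) (p ∷ ps) = cong₂ _∷_ (trans (dot-comm a w) p) (lem ws ps)

  dot-annihilator : ∀ {m n} (a : Vec F n) {us : Vec (Vec F n) m} → dots a us ≡ 𝟎 → ∀ t → dot a (comb t us) ≡ 0#
  dot-annihilator a {us} h t = trans (dot-comb a t us) (trans (cong (λ z → dot z t) h) (dot-𝟎ˡ t))

  unit-vector : ∀ {n} {l : Vec F n} → l ≢ 𝟎 → ∃ λ e → dot l e ≡ 1#
  unit-vector {zero} {[]} h = ⊥-elim (h refl)
  unit-vector {suc n} {a ∷ l} h with a ≟ 0#
  ... | no a≢0 = (a ⁻¹ ∷ 𝟎) , trans (cong₂ _+_ (⁻¹-inverseʳ a≢0) (dot-𝟎ʳ l)) (+-identityʳ 1#)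
  ... | yes refl with unit-vector {n} {l} (λ e → h (cong (0# ∷_) e))
  ...   | e , le≡1 = (0# ∷ e) , trans (cong₂ _+_ (zeroʳ 0#) le≡1) (+-identityˡ 1#)

  -- Otherwise `v` and a vector off the hyperplane would extend `us` to more independent vectors
  -- than the dimension allows.
  hyperplane-span : ∀ {n} {us : Vec (Vec F (suc n)) n} {l} → Indep us → l ≢ 𝟎 → dots l us ≡ 𝟎 →
    ∀ v → dot l v ≡ 0# → InSpan v us
  hyperplane-span {n} {us} {l} ind l≢𝟎 lus v lv with inSpan? v us
  ... | yes p = p
  ... | no v∉ = ⊥-elim (ℕₚ.<-irrefl refl (indep-bound (indep-∷ (indep-∷ ind v∉) e∉)))
    where
    e = proj₁ (unit-vector l≢𝟎)
    e∉ : ¬ InSpan e (v ∷ us)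
    e∉ (t , eq) = 1≢0 (trans (sym (proj₂ (unit-vector l≢𝟎))) (trans (cong (dot l) (sym eq))
      (dot-annihilator l (cong₂ _∷_ lv lus) t)))

  module _ {N} (c : Vec F N → F) where
    -- The forms may repeat or be dependent, which covers kernels of codimension below three.
    record Periodic : Set where
      field
        l₁ l₂ l₃ : Vec F N
        period : ∀ x z → dot l₁ z ≡ 0# → dot l₂ z ≡ 0# → dot l₃ z ≡ 0# → c (x ⊕ z) ≡ c x

  castList : ∀ {n} → List (ℕ × Vec F n) → Combination n
  castList = map (λ { (α , a) → ⟦ α ⟧ , a })

  code-++ : ∀ {n} (L L′ : Combination n) x → code (L ++ L′) x ≡ code L x + code L′ x
  code-++ [] L′ x = sym (+-identityˡ _)
  code-++ (_ ∷ L) L′ x = trans (cong (_ +_) (code-++ L L′ x)) (sym (+-assoc _ _ _))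

  code-tabulate : ∀ {k n} α (f : Fin k → Vec F n) x →
    code (castList (tabulate (λ i → α , f i))) x ≡ ⟦ α ⟧ * ∑F (λ i → δ (dot (f i) x))
  code-tabulate {zero} α f x = sym (trans (cong (⟦ α ⟧ *_) (∑F-nil _)) (zeroʳ _))
  code-tabulate {suc k} α f x = trans (cong (⟦ α ⟧ * δ (dot (f zero) x) +_) (code-tabulate α (λ i → f (suc i)) x))
    (sym (trans (cong (⟦ α ⟧ *_) (∑F-suc _)) (distribˡ _ _ _)))

  module _ {M} (L : List (ℕ × Vec F (suc (suc (suc M))))) (P : Periodic (code (castList L))) where
    open Periodic P
    private
      N : ℕ
      N = suc (suc (suc M))
      c = code (castList L)
      module K₁ = Kernel (kernel l₁)
      l₂′ = rep (λ x → dot l₂ (K₁.ι x))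
      module K₂ = Kernel (kernel l₂′)
      l₃′ = rep (λ x → dot l₃ (K₁.ι (K₂.ι x)))
      module K₃ = Kernel (kernel l₃′)

      ι : Vec F M → Vec F N
      ι y = K₁.ι (K₂.ι (K₃.ι y))
      ρ : Vec F N → Vec F M
      ρ x = K₃.ρ (K₂.ρ (K₁.ρ x))
      ι₁₂-linear : IsLinear (λ y → K₁.ι (K₂.ι y))
      ι₁₂-linear = ∘-linear K₁.ι-linear K₂.ι-linear
      ι-linear : IsLinear ι
      ι-linear = ∘-linear ι₁₂-linear K₃.ι-linear
      ρ-linear : IsLinear ρ
      ρ-linear = ∘-linear K₃.ρ-linear (∘-linear K₂.ρ-linear K₁.ρ-linear)
      ρι : ∀ y → ρ (ι y) ≡ y
      ρι y = trans (cong (λ z → K₃.ρ (K₂.ρ z)) (K₁.ρι _)) (trans (cong K₃.ρ (K₂.ρι _)) (K₃.ρι y))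
      ιρ-linear : IsLinear (λ x → ι (ρ x))
      ιρ-linear = ∘-linear ι-linear ρ-linear

      -- The projection along the image of `ι` onto the kernel of `ρ`. The word is invariant under
      -- it, so each of its hyperplanes may be replaced by the pullback along `π`.
      π : Vec F N → Vec F N
      π x = x ⊕ (- 1#) · ι (ρ x)

      π-linear : IsLinear π
      π-linear = record
        { ⊕-homo = λ x y → trans (cong (λ z → (x ⊕ y) ⊕ (- 1#) · z) (IsLinear.⊕-homo ιρ-linear x y)) (lem x y _ _)
        ; ·-homo = λ r x → trans (cong (λ z → r · x ⊕ (- 1#) · z) (IsLinear.·-homo ιρ-linear r x)) (lem′ r x _) }
        where
        lem : ∀ {n} (x y u w : Vec F n) → (x ⊕ y) ⊕ (- 1#) · (u ⊕ w) ≡ (x ⊕ (- 1#) · u) ⊕ (y ⊕ (- 1#) · w)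
        lem [] [] [] [] = refl
        lem (x ∷ xs) (y ∷ ys) (u ∷ us) (w ∷ ws) = cong₂ _∷_
          (solve 4 (λ x y u w → (x :+ y) :+ (:- :1) :* (u :+ w) := (x :+ (:- :1) :* u) :+ (y :+ (:- :1) :* w)) refl x y u w) (lem xs ys us ws)
        lem′ : ∀ {n} r (x u : Vec F n) → r · x ⊕ (- 1#) · (r · u) ≡ r · (x ⊕ (- 1#) · u)
        lem′ r [] [] = refl
        lem′ r (x ∷ xs) (u ∷ us) = cong₂ _∷_
          (solve 3 (λ r x u → r :* x :+ (:- :1) :* (r :* u) := r :* (x :+ (:- :1) :* u)) refl r x u) (lem′ r xs us)

      πι : ∀ y → π (ι y) ≡ 𝟎
      πι y = trans (cong (λ z → ι y ⊕ (- 1#) · ι z) (ρι y)) (lem (ι y))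
        where
        lem : ∀ {n} (x : Vec F n) → x ⊕ (- 1#) · x ≡ 𝟎
        lem [] = refl
        lem (x ∷ xs) = cong₂ _∷_ (solve 1 (λ x → x :+ (:- :1) :* x := :0) refl x) (lem xs)

      c-π : ∀ x → c x ≡ c (π x)
      c-π x = trans (cong c (sym (⊖-cancelʳ x (ι (ρ x))))) (period (π x) (ι (ρ x))
        (K₁.lι _)
        (trans (sym (dot-rep (dot-linear K₁.ι-linear l₂) _)) (K₂.lι _))
        (trans (sym (dot-rep (dot-linear ι₁₂-linear l₃) _)) (K₃.lι _)))

      proj : Vec F N → Vec F N
      proj a = rep (λ x → dot a (π x))

      dot-proj : ∀ a x → dot (proj a) x ≡ dot a (π x)
      dot-proj a = dot-rep (dot-linear π-linear a)

      -- A form that vanishes on the image of `ι` and is independent of `K₁.μ`; together the two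
      -- span the pencil below.
      μ₂ : Vec F N
      μ₂ = rep (λ x → dot K₂.μ (K₁.ρ x))

      dot-μ₂ : ∀ x → dot μ₂ x ≡ dot K₂.μ (K₁.ρ x)
      dot-μ₂ = dot-rep (dot-linear K₁.ρ-linear K₂.μ)

      -- A pencil of hyperplanes covers every point 1 time modulo p: it represents the zero form.
      pencil : ℕ → List (ℕ × Vec F N)
      pencil α = (α , K₁.μ) ∷ tabulate {n = q} (λ t → α , μ₂ ⊕ t · K₁.μ)

      code-pencil : ∀ α x → code (castList (pencil α)) x ≡ ⟦ α ⟧
      code-pencil α x = begin
        ⟦ α ⟧ * δ (dot K₁.μ x) + code (castList (tabulate {n = q} (λ t → α , μ₂ ⊕ t · K₁.μ))) x
          ≡⟨ cong (⟦ α ⟧ * δ (dot K₁.μ x) +_) (trans (code-tabulate α (λ t → μ₂ ⊕ t · K₁.μ) x)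
               (cong (⟦ α ⟧ *_) (∑F-cong {q} (λ t → cong δ (trans (dot-⊕ˡ μ₂ (t · K₁.μ) x) (cong (dot μ₂ x +_) (dot-·ˡ t K₁.μ x))))))) ⟩
        ⟦ α ⟧ * δ (dot K₁.μ x) + ⟦ α ⟧ * ∑F {q} (λ t → δ (dot μ₂ x + t * dot K₁.μ x))
          ≡⟨ solve 3 (λ a d s → a :* d :+ a :* s := a :* (s :+ d)) refl ⟦ α ⟧ _ _ ⟩
        ⟦ α ⟧ * (∑F {q} (λ t → δ (dot μ₂ x + t * dot K₁.μ x)) + δ (dot K₁.μ x))
          ≡⟨ cong (⟦ α ⟧ *_) (δ-line (dot μ₂ x) (dot K₁.μ x)) ⟩
        ⟦ α ⟧ * 1#   ≡⟨ *-identityʳ _ ⟩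
        ⟦ α ⟧        ∎
        where open ≡-Reasoning

      Good : ℕ × Vec F N → Set
      Good (_ , a) = a ≢ 𝟎 × (∀ y → dot a (ι y) ≡ 0#)

      pencil-good : ∀ α → All Good (pencil α)
      pencil-good α = (K₁.μ≢𝟎 , λ y → K₁.μι _) ∷ Allₚ.tabulate⁺ (λ t → nonzero t , vanish t)
        where
        vanish : ∀ t y → dot (μ₂ ⊕ t · K₁.μ) (ι y) ≡ 0#
        vanish t y = begin
          dot (μ₂ ⊕ t · K₁.μ) (ι y)             ≡⟨ dot-⊕ˡ μ₂ (t · K₁.μ) (ι y) ⟩
          dot μ₂ (ι y) + dot (t · K₁.μ) (ι y)   ≡⟨ cong₂ _+_ (trans (dot-μ₂ (ι y)) (trans (cong (dot K₂.μ) (K₁.ρι _)) (K₂.μι _)))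
                                                     (trans (dot-·ˡ t K₁.μ (ι y)) (trans (cong (t *_) (K₁.μι _)) (zeroʳ t))) ⟩
          0# + 0#                               ≡⟨ +-identityˡ 0# ⟩
          0#                                    ∎
          where open ≡-Reasoning
        nonzero : ∀ t → μ₂ ⊕ t · K₁.μ ≢ 𝟎
        nonzero t e = 1≢0 (begin
          1#                                        ≡⟨ proj₂ uv ⟨
          dot K₂.μ y                                ≡⟨ cong (dot K₂.μ) (K₁.ρι y) ⟨
          dot K₂.μ (K₁.ρ (K₁.ι y))                  ≡⟨ dot-μ₂ _ ⟨
          dot μ₂ (K₁.ι y)                           ≡⟨ trans (sym (+-identityʳ _)) (cong (dot μ₂ (K₁.ι y) +_)
                                                         (sym (trans (dot-·ˡ t K₁.μ _) (trans (cong (t *_) (K₁.μι _)) (zeroʳ t))))) ⟩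
          dot μ₂ (K₁.ι y) + dot (t · K₁.μ) (K₁.ι y) ≡⟨ dot-⊕ˡ μ₂ (t · K₁.μ) _ ⟨
          dot (μ₂ ⊕ t · K₁.μ) (K₁.ι y)              ≡⟨ trans (cong (λ z → dot z (K₁.ι y)) e) (dot-𝟎ˡ (K₁.ι y)) ⟩
          0#                                        ∎)
          where
          open ≡-Reasoning
          uv = unit-vector K₂.μ≢𝟎
          y = proj₁ uv

      -- A hyperplane containing the image of `π` pulls back to the zero form, which is no
      -- hyperplane. The pencil has the same incidence, constantly 1 in the field, and takes its
      -- place.
      piece : ℕ × Vec F N → List (ℕ × Vec F N)
      piece (α , a) with proj a ≟V 𝟎
      ... | yes _ = pencil α
      ... | no _ = (α , proj a) ∷ []

      piece-good : ∀ t → All Good (piece t)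
      piece-good (α , a) with proj a ≟V 𝟎
      ... | yes _ = pencil-good α
      ... | no n = (n , λ y → trans (dot-proj a (ι y)) (trans (cong (dot a) (πι y)) (dot-𝟎ʳ a))) ∷ []

      code-piece : ∀ α a x → code (castList (piece (α , a))) x ≡ ⟦ α ⟧ * δ (dot a (π x))
      code-piece α a x with proj a ≟V 𝟎
      ... | yes e = trans (code-pencil α x) (trans (sym (*-identityʳ _)) (cong (⟦ α ⟧ *_) (sym (δ-0
              (trans (sym (dot-proj a x)) (trans (cong (λ z → dot z x) e) (dot-𝟎ˡ x)))))))
      ... | no _ = trans (+-identityʳ _) (cong (λ z → ⟦ α ⟧ * δ z) (dot-proj a x))

      pieces : List (ℕ × Vec F N) → List (ℕ × Vec F N)
      pieces [] = []
      pieces (t ∷ K) = piece t ++ pieces K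

      pieces-good : ∀ K → All Good (pieces K)
      pieces-good [] = []
      pieces-good (t ∷ K) = Allₚ.++⁺ (piece-good t) (pieces-good K)

      code-pieces : ∀ K x → code (castList (pieces K)) x ≡ code (castList K) (π x)
      code-pieces [] x = refl
      code-pieces ((α , a) ∷ K) x = trans (cong (λ z → code z x) (Lₚ.map-++ _ (piece (α , a)) (pieces K)))
        (trans (code-++ (castList (piece (α , a))) _ x) (cong₂ _+_ (code-piece α a x) (code-pieces K x)))

    periodic⇒cone : ∃ λ (κ : Vec (Vec F N) M) → Indep κ ×
      ∃ λ (L′ : List (ℕ × Vec F N)) → All (λ t → proj₂ t ≢ 𝟎) L′ × All (λ t → dots (proj₂ t) κ ≡ 𝟎) L′
        × (∀ x → code (castList L) x ≡ code (castList L′) x)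
    periodic⇒cone = columns ι ,
      (λ t e → trans (sym (ρι t)) (trans (cong ρ (trans (sym (comb-columns ι-linear t)) e)) (IsLinear.𝟎-homo ρ-linear))) ,
      pieces L , All.map proj₁ (pieces-good L) , All.map (λ { {_ , a} (_ , h) → vanish a h }) (pieces-good L) ,
      λ x → trans (c-π x) (sym (code-pieces L x))
      where
      dots-columns : ∀ {m n} (a : Vec F n) (f : Vec F m → Vec F n) → (∀ y → dot a (f y) ≡ 0#) → dots a (columns f) ≡ 𝟎
      dots-columns {zero} a f h = refl
      dots-columns {suc m} a f h = cong₂ _∷_ (h _) (dots-columns a (λ x → f (0# ∷ x)) (λ y → h _))
      vanish : ∀ a → (∀ y → dot a (ι y) ≡ 0#) → dots a (columns ι) ≡ 𝟎
      vanish a = dots-columns a ι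

-- Polynomial moments and the weight of parallel lines

module LineLemma {q : ℕ} (𝔽 : FinField q) where
  open LinearAlgebra 𝔽 public

  private
    -- Polynomials given by coefficient sequences, truncated to degree below n.
    evS : ℕ → (ℕ → F) → F → F
    evS zero f y = 0#
    evS (suc n) f y = f 0 + y * evS n (f ∘ suc) y

    sumN : ℕ → (ℕ → F) → F
    sumN zero f = 0#
    sumN (suc n) f = f 0 + sumN n (f ∘ suc)

    conv : (ℕ → F) → (ℕ → F) → ℕ → F
    conv f g zero = f 0 * g 0
    conv f g (suc e) = f 0 * g (suc e) + conv (f ∘ suc) g e

    evS-cong : ∀ n {f g} y → (∀ i → i < n → f i ≡ g i) → evS n f y ≡ evS n g y
    evS-cong zero y h = refl
    evS-cong (suc n) y h = cong₂ (λ a b → a + y * b) (h 0 (s≤s z≤n)) (evS-cong n y (λ i i<n → h (suc i) (s≤s i<n)))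

    evS-0 : ∀ n y → evS n (λ _ → 0#) y ≡ 0#
    evS-0 zero y = refl
    evS-0 (suc n) y = trans (cong (λ z → 0# + y * z) (evS-0 n y)) (trans (+-identityˡ _) (zeroʳ y))

    evS-+ : ∀ n f g y → evS n (λ i → f i + g i) y ≡ evS n f y + evS n g y
    evS-+ zero f g y = sym (+-identityˡ 0#)
    evS-+ (suc n) f g y = trans (cong (λ z → f 0 + g 0 + y * z) (evS-+ n (f ∘ suc) (g ∘ suc) y))
      (solve 5 (λ a b y u w → a :+ b :+ y :* (u :+ w) := (a :+ y :* u) :+ (b :+ y :* w)) refl _ _ y _ _)

    evS-* : ∀ n c f y → evS n (λ i → c * f i) y ≡ c * evS n f y
    evS-* zero c f y = sym (zeroʳ c)
    evS-* (suc n) c f y = trans (cong (λ z → c * f 0 + y * z) (evS-* n c (f ∘ suc) y))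
      (solve 4 (λ c a y u → c :* a :+ y :* (c :* u) := c :* (a :+ y :* u)) refl c _ y _)

    evS-extend : ∀ n k {f} y → (∀ i → n ≤ i → f i ≡ 0#) → evS (n ℕ.+ k) f y ≡ evS n f y
    evS-extend zero k y h = trans (evS-cong k y (λ i _ → h i z≤n)) (evS-0 k y)
    evS-extend (suc n) k {f} y h = cong (λ z → f 0 + y * z) (evS-extend n k y (λ i n≤i → h (suc i) (s≤s n≤i)))

    evS-extend′ : ∀ {n n′ f} y → n ≤ n′ → (∀ i → n ≤ i → f i ≡ 0#) → evS n′ f y ≡ evS n f y
    evS-extend′ {n} {n′} {f} y n≤n′ h = trans (cong (λ k → evS k f y) (sym (ℕₚ.m+[n∸m]≡n n≤n′))) (evS-extend n (n′ ∸ n) y h)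

    conv-0ˡ : ∀ {f} g e → (∀ i → f i ≡ 0#) → conv f g e ≡ 0#
    conv-0ˡ g zero h = trans (cong (_* g 0) (h 0)) (zeroˡ _)
    conv-0ˡ g (suc e) h = trans (cong₂ _+_ (trans (cong (_* g (suc e)) (h 0)) (zeroˡ _)) (conv-0ˡ g e (λ i → h (suc i)))) (+-identityˡ 0#)

    evS-conv : ∀ n A B {f g} y → A ℕ.+ B ≤ n → (∀ i → A ≤ i → f i ≡ 0#) → (∀ i → B ≤ i → g i ≡ 0#) →
      evS n (conv f g) y ≡ evS A f y * evS B g y
    evS-conv n zero B {f} {g} y h hf hg = trans (evS-cong n y (λ i _ → conv-0ˡ g i (λ k → hf k z≤n)))
      (trans (evS-0 n y) (sym (zeroˡ _)))
    evS-conv (suc n) (suc A) B {f} {g} y (s≤s h) hf hg = begin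
      f 0 * g 0 + y * evS n (λ e → f 0 * g (suc e) + conv (f ∘ suc) g e) y
        ≡⟨ cong (λ z → f 0 * g 0 + y * z) (trans (evS-+ n _ _ y) (cong (_+ evS n (conv (f ∘ suc) g) y) (evS-* n (f 0) (g ∘ suc) y))) ⟩
      f 0 * g 0 + y * (f 0 * evS n (g ∘ suc) y + evS n (conv (f ∘ suc) g) y)
        ≡⟨ solve 5 (λ a b y u w → a :* b :+ y :* (a :* u :+ w) := a :* (b :+ y :* u) :+ y :* w) refl (f 0) (g 0) y _ _ ⟩
      f 0 * evS (suc n) g y + y * evS n (conv (f ∘ suc) g) y
        ≡⟨ cong₂ (λ u w → f 0 * u + y * w) (evS-extend′ y (ℕₚ.≤-trans (ℕₚ.m≤n+m B A) (ℕₚ.m≤n⇒m≤1+n h)) hg)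
             (evS-conv n A B y h (λ i A≤i → hf (suc i) (s≤s A≤i)) hg) ⟩
      f 0 * evS B g y + y * (evS A (f ∘ suc) y * evS B g y)
        ≡⟨ solve 4 (λ a y u w → a :* w :+ y :* (u :* w) := (a :+ y :* u) :* w) refl (f 0) y _ _ ⟩
      (f 0 + y * evS A (f ∘ suc) y) * evS B g y ∎
      where open ≡-Reasoning

    conv-high : ∀ A B {f g} e → A ℕ.+ B ≤ e → (∀ i → A < i → f i ≡ 0#) → (∀ i → B ≤ i → g i ≡ 0#) → conv f g e ≡ 0#
    conv-high A B {f} {g} zero h hf hg = trans (cong (f 0 *_) (hg 0 (ℕₚ.≤-trans (ℕₚ.m≤n+m B A) h))) (zeroʳ _)
    conv-high zero B {f} {g} (suc e) h hf hg = trans (cong₂ _+_ (trans (cong (f 0 *_) (hg (suc e) h)) (zeroʳ _))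
      (conv-0ˡ g e (λ i → hf (suc i) (s≤s z≤n)))) (+-identityˡ 0#)
    conv-high (suc A) B {f} {g} (suc e) (s≤s h) hf hg = trans (cong₂ _+_
      (trans (cong (f 0 *_) (hg (suc e) (ℕₚ.≤-trans (ℕₚ.m≤n+m B A) (ℕₚ.m≤n⇒m≤1+n h)))) (zeroʳ _))
      (conv-high A B e h (λ i A<i → hf (suc i) (s≤s A<i)) hg)) (+-identityˡ 0#)

    conv-low : ∀ {f g} e → (∀ i → i < e → g i ≡ 0#) → conv f g e ≡ f 0 * g e
    conv-low zero h = refl
    conv-low {f} {g} (suc e) h = trans (cong (f 0 * g (suc e) +_) (rest e (f ∘ suc) (λ i i≤e → h i (s≤s i≤e)))) (+-identityʳ _)
      where
      rest : ∀ e f → (∀ i → i ≤ e → g i ≡ 0#) → conv f g e ≡ 0#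
      rest zero f h = trans (cong (f 0 *_) (h 0 z≤n)) (zeroʳ _)
      rest (suc e) f h = trans (cong₂ _+_ (trans (cong (f 0 *_) (h (suc e) ℕₚ.≤-refl)) (zeroʳ _))
        (rest e (f ∘ suc) (λ i i≤e → h i (ℕₚ.m≤n⇒m≤1+n i≤e)))) (+-identityˡ 0#)

    sumN-cong : ∀ n {f g} → (∀ i → i < n → f i ≡ g i) → sumN n f ≡ sumN n g
    sumN-cong zero h = refl
    sumN-cong (suc n) h = cong₂ _+_ (h 0 (s≤s z≤n)) (sumN-cong n (λ i i<n → h (suc i) (s≤s i<n)))

    sumN-0 : ∀ n {f} → (∀ i → i < n → f i ≡ 0#) → sumN n f ≡ 0#
    sumN-0 zero h = refl
    sumN-0 (suc n) h = trans (cong₂ _+_ (h 0 (s≤s z≤n)) (sumN-0 n (λ i i<n → h (suc i) (s≤s i<n)))) (+-identityˡ 0#)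

    evS-sumN : ∀ n s (f : ℕ → ℕ → F) y → evS n (λ e → sumN s (λ j → f j e)) y ≡ sumN s (λ j → evS n (f j) y)
    evS-sumN n zero f y = evS-0 n y
    evS-sumN n (suc s) f y = trans (evS-+ n (f 0) (λ e → sumN s (λ j → f (suc j) e)) y) (cong (evS n (f 0) y +_) (evS-sumN n s (f ∘ suc) y))

    tab : ∀ n → (ℕ → F) → Vec F n
    tab zero f = []
    tab (suc n) f = f 0 ∷ tab n (f ∘ suc)

    ev-tab : ∀ n f y → ev (tab n f) y ≡ evS n f y
    ev-tab zero f y = refl
    ev-tab (suc n) f y = cong (λ z → f 0 + y * z) (ev-tab n (f ∘ suc) y)

    tab-𝟎 : ∀ n {f} → tab n f ≡ 𝟎 → ∀ i → i < n → f i ≡ 0#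
    tab-𝟎 (suc n) e zero _ = cong head e
    tab-𝟎 (suc n) e (suc i) (s≤s h) = tab-𝟎 n (cong tail e) i h

    evS-vanish : ∀ n f (xs : List F) → Unique xs → All (λ x → evS n f x ≡ 0#) xs → n ≤ length xs → ∀ i → i < n → f i ≡ 0#
    evS-vanish n f xs u a h = tab-𝟎 n (vanishing⇒𝟎 (tab n f) xs u (All.map (λ {x} e → trans (ev-tab n f x) e) a) h)

    nth : ∀ {n} → Vec F n → ℕ → F
    nth [] k = 0#
    nth (a ∷ v) zero = a
    nth (a ∷ v) (suc k) = nth v k

    nth-⊕ : ∀ {n} (x y : Vec F n) k → nth (x ⊕ y) k ≡ nth x k + nth y k
    nth-⊕ [] [] k = sym (+-identityˡ 0#)
    nth-⊕ (a ∷ x) (b ∷ y) zero = refl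
    nth-⊕ (a ∷ x) (b ∷ y) (suc k) = nth-⊕ x y k

    nth-· : ∀ {n} r (x : Vec F n) k → nth (r · x) k ≡ r * nth x k
    nth-· r [] k = sym (zeroʳ r)
    nth-· r (a ∷ x) zero = refl
    nth-· r (a ∷ x) (suc k) = nth-· r x k

    nth-𝟎 : ∀ {n} (x : Vec F n) → (∀ k → k < n → nth x k ≡ 0#) → x ≡ 𝟎
    nth-𝟎 [] h = refl
    nth-𝟎 (a ∷ x) h = cong₂ _∷_ (h 0 (s≤s z≤n)) (nth-𝟎 x (λ k k<n → h (suc k) (s≤s k<n)))

    module _ {n : ℕ} where
      open IsFunctional

      fun-0 : IsFunctional {n} (λ _ → 0#)
      fun-0 = record { +-homo = λ _ _ → sym (+-identityˡ 0#) ; ·-homo = λ r _ → sym (zeroʳ r) }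

      fun-nth : ∀ k → IsFunctional {n} (λ v → nth v k)
      fun-nth k = record { +-homo = λ x y → nth-⊕ x y k ; ·-homo = λ r x → nth-· r x k }

      fun-+ : ∀ {f g : Vec F n → F} → IsFunctional f → IsFunctional g → IsFunctional (λ v → f v + g v)
      fun-+ F G = record
        { +-homo = λ x y → trans (cong₂ _+_ (+-homo F x y) (+-homo G x y))
            (solve 4 (λ a b c d → (a :+ b) :+ (c :+ d) := (a :+ c) :+ (b :+ d)) refl _ _ _ _)
        ; ·-homo = λ r x → trans (cong₂ _+_ (·-homo F r x) (·-homo G r x)) (sym (distribˡ r _ _)) }

      fun-* : ∀ c {f : Vec F n → F} → IsFunctional f → IsFunctional (λ v → c * f v)
      fun-* c F = record
        { +-homo = λ x y → trans (cong (c *_) (+-homo F x y)) (distribˡ c _ _)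
        ; ·-homo = λ r x → trans (cong (c *_) (·-homo F r x)) (solve 3 (λ c r a → c :* (r :* a) := r :* (c :* a)) refl c r _) }

      fun-evS : ∀ k {f : ℕ → Vec F n → F} y → (∀ i → IsFunctional (f i)) → IsFunctional (λ v → evS k (λ i → f i v) y)
      fun-evS zero y h = fun-0
      fun-evS (suc k) y h = fun-+ (h 0) (fun-* y (fun-evS k y (λ i → h (suc i))))

      fun-sumN : ∀ k {f : ℕ → Vec F n → F} → (∀ i → IsFunctional (f i)) → IsFunctional (λ v → sumN k (λ i → f i v))
      fun-sumN zero h = fun-0
      fun-sumN (suc k) h = fun-+ (h 0) (fun-sumN k (λ i → h (suc i)))

      fun-conv : ∀ a {g : ℕ → Vec F n → F} e → (∀ i → IsFunctional (g i)) → IsFunctional (λ v → conv a (λ i → g i v) e)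
      fun-conv a zero h = fun-* (a 0) (h 0)
      fun-conv a (suc e) h = fun-+ (fun-* (a 0) (h (suc e))) (fun-conv (a ∘ suc) e h)

    -- The coefficients of (β + y γ)^m as a polynomial in y.
    pw : F → F → ℕ → ℕ → F
    pw β γ zero zero = 1#
    pw β γ zero (suc i) = 0#
    pw β γ (suc m) zero = β * pw β γ m 0
    pw β γ (suc m) (suc i) = β * pw β γ m (suc i) + γ * pw β γ m i

    pw-high : ∀ β γ m i → m < i → pw β γ m i ≡ 0#
    pw-high β γ zero (suc i) h = refl
    pw-high β γ (suc m) (suc i) (s≤s h) = trans (cong₂ (λ a b → β * a + γ * b) (pw-high β γ m (suc i) (ℕₚ.m≤n⇒m≤1+n h)) (pw-high β γ m i h))
      (solve 2 (λ b g → b :* :0 :+ g :* :0 := :0) refl β γ)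

    ev-pw : ∀ β γ m n y → m < n → evS n (pw β γ m) y ≡ (β + y * γ) ^ m
    ev-pw β γ zero (suc n) y h = trans (cong (λ z → 1# + y * z) (evS-0 n y)) (solve 1 (λ y → :1 :+ y :* :0 := :1) refl y)
    ev-pw β γ (suc m) (suc n) y (s≤s h) = begin
      β * pw β γ m 0 + y * evS n (λ i → β * pw β γ m (suc i) + γ * pw β γ m i) y
        ≡⟨ cong (λ z → β * pw β γ m 0 + y * z) (trans (evS-+ n _ _ y) (cong₂ _+_ (evS-* n β (pw β γ m ∘ suc) y) (evS-* n γ (pw β γ m) y))) ⟩
      β * pw β γ m 0 + y * (β * evS n (pw β γ m ∘ suc) y + γ * evS n (pw β γ m) y)
        ≡⟨ solve 6 (λ b p y u g w → b :* p :+ y :* (b :* u :+ g :* w) := b :* (p :+ y :* u) :+ y :* g :* w) refl β _ y _ γ _ ⟩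
      β * evS (suc n) (pw β γ m) y + y * γ * evS n (pw β γ m) y
        ≡⟨ cong₂ (λ u w → β * u + y * γ * w) (ev-pw β γ m (suc n) y (ℕₚ.m≤n⇒m≤1+n h)) (ev-pw β γ m n y h) ⟩
      β * (β + y * γ) ^ m + y * γ * (β + y * γ) ^ m ≡⟨ distribʳ _ _ _ ⟨
      (β + y * γ) * (β + y * γ) ^ m ∎
      where open ≡-Reasoning

    -- The moments of u along the lines of constant y are polynomials in y: the m-th has degree at most m.
    record Moments (u : F → F → F) : Set where
      field
        H : ℕ → ℕ → F
        H-high : ∀ m i → m < i → H m i ≡ 0#
        H-eval : ∀ m n y → m < n → ∑F {q} (λ x → u x y * x ^ m) ≡ evS n (H m) y

    moments-cong : ∀ {u u′} → (∀ x y → u x y ≡ u′ x y) → Moments u → Moments u′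
    moments-cong e M = record
      { H = H ; H-high = H-high
      ; H-eval = λ m n y h → trans (∑F-cong {q} (λ x → cong (_* x ^ m) (sym (e x y)))) (H-eval m n y h) }
      where open Moments M

    moments-0 : Moments (λ _ _ → 0#)
    moments-0 = record
      { H = λ _ _ → 0# ; H-high = λ _ _ _ → refl
      ; H-eval = λ m n y h → trans (trans (∑F-cong {q} (λ x → zeroˡ _)) (∑F-0 q)) (sym (evS-0 n y)) }

    moments-+ : ∀ {u u′} α → Moments u → Moments u′ → Moments (λ x y → α * u x y + u′ x y)
    moments-+ {u} {u′} α M M′ = record
      { H = λ m i → α * A.H m i + B.H m i
      ; H-high = λ m i h → trans (cong₂ (λ a b → α * a + b) (A.H-high m i h) (B.H-high m i h)) (trans (+-identityʳ _) (zeroʳ α))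
      ; H-eval = λ m n y h → begin
          ∑F {q} (λ x → (α * u x y + u′ x y) * x ^ m)
            ≡⟨ ∑F-cong {q} (λ x → solve 4 (λ a u w p → (a :* u :+ w) :* p := a :* (u :* p) :+ w :* p) refl α _ _ _) ⟩
          ∑F {q} (λ x → α * (u x y * x ^ m) + u′ x y * x ^ m)
            ≡⟨ trans (∑F-+ {q} _ _) (cong (_+ ∑F {q} (λ x → u′ x y * x ^ m)) (∑F-*ˡ {q} α _)) ⟩
          α * ∑F {q} (λ x → u x y * x ^ m) + ∑F {q} (λ x → u′ x y * x ^ m)
            ≡⟨ cong₂ (λ a b → α * a + b) (A.H-eval m n y h) (B.H-eval m n y h) ⟩
          α * evS n (A.H m) y + evS n (B.H m) y
            ≡⟨ trans (evS-+ n _ _ y) (cong (_+ evS n (B.H m) y) (evS-* n α (A.H m) y)) ⟨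
          evS n (λ i → α * A.H m i + B.H m i) y ∎ }
      where
      open ≡-Reasoning
      module A = Moments M
      module B = Moments M′

    -- If the lines cross the hyperplane, the crossing point x is affine in y, and its m-th power
    -- has degree at most m. If they are parallel to it, the moment is the m-th power sum times a
    -- `δ` of degree at most q - 1 in y, and the power sum vanishes for m < q - 1.
    moments-δ : ∀ β d γ → Moments (λ x y → δ (β + x * d + y * γ))
    moments-δ β d γ with d ≟ 0#
    ... | no d≢0 = record
      { H = pw (- (d ⁻¹ * β)) (- (d ⁻¹ * γ)) ; H-high = pw-high _ _
      ; H-eval = λ m n y h → trans (∑F-single (root y) (off m y)) (trans (at m y) (sym (ev-pw _ _ m n y h))) }
      where
      root : F → F
      root y = - (d ⁻¹ * β) + y * (- (d ⁻¹ * γ))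
      is-root : ∀ y → β + root y * d + y * γ ≡ 0#
      is-root y = trans (solve 5 (λ b i g y d → b :+ (:- (i :* b) :+ y :* (:- (i :* g))) :* d :+ y :* g := (:1 :- i :* d) :* (b :+ y :* g)) refl β (d ⁻¹) γ y d)
        (trans (cong (λ z → (1# - z) * (β + y * γ)) (⁻¹-inverseˡ d≢0)) (solve 1 (λ b → (:1 :- :1) :* b := :0) refl _))
      off : ∀ m y x → x ≢ root y → δ (β + x * d + y * γ) * x ^ m ≡ 0#
      off m y x x≢ = trans (cong (_* x ^ m) (δ-≢0 (λ e → x≢ (x-y≡0⇒x≡y (*-cancelˡ d≢0
        (trans (solve 5 (λ d x r b g → d :* (x :- r) := (b :+ x :* d :+ g) :- (b :+ r :* d :+ g)) refl d x (root y) β (y * γ))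
          (trans (cong₂ _-_ e (is-root y)) (solve 1 (λ d → :0 :- :0 := d :* :0) refl d)))))))) (zeroˡ _)
      at : ∀ m y → δ (β + root y * d + y * γ) * root y ^ m ≡ root y ^ m
      at m y = trans (cong (_* root y ^ m) (δ-0 (is-root y))) (*-identityˡ _)
    ... | yes refl = record
      { H = λ m i → S m * (pw β γ 0 i - pw β γ q-1 i)
      ; H-high = high
      ; H-eval = λ m n y h → trans (trans (∑F-cong {q} (λ x → cong (λ z → δ z * x ^ m)
            (solve 3 (λ b x g → b :+ x :* :0 :+ g := b :+ g) refl β x (y * γ)))) (trans (∑F-*ˡ {q} _ _) (*-comm _ (S m)))) (value m n y h) }
      where
      S : ℕ → F
      S m = ∑F {q} (λ x → x ^ m)
      high : ∀ m i → m < i → S m * (pw β γ 0 i - pw β γ q-1 i) ≡ 0#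
      high m i h with m ℕₚ.<? q-1
      ... | yes m< = trans (cong (_* _) (powerSum m m<)) (zeroˡ _)
      ... | no m≮ = trans (cong₂ (λ a b → S m * (a - b)) (pw-high β γ 0 i (ℕₚ.≤-<-trans z≤n h)) (pw-high β γ q-1 i (ℕₚ.≤-<-trans (ℕₚ.≮⇒≥ m≮) h)))
        (solve 1 (λ s → s :* (:0 :- :0) := :0) refl (S m))
      value : ∀ m n y → m < n → S m * δ (β + y * γ) ≡ evS n (λ i → S m * (pw β γ 0 i - pw β γ q-1 i)) y
      value m n y h with m ℕₚ.<? q-1
      ... | yes m< = trans (trans (cong (_* δ (β + y * γ)) (powerSum m m<)) (zeroˡ _))
          (sym (trans (evS-* n (S m) (λ i → pw β γ 0 i - pw β γ q-1 i) y) (trans (cong (_* evS n (λ i → pw β γ 0 i - pw β γ q-1 i) y) (powerSum m m<)) (zeroˡ _))))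
      ... | no m≮ = trans (cong (S m *_) (begin
          δ (β + y * γ)                        ≡⟨ δ-pow _ ⟩
          1# - (β + y * γ) ^ q-1               ≡⟨ solve 2 (λ a b → a :- b := a :+ (:- :1) :* b) refl _ _ ⟩
          1# + - 1# * (β + y * γ) ^ q-1        ≡⟨ cong₂ (λ a b → a + - 1# * b) (ev-pw β γ 0 n y (ℕₚ.≤-<-trans z≤n h)) (ev-pw β γ q-1 n y (ℕₚ.≤-<-trans (ℕₚ.≮⇒≥ m≮) h)) ⟨
          evS n (pw β γ 0) y + - 1# * evS n (pw β γ q-1) y
                                               ≡⟨ cong (evS n (pw β γ 0) y +_) (evS-* n (- 1#) (pw β γ q-1) y) ⟨
          evS n (pw β γ 0) y + evS n (λ i → - 1# * pw β γ q-1 i) y ≡⟨ evS-+ n _ _ y ⟨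
          evS n (λ i → pw β γ 0 i + - 1# * pw β γ q-1 i) y
            ≡⟨ evS-cong n y (λ i _ → solve 2 (λ a b → a :+ (:- :1) :* b := a :- b) refl _ _) ⟩
          evS n (λ i → pw β γ 0 i - pw β γ q-1 i) y ∎)) (sym (evS-* n (S m) _ y))
          where open ≡-Reasoning

    moments-code : ∀ {N} (L : Combination N) b d v → Moments (λ x y → code L (b ⊕ x · d ⊕ y · v))
    moments-code [] b d v = moments-0
    moments-code ((α , a) ∷ L) b d v = moments-+ α
      (moments-cong (λ x y → cong δ (sym (trans (dot-⊕ʳ a (b ⊕ x · d) (y · v))
         (cong₂ _+_ (trans (dot-⊕ʳ a b (x · d)) (cong (dot a b +_) (dot-·ʳ a x d))) (dot-·ʳ a y v))))) (moments-δ (dot a b) (dot a d) (dot a v)))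
      (moments-code L b d v)

    -- The pairs (j, k) with k < j < s. There are s (s - 1) / 2 of them, and they index two families
    -- of coefficients that are forced to vanish.
    tri : ℕ → List (ℕ × ℕ)
    tri zero = []
    tri (suc s) = map (λ k → s , k) (upTo s) ++ tri s

    length-tri : ∀ s → length (tri s) ℕ.+ length (tri s) ℕ.+ s ≡ s ℕ.* s
    length-tri zero = refl
    length-tri (suc s) = trans (cong (λ z → z ℕ.+ z ℕ.+ suc s) (trans (Lₚ.length-++ (map _ (upTo s)))
      (cong (ℕ._+ length (tri s)) (trans (Lₚ.length-map _ (upTo s)) (Lₚ.length-upTo s)))))
      (trans (lem s (length (tri s))) (trans (cong (λ z → z ℕ.+ suc (s ℕ.+ s)) (length-tri s)) (lem′ s)))
      where
      lem : ∀ s t → s ℕ.+ t ℕ.+ (s ℕ.+ t) ℕ.+ suc s ≡ (t ℕ.+ t ℕ.+ s) ℕ.+ suc (s ℕ.+ s)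
      lem = solve-∀
      lem′ : ∀ s → s ℕ.* s ℕ.+ suc (s ℕ.+ s) ≡ suc s ℕ.* suc s
      lem′ = solve-∀

    All-tri : ∀ {P : ℕ × ℕ → Set} s → All P (tri s) → ∀ j k → j < s → k < j → P (j , k)
    All-tri (suc s) h j k (s≤s j≤s) k<j with ℕₚ.m≤n⇒m<n∨m≡n j≤s
    ... | inj₁ j<s = All-tri s (Allₚ.++⁻ʳ (map _ (upTo s)) h) j k j<s k<j
    ... | inj₂ refl = All.lookup (Allₚ.map⁻ (Allₚ.++⁻ˡ (map _ (upTo s)) h)) (∈-upTo⁺ k<j)

    join : ∀ {A : Set} n → (Fin n → List A) → List A
    join zero f = []
    join (suc n) f = f zero ++ join n (f ∘ suc)

    length-join : ∀ {A : Set} n (f : Fin n → List A) → length (join n f) ≡ ∑ (λ i → length (f i))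
    length-join zero f = sym (∑-nil _)
    length-join (suc n) f = trans (Lₚ.length-++ (f zero)) (trans (cong (length (f zero) ℕ.+_) (length-join n (f ∘ suc))) (sym (∑-suc _)))

    All-join : ∀ {A : Set} {P : A → Set} n (f : Fin n → List A) → All P (join n f) → ∀ i → All P (f i)
    All-join (suc n) f h zero = Allₚ.++⁻ˡ (f zero) h
    All-join (suc n) f h (suc i) = All-join n (f ∘ suc) (Allₚ.++⁻ʳ (f zero) h) i

  length-filter-tabulate : ∀ {n} {X : Set} (f : Fin n → X) (g : X → F) →
    length (filter (λ x → ¬? (g x ≟ 0#)) (tabulate f)) ≡ ∑ (λ i → nz (g (f i)))
  length-filter-tabulate {zero} f g = sym (∑-nil _)
  length-filter-tabulate {suc n} f g with g (f zero) ≟ 0#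
  ... | yes e = trans (length-filter-tabulate (f ∘ suc) g) (sym (trans (∑-suc _) (cong (ℕ._+ ∑ (λ i → nz (g (f (suc i))))) (nz-0 e))))
  ... | no e = trans (cong suc (length-filter-tabulate (f ∘ suc) g)) (sym (trans (∑-suc _) (cong (ℕ._+ ∑ (λ i → nz (g (f (suc i))))) (nz-1 e))))

  private
    mulLin : ∀ {n} → F → Vec F n → Vec F (suc n)
    mulLin r [] = 0# ∷ []
    mulLin r (c ∷ p) = (- (r * c)) ∷ add c (mulLin r p)
      where
      add : ∀ {n} → F → Vec F (suc n) → Vec F (suc n)
      add c (d ∷ p) = (c + d) ∷ p

    ev-mulLin : ∀ {n} r (p : Vec F n) x → ev (mulLin r p) x ≡ (x - r) * ev p x
    ev-mulLin r [] x = solve 2 (λ x r → :0 :+ x :* :0 := (x :- r) :* :0) refl x r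
    ev-mulLin r (c ∷ p) x with mulLin r p | ev-mulLin r p x
    ... | d ∷ p′ | ih = trans (solve 5 (λ r c x d w → :- (r :* c) :+ x :* (c :+ d :+ w) := (x :- r) :* c :+ x :* (d :+ w)) refl r c x d _)
      (trans (cong (λ z → (x - r) * c + x * z) ih) (solve 4 (λ x r c u → (x :- r) :* c :+ x :* ((x :- r) :* u) := (x :- r) :* (c :+ x :* u)) refl x r c _))

    -- The product of x - b over the other members b of the list: a Lagrange polynomial without its
    -- normalisation.
    isolate : ∀ a (xs : List F) → a ∈ xs → Unique xs →
      ∃ λ (p : Vec F (length xs)) → (∀ x → x ∈ xs → x ≢ a → ev p x ≡ 0#) × ev p a ≢ 0#
    isolate a (x ∷ xs) (here refl) (a∉ ∷ u) = p , (λ { x (here refl) n → ⊥-elim (n refl) ; x (there x∈) n → proj₁ (proj₂ (all xs)) x x∈ }) ,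
        proj₂ (proj₂ (all xs)) a a∉
      where
      all : ∀ ys → ∃ λ (p : Vec F (suc (length ys))) → (∀ x → x ∈ ys → ev p x ≡ 0#) × (∀ b → All (b ≢_) ys → ev p b ≢ 0#)
      all [] = (1# ∷ []) , (λ { x () }) , (λ b _ e → 1≢0 (trans (solve 1 (λ b → :1 := :1 :+ b :* :0) refl b) e))
      all (y ∷ ys) with all ys
      ... | p , zeros , nonzero = mulLin y p ,
        (λ { x (here refl) → trans (ev-mulLin x p x) (trans (cong (_* ev p x) (-‿inverseʳ x)) (zeroˡ _))
           ; x (there x∈) → trans (ev-mulLin y p x) (trans (cong ((x - y) *_) (zeros x x∈)) (zeroʳ _)) }) ,
        (λ { b (b≢y ∷ b∉) e → *-≢0 (λ z → b≢y (x-y≡0⇒x≡y z)) (nonzero b b∉) (trans (sym (ev-mulLin y p b)) e) })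
      p = proj₁ (all xs)
    isolate a (x ∷ xs) (there a∈) (x∉ ∷ u) with isolate a xs a∈ u
    ... | p , zeros , nonzero = mulLin x p ,
      (λ { y (here refl) n → trans (ev-mulLin y p y) (trans (cong (_* ev p y) (-‿inverseʳ y)) (zeroˡ _))
         ; y (there y∈) n → trans (ev-mulLin x p y) (trans (cong ((y - x) *_) (zeros y y∈ n)) (zeroʳ _)) }) ,
      (λ e → *-≢0 (λ z → All.lookup x∉ a∈ (sym (x-y≡0⇒x≡y z))) nonzero (trans (sym (ev-mulLin x p a)) e))

    moments⇒Σ : ∀ {n} (g : F → F) (p : Vec F n) → (∀ l → l < n → ∑F {q} (λ x → g x * x ^ l) ≡ 0#) → ∑F {q} (λ x → g x * ev p x) ≡ 0#
    moments⇒Σ g [] h = trans (∑F-cong {q} (λ x → zeroʳ _)) (∑F-0 q)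
    moments⇒Σ g (c ∷ p) h = begin
      ∑F {q} (λ x → g x * (c + x * ev p x))
        ≡⟨ ∑F-cong {q} (λ x → solve 4 (λ g c x w → g :* (c :+ x :* w) := c :* (g :* :1) :+ g :* x :* w) refl (g x) c x _) ⟩
      ∑F {q} (λ x → c * (g x * 1#) + g x * x * ev p x)
        ≡⟨ trans (∑F-+ {q} _ _) (cong (_+ ∑F {q} (λ x → g x * x * ev p x)) (∑F-*ˡ {q} c _)) ⟩
      c * ∑F {q} (λ x → g x * 1#) + ∑F {q} (λ x → g x * x * ev p x)
        ≡⟨ cong₂ (λ a b → c * a + b) (h 0 (s≤s z≤n)) (moments⇒Σ (λ x → g x * x) p (λ l l< → trans (∑F-cong {q} (λ x → *-assoc _ _ _)) (h (suc l) (s≤s l<)))) ⟩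
      c * 0# + 0#  ≡⟨ trans (+-identityʳ _) (zeroʳ c) ⟩
      0#           ∎
      where open ≡-Reasoning

    Σ-evS : ∀ s (g : F → F) f → ∑F {q} (λ x → g x * evS s f x) ≡ sumN s (λ j → f j * ∑F {q} (λ x → g x * x ^ j))
    Σ-evS zero g f = trans (∑F-cong {q} (λ x → zeroʳ _)) (∑F-0 q)
    Σ-evS (suc s) g f = begin
      ∑F {q} (λ x → g x * (f 0 + x * evS s (f ∘ suc) x))
        ≡⟨ ∑F-cong {q} (λ x → solve 4 (λ g c x w → g :* (c :+ x :* w) := c :* (g :* :1) :+ g :* x :* w) refl (g x) (f 0) x _) ⟩
      ∑F {q} (λ x → f 0 * (g x * 1#) + g x * x * evS s (f ∘ suc) x)
        ≡⟨ trans (∑F-+ {q} _ _) (cong (_+ ∑F {q} (λ x → g x * x * evS s (f ∘ suc) x)) (∑F-*ˡ {q} (f 0) _)) ⟩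
      f 0 * ∑F {q} (λ x → g x * 1#) + ∑F {q} (λ x → g x * x * evS s (f ∘ suc) x)
        ≡⟨ cong (f 0 * ∑F {q} (λ x → g x * 1#) +_) (trans (Σ-evS s (λ x → g x * x) (f ∘ suc))
             (sumN-cong s (λ j _ → cong (f (suc j) *_) (∑F-cong {q} (λ x → *-assoc _ _ _))))) ⟩
      f 0 * ∑F {q} (λ x → g x * 1#) + sumN s (λ j → f (suc j) * ∑F {q} (λ x → g x * (x * x ^ j))) ∎
      where open ≡-Reasoning

    -- A polynomial P(x, y) of degree below s in x is sought among s q unknown coefficients. It is
    -- to vanish on the support of `u`, and certain high coefficients are to be zero. With fewer
    -- equations than unknowns a nonzero P would exist; but then the moments of u P vanish
    -- identically as polynomials in y, and comparing coefficients gives P = 0. So there are at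
    -- least s q equations, which is the asserted `bound`.
    module Core (u : F → F → F) (M : Moments u) where
      open Moments M

      supp : F → List F
      supp y = filter (λ x → ¬? (u x y ≟ 0#)) (allFin q)

      supp-unique : ∀ y → Unique (supp y)
      supp-unique y = Uniqueₚ.filter⁺ _ (Uniqueₚ.allFin⁺ q)

      ∈-supp : ∀ {x y} → u x y ≢ 0# → x ∈ supp y
      ∈-supp {x} {y} n = ∈-filter⁺ (λ x → ¬? (u x y ≟ 0#)) (∈-allFin x) n

      s : ℕ
      s = length (supp 0#)

      s≤q : s ≤ q
      s≤q = ℕₚ.≤-trans (Lₚ.length-filter _ (allFin q)) (ℕₚ.≤-reflexive (length-allFin q))

      U : ℕ
      U = s ℕ.* q

      -- The coefficient of x^j y^i in P. It is 0 from i = q on, where `nth` would otherwise read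
      -- from the next row.
      coef : Vec F U → ℕ → ℕ → F
      coef v j i with i ℕₚ.<? q
      ... | yes _ = nth v (j ℕ.* q ℕ.+ i)
      ... | no _ = 0#

      fun-coef : ∀ j i → IsFunctional (λ v → coef v j i)
      fun-coef j i with i ℕₚ.<? q
      ... | yes _ = fun-nth (j ℕ.* q ℕ.+ i)
      ... | no _ = fun-0

      coef-high : ∀ v j i → q ≤ i → coef v j i ≡ 0#
      coef-high v j i h with i ℕₚ.<? q
      ... | yes i<q = ⊥-elim (ℕₚ.<⇒≱ i<q h)
      ... | no _ = refl

      coef-𝟎 : ∀ v → (∀ j i → j < s → i < q → coef v j i ≡ 0#) → v ≡ 𝟎
      coef-𝟎 v h = nth-𝟎 v (λ k k<U → trans (cong (nth v) (trans (m≡m%n+[m/n]*n k q) (ℕₚ.+-comm (k % q) _)))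
          (get (k / q) (k % q) (m<n*o⇒m/o<n k<U) (m%n<n k q)))
        where
        instance _ = ℕ.≢-nonZero q≢0
        get : ∀ j i → j < s → i < q → nth v (j ℕ.* q ℕ.+ i) ≡ 0#
        get j i j<s i<q with i ℕₚ.<? q | h j i j<s i<q
        ... | yes _ | e = e
        ... | no n | _ = ⊥-elim (n i<q)

      -- The coefficient of y^e in the l-th moment of u P, that is, in the sum of u(x, y) P(x, y)
      -- x^l over x.
      W : Vec F U → ℕ → ℕ → F
      W v l e = sumN s (λ j → conv (H (j ℕ.+ l)) (coef v j) e)

      P : Vec F U → F → F → F
      P v x y = evS s (λ j → evS q (coef v j) y) x

      -- `E₁` makes the coefficient of x^j a polynomial in y of degree below q - j, so that the l-th
      -- moment of u P has degree below q + l. `E₂` removes its coefficients from q on. `E₃` lets P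
      -- vanish at up to `s` support points of every line.
      E₁ E₂ E₃ E : List (Vec F U)
      E₁ = map (λ { (j , k) → rep (λ v → coef v j (q ∸ suc k)) }) (tri s)
      E₂ = map (λ { (l , k) → rep (λ v → W v l (q ℕ.+ k)) }) (tri s)
      points : F → List (Vec F U)
      points y = map (λ x → rep (λ v → P v x y)) (take s (supp y))
      E₃ = join q points
      E = E₁ ++ E₂ ++ E₃

      length-E : length E ℕ.+ s ≡ s ℕ.* s ℕ.+ ∑ (λ y → s ⊓ length (supp y))
      length-E = trans (cong (ℕ._+ s) (trans (Lₚ.length-++ E₁) (cong₂ ℕ._+_ (Lₚ.length-map _ (tri s))
          (trans (Lₚ.length-++ E₂) (cong₂ ℕ._+_ (Lₚ.length-map _ (tri s)) (trans (length-join q points)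
            (∑-cong (λ y → trans (Lₚ.length-map _ (take s (supp y))) (Lₚ.length-take s (supp y))))))))))
        (trans (lem (length (tri s)) _ s) (cong (ℕ._+ ∑ (λ y → s ⊓ length (supp y))) (length-tri s)))
        where
        lem : ∀ t m s → t ℕ.+ (t ℕ.+ m) ℕ.+ s ≡ t ℕ.+ t ℕ.+ s ℕ.+ m
        lem = solve-∀

      module Contradiction (v : Vec F U) (sol : All (λ e → dot e v ≡ 0#) E) where

        p : ℕ → ℕ → F
        p = coef v

        sol₁ : All (λ e → dot e v ≡ 0#) E₁
        sol₁ = Allₚ.++⁻ˡ E₁ sol
        sol₂ : All (λ e → dot e v ≡ 0#) E₂
        sol₂ = Allₚ.++⁻ˡ E₂ (Allₚ.++⁻ʳ E₁ sol)
        sol₃ : All (λ e → dot e v ≡ 0#) E₃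
        sol₃ = Allₚ.++⁻ʳ E₂ (Allₚ.++⁻ʳ E₁ sol)

        p-high : ∀ j i → j < s → q ∸ j ≤ i → p j i ≡ 0#
        p-high j i j<s h with ℕₚ.<-≤-connex i q
        ... | inj₂ q≤i = coef-high v j i q≤i
        ... | inj₁ i<q = trans (cong (p j) (sym i≡)) (trans (sym (dot-rep (fun-coef j (q ∸ suc k)) v))
            (All-tri {P = λ { (j , k) → dot (rep (λ v → coef v j (q ∸ suc k))) v ≡ 0# }} s (Allₚ.map⁻ sol₁) j k j<s k<j))
          where
          k = q ∸ suc i
          k<j : k < j
          k<j = ℕₚ.+-cancelʳ-< i k j (ℕₚ.<-≤-trans (ℕₚ.≤-reflexive (trans (cong suc (ℕₚ.+-comm k i)) (ℕₚ.m+[n∸m]≡n i<q)))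
            (ℕₚ.≤-trans (ℕₚ.m≤n+m∸n q j) (ℕₚ.+-monoʳ-≤ j h)))
          i≡ : q ∸ suc k ≡ i
          i≡ = trans (cong (_∸ suc k) (sym (trans (ℕₚ.+-suc i k) (ℕₚ.m+[n∸m]≡n i<q)))) (ℕₚ.m+n∸n≡m i (suc k))

        -- A line with fewer than `s` support points has all of them in `E₃`. On any other line P
        -- has degree below `s` in x and `s` roots, so it vanishes there.
        uP : ∀ x y → u x y * P v x y ≡ 0#
        uP x y with u x y ≟ 0#
        ... | yes e = trans (cong (_* P v x y) e) (zeroˡ _)
        ... | no n = trans (cong (u x y *_) Pxy) (zeroʳ _)
          where
          onPts : All (λ x → P v x y ≡ 0#) (take s (supp y))
          onPts = All.map (λ {x} e → trans (sym (dot-rep (fun-evS s x (λ j → fun-evS q y (λ i → fun-coef j i))) v)) e)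
            (Allₚ.map⁻ (All-join q points sol₃ y))
          Pxy : P v x y ≡ 0#
          Pxy with s ℕₚ.≤? length (supp y)
          ... | yes s≤ = trans (evS-cong s x (evS-vanish s (λ j → evS q (coef v j) y) (take s (supp y)) (Uniqueₚ.take⁺ s (supp-unique y)) onPts
                  (ℕₚ.≤-reflexive (sym (trans (Lₚ.length-take s (supp y)) (ℕₚ.m≤n⇒m⊓n≡m s≤)))))) (evS-0 s x)
          ... | no s≰ = All.lookup (subst (All _) (Lₚ.take-all s (supp y) (ℕₚ.≰⇒≥ s≰)) onPts) (∈-supp n)

        big : ℕ
        big = (s ℕ.+ s) ℕ.+ q

        W-eval : ∀ l y → l < s → evS big (W v l) y ≡ 0#
        W-eval l y l<s = begin
          evS big (W v l) y
            ≡⟨ evS-sumN big s (λ j → conv (H (j ℕ.+ l)) (p j)) y ⟩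
          sumN s (λ j → evS big (conv (H (j ℕ.+ l)) (p j)) y)
            ≡⟨ sumN-cong s (λ j j<s → trans (evS-conv big (s ℕ.+ s) q y ℕₚ.≤-refl (λ i h → H-high (j ℕ.+ l) i (ℕₚ.<-≤-trans (ℕₚ.+-mono-< j<s l<s) h)) (coef-high v j))
                 (trans (*-comm _ _) (cong (evS q (p j) y *_) (sym (H-eval (j ℕ.+ l) (s ℕ.+ s) y (ℕₚ.+-mono-< j<s l<s)))))) ⟩
          sumN s (λ j → evS q (p j) y * ∑F {q} (λ x → u x y * x ^ (j ℕ.+ l)))
            ≡⟨ sumN-cong s (λ j _ → cong (evS q (p j) y *_) (∑F-cong {q} (λ x → trans (cong (u x y *_) (trans (cong (x ^_) (ℕₚ.+-comm j l)) (^-+ x l j))) (sym (*-assoc _ _ _))))) ⟩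
          sumN s (λ j → evS q (p j) y * ∑F {q} (λ x → u x y * x ^ l * x ^ j))
            ≡⟨ Σ-evS s (λ x → u x y * x ^ l) (λ j → evS q (p j) y) ⟨
          ∑F {q} (λ x → u x y * x ^ l * P v x y)
            ≡⟨ ∑F-cong {q} (λ x → trans (solve 3 (λ a b c → a :* b :* c := b :* (a :* c)) refl _ _ _) (trans (cong (x ^ l *_) (uP x y)) (zeroʳ _))) ⟩
          ∑F {q} (λ x → 0#) ≡⟨ ∑F-0 q ⟩
          0# ∎
          where open ≡-Reasoning

        W-high : ∀ l e → l < s → q ≤ e → W v l e ≡ 0#
        W-high l e l<s h with (q ℕ.+ l) ℕₚ.≤? e
        ... | yes q+l≤e = sumN-0 s (λ j j<s → conv-high (j ℕ.+ l) (q ∸ j) e (ℕₚ.≤-trans (ℕₚ.≤-reflexive (sum j (ℕₚ.<⇒≤ (ℕₚ.<-≤-trans j<s s≤q)))) q+l≤e)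
              (H-high (j ℕ.+ l)) (λ i → p-high j i j<s))
          where
          sum : ∀ j → j ≤ q → j ℕ.+ l ℕ.+ (q ∸ j) ≡ q ℕ.+ l
          sum j j≤q = trans (cong (ℕ._+ (q ∸ j)) (ℕₚ.+-comm j l)) (trans (ℕₚ.+-assoc l j (q ∸ j)) (trans (cong (l ℕ.+_) (ℕₚ.m+[n∸m]≡n j≤q)) (ℕₚ.+-comm l q)))
        ... | no e<q+l = trans (cong (W v l) (sym (ℕₚ.m+[n∸m]≡n h))) (trans (sym (dot-rep (fun-sumN s (λ j → fun-conv (H (j ℕ.+ l)) (q ℕ.+ k) (λ i → fun-coef j i))) v))
            (All-tri {P = λ { (l , k) → dot (rep (λ v → W v l (q ℕ.+ k))) v ≡ 0# }} s (Allₚ.map⁻ sol₂) l k l<s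
              (ℕₚ.+-cancelˡ-< q k l (subst (_< q ℕ.+ l) (sym (ℕₚ.m+[n∸m]≡n h)) (ℕₚ.≰⇒> e<q+l)))))
          where k = e ∸ q

        -- The degree is below q by `W-high`, and the polynomial has all q elements of the field as
        -- roots.
        W-zero : ∀ l e → l < s → e < q → W v l e ≡ 0#
        W-zero l e l<s = evS-vanish q (W v l) (allFin q) (Uniqueₚ.allFin⁺ q)
          (All.universal (λ y → trans (sym (evS-extend′ y (ℕₚ.m≤n+m q (s ℕ.+ s)) (λ i → W-high l i l<s))) (W-eval l y l<s)) (allFin q))
          (ℕₚ.≤-reflexive (sym (length-allFin q))) e

        H-0 : ∀ m → H m 0 ≡ ∑F {q} (λ x → u x 0# * x ^ m)
        H-0 m = sym (trans (H-eval m (suc m) 0# ℕₚ.≤-refl) (trans (cong (H m 0 +_) (zeroˡ _)) (+-identityʳ _)))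

        -- The coefficients of lower powers of y are already zero, so the coefficient of y^i in the
        -- moments only sees H at y = 0. Hence the product of u(x, 0) and the polynomial A is
        -- orthogonal to x^l for all l < s. It is supported on `s` points, so A vanishes at each of
        -- them, and A has degree below `s`.
        p-zero : ∀ n i → i < n → i < q → ∀ j → j < s → p j i ≡ 0#
        p-zero (suc n) i (s≤s i≤n) i<q = evS-vanish s (λ j → p j i) (supp 0#) (supp-unique 0#) (All.tabulate root) ℕₚ.≤-refl
          where
          A : F → F
          A = evS s (λ j → p j i)
          moment : ∀ l → l < s → ∑F {q} (λ x → u x 0# * A x * x ^ l) ≡ 0#
          moment l l<s = begin
            ∑F {q} (λ x → u x 0# * A x * x ^ l)   ≡⟨ ∑F-cong {q} (λ x → solve 3 (λ a b c → a :* b :* c := a :* c :* b) refl _ _ _) ⟩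
            ∑F {q} (λ x → u x 0# * x ^ l * A x)   ≡⟨ Σ-evS s (λ x → u x 0# * x ^ l) (λ j → p j i) ⟩
            sumN s (λ j → p j i * ∑F {q} (λ x → u x 0# * x ^ l * x ^ j))
              ≡⟨ sumN-cong s (λ j j<s → trans (cong (p j i *_) (trans (∑F-cong {q} (λ x → trans (*-assoc _ _ _) (cong (u x 0# *_) (trans (sym (^-+ x l j)) (cong (x ^_) (ℕₚ.+-comm l j))))))
                   (sym (H-0 (j ℕ.+ l))))) (trans (*-comm _ _) (sym (conv-low i (λ i′ i′<i → p-zero n i′ (ℕₚ.<-≤-trans i′<i i≤n) (ℕₚ.<-trans i′<i i<q) j j<s))))) ⟩
            W v l i                           ≡⟨ W-zero l i l<s i<q ⟩
            0#                                ∎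
            where open ≡-Reasoning
          root : ∀ {a} → a ∈ supp 0# → A a ≡ 0#
          root {a} a∈ with isolate a (supp 0#) a∈ (supp-unique 0#)
          ... | b , zeros , nonzero with *-zero-cases single
            where
            single : u a 0# * A a * ev b a ≡ 0#
            single = trans (sym (∑F-single a off)) (moments⇒Σ (λ x → u x 0# * A x) b moment)
              where
              off : ∀ x → x ≢ a → u x 0# * A x * ev b x ≡ 0#
              off x x≢a with u x 0# ≟ 0#
              ... | yes e = trans (cong (λ z → z * A x * ev b x) e) (trans (cong (_* ev b x) (zeroˡ _)) (zeroˡ _))
              ... | no n = trans (cong (u x 0# * A x *_) (zeros x (∈-supp n) x≢a)) (zeroʳ _)
          ...   | inj₂ e = ⊥-elim (nonzero e)
          ...   | inj₁ e with *-zero-cases e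
          ...     | inj₂ e′ = e′
          ...     | inj₁ e′ = ⊥-elim (proj₂ (∈-filter⁻ (λ x → ¬? (u x 0# ≟ 0#)) {xs = allFin q} a∈) e′)

        v≡𝟎 : v ≡ 𝟎
        v≡𝟎 = coef-𝟎 v (λ j i j<s i<q → p-zero (suc i) i ℕₚ.≤-refl i<q j j<s)

      bound : s ℕ.* q ℕ.+ s ≤ s ℕ.* s ℕ.+ ∑ (λ y → s ⊓ length (supp y))
      bound with length E ℕₚ.<? U
      ... | no h = ℕₚ.≤-trans (ℕₚ.+-monoˡ-≤ s (ℕₚ.≮⇒≥ h)) (ℕₚ.≤-reflexive length-E)
      ... | yes h with solution E h
      ...   | v , v≢𝟎 , sol = ⊥-elim (v≢𝟎 (Contradiction.v≡𝟎 v sol))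

  lineWeight : ∀ {N} (L : Combination N) → Vec F N → Vec F N → ℕ
  lineWeight L x d = ∑ {q} (λ t → nz (code L (x ⊕ t · d)))

  parallel-lines : ∀ {N} (L : Combination N) x d v → let s = lineWeight L x d in
    s ℕ.* q ℕ.+ s ≤ s ℕ.* s ℕ.+ ∑ {q} (λ y → lineWeight L (x ⊕ y · v) d)
  parallel-lines L x d v = subst (λ z → z ℕ.* q ℕ.+ z ≤ z ℕ.* z ℕ.+ ∑ {q} (λ y → lineWeight L (x ⊕ y · v) d))
    (trans (supp-length 0#) (∑-cong (λ t → cong (λ z → nz (code L (z ⊕ t · d))) (trans (cong (x ⊕_) (·-zeroˡ v)) (⊕-identityʳ x)))))
    (ℕₚ.≤-trans C.bound (ℕₚ.+-monoʳ-≤ (C.s ℕ.* C.s) (∑-mono (λ y → ℕₚ.≤-trans (ℕₚ.m⊓n≤n C.s _) (ℕₚ.≤-reflexive (supp-length y))))))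
    where
    u : F → F → F
    u t y = code L (x ⊕ t · d ⊕ y · v)
    module C = Core u (moments-code L x d v)
    swap : ∀ {n} (a b c : Vec F n) → a ⊕ b ⊕ c ≡ a ⊕ c ⊕ b
    swap a b c = trans (⊕-assoc a b c) (trans (cong (a ⊕_) (⊕-comm b c)) (sym (⊕-assoc a c b)))
    supp-length : ∀ y → length (C.supp y) ≡ lineWeight L (x ⊕ y · v) d
    supp-length y = trans (length-filter-tabulate (λ i → i) (λ t → u t y)) (∑-cong (λ t → cong (λ z → nz (code L z)) (swap x (t · d) (y · v))))

-- The gap in line intersections and the self-improvement of density

module Counting {q : ℕ} (𝔽 : FinField q) where
  open LineLemma 𝔽 public

  instance
    q-nonZero : NonZero q
    q-nonZero = ℕ.≢-nonZero q≢0

  -- Counts vectors: each point of the support q - 1 times, and the zero vector if the word is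
  -- nonzero there.
  weight : ∀ {N} → Combination N → ℕ
  weight L = ΣV (λ x → nz (code L x))

  pull : ∀ {m n} → Combination n → Vec (Vec F n) m → Combination m
  pull L us = map (λ { (α , a) → α , dots a us }) L

  code-pull : ∀ {m n} (L : Combination n) (us : Vec (Vec F n) m) t → code (pull L us) t ≡ code L (comb t us)
  code-pull [] us t = refl
  code-pull ((α , a) ∷ L) us t = cong₂ (λ u w → α * δ u + w) (sym (dot-comb a t us)) (code-pull L us t)

  -- Translating by all multiples of `y` and averaging turns a sum over vectors into a sum over the
  -- lines in direction `y`.
  ΣV-average : ∀ {N} (y : Vec F N) (f g : Vec F N → ℕ) → (∀ t x → g (x ⊕ t · y) ≡ g x) →
    q ℕ.* ΣV (λ x → f x ℕ.* g x) ≡ ΣV (λ x → ∑ {q} (λ t → f (x ⊕ t · y)) ℕ.* g x)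
  ΣV-average y f g inv = begin
    q ℕ.* ΣV (λ x → f x ℕ.* g x)
      ≡⟨ ∑-const q _ ⟨
    ∑ {q} (λ t → ΣV (λ x → f x ℕ.* g x))
      ≡⟨ ∑-cong {q} (λ t → sym (ΣV-shift (t · y) (λ x → f x ℕ.* g x))) ⟩
    ∑ {q} (λ t → ΣV (λ x → f (x ⊕ t · y) ℕ.* g (x ⊕ t · y)))
      ≡⟨ ∑-ΣV (λ t x → f (x ⊕ t · y) ℕ.* g (x ⊕ t · y)) ⟩
    ΣV (λ x → ∑ {q} (λ t → f (x ⊕ t · y) ℕ.* g (x ⊕ t · y)))
      ≡⟨ ΣV-cong (λ x → trans (∑-cong {q} (λ t → trans (cong (f (x ⊕ t · y) ℕ.*_) (inv t x)) (ℕₚ.*-comm _ (g x))))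
           (trans (∑-*ˡ {q} (g x) _) (ℕₚ.*-comm (g x) _))) ⟩
    ΣV (λ x → ∑ {q} (λ t → f (x ⊕ t · y)) ℕ.* g x) ∎
    where open ≡-Reasoning

  lineWeight-shift : ∀ {N} (L : Combination N) d t x → lineWeight L (x ⊕ t · d) d ≡ lineWeight L x d
  lineWeight-shift L d t x = trans (∑-cong {q} (λ r → cong (λ z → nz (code L z))
      (trans (⊕-assoc x (t · d) (r · d)) (cong (x ⊕_) (trans (sym (·-distribʳ t r d)) (cong (_· d) (+-comm t r)))))))
    (∑-shift t (λ r → nz (code L (x ⊕ r · d))))

  lineWeight≤q : ∀ {N} (L : Combination N) x d → lineWeight L x d ≤ q
  lineWeight≤q L x d = ℕₚ.≤-trans (∑-mono {q} (λ t → nz≤1 _)) (ℕₚ.≤-reflexive (trans (∑-const q 1) (ℕₚ.*-identityʳ q)))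

  -- This is (q - 1) W ≥ q^N s (q - s) without subtraction, obtained by summing `parallel-lines`
  -- over all `v`. For a fixed y ≠ 0 the points x + y v run through the whole space, while y = 0
  -- always returns the given line.
  line-bound : ∀ {N} (L : Combination (suc N)) x d → let s = lineWeight L x d; P = q ℕ.^ N in
    P ℕ.* (s ℕ.* q) ℕ.+ weight L ≤ P ℕ.* (s ℕ.* s) ℕ.+ q ℕ.* weight L
  line-bound {N} L x d = ℕₚ.*-cancelˡ-≤ q (ℕₚ.+-cancelʳ-≤ (q ℕ.* P ℕ.* s) _ _ (begin
      q ℕ.* (P ℕ.* (s ℕ.* q) ℕ.+ W) ℕ.+ q ℕ.* P ℕ.* s        ≡⟨ lem₁ q P s W ⟩
      q ℕ.* P ℕ.* (s ℕ.* q ℕ.+ s) ℕ.+ q ℕ.* W                ≡⟨ cong (ℕ._+ q ℕ.* W) (ΣV-const (suc N) _) ⟨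
      ΣV {m = suc N} (λ v → s ℕ.* q ℕ.+ s) ℕ.+ q ℕ.* W       ≤⟨ ℕₚ.+-monoˡ-≤ (q ℕ.* W) (ΣV-mono (λ v → parallel-lines L x d v)) ⟩
      ΣV (λ v → s ℕ.* s ℕ.+ ∑ {q} (λ y → lineWeight L (x ⊕ y · v) d)) ℕ.+ q ℕ.* W
        ≡⟨ cong (ℕ._+ q ℕ.* W) (trans (ΣV-∙ _ _) (cong₂ ℕ._+_ (ΣV-const (suc N) (s ℕ.* s)) (sym (∑-ΣV (λ y v → lineWeight L (x ⊕ y · v) d))))) ⟩
      q ℕ.* P ℕ.* (s ℕ.* s) ℕ.+ ∑ {q} g ℕ.+ q ℕ.* W          ≡⟨ ℕₚ.+-assoc _ (∑ {q} g) (q ℕ.* W) ⟩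
      q ℕ.* P ℕ.* (s ℕ.* s) ℕ.+ (∑ {q} g ℕ.+ q ℕ.* W)        ≡⟨ cong (q ℕ.* P ℕ.* (s ℕ.* s) ℕ.+_) (∑-two 0# g g0 gy) ⟩
      q ℕ.* P ℕ.* (s ℕ.* s) ℕ.+ (q ℕ.* P ℕ.* s ℕ.+ q ℕ.* (q ℕ.* W)) ≡⟨ lem₂ q P s W ⟩
      q ℕ.* (P ℕ.* (s ℕ.* s) ℕ.+ q ℕ.* W) ℕ.+ q ℕ.* P ℕ.* s  ∎))
    where
    open ℕₚ.≤-Reasoning
    s = lineWeight L x d
    P = q ℕ.^ N
    W = weight L
    g : F → ℕ
    g y = ΣV (λ v → lineWeight L (x ⊕ y · v) d)
    g0 : g 0# ≡ q ℕ.* P ℕ.* s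
    g0 = trans (ΣV-cong (λ v → cong (λ z → lineWeight L z d) (trans (cong (x ⊕_) (·-zeroˡ v)) (⊕-identityʳ x)))) (ΣV-const (suc N) s)
    gy : ∀ y → y ≢ 0# → g y ≡ q ℕ.* W
    gy y y≢0 = trans (sym (∑-ΣV (λ t v → nz (code L (x ⊕ y · v ⊕ t · d))))) (trans (∑-cong {q} (λ t →
        trans (ΣV-cong (λ v → cong (λ z → nz (code L z)) (trans (cong (_⊕ t · d) (⊕-comm x (y · v))) (⊕-assoc (y · v) x (t · d)))))
        (trans (ΣV-scale y≢0 (λ v → nz (code L (v ⊕ (x ⊕ t · d))))) (ΣV-shift (x ⊕ t · d) (λ v → nz (code L v)))))) (∑-const q W))
    lem₁ : ∀ q P s W → q ℕ.* (P ℕ.* (s ℕ.* q) ℕ.+ W) ℕ.+ q ℕ.* P ℕ.* s ≡ q ℕ.* P ℕ.* (s ℕ.* q ℕ.+ s) ℕ.+ q ℕ.* W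
    lem₁ = solve-∀
    lem₂ : ∀ q P s W → q ℕ.* P ℕ.* (s ℕ.* s) ℕ.+ (q ℕ.* P ℕ.* s ℕ.+ q ℕ.* (q ℕ.* W)) ≡ q ℕ.* (P ℕ.* (s ℕ.* s) ℕ.+ q ℕ.* W) ℕ.+ q ℕ.* P ℕ.* s
    lem₂ = solve-∀

  Dichotomy : ∀ {N} → ℕ → Combination N → Set
  Dichotomy k L = ∀ x d → lineWeight L x d ≤ k ⊎ q ≤ lineWeight L x d ℕ.+ k

  -- The function s (q - s) is concave and takes the value (k + 1) g both at k + 1 and at q - k - 1
  -- = g. So it is at least that for every s strictly between k and q - k, against `line-bound`.
  dichotomy : ∀ {N} (L : Combination (suc N)) k g → q ≡ 1 ℕ.+ k ℕ.+ g →
    q ℕ.* weight L < weight L ℕ.+ q ℕ.^ N ℕ.* (suc k ℕ.* g) → Dichotomy k L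
  dichotomy {N} L k g q≡ h x d with lineWeight L x d ℕₚ.≤? k | q ℕₚ.≤? lineWeight L x d ℕ.+ k
  ... | yes p | _ = inj₁ p
  ... | no _ | yes p = inj₂ p
  ... | no s≰k | no s+k≱q = ⊥-elim (ℕₚ.<⇒≱ h (ℕₚ.+-cancelˡ-≤ (P ℕ.* (s ℕ.* s)) _ _ (begin
      P ℕ.* (s ℕ.* s) ℕ.+ (W ℕ.+ P ℕ.* (suc k ℕ.* g))            ≤⟨ ℕₚ.+-monoʳ-≤ (P ℕ.* (s ℕ.* s)) (ℕₚ.+-monoʳ-≤ W (ℕₚ.*-monoʳ-≤ P prod≤)) ⟩
      P ℕ.* (s ℕ.* s) ℕ.+ (W ℕ.+ P ℕ.* (s ℕ.* (suc k ℕ.+ b)))    ≡⟨ lem P s W (suc k ℕ.+ b) ⟩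
      P ℕ.* (s ℕ.* (s ℕ.+ (suc k ℕ.+ b))) ℕ.+ W                  ≡⟨ cong (λ z → P ℕ.* (s ℕ.* z) ℕ.+ W) q≡s ⟨
      P ℕ.* (s ℕ.* q) ℕ.+ W                                      ≤⟨ line-bound L x d ⟩
      P ℕ.* (s ℕ.* s) ℕ.+ q ℕ.* W                                ∎)))
    where
    open ℕₚ.≤-Reasoning
    s = lineWeight L x d
    P = q ℕ.^ N
    W = weight L
    k<s : k < s
    k<s = ℕₚ.≰⇒> s≰k
    s+k<q : s ℕ.+ k < q
    s+k<q = ℕₚ.≰⇒> s+k≱q
    a b : ℕ
    a = s ∸ suc k
    b = q ∸ suc (s ℕ.+ k)
    s≡ : s ≡ suc k ℕ.+ a
    s≡ = sym (ℕₚ.m+[n∸m]≡n k<s)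
    q≡s : q ≡ s ℕ.+ (suc k ℕ.+ b)
    q≡s = trans (sym (ℕₚ.m+[n∸m]≡n s+k<q)) (lem₀ s k b)
      where
      lem₀ : ∀ s k b → suc (s ℕ.+ k) ℕ.+ b ≡ s ℕ.+ (suc k ℕ.+ b)
      lem₀ = solve-∀
    g≡ : g ≡ suc k ℕ.+ a ℕ.+ b
    g≡ = ℕₚ.+-cancelˡ-≡ (1 ℕ.+ k) _ _ (trans (sym q≡) (trans q≡s (trans (cong (ℕ._+ (suc k ℕ.+ b)) s≡) (lem₀ k a b))))
      where
      lem₀ : ∀ k a b → suc k ℕ.+ a ℕ.+ (suc k ℕ.+ b) ≡ suc k ℕ.+ (suc k ℕ.+ a ℕ.+ b)
      lem₀ = solve-∀
    prod≤ : suc k ℕ.* g ≤ s ℕ.* (suc k ℕ.+ b)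
    prod≤ = subst₂ _≤_ (cong (suc k ℕ.*_) (sym g≡)) (trans (lem₀ k a b) (cong (ℕ._* (suc k ℕ.+ b)) (sym s≡))) (ℕₚ.m≤m+n _ (a ℕ.* b))
      where
      lem₀ : ∀ k a b → suc k ℕ.* (suc k ℕ.+ a ℕ.+ b) ℕ.+ a ℕ.* b ≡ (suc k ℕ.+ a) ℕ.* (suc k ℕ.+ b)
      lem₀ = solve-∀
    lem : ∀ P s W z → P ℕ.* (s ℕ.* s) ℕ.+ (W ℕ.+ P ℕ.* (s ℕ.* z)) ≡ P ℕ.* (s ℕ.* (s ℕ.+ z)) ℕ.+ W
    lem = solve-∀

  lineWeight-pull : ∀ {m n} (L : Combination n) (us : Vec (Vec F n) m) x d → lineWeight (pull L us) x d ≡ lineWeight L (comb x us) (comb d us)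
  lineWeight-pull L us x d = ∑-cong {q} (λ t → cong nz (trans (code-pull L us _) (cong (code L)
    (trans (comb-⊕ x (t · d) us) (cong (comb x us ⊕_) (comb-· t d us))))))

  dichotomy-pull : ∀ {m n k} {L : Combination n} → Dichotomy k L → (us : Vec (Vec F n) m) → Dichotomy k (pull L us)
  dichotomy-pull {k = k} {L} D us x d = subst (λ w → w ≤ k ⊎ q ≤ w ℕ.+ k) (sym (lineWeight-pull L us x d)) (D (comb x us) (comb d us))

  -- A line is long if at most `k` of its q affine points are zeros of the word; then at least 1 + g
  -- of them are nonzero.
  module Long (k g : ℕ) (q≡ : q ≡ 1 ℕ.+ k ℕ.+ g) where

    long : ℕ → ℕ
    long w with q ℕₚ.≤? w ℕ.+ k
    ... | yes _ = 1
    ... | no _ = 0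

    long-yes : ∀ {w} → q ≤ w ℕ.+ k → long w ≡ 1
    long-yes {w} h with q ℕₚ.≤? w ℕ.+ k
    ... | yes _ = refl
    ... | no n = ⊥-elim (n h)

    1+g≤ : ∀ {w} → q ≤ w ℕ.+ k → 1 ℕ.+ g ≤ w
    1+g≤ {w} h = ℕₚ.+-cancelʳ-≤ k (1 ℕ.+ g) w (subst (_≤ w ℕ.+ k) (trans q≡ (lem k g)) h)
      where
      lem : ∀ k g → 1 ℕ.+ k ℕ.+ g ≡ 1 ℕ.+ g ℕ.+ k
      lem = solve-∀

    long-≤ : ∀ {w} → w ≤ k ⊎ q ≤ w ℕ.+ k → w < q → w ≤ k ℕ.+ g ℕ.* long w
    long-≤ {w} h w<q with q ℕₚ.≤? w ℕ.+ k
    ... | yes _ = subst (w ≤_) (cong (k ℕ.+_) (sym (ℕₚ.*-identityʳ g))) (ℕₚ.≤-pred (subst (w <_) q≡ w<q))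
    long-≤ {w} (inj₁ h) w<q | no _ = ℕₚ.≤-trans h (ℕₚ.m≤m+n k _)
    long-≤ {w} (inj₂ h) w<q | no n = ⊥-elim (n h)

    ≤-long : ∀ {w} → 1 ≤ w → 1 ℕ.+ g ℕ.* long w ≤ w
    ≤-long {w} h with q ℕₚ.≤? w ℕ.+ k
    ... | yes p = subst (_≤ w) (cong suc (sym (ℕₚ.*-identityʳ g))) (1+g≤ p)
    ... | no _ = subst (_≤ w) (cong suc (sym (ℕₚ.*-zeroʳ g))) h

    long-ratio : ∀ {w n} → w ℕ.+ n ≡ q → (1 ℕ.+ g) ℕ.* (n ℕ.* long w) ≤ k ℕ.* (w ℕ.* long w)
    long-ratio {w} {n} e with q ℕₚ.≤? w ℕ.+ k
    ... | yes p = subst₂ _≤_ (cong ((1 ℕ.+ g) ℕ.*_) (sym (ℕₚ.*-identityʳ n))) (cong (k ℕ.*_) (sym (ℕₚ.*-identityʳ w)))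
        (ℕₚ.≤-trans (ℕₚ.*-mono-≤ (1+g≤ p) (ℕₚ.+-cancelˡ-≤ w n k (subst (_≤ w ℕ.+ k) (sym e) p))) (ℕₚ.≤-reflexive (ℕₚ.*-comm w k)))
    ... | no _ = subst (_≤ k ℕ.* (w ℕ.* 0)) (sym (trans (cong ((1 ℕ.+ g) ℕ.*_) (ℕₚ.*-zeroʳ n)) (ℕₚ.*-zeroʳ (1 ℕ.+ g)))) z≤n

    coz : F → ℕ
    coz a = 1 ∸ nz a

    nz+coz : ∀ a → nz a ℕ.+ coz a ≡ 1
    nz+coz a = ℕₚ.m+[n∸m]≡n (nz≤1 a)

    module _ {m} (L : Combination m) (D : Dichotomy k L) where
      private
        Q = q ℕ.^ m
        s = weight L
        n = ΣV {m = m} (λ x → coz (code L x))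
        w : Vec F m → Vec F m → ℕ
        w = lineWeight L
        Xl : Vec F m → ℕ
        Xl x = ΣV (λ d → long (w x d))
        Y = ΣV (λ x → coz (code L x) ℕ.* Xl x)
        Z = ΣV (λ x → nz (code L x) ℕ.* Xl x)

        s+n : s ℕ.+ n ≡ Q
        s+n = trans (sym (ΣV-∙ _ _)) (trans (ΣV-cong (λ x → nz+coz (code L x))) (trans (ΣV-const m 1) (ℕₚ.*-identityʳ Q)))

        total : ∀ x → ΣV (λ d → w x d) ℕ.+ s ≡ Q ℕ.* nz (code L x) ℕ.+ q ℕ.* s
        total x = trans (cong (ℕ._+ s) (sym (∑-ΣV (λ t d → nz (code L (x ⊕ t · d))))))
          (∑-two 0# (λ t → ΣV (λ d → nz (code L (x ⊕ t · d))))
            (trans (ΣV-cong (λ d → cong (λ z → nz (code L z)) (trans (cong (x ⊕_) (·-zeroˡ d)) (⊕-identityʳ x)))) (ΣV-const m _))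
            (λ t t≢0 → trans (ΣV-scale t≢0 (λ d → nz (code L (x ⊕ d)))) (trans (ΣV-cong (λ d → cong (λ z → nz (code L z)) (⊕-comm x d))) (ΣV-shift x (λ d → nz (code L d))))))

        qs : q ℕ.* s ≡ s ℕ.+ (k ℕ.+ g) ℕ.* s
        qs = trans (cong (ℕ._* s) q≡) refl

        -- The zero at `x` caps the weight of each line through it at q - 1 = k + g. So a long
        -- direction contributes at most k + g and any other at most k.
        off : ∀ x → code L x ≡ 0# → (k ℕ.+ g) ℕ.* s ≤ Q ℕ.* k ℕ.+ g ℕ.* Xl x
        off x e = begin
          (k ℕ.+ g) ℕ.* s                       ≡⟨ Σw ⟨
          ΣV (λ d → w x d)                      ≤⟨ ΣV-mono (λ d → long-≤ (D x d) (w<q d)) ⟩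
          ΣV (λ d → k ℕ.+ g ℕ.* long (w x d))   ≡⟨ trans (ΣV-∙ _ _) (cong₂ ℕ._+_ (ΣV-const m k) (ΣV-*ˡ g _)) ⟩
          Q ℕ.* k ℕ.+ g ℕ.* Xl x                ∎
          where
          open ℕₚ.≤-Reasoning
          Σw : ΣV (λ d → w x d) ≡ (k ℕ.+ g) ℕ.* s
          Σw = ℕₚ.+-cancelʳ-≡ s _ _ (trans (total x) (trans (cong₂ (λ a b → Q ℕ.* a ℕ.+ b) (nz-0 e) qs)
            (trans (cong (ℕ._+ (s ℕ.+ (k ℕ.+ g) ℕ.* s)) (ℕₚ.*-zeroʳ Q)) (ℕₚ.+-comm s _))))
          w<q : ∀ d → w x d < q
          w<q d = ℕₚ.≤∧≢⇒< (lineWeight≤q L x d) (λ w≡q → ℕₚ.<-irrefl refl (ℕₚ.<-≤-trans (ℕₚ.n<1+n 0) (ℕₚ.≤-trans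
              (ℕₚ.≤-trans (ℕₚ.≤-reflexive (sym coz1)) (∑-term (λ t → coz (code L (x ⊕ t · d))) 0#))
              (ℕₚ.≤-reflexive (ℕₚ.+-cancelˡ-≡ q _ _ (trans (cong (ℕ._+ ∑ {q} (λ t → coz (code L (x ⊕ t · d)))) (sym w≡q))
                (trans (sym (∑-∙ _ _)) (trans (∑-cong {q} (λ t → nz+coz (code L (x ⊕ t · d)))) (trans (∑-const q 1) (trans (ℕₚ.*-identityʳ q) (sym (ℕₚ.+-identityʳ q))))))))))))
            where
            coz1 : coz (code L (x ⊕ 0# · d)) ≡ 1
            coz1 = cong (1 ∸_) (nz-0 (trans (cong (code L) (trans (cong (x ⊕_) (·-zeroˡ d)) (⊕-identityʳ x))) e))

        -- Here `x` itself is counted in every direction, and a long direction contributes at least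
        -- 1 + g.
        on : ∀ x → code L x ≢ 0# → g ℕ.* Xl x ≤ (k ℕ.+ g) ℕ.* s
        on x e = ℕₚ.+-cancelˡ-≤ Q _ _ (begin
          Q ℕ.+ g ℕ.* Xl x                        ≡⟨ trans (ΣV-∙ _ _) (cong₂ ℕ._+_ (trans (ΣV-const m 1) (ℕₚ.*-identityʳ Q)) (ΣV-*ˡ g _)) ⟨
          ΣV (λ d → 1 ℕ.+ g ℕ.* long (w x d))     ≤⟨ ΣV-mono (λ d → ≤-long (1≤w d)) ⟩
          ΣV (λ d → w x d)                        ≡⟨ Σw ⟩
          Q ℕ.+ (k ℕ.+ g) ℕ.* s                   ∎)
          where
          open ℕₚ.≤-Reasoning
          Σw : ΣV (λ d → w x d) ≡ Q ℕ.+ (k ℕ.+ g) ℕ.* s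
          Σw = ℕₚ.+-cancelʳ-≡ s _ _ (trans (total x) (trans (cong₂ (λ a b → Q ℕ.* a ℕ.+ b) (nz-1 e) qs) (lem Q s ((k ℕ.+ g) ℕ.* s))))
            where
            lem : ∀ Q s z → Q ℕ.* 1 ℕ.+ (s ℕ.+ z) ≡ Q ℕ.+ z ℕ.+ s
            lem = solve-∀
          1≤w : ∀ d → 1 ≤ w x d
          1≤w d = ℕₚ.≤-trans (ℕₚ.≤-reflexive (sym (nz-1 (λ z → e (trans (cong (code L) (sym (trans (cong (x ⊕_) (·-zeroˡ d)) (⊕-identityʳ x)))) z)))))
            (∑-term (λ t → nz (code L (x ⊕ t · d))) 0#)

        swapΣ : (f : Vec F m → ℕ) → ΣV (λ x → f x ℕ.* Xl x) ≡ ΣV (λ d → ΣV (λ x → f x ℕ.* long (w x d)))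
        swapΣ f = trans (ΣV-cong (λ x → sym (ΣV-*ˡ (f x) _))) (ΣV-comm (λ x d → f x ℕ.* long (w x d)))

        -- Double counting on long lines, one direction at a time: the ratio of zeros to nonzeros on
        -- each of them is at most k to 1 + g.
        YZ : (1 ℕ.+ g) ℕ.* Y ≤ k ℕ.* Z
        YZ = begin
          (1 ℕ.+ g) ℕ.* Y   ≡⟨ trans (cong ((1 ℕ.+ g) ℕ.*_) (swapΣ (λ x → coz (code L x)))) (sym (ΣV-*ˡ (1 ℕ.+ g) _)) ⟩
          ΣV (λ d → (1 ℕ.+ g) ℕ.* ΣV (λ x → coz (code L x) ℕ.* long (w x d)))   ≤⟨ ΣV-mono perDirection ⟩
          ΣV (λ d → k ℕ.* ΣV (λ x → nz (code L x) ℕ.* long (w x d)))            ≡⟨ trans (cong (k ℕ.*_) (swapΣ (λ x → nz (code L x)))) (sym (ΣV-*ˡ k _)) ⟨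
          k ℕ.* Z           ∎
          where
          open ℕₚ.≤-Reasoning
          perDirection : ∀ d → (1 ℕ.+ g) ℕ.* ΣV (λ x → coz (code L x) ℕ.* long (w x d)) ≤ k ℕ.* ΣV (λ x → nz (code L x) ℕ.* long (w x d))
          perDirection d = ℕₚ.*-cancelˡ-≤ q (begin
            q ℕ.* ((1 ℕ.+ g) ℕ.* A)   ≡⟨ lem q (1 ℕ.+ g) A ⟩
            (1 ℕ.+ g) ℕ.* (q ℕ.* A)   ≡⟨ cong ((1 ℕ.+ g) ℕ.*_) (ΣV-average d (λ x → coz (code L x)) (λ x → long (w x d)) invariant) ⟩
            (1 ℕ.+ g) ℕ.* ΣV (λ x → ∑ {q} (λ t → coz (code L (x ⊕ t · d))) ℕ.* long (w x d))   ≡⟨ ΣV-*ˡ (1 ℕ.+ g) _ ⟨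
            ΣV (λ x → (1 ℕ.+ g) ℕ.* (∑ {q} (λ t → coz (code L (x ⊕ t · d))) ℕ.* long (w x d))) ≤⟨ ΣV-mono (λ x → long-ratio {w x d} {∑ {q} (λ t → coz (code L (x ⊕ t · d)))} (compl x)) ⟩
            ΣV (λ x → k ℕ.* (w x d ℕ.* long (w x d)))   ≡⟨ ΣV-*ˡ k _ ⟩
            k ℕ.* ΣV (λ x → w x d ℕ.* long (w x d))     ≡⟨ cong (k ℕ.*_) (ΣV-average d (λ x → nz (code L x)) (λ x → long (w x d)) invariant) ⟨
            k ℕ.* (q ℕ.* B)           ≡⟨ lem k q B ⟩
            q ℕ.* (k ℕ.* B)           ∎)
            where
            A = ΣV (λ x → coz (code L x) ℕ.* long (w x d))
            B = ΣV (λ x → nz (code L x) ℕ.* long (w x d))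
            invariant : ∀ t x → long (w (x ⊕ t · d) d) ≡ long (w x d)
            invariant t x = cong long (lineWeight-shift L d t x)
            compl : ∀ x → w x d ℕ.+ ∑ {q} (λ t → coz (code L (x ⊕ t · d))) ≡ q
            compl x = trans (sym (∑-∙ _ _)) (trans (∑-cong {q} (λ t → nz+coz (code L (x ⊕ t · d)))) (trans (∑-const q 1) (ℕₚ.*-identityʳ q)))
            lem : ∀ a b c → a ℕ.* (b ℕ.* c) ≡ b ℕ.* (a ℕ.* c)
            lem = solve-∀

        sumOff : n ℕ.* ((k ℕ.+ g) ℕ.* s) ≤ n ℕ.* (Q ℕ.* k) ℕ.+ g ℕ.* Y
        sumOff = begin
          n ℕ.* ((k ℕ.+ g) ℕ.* s)   ≡⟨ trans (ℕₚ.*-comm n _) (sym (ΣV-*ˡ ((k ℕ.+ g) ℕ.* s) _)) ⟩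
          ΣV (λ x → (k ℕ.+ g) ℕ.* s ℕ.* coz (code L x))   ≤⟨ ΣV-mono pt ⟩
          ΣV (λ x → Q ℕ.* k ℕ.* coz (code L x) ℕ.+ g ℕ.* (coz (code L x) ℕ.* Xl x))
            ≡⟨ trans (ΣV-∙ _ _) (cong₂ ℕ._+_ (trans (ΣV-*ˡ (Q ℕ.* k) _) (ℕₚ.*-comm _ n)) (ΣV-*ˡ g _)) ⟩
          n ℕ.* (Q ℕ.* k) ℕ.+ g ℕ.* Y   ∎
          where
          open ℕₚ.≤-Reasoning
          pt : ∀ x → (k ℕ.+ g) ℕ.* s ℕ.* coz (code L x) ≤ Q ℕ.* k ℕ.* coz (code L x) ℕ.+ g ℕ.* (coz (code L x) ℕ.* Xl x)
          pt x with code L x ≟ 0#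
          ... | no e = ℕₚ.≤-trans (ℕₚ.≤-reflexive (ℕₚ.*-zeroʳ ((k ℕ.+ g) ℕ.* s))) z≤n
          ... | yes e = ℕₚ.≤-trans (ℕₚ.≤-reflexive (ℕₚ.*-identityʳ _)) (ℕₚ.≤-trans (off x e) (ℕₚ.≤-reflexive (lem (Q ℕ.* k) g (Xl x))))
            where
            lem : ∀ a g X → a ℕ.+ g ℕ.* X ≡ a ℕ.* 1 ℕ.+ g ℕ.* (1 ℕ.* X)
            lem = solve-∀

        sumOn : g ℕ.* Z ≤ s ℕ.* ((k ℕ.+ g) ℕ.* s)
        sumOn = begin
          g ℕ.* Z                                       ≡⟨ ΣV-*ˡ g _ ⟨
          ΣV (λ x → g ℕ.* (nz (code L x) ℕ.* Xl x))     ≤⟨ ΣV-mono pt ⟩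
          ΣV (λ x → (k ℕ.+ g) ℕ.* s ℕ.* nz (code L x))  ≡⟨ trans (ΣV-*ˡ ((k ℕ.+ g) ℕ.* s) _) (ℕₚ.*-comm _ s) ⟩
          s ℕ.* ((k ℕ.+ g) ℕ.* s)                       ∎
          where
          open ℕₚ.≤-Reasoning
          pt : ∀ x → g ℕ.* (nz (code L x) ℕ.* Xl x) ≤ (k ℕ.+ g) ℕ.* s ℕ.* nz (code L x)
          pt x with code L x ≟ 0#
          ... | yes e = ℕₚ.≤-trans (ℕₚ.≤-reflexive (ℕₚ.*-zeroʳ g)) z≤n
          ... | no e = ℕₚ.≤-trans (ℕₚ.≤-reflexive (cong (g ℕ.*_) (ℕₚ.*-identityˡ _))) (ℕₚ.≤-trans (on x e) (ℕₚ.≤-reflexive (sym (ℕₚ.*-identityʳ _))))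

      -- Self-improvement: a set that is not too sparse and that no line meets in an intermediate number of points is dense.
      boot : ∀ a b e → 0 < s → a ℕ.* Q ≤ b ℕ.* s → a ℕ.* (k ℕ.+ g) ≡ k ℕ.* b ℕ.+ e →
        (1 ℕ.+ g) ℕ.* e ℕ.* Q ≤ (a ℕ.* k ℕ.* (k ℕ.+ g) ℕ.+ (1 ℕ.+ g) ℕ.* e) ℕ.* s
      boot a b e 0<s h eq = begin
        (1 ℕ.+ g) ℕ.* e ℕ.* Q                                    ≡⟨ cong ((1 ℕ.+ g) ℕ.* e ℕ.*_) (sym s+n) ⟩
        (1 ℕ.+ g) ℕ.* e ℕ.* (s ℕ.+ n)                            ≡⟨ lem₁ ((1 ℕ.+ g) ℕ.* e) s n ⟩
        (1 ℕ.+ g) ℕ.* e ℕ.* n ℕ.+ (1 ℕ.+ g) ℕ.* e ℕ.* s          ≤⟨ ℕₚ.+-monoˡ-≤ _ main ⟩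
        a ℕ.* k ℕ.* (k ℕ.+ g) ℕ.* s ℕ.+ (1 ℕ.+ g) ℕ.* e ℕ.* s    ≡⟨ ℕₚ.*-distribʳ-+ s (a ℕ.* k ℕ.* (k ℕ.+ g)) ((1 ℕ.+ g) ℕ.* e) ⟨
        (a ℕ.* k ℕ.* (k ℕ.+ g) ℕ.+ (1 ℕ.+ g) ℕ.* e) ℕ.* s        ∎
        where
        open ℕₚ.≤-Reasoning
        instance _ = ℕ.>-nonZero 0<s
        lem₁ : ∀ c s n → c ℕ.* (s ℕ.+ n) ≡ c ℕ.* n ℕ.+ c ℕ.* s
        lem₁ = solve-∀
        -- `sumOff` bounds Y from below, `YZ` and `sumOn` bound it from above. The density
        -- assumption replaces Q by a multiple of `s` in the loss term, and what remains on the left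
        -- is the excess `e`.
        main : (1 ℕ.+ g) ℕ.* e ℕ.* n ≤ a ℕ.* k ℕ.* (k ℕ.+ g) ℕ.* s
        main = ℕₚ.*-cancelʳ-≤ _ _ s (ℕₚ.+-cancelˡ-≤ ((1 ℕ.+ g) ℕ.* n ℕ.* (k ℕ.* (b ℕ.* s))) _ _ (begin
          (1 ℕ.+ g) ℕ.* n ℕ.* (k ℕ.* (b ℕ.* s)) ℕ.+ (1 ℕ.+ g) ℕ.* e ℕ.* n ℕ.* s   ≡⟨ l₁ g n k b s e ⟩
          (1 ℕ.+ g) ℕ.* n ℕ.* s ℕ.* (k ℕ.* b ℕ.+ e)                              ≡⟨ cong ((1 ℕ.+ g) ℕ.* n ℕ.* s ℕ.*_) (sym eq) ⟩
          (1 ℕ.+ g) ℕ.* n ℕ.* s ℕ.* (a ℕ.* (k ℕ.+ g))                            ≡⟨ l₂ g n s a (k ℕ.+ g) ⟩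
          a ℕ.* (1 ℕ.+ g) ℕ.* (n ℕ.* ((k ℕ.+ g) ℕ.* s))                          ≤⟨ ℕₚ.*-monoʳ-≤ (a ℕ.* (1 ℕ.+ g)) sumOff ⟩
          a ℕ.* (1 ℕ.+ g) ℕ.* (n ℕ.* (Q ℕ.* k) ℕ.+ g ℕ.* Y)                      ≡⟨ l₃ a g n Q k Y ⟩
          (1 ℕ.+ g) ℕ.* n ℕ.* (k ℕ.* (a ℕ.* Q)) ℕ.+ a ℕ.* g ℕ.* ((1 ℕ.+ g) ℕ.* Y)
            ≤⟨ ℕₚ.+-mono-≤ (ℕₚ.*-monoʳ-≤ ((1 ℕ.+ g) ℕ.* n) (ℕₚ.*-monoʳ-≤ k h)) (ℕₚ.*-monoʳ-≤ (a ℕ.* g) YZ) ⟩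
          (1 ℕ.+ g) ℕ.* n ℕ.* (k ℕ.* (b ℕ.* s)) ℕ.+ a ℕ.* g ℕ.* (k ℕ.* Z)        ≡⟨ cong ((1 ℕ.+ g) ℕ.* n ℕ.* (k ℕ.* (b ℕ.* s)) ℕ.+_) (l₄ a g k Z) ⟩
          (1 ℕ.+ g) ℕ.* n ℕ.* (k ℕ.* (b ℕ.* s)) ℕ.+ a ℕ.* k ℕ.* (g ℕ.* Z)        ≤⟨ ℕₚ.+-monoʳ-≤ _ (ℕₚ.*-monoʳ-≤ (a ℕ.* k) sumOn) ⟩
          (1 ℕ.+ g) ℕ.* n ℕ.* (k ℕ.* (b ℕ.* s)) ℕ.+ a ℕ.* k ℕ.* (s ℕ.* ((k ℕ.+ g) ℕ.* s))
            ≡⟨ cong ((1 ℕ.+ g) ℕ.* n ℕ.* (k ℕ.* (b ℕ.* s)) ℕ.+_) (l₅ a k s (k ℕ.+ g)) ⟩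
          (1 ℕ.+ g) ℕ.* n ℕ.* (k ℕ.* (b ℕ.* s)) ℕ.+ a ℕ.* k ℕ.* (k ℕ.+ g) ℕ.* s ℕ.* s ∎))
          where
          l₁ : ∀ g n k b s e → (1 ℕ.+ g) ℕ.* n ℕ.* (k ℕ.* (b ℕ.* s)) ℕ.+ (1 ℕ.+ g) ℕ.* e ℕ.* n ℕ.* s ≡ (1 ℕ.+ g) ℕ.* n ℕ.* s ℕ.* (k ℕ.* b ℕ.+ e)
          l₁ = solve-∀
          l₂ : ∀ g n s a c → (1 ℕ.+ g) ℕ.* n ℕ.* s ℕ.* (a ℕ.* c) ≡ a ℕ.* (1 ℕ.+ g) ℕ.* (n ℕ.* (c ℕ.* s))
          l₂ = solve-∀
          l₃ : ∀ a g n Q k Y → a ℕ.* (1 ℕ.+ g) ℕ.* (n ℕ.* (Q ℕ.* k) ℕ.+ g ℕ.* Y) ≡ (1 ℕ.+ g) ℕ.* n ℕ.* (k ℕ.* (a ℕ.* Q)) ℕ.+ a ℕ.* g ℕ.* ((1 ℕ.+ g) ℕ.* Y)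
          l₃ = solve-∀
          l₄ : ∀ a g k Z → a ℕ.* g ℕ.* (k ℕ.* Z) ≡ a ℕ.* k ℕ.* (g ℕ.* Z)
          l₄ = solve-∀
          l₅ : ∀ a k s c → a ℕ.* k ℕ.* (s ℕ.* (c ℕ.* s)) ≡ a ℕ.* k ℕ.* c ℕ.* s ℕ.* s
          l₅ = solve-∀

-- Chains of dense subspaces and covers by at most three hyperplanes

module Covers {q : ℕ} (𝔽 : FinField q) where
  open Counting 𝔽 public

  -- The support of L lies on at most two (three) hyperplanes; the witnesses xᵢ show that they are distinct.
  data Cover {N} (L : Combination N) : Set where
    cover₁ : ∀ l → l ≢ 𝟎 → (∀ v → code L v ≢ 0# → dot l v ≡ 0#) → Cover L
    cover₂ : ∀ l₁ l₂ x₂ → l₂ ≢ 𝟎 → dot l₁ x₂ ≢ 0# → dot l₂ x₂ ≡ 0# →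
      (∀ v → code L v ≢ 0# → dot l₁ v ≡ 0# ⊎ dot l₂ v ≡ 0#) → Cover L

  data TripleCover {N} (L : Combination N) : Set where
    few : Cover L → TripleCover L
    triple : ∀ l₁ l₂ l₃ x₂ x₃ → l₂ ≢ 𝟎 → l₃ ≢ 𝟎 → dot l₁ x₂ ≢ 0# → dot l₂ x₂ ≡ 0# →
      dot l₁ x₃ ≢ 0# → dot l₂ x₃ ≢ 0# → dot l₃ x₃ ≡ 0# →
      (∀ v → code L v ≢ 0# → dot l₁ v ≡ 0# ⊎ dot l₂ v ≡ 0# ⊎ dot l₃ v ≡ 0#) → TripleCover L

  ⁻¹-0 : 0# ⁻¹ ≡ 0#
  ⁻¹-0 with 0# ≟ 0#
  ... | yes _ = refl
  ... | no n = ⊥-elim (n refl)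

  ⁻¹-involutive : ∀ x → x ⁻¹ ⁻¹ ≡ x
  ⁻¹-involutive x with x ≟ 0#
  ... | yes refl = ⁻¹-0
  ... | no x≢0 = *-cancelˡ (proj≢0) (trans (⁻¹-inverseʳ proj≢0) (sym (trans (*-comm _ x) (proj₂ (inv x x≢0)))))
    where
    proj≢0 : proj₁ (inv x x≢0) ≢ 0#
    proj≢0 e = 1≢0 (trans (sym (proj₂ (inv x x≢0))) (trans (cong (x *_) e) (zeroʳ x)))

  ⊕-0· : ∀ {n} (x y : Vec F n) → x ⊕ 0# · y ≡ x
  ⊕-0· x y = trans (cong (x ⊕_) (·-zeroˡ y)) (⊕-identityʳ x)

  indep-injective : ∀ {m n} {us : Vec (Vec F n) m} → Indep us → ∀ s t → comb s us ≡ comb t us → s ≡ t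
  indep-injective {us = us} ind s t e = trans (sym (⊖-cancelʳ s t)) (trans (cong (_⊕ t) (ind _ (begin
      comb (s ⊕ (- 1#) · t) us             ≡⟨ trans (comb-⊕ s _ us) (cong (comb s us ⊕_) (comb-· (- 1#) t us)) ⟩
      comb s us ⊕ (- 1#) · comb t us       ≡⟨ cong (_⊕ (- 1#) · comb t us) e ⟩
      comb t us ⊕ (- 1#) · comb t us       ≡⟨ cong (_⊕ (- 1#) · comb t us) (⊕-identityˡ _) ⟨
      𝟎 ⊕ comb t us ⊕ (- 1#) · comb t us   ≡⟨ ⊖-cancelʳ′ 𝟎 (comb t us) ⟩
      𝟎                                    ∎))) (⊕-identityˡ t))
    where open ≡-Reasoning

  eq1 : ∀ {n} → Vec F n → Vec F n → ℕ
  eq1 w z with z ≟V w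
  ... | yes _ = 1
  ... | no _ = 0

  eq1-≡ : ∀ {n} (w : Vec F n) → eq1 w w ≡ 1
  eq1-≡ w with w ≟V w
  ... | yes _ = refl
  ... | no n = ⊥-elim (n refl)

  eq1-≢ : ∀ {n} {w z : Vec F n} → z ≢ w → eq1 w z ≡ 0
  eq1-≢ {w = w} {z} h with z ≟V w
  ... | yes e = ⊥-elim (h e)
  ... | no _ = refl

  Σ-eq1 : ∀ {n} (w : Vec F n) (f : Vec F n → ℕ) → ΣV (λ z → eq1 w z ℕ.* f z) ≡ f w
  Σ-eq1 w f = trans (ΣV-single w (λ z z≢w → cong (ℕ._* f z) (eq1-≢ z≢w))) (trans (cong (ℕ._* f w) (eq1-≡ w)) (ℕₚ.*-identityˡ _))

  -- The number of representations of a vector in the span: 0 or 1 when `us` is independent.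
  -- Weighting by it turns sums over coefficient vectors into sums over the ambient space.
  spanCount : ∀ {m n} → Vec (Vec F n) m → Vec F n → ℕ
  spanCount us z = ΣV (λ t → eq1 (comb t us) z)

  Σ-spanCount : ∀ {m n} (us : Vec (Vec F n) m) (f : Vec F n → ℕ) → ΣV (λ z → spanCount us z ℕ.* f z) ≡ ΣV (λ t → f (comb t us))
  Σ-spanCount us f = trans (ΣV-cong (λ z → trans (ℕₚ.*-comm _ (f z)) (sym (ΣV-*ˡ (f z) _))))
    (trans (ΣV-comm (λ z t → f z ℕ.* eq1 (comb t us) z)) (ΣV-cong (λ t → trans (ΣV-cong (λ z → ℕₚ.*-comm (f z) _)) (Σ-eq1 (comb t us) f))))

  1≤spanCount : ∀ {m n} {us : Vec (Vec F n) m} {z} → InSpan z us → 1 ≤ spanCount us z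
  1≤spanCount {us = us} {z} (t , e) = ℕₚ.≤-trans (ℕₚ.≤-reflexive (sym (trans (cong (λ w → eq1 w z) e) (eq1-≡ z)))) (ΣV-term (λ t → eq1 (comb t us) z) t)

  coz : F → ℕ
  coz a = 1 ∸ nz a

  coz-0 : ∀ {a} → a ≡ 0# → coz a ≡ 1
  coz-0 e = cong (1 ∸_) (nz-0 e)

  coz-≢0 : ∀ {a} → a ≢ 0# → coz a ≡ 0
  coz-≢0 e = cong (1 ∸_) (nz-1 e)

  spanCount≤coz : ∀ {m n} {us : Vec (Vec F n) m} {l} → Indep us → dots l us ≡ 𝟎 → ∀ z → spanCount us z ≤ coz (dot l z)
  spanCount≤coz {us = us} {l} ind lus z with inSpan? z us
  ... | yes (t₀ , e) = ℕₚ.≤-reflexive (trans (ΣV-single t₀ (λ t t≢ → eq1-≢ (λ z≡ → t≢ (indep-injective ind t t₀ (trans (sym z≡) (sym e))))))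
        (trans (trans (cong (λ w → eq1 w z) e) (eq1-≡ z)) (sym (coz-0 (trans (cong (dot l) (sym e)) (dot-annihilator l lus t₀))))))
  ... | no z∉ = ℕₚ.≤-trans (ℕₚ.≤-reflexive (ΣV-zero (λ t → eq1-≢ (λ z≡ → z∉ (t , sym z≡))))) z≤n

  ∑-coz : ∀ (α : F) {β} → β ≢ 0# → ∑ {q} (λ t → coz (α + t * β)) ≡ 1
  ∑-coz α {β} β≢0 = trans (ℕSum.∑-single t₀ (λ t t≢ → coz-≢0 (λ e → t≢ (*-cancelˡ β≢0 (trans (*-comm β t) (trans (+-cancelˡ α (trans e (sym at))) (*-comm t₀ β))))))) (coz-0 at)
    where
    t₀ = - α * β ⁻¹
    at : α + t₀ * β ≡ 0#
    at = trans (solve 3 (λ a i b → a :+ :- a :* i :* b := a :- a :* (i :* b)) refl α (β ⁻¹) β)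
      (trans (cong (λ z → α - α * z) (⁻¹-inverseˡ β≢0)) (solve 1 (λ a → a :- a :* :1 := :0) refl α))

  -- Every line in direction `x` meets the hyperplane in exactly one point.
  q*Σ-coz : ∀ {N} (l x : Vec F N) (f : Vec F N → ℕ) → dot l x ≢ 0# → (∀ t v → f (v ⊕ t · x) ≡ f v) →
    q ℕ.* ΣV (λ v → coz (dot l v) ℕ.* f v) ≡ ΣV f
  q*Σ-coz l x f lx≢0 inv′ = trans (ΣV-average x (λ v → coz (dot l v)) f inv′)
    (ΣV-cong (λ v → trans (cong (ℕ._* f v) (trans (∑-cong {q} (λ t → cong coz (trans (dot-⊕ʳ l v (t · x)) (cong (dot l v +_) (dot-·ʳ l t x))))) (∑-coz (dot l v) lx≢0)))
      (ℕₚ.*-identityˡ _)))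

  Σ-hyperplane : ∀ {N} {l : Vec F (suc N)} → l ≢ 𝟎 → ΣV (λ v → coz (dot l v)) ≡ q ℕ.^ N
  Σ-hyperplane {N} {l} l≢𝟎 = ℕₚ.*-cancelˡ-≡ _ _ q (trans (cong (q ℕ.*_) (ΣV-cong (λ v → sym (ℕₚ.*-identityʳ _))))
    (trans (q*Σ-coz l (proj₁ u) (λ _ → 1) (λ e → 1≢0 (trans (sym (proj₂ u)) e)) (λ _ _ → refl)) (trans (ΣV-const (suc N) 1) (ℕₚ.*-identityʳ _))))
    where u = unit-vector l≢𝟎

  Σ-two-hyperplanes : ∀ {N} {l₁ l₂ x : Vec F (suc (suc N))} → l₂ ≢ 𝟎 → dot l₁ x ≢ 0# → dot l₂ x ≡ 0# →
    ΣV (λ v → coz (dot l₁ v) ℕ.* coz (dot l₂ v)) ≡ q ℕ.^ N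
  Σ-two-hyperplanes {N} {l₁} {l₂} {x} l₂≢𝟎 h₁ h₂ = ℕₚ.*-cancelˡ-≡ _ _ q (trans
    (q*Σ-coz l₁ x (λ v → coz (dot l₂ v)) h₁ (λ t v → cong coz (trans (dot-⊕ʳ l₂ v (t · x)) (trans (cong (dot l₂ v +_) (trans (dot-·ʳ l₂ t x) (trans (cong (t *_) h₂) (zeroʳ t)))) (+-identityʳ _)))))
    (Σ-hyperplane l₂≢𝟎))

  module Chain (k′ g : ℕ) (q≡ : q ≡ 1 ℕ.+ suc k′ ℕ.+ g) (k<g : suc k′ < g)
               {N} (L : Combination (suc (suc N))) (D : Dichotomy (suc k′) L) where
    private
      k = suc k′
      open Long k g q≡ using (long; long-yes; ≤-long)
      c = code L
      W = weight L
      P = q ℕ.^ suc N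
      a : Vec F (suc (suc N)) → Vec F (suc (suc N)) → ℕ
      a z y = lineWeight L z y

      k+k<q : k ℕ.+ suc k < q
      k+k<q = subst (k ℕ.+ suc k <_) (sym q≡) (subst (_≤ 1 ℕ.+ k ℕ.+ g) (lem k) (ℕₚ.+-monoʳ-≤ (1 ℕ.+ k) k<g))
        where
        lem : ∀ k → 1 ℕ.+ k ℕ.+ suc k ≡ suc (k ℕ.+ suc k)
        lem = solve-∀

      long≤1 : ∀ w → long w ≤ 1
      long≤1 w with q ℕₚ.≤? w ℕ.+ k
      ... | yes _ = ℕₚ.≤-refl
      ... | no _ = z≤n

      zero? : ∀ (r : F) → r ≡ 0# ⊎ r ≢ 0#
      zero? r with r ≟ 0#
      ... | yes e = inj₁ e
      ... | no n = inj₂ n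

      -- The line through w and y, once without the point y and once without the point w.
      reflect : ∀ w y → c y ≢ 0# → c w ≡ 0# → a y w ≡ suc (a w y)
      reflect w y cy≢0 cw≡0 = trans (∑-cong {q} pointwise) (trans (∑-∙ {q} coz (λ r → G (r ⁻¹))) (cong₂ ℕ._+_
          (trans (∑-cong {q} (λ r → cong coz (solve 1 (λ r → r := :0 :+ r :* :1) refl r))) (∑-coz 0# 1≢0))
          (ℕSum.∑-bij _⁻¹ _⁻¹ ⁻¹-involutive ⁻¹-involutive G)))
        where
        G : F → ℕ
        G τ = nz (c (w ⊕ τ · y))
        pointwise : ∀ r → nz (c (y ⊕ r · w)) ≡ coz r ℕ.+ G (r ⁻¹)
        pointwise r with zero? r
        ... | inj₁ refl = trans (nz-1 (λ e → cy≢0 (trans (cong c (sym (⊕-0· y w))) e)))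
              (sym (cong₂ ℕ._+_ (coz-0 refl) (nz-0 (trans (cong (λ i → c (w ⊕ i · y)) ⁻¹-0) (trans (cong c (⊕-0· w y)) cw≡0)))))
        ... | inj₂ r≢0 = trans (cong nz (trans (sym (code-· L (⁻¹-≢0 r≢0) _)) (cong c (trans (·-distribˡ (r ⁻¹) y (r · w))
              (trans (cong ((r ⁻¹) · y ⊕_) (trans (·-assoc (r ⁻¹) r w) (trans (cong (_· w) (⁻¹-inverseˡ r≢0)) (·-identity w)))) (⊕-comm _ w))))))
              (cong (ℕ._+ G (r ⁻¹)) (sym (coz-≢0 r≢0)))

      -- The projective line carries the further support point `y` at infinity. If exactly `k`
      -- affine points were in the support, one of the remaining points would be a zero; taking that
      -- zero as the point at infinity leaves k + 1 affine support points, and these lie in the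
      -- forbidden gap. So a line that is not long has at most k - 1.
      secant : ∀ z y → c y ≢ 0# → a z y ≤ k′ ⊎ q ≤ a z y ℕ.+ k
      secant z y cy≢0 with D z y
      ... | inj₂ h = inj₂ h
      ... | inj₁ h with ℕₚ.m≤n⇒m<n∨m≡n h
      ...   | inj₁ (s≤s h′) = inj₁ h′
      ...   | inj₂ a≡k with Finₚ.any? (λ t → c (z ⊕ t · y) ≟ 0#)
      ...     | no none = ⊥-elim (ℕₚ.<⇒≱ k+k<q (ℕₚ.≤-trans (ℕₚ.≤-reflexive (trans (sym all) a≡k)) (ℕₚ.m≤m+n k (suc k))))
                where
                all : a z y ≡ q
                all = trans (∑-cong {q} (λ t → nz-1 (λ e → none (t , e)))) (trans (∑-const q 1) (ℕₚ.*-identityʳ q))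
      ...     | yes (t₀ , e) = ⊥-elim (impossible (D y (z ⊕ t₀ · y)))
                where
                ayw : a y (z ⊕ t₀ · y) ≡ suc k
                ayw = trans (reflect (z ⊕ t₀ · y) y cy≢0 e) (cong suc (trans (lineWeight-shift L y t₀ z) a≡k))
                impossible : a y (z ⊕ t₀ · y) ≤ k ⊎ q ≤ a y (z ⊕ t₀ · y) ℕ.+ k → ⊥
                impossible (inj₁ h) = ℕₚ.<-irrefl refl (subst (_≤ k) ayw h)
                impossible (inj₂ h) = ℕₚ.<⇒≱ k+k<q (ℕₚ.≤-trans h (ℕₚ.≤-reflexive (trans (cong (ℕ._+ k) ayw) (ℕₚ.+-comm (suc k) k))))

      longCount : Vec F (suc (suc N)) → ℕ
      longCount y = ΣV (λ z → nz (c z) ℕ.* long (a z y))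

      -- There are P lines in direction `y`, and by `secant` each one that is not long accounts for
      -- at most `k′` support vectors.
      longCount-bound : ∀ y → c y ≢ 0# → W ≤ longCount y ℕ.+ k′ ℕ.* P
      longCount-bound y cy≢0 = ℕₚ.*-cancelˡ-≤ q (begin
        q ℕ.* W                                   ≡⟨ cong (q ℕ.*_) (trans (ΣV-cong split) (ΣV-∙ _ _)) ⟩
        q ℕ.* (longCount y ℕ.+ shortCount)        ≡⟨ ℕₚ.*-distribˡ-+ q (longCount y) _ ⟩
        q ℕ.* longCount y ℕ.+ q ℕ.* shortCount    ≡⟨ cong (q ℕ.* longCount y ℕ.+_) (ΣV-average y (λ z → nz (c z)) (λ z → 1 ∸ long (a z y)) (λ t z → cong (λ w → 1 ∸ long w) (lineWeight-shift L y t z))) ⟩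
        q ℕ.* longCount y ℕ.+ ΣV (λ z → a z y ℕ.* (1 ∸ long (a z y)))   ≤⟨ ℕₚ.+-monoʳ-≤ _ (ΣV-mono short) ⟩
        q ℕ.* longCount y ℕ.+ ΣV {m = suc (suc N)} (λ z → k′)           ≡⟨ cong (q ℕ.* longCount y ℕ.+_) (ΣV-const (suc (suc N)) k′) ⟩
        q ℕ.* longCount y ℕ.+ q ℕ.* P ℕ.* k′      ≡⟨ lem q (longCount y) P k′ ⟩
        q ℕ.* (longCount y ℕ.+ k′ ℕ.* P)          ∎)
        where
        open ℕₚ.≤-Reasoning
        shortCount = ΣV (λ z → nz (c z) ℕ.* (1 ∸ long (a z y)))
        split : ∀ z → nz (c z) ≡ nz (c z) ℕ.* long (a z y) ℕ.+ nz (c z) ℕ.* (1 ∸ long (a z y))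
        split z = sym (trans (sym (ℕₚ.*-distribˡ-+ (nz (c z)) _ _)) (trans (cong (nz (c z) ℕ.*_) (ℕₚ.m+[n∸m]≡n (long≤1 (a z y)))) (ℕₚ.*-identityʳ _)))
        short : ∀ z → a z y ℕ.* (1 ∸ long (a z y)) ≤ k′
        short z with secant z y cy≢0
        ... | inj₁ h = ℕₚ.≤-trans (ℕₚ.*-mono-≤ h (ℕₚ.m∸n≤m 1 (long (a z y)))) (ℕₚ.≤-reflexive (ℕₚ.*-identityʳ k′))
        ... | inj₂ h = ℕₚ.≤-trans (ℕₚ.≤-reflexive (trans (cong (λ w → a z y ℕ.* (1 ∸ w)) (long-yes h)) (ℕₚ.*-zeroʳ (a z y)))) z≤n
        lem : ∀ q x P k → q ℕ.* x ℕ.+ q ℕ.* P ℕ.* k ≡ q ℕ.* (x ℕ.+ k ℕ.* P)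
        lem = solve-∀

    subspaceWeight : ∀ {j} → Vec (Vec F (suc (suc N))) j → ℕ
    subspaceWeight us = ΣV (λ t → nz (c (comb t us)))

    private
      module Step {j} (us : Vec (Vec F (suc (suc N))) j) where
        E = subspaceWeight us
        K = k′ ℕ.* P ℕ.+ q ℕ.^ j

        B : Vec F (suc (suc N)) → ℕ
        B z = ΣV (λ t → nz (c (comb t us)) ℕ.* long (a z (comb t us)))

        B≤E : ∀ z → B z ≤ E
        B≤E z = ΣV-mono (λ t → ℕₚ.≤-trans (ℕₚ.*-monoʳ-≤ (nz (c (comb t us))) (long≤1 _)) (ℕₚ.≤-reflexive (ℕₚ.*-identityʳ _)))

        ΣB = ΣV (λ z → nz (c z) ℕ.* B z)

        ΣB-bound : E ℕ.* W ≤ ΣB ℕ.+ E ℕ.* (k′ ℕ.* P)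
        ΣB-bound = begin
          E ℕ.* W                                                              ≡⟨ trans (ℕₚ.*-comm E W) (sym (ΣV-*ˡ W _)) ⟩
          ΣV (λ t → W ℕ.* nz (c (comb t us)))                                  ≤⟨ ΣV-mono pt ⟩
          ΣV (λ t → nz (c (comb t us)) ℕ.* longCount (comb t us) ℕ.+ k′ ℕ.* P ℕ.* nz (c (comb t us)))
            ≡⟨ trans (ΣV-∙ _ _) (cong₂ ℕ._+_ swap (trans (ΣV-*ˡ (k′ ℕ.* P) _) (ℕₚ.*-comm _ E))) ⟩
          ΣB ℕ.+ E ℕ.* (k′ ℕ.* P)                                              ∎
          where
          open ℕₚ.≤-Reasoning
          swap : ΣV (λ t → nz (c (comb t us)) ℕ.* longCount (comb t us)) ≡ ΣB
          swap = trans (ΣV-cong (λ t → sym (ΣV-*ˡ (nz (c (comb t us))) _))) (trans (ΣV-comm _)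
            (ΣV-cong (λ z → trans (ΣV-cong (λ t → lem (nz (c (comb t us))) (nz (c z)) (long (a z (comb t us))))) (ΣV-*ˡ (nz (c z)) _))))
            where
            lem : ∀ x y z → x ℕ.* (y ℕ.* z) ≡ y ℕ.* (x ℕ.* z)
            lem = solve-∀
          pt : ∀ t → W ℕ.* nz (c (comb t us)) ≤ nz (c (comb t us)) ℕ.* longCount (comb t us) ℕ.+ k′ ℕ.* P ℕ.* nz (c (comb t us))
          pt t with zero? (c (comb t us))
          ... | inj₁ e = ℕₚ.≤-trans (ℕₚ.≤-reflexive (trans (cong (W ℕ.*_) (nz-0 e)) (ℕₚ.*-zeroʳ W))) z≤n
          ... | inj₂ n rewrite nz-1 n = ℕₚ.≤-trans (ℕₚ.≤-reflexive (ℕₚ.*-identityʳ W)) (ℕₚ.≤-trans (longCount-bound (comb t us) n)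
                (ℕₚ.≤-reflexive (lem (longCount (comb t us)) (k′ ℕ.* P))))
            where
            lem : ∀ x y → x ℕ.+ y ≡ 1 ℕ.* x ℕ.+ y ℕ.* 1
            lem = solve-∀

        Σ-span : ΣV (spanCount us) ≡ q ℕ.^ j
        Σ-span = trans (ΣV-cong (λ z → sym (ℕₚ.*-identityʳ _))) (trans (Σ-spanCount us (λ _ → 1)) (trans (ΣV-const j 1) (ℕₚ.*-identityʳ _)))

        -- Averages `B` over the support. The two parts of `K` are the losses: `k′ ℕ.* P` comes from
        -- `longCount-bound`, and q^j from the vectors inside the span, each of which contributes at
        -- most `E`.
        find : 0 < E → K < W → ∃ λ z → c z ≢ 0# × ¬ InSpan z us × E ℕ.* (W ∸ K) ≤ B z ℕ.* W
        find 0<E K<W with findV (λ z → ¬? (c z ≟ 0#) ×-dec ¬? (inSpan? z us) ×-dec (E ℕ.* (W ∸ K) ℕₚ.≤? B z ℕ.* W))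
        ... | inj₁ p = p
        ... | inj₂ none = ⊥-elim (ℕₚ.<⇒≱ (ℕₚ.m<n+m (W ℕ.* (T ∸ 1)) 0<W) (begin
            W ℕ.+ W ℕ.* (T ∸ 1)                  ≡⟨ ℕₚ.*-suc W (T ∸ 1) ⟨
            W ℕ.* suc (T ∸ 1)                    ≡⟨ cong (W ℕ.*_) (ℕₚ.m+[n∸m]≡n 0<T) ⟩
            W ℕ.* T                              ≤⟨ ℕₚ.+-cancelˡ-≤ (q ℕ.^ j ℕ.* (E ℕ.* W)) _ _ combined ⟩
            W ℕ.* (T ∸ 1)                        ∎))
          where
          open ℕₚ.≤-Reasoning
          T = E ℕ.* (W ∸ K)
          0<W : 0 < W
          0<W = ℕₚ.≤-<-trans z≤n K<W
          0<T : 0 < T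
          0<T = ℕₚ.*-mono-< 0<E (ℕₚ.m<n⇒0<n∸m K<W)
          T+ : T ℕ.+ E ℕ.* q ℕ.^ j ≤ ΣB
          T+ = ℕₚ.+-cancelʳ-≤ (E ℕ.* (k′ ℕ.* P)) _ _ (ℕₚ.≤-trans (ℕₚ.≤-reflexive (trans (lem E (W ∸ K) (q ℕ.^ j) (k′ ℕ.* P)) (cong (E ℕ.*_) (ℕₚ.m+[n∸m]≡n (ℕₚ.<⇒≤ K<W))))) ΣB-bound)
            where
            lem : ∀ E w x y → E ℕ.* w ℕ.+ E ℕ.* x ℕ.+ E ℕ.* y ≡ E ℕ.* (y ℕ.+ x ℕ.+ w)
            lem = solve-∀
          -- A support vector outside the span that fails the required inequality contributes at
          -- most T - 1; this lost unit makes the contradiction strict.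
          pt : ∀ z → W ℕ.* (nz (c z) ℕ.* B z) ≤ E ℕ.* W ℕ.* spanCount us z ℕ.+ (T ∸ 1) ℕ.* nz (c z)
          pt z with zero? (c z)
          ... | inj₁ e = ℕₚ.≤-trans (ℕₚ.≤-reflexive (trans (cong (λ n → W ℕ.* (n ℕ.* B z)) (nz-0 e)) (ℕₚ.*-zeroʳ W))) z≤n
          ... | inj₂ n with inSpan? z us
          ...   | yes p = ℕₚ.≤-trans (ℕₚ.≤-reflexive (trans (cong (λ n → W ℕ.* (n ℕ.* B z)) (nz-1 n)) (trans (cong (W ℕ.*_) (ℕₚ.*-identityˡ (B z))) (ℕₚ.*-comm W (B z)))))
                  (ℕₚ.≤-trans (ℕₚ.*-monoˡ-≤ W (B≤E z)) (ℕₚ.≤-trans (ℕₚ.≤-trans (ℕₚ.≤-reflexive (sym (ℕₚ.*-identityʳ (E ℕ.* W)))) (ℕₚ.*-monoʳ-≤ (E ℕ.* W) (1≤spanCount p))) (ℕₚ.m≤m+n _ _)))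
          ...   | no p = ℕₚ.≤-trans (ℕₚ.≤-reflexive (trans (cong (λ n → W ℕ.* (n ℕ.* B z)) (nz-1 n)) (trans (cong (W ℕ.*_) (ℕₚ.*-identityˡ (B z))) (ℕₚ.*-comm W (B z)))))
                  (ℕₚ.≤-trans (ℕₚ.≤-trans (ℕₚ.≤-pred (ℕₚ.<-≤-trans (ℕₚ.≰⇒> (λ h → none z (n , p , h))) (ℕₚ.≤-reflexive (sym (ℕₚ.m+[n∸m]≡n 0<T)))))
                    (ℕₚ.≤-reflexive (sym (trans (cong ((T ∸ 1) ℕ.*_) (nz-1 n)) (ℕₚ.*-identityʳ _))))) (ℕₚ.m≤n+m _ _))
          combined : q ℕ.^ j ℕ.* (E ℕ.* W) ℕ.+ W ℕ.* T ≤ q ℕ.^ j ℕ.* (E ℕ.* W) ℕ.+ W ℕ.* (T ∸ 1)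
          combined = begin
            q ℕ.^ j ℕ.* (E ℕ.* W) ℕ.+ W ℕ.* T         ≡⟨ lem (q ℕ.^ j) E W T ⟩
            W ℕ.* (T ℕ.+ E ℕ.* q ℕ.^ j)               ≤⟨ ℕₚ.*-monoʳ-≤ W T+ ⟩
            W ℕ.* ΣB                                  ≡⟨ ΣV-*ˡ W _ ⟨
            ΣV (λ z → W ℕ.* (nz (c z) ℕ.* B z))       ≤⟨ ΣV-mono pt ⟩
            ΣV (λ z → E ℕ.* W ℕ.* spanCount us z ℕ.+ (T ∸ 1) ℕ.* nz (c z))
              ≡⟨ trans (ΣV-∙ _ _) (cong₂ ℕ._+_ (trans (ΣV-*ˡ (E ℕ.* W) _) (trans (cong (E ℕ.* W ℕ.*_) Σ-span) (ℕₚ.*-comm (E ℕ.* W) _))) (trans (ΣV-*ˡ (T ∸ 1) _) (ℕₚ.*-comm _ W))) ⟩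
            q ℕ.^ j ℕ.* (E ℕ.* W) ℕ.+ W ℕ.* (T ∸ 1)   ∎
            where
            lem : ∀ x E W T → x ℕ.* (E ℕ.* W) ℕ.+ W ℕ.* T ≡ W ℕ.* (T ℕ.+ E ℕ.* x)
            lem = solve-∀

        -- The lines through `z` with directions in the span are counted: each contains `z`, and a
        -- long one at least `g` further support points. They fill the slice z + span, whose q - 1
        -- scaled copies and the span itself make up the enlarged subspace.
        grow : ∀ z → c z ≢ 0# → E ℕ.+ g ℕ.* B z ≤ subspaceWeight (z ∷ us)
        grow z cz≢0 = ℕₚ.+-cancelʳ-≤ f₁ _ _ (begin
          E ℕ.+ g ℕ.* B z ℕ.+ f₁              ≡⟨ ℕₚ.+-assoc E _ f₁ ⟩
          E ℕ.+ (g ℕ.* B z ℕ.+ f₁)            ≤⟨ ℕₚ.+-monoʳ-≤ E gB ⟩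
          E ℕ.+ q ℕ.* f₁                      ≡⟨ E′ ⟨
          subspaceWeight (z ∷ us) ℕ.+ f₁      ∎)
          where
          open ℕₚ.≤-Reasoning
          f₁ = ΣV (λ t → nz (c (z ⊕ comb t us)))
          E′ : subspaceWeight (z ∷ us) ℕ.+ f₁ ≡ E ℕ.+ q ℕ.* f₁
          E′ = trans (cong (ℕ._+ f₁) (ΣV-∷ _)) (∑-two 0# (λ r → ΣV (λ t → nz (c (r · z ⊕ comb t us))))
            (ΣV-cong (λ t → cong (λ w → nz (c w)) (trans (cong (_⊕ comb t us) (·-zeroˡ z)) (⊕-identityˡ _))))
            (λ r r≢0 → trans (sym (ΣV-scale r≢0 _)) (ΣV-cong (λ t → cong nz (trans (cong c (trans (cong (r · z ⊕_) (comb-· r t us)) (sym (·-distribˡ r z _)))) (code-· L r≢0 _))))))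
          Σa : ΣV (λ t → a z (comb t us)) ℕ.+ f₁ ≡ q ℕ.^ j ℕ.+ q ℕ.* f₁
          Σa = trans (cong (ℕ._+ f₁) (sym (∑-ΣV (λ r t → nz (c (z ⊕ r · comb t us)))))) (∑-two 0# (λ r → ΣV (λ t → nz (c (z ⊕ r · comb t us))))
            (trans (ΣV-cong (λ t → trans (cong (λ w → nz (c w)) (⊕-0· z (comb t us))) (nz-1 cz≢0))) (trans (ΣV-const j 1) (ℕₚ.*-identityʳ _)))
            (λ r r≢0 → trans (ΣV-cong (λ t → cong (λ w → nz (c (z ⊕ w))) (sym (comb-· r t us)))) (ΣV-scale r≢0 (λ t → nz (c (z ⊕ comb t us))))))
          pt : ∀ t → 1 ℕ.+ g ℕ.* (nz (c (comb t us)) ℕ.* long (a z (comb t us))) ≤ a z (comb t us)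
          pt t = ℕₚ.≤-trans (s≤s (ℕₚ.*-monoʳ-≤ g (ℕₚ.≤-trans (ℕₚ.*-monoˡ-≤ (long (a z (comb t us))) (nz≤1 (c (comb t us)))) (ℕₚ.≤-reflexive (ℕₚ.*-identityˡ _)))))
            (≤-long (ℕₚ.≤-trans (ℕₚ.≤-reflexive (sym (trans (cong (λ w → nz (c w)) (⊕-0· z (comb t us))) (nz-1 cz≢0)))) (∑-term (λ r → nz (c (z ⊕ r · comb t us))) 0#)))
          gB : g ℕ.* B z ℕ.+ f₁ ≤ q ℕ.* f₁
          gB = ℕₚ.+-cancelˡ-≤ (q ℕ.^ j) _ _ (begin
            q ℕ.^ j ℕ.+ (g ℕ.* B z ℕ.+ f₁)     ≡⟨ ℕₚ.+-assoc (q ℕ.^ j) _ f₁ ⟨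
            q ℕ.^ j ℕ.+ g ℕ.* B z ℕ.+ f₁       ≡⟨ cong (ℕ._+ f₁) (trans (ΣV-∙ _ _) (cong₂ ℕ._+_ (trans (ΣV-const j 1) (ℕₚ.*-identityʳ _)) (ΣV-*ˡ g _))) ⟨
            ΣV (λ t → 1 ℕ.+ g ℕ.* (nz (c (comb t us)) ℕ.* long (a z (comb t us)))) ℕ.+ f₁   ≤⟨ ℕₚ.+-monoˡ-≤ f₁ (ΣV-mono pt) ⟩
            ΣV (λ t → a z (comb t us)) ℕ.+ f₁  ≡⟨ Σa ⟩
            q ℕ.^ j ℕ.+ q ℕ.* f₁               ∎)

    -- r₁ / r₂ bounds from below the fraction (W - K) / W of the support of a subspace that a good
    -- `z` sees along long lines. From density θ / q a step leaves at least θ (r₂ + g r₁) / (q^2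
    -- r₂), and `improve` lifts this back to θ / q.
    module Dense (θ r₁ r₂ : ℕ) (θ<q : θ < q) (0<θ : 0 < θ)
      (ratio : r₁ ℕ.* W ℕ.+ r₂ ℕ.* (k′ ℕ.* P ℕ.+ q ℕ.^ N) ≤ r₂ ℕ.* W)
      (0<r₁ : 0 < r₁) (0<r₂ : 0 < r₂)
      (improve : ∀ {m} (M : Combination m) → Dichotomy k M → 0 < weight M →
         θ ℕ.* (r₂ ℕ.+ g ℕ.* r₁) ℕ.* q ℕ.^ m ≤ q ℕ.* q ℕ.* r₂ ℕ.* weight M → θ ℕ.* q ℕ.^ m ≤ q ℕ.* weight M)
      (sparse : W ℕ.+ 6 ℕ.* q ℕ.^ N < 4 ℕ.* (θ ℕ.* q ℕ.^ N)) where

      private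
        instance
          _ = ℕ.>-nonZero 0<r₂

        weight-pull : ∀ {j} (us : Vec (Vec F (suc (suc N))) j) → weight (pull L us) ≡ subspaceWeight us
        weight-pull us = ΣV-cong (λ t → cong nz (code-pull L us t))

        Chained : ∀ j → Vec F (suc (suc N)) → Set
        Chained j x = ∃ λ (us : Vec (Vec F (suc (suc N))) j) → Indep us × InSpan x us × θ ℕ.* q ℕ.^ j ≤ q ℕ.* subspaceWeight us

        -- By homogeneity all q - 1 nonzero multiples of `x` are in the support, and θ is at most q
        -- - 1.
        start : ∀ x → x ≢ 𝟎 → c x ≢ 0# → Chained 1 x
        start x x≢𝟎 cx≢0 = (x ∷ []) , indep-∷ indep-[] (λ { ([] , e) → x≢𝟎 (sym e) }) , (1# ∷ [] , trans (⊕-identityʳ _) (·-identity x)) ,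
            subst (_≤ q ℕ.* E) (lem q θ) (ℕₚ.*-monoʳ-≤ q (ℕₚ.≤-pred (ℕₚ.≤-trans θ<q q≤)))
          where
          E = subspaceWeight (x ∷ [])
          lem : ∀ q θ → q ℕ.* θ ≡ θ ℕ.* (q ℕ.* 1)
          lem = solve-∀
          pt : ∀ t → 1 ≤ coz t ℕ.+ nz (c (t · x ⊕ 𝟎))
          pt t with zero? t
          ... | inj₁ e = ℕₚ.≤-trans (ℕₚ.≤-reflexive (sym (coz-0 e))) (ℕₚ.m≤m+n _ _)
          ... | inj₂ t≢0 = ℕₚ.≤-trans (ℕₚ.≤-reflexive (sym (nz-1 (λ e → cx≢0 (trans (sym (code-· L t≢0 x)) (trans (cong c (sym (⊕-identityʳ _))) e)))))) (ℕₚ.m≤n+m _ (coz t))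
          q≤ : q ≤ suc E
          q≤ = begin
            q                                                ≡⟨ trans (∑-const q 1) (ℕₚ.*-identityʳ q) ⟨
            ∑ {q} (λ t → 1)                                  ≤⟨ ∑-mono {q} pt ⟩
            ∑ {q} (λ t → coz t ℕ.+ nz (c (t · x ⊕ 𝟎)))       ≡⟨ ∑-∙ {q} _ _ ⟩
            ∑ {q} coz ℕ.+ ∑ {q} (λ t → nz (c (t · x ⊕ 𝟎)))
              ≡⟨ cong₂ ℕ._+_ (trans (∑-cong {q} (λ r → cong coz (solve 1 (λ r → r := :0 :+ r :* :1) refl r))) (∑-coz 0# 1≢0))
                   (sym (trans (ΣV-∷ _) (∑-cong {q} (λ t → ΣV-[] _)))) ⟩
            suc E                                            ∎
            where open ℕₚ.≤-Reasoning

        0<qʲ : ∀ j → 0 < q ℕ.^ j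
        0<qʲ j = ℕₚ.m^n>0 q j

        extend : ∀ {j x} → suc j ≤ suc N → Chained j x → Chained (suc j) x
        extend {j} {x} j≤N (us , ind , (t , t≡) , dense) = (z ∷ us) , indep-∷ ind z∉ ,
            (0# ∷ t , trans (cong (_⊕ comb t us) (·-zeroˡ z)) (trans (⊕-identityˡ _) t≡)) ,
            subst (λ w → θ ℕ.* q ℕ.^ suc j ≤ q ℕ.* w) (weight-pull (z ∷ us))
              (improve (pull L (z ∷ us)) (dichotomy-pull {L = L} D (z ∷ us)) (ℕₚ.<-≤-trans 0<E (ℕₚ.≤-trans (ℕₚ.m≤m+n E _) (ℕₚ.≤-trans (grow z cz≢0) (ℕₚ.≤-reflexive (sym (weight-pull (z ∷ us)))))))
                (subst (λ w → θ ℕ.* (r₂ ℕ.+ g ℕ.* r₁) ℕ.* q ℕ.^ suc j ≤ q ℕ.* q ℕ.* r₂ ℕ.* w) (sym (weight-pull (z ∷ us))) dense₀))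
          where
          open Step us
          open ℕₚ.≤-Reasoning
          0<E : 0 < E
          0<E with ℕₚ.m≤n⇒m<n∨m≡n (z≤n {E})
          ... | inj₁ h = h
          ... | inj₂ 0≡E = ⊥-elim (ℕₚ.<⇒≱ (ℕₚ.*-mono-< 0<θ (0<qʲ j)) (ℕₚ.≤-trans dense (ℕₚ.≤-reflexive (trans (cong (q ℕ.*_) (sym 0≡E)) (ℕₚ.*-zeroʳ q)))))
          K≤ : K ≤ k′ ℕ.* P ℕ.+ q ℕ.^ N
          K≤ = ℕₚ.+-monoʳ-≤ (k′ ℕ.* P) (ℕₚ.^-monoʳ-≤ q (ℕₚ.≤-pred j≤N))
          ratioK : r₁ ℕ.* W ℕ.+ r₂ ℕ.* K ≤ r₂ ℕ.* W
          ratioK = ℕₚ.≤-trans (ℕₚ.+-monoʳ-≤ (r₁ ℕ.* W) (ℕₚ.*-monoʳ-≤ r₂ K≤)) ratio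
          0<W : 0 < W
          0<W with ℕₚ.m≤n⇒m<n∨m≡n (z≤n {W})
          ... | inj₁ h = h
          ... | inj₂ 0≡W = ⊥-elim (ℕₚ.<⇒≱ (ℕₚ.*-mono-< 0<r₂ (ℕₚ.<-≤-trans (0<qʲ j) (ℕₚ.m≤n+m (q ℕ.^ j) (k′ ℕ.* P))))
                (ℕₚ.≤-trans (ℕₚ.m≤n+m (r₂ ℕ.* K) (r₁ ℕ.* W)) (ℕₚ.≤-trans ratioK (ℕₚ.≤-reflexive (trans (cong (r₂ ℕ.*_) (sym 0≡W)) (ℕₚ.*-zeroʳ r₂))))))
          K<W : K < W
          K<W = ℕₚ.*-cancelˡ-< r₂ K W (ℕₚ.<-≤-trans (ℕₚ.m<n+m (r₂ ℕ.* K) (ℕₚ.*-mono-< 0<r₁ 0<W)) ratioK)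
          found = find 0<E K<W
          z = proj₁ found
          cz≢0 = proj₁ (proj₂ found)
          z∉ = proj₁ (proj₂ (proj₂ found))
          r₁E≤r₂B : r₁ ℕ.* E ≤ r₂ ℕ.* B z
          r₁E≤r₂B = ℕₚ.*-cancelʳ-≤ _ _ W (begin
            r₁ ℕ.* E ℕ.* W             ≡⟨ lem₁ r₁ E W ⟩
            E ℕ.* (r₁ ℕ.* W)           ≤⟨ ℕₚ.*-monoʳ-≤ E (ℕₚ.+-cancelʳ-≤ (r₂ ℕ.* K) _ _ (ℕₚ.≤-trans ratioK (ℕₚ.≤-reflexive
                                            (trans (cong (r₂ ℕ.*_) (sym (ℕₚ.m∸n+n≡m (ℕₚ.<⇒≤ K<W)))) (ℕₚ.*-distribˡ-+ r₂ (W ∸ K) K))))) ⟩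
            E ℕ.* (r₂ ℕ.* (W ∸ K))     ≡⟨ lem₂ E r₂ (W ∸ K) ⟩
            r₂ ℕ.* (E ℕ.* (W ∸ K))     ≤⟨ ℕₚ.*-monoʳ-≤ r₂ (proj₂ (proj₂ (proj₂ found))) ⟩
            r₂ ℕ.* (B z ℕ.* W)         ≡⟨ ℕₚ.*-assoc r₂ (B z) W ⟨
            r₂ ℕ.* B z ℕ.* W           ∎)
            where
            instance _ = ℕ.>-nonZero 0<W
            lem₁ : ∀ a b c → a ℕ.* b ℕ.* c ≡ b ℕ.* (a ℕ.* c)
            lem₁ = solve-∀
            lem₂ : ∀ a b c → a ℕ.* (b ℕ.* c) ≡ b ℕ.* (a ℕ.* c)
            lem₂ = solve-∀
          dense₀ : θ ℕ.* (r₂ ℕ.+ g ℕ.* r₁) ℕ.* q ℕ.^ suc j ≤ q ℕ.* q ℕ.* r₂ ℕ.* subspaceWeight (z ∷ us)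
          dense₀ = begin
            θ ℕ.* (r₂ ℕ.+ g ℕ.* r₁) ℕ.* (q ℕ.* q ℕ.^ j)    ≡⟨ lem₁ θ (r₂ ℕ.+ g ℕ.* r₁) q (q ℕ.^ j) ⟩
            q ℕ.* (r₂ ℕ.+ g ℕ.* r₁) ℕ.* (θ ℕ.* q ℕ.^ j)    ≤⟨ ℕₚ.*-monoʳ-≤ (q ℕ.* (r₂ ℕ.+ g ℕ.* r₁)) dense ⟩
            q ℕ.* (r₂ ℕ.+ g ℕ.* r₁) ℕ.* (q ℕ.* E)          ≡⟨ lem₂ q r₂ g r₁ E ⟩
            q ℕ.* q ℕ.* (r₂ ℕ.* E ℕ.+ g ℕ.* (r₁ ℕ.* E))    ≤⟨ ℕₚ.*-monoʳ-≤ (q ℕ.* q) (ℕₚ.+-monoʳ-≤ (r₂ ℕ.* E) (ℕₚ.*-monoʳ-≤ g r₁E≤r₂B)) ⟩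
            q ℕ.* q ℕ.* (r₂ ℕ.* E ℕ.+ g ℕ.* (r₂ ℕ.* B z))  ≡⟨ lem₃ q r₂ E g (B z) ⟩
            q ℕ.* q ℕ.* r₂ ℕ.* (E ℕ.+ g ℕ.* B z)           ≤⟨ ℕₚ.*-monoʳ-≤ (q ℕ.* q ℕ.* r₂) (grow z cz≢0) ⟩
            q ℕ.* q ℕ.* r₂ ℕ.* subspaceWeight (z ∷ us)     ∎
            where
            lem₁ : ∀ θ r q x → θ ℕ.* r ℕ.* (q ℕ.* x) ≡ q ℕ.* r ℕ.* (θ ℕ.* x)
            lem₁ = solve-∀
            lem₂ : ∀ q r₂ g r₁ E → q ℕ.* (r₂ ℕ.+ g ℕ.* r₁) ℕ.* (q ℕ.* E) ≡ q ℕ.* q ℕ.* (r₂ ℕ.* E ℕ.+ g ℕ.* (r₁ ℕ.* E))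
            lem₂ = solve-∀
            lem₃ : ∀ q r₂ E g B → q ℕ.* q ℕ.* (r₂ ℕ.* E ℕ.+ g ℕ.* (r₂ ℕ.* B)) ≡ q ℕ.* q ℕ.* r₂ ℕ.* (E ℕ.+ g ℕ.* B)
            lem₃ = solve-∀

        chain : ∀ x → x ≢ 𝟎 → c x ≢ 0# → ∀ j → j ≤ N → Chained (suc j) x
        chain x x≢𝟎 cx≢0 zero _ = start x x≢𝟎 cx≢0
        chain x x≢𝟎 cx≢0 (suc j) j<N = extend (s≤s j<N) (chain x x≢𝟎 cx≢0 j (ℕₚ.<⇒≤ j<N))

        hyperplaneWeight : Vec F (suc (suc N)) → ℕ
        hyperplaneWeight l = ΣV (λ v → coz (dot l v) ℕ.* nz (c v))

        DenseHyperplane : Vec F (suc (suc N)) → Set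
        DenseHyperplane x = ∃ λ l → l ≢ 𝟎 × dot l x ≡ 0# × θ ℕ.* q ℕ.^ N ≤ hyperplaneWeight l

        dense-hyperplane : ∀ x → x ≢ 𝟎 → c x ≢ 0# → DenseHyperplane x
        dense-hyperplane x x≢𝟎 cx≢0 with chain x x≢𝟎 cx≢0 N ℕₚ.≤-refl
        ... | us , ind , (t , t≡) , dense with annihilator us ℕₚ.≤-refl
        ...   | l , l≢𝟎 , lus = l , l≢𝟎 , trans (cong (dot l) (sym t≡)) (dot-annihilator l lus t) ,
                ℕₚ.≤-trans (ℕₚ.*-cancelˡ-≤ q (ℕₚ.≤-trans (ℕₚ.≤-reflexive (lem q θ (q ℕ.^ N))) dense))
                  (ℕₚ.≤-trans (ℕₚ.≤-reflexive (sym (Σ-spanCount us (λ v → nz (c v))))) (ΣV-mono (λ v → ℕₚ.*-monoˡ-≤ (nz (c v)) (spanCount≤coz ind lus v))))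
          where
          lem : ∀ q θ x → q ℕ.* (θ ℕ.* x) ≡ θ ℕ.* (q ℕ.* x)
          lem = solve-∀

        -- Bonferroni's inequality at one vector: four sets count their union at least as the sum of
        -- their sizes minus the pairwise intersections. The case n = 0 is trivial, the others are
        -- checked for all values 0 and 1.
        four : ∀ {a b c d n} → a ≤ 1 → b ≤ 1 → c ≤ 1 → d ≤ 1 → n ≤ 1 →
          a ℕ.* n ℕ.+ b ℕ.* n ℕ.+ c ℕ.* n ℕ.+ d ℕ.* n ≤
          n ℕ.+ (a ℕ.* b ℕ.+ a ℕ.* c ℕ.+ a ℕ.* d ℕ.+ b ℕ.* c ℕ.+ b ℕ.* d ℕ.+ c ℕ.* d)
        four {a} {b} {c} {d} _ _ _ _ z≤n = ℕₚ.≤-trans (ℕₚ.≤-reflexive (lem a b c d)) z≤n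
          where
          lem : ∀ a b c d → a ℕ.* 0 ℕ.+ b ℕ.* 0 ℕ.+ c ℕ.* 0 ℕ.+ d ℕ.* 0 ≡ 0
          lem = solve-∀
        four z≤n z≤n z≤n z≤n (s≤s z≤n) = ℕₚ.≤ᵇ⇒≤ _ _ _
        four z≤n z≤n z≤n (s≤s z≤n) (s≤s z≤n) = ℕₚ.≤ᵇ⇒≤ _ _ _
        four z≤n z≤n (s≤s z≤n) z≤n (s≤s z≤n) = ℕₚ.≤ᵇ⇒≤ _ _ _
        four z≤n z≤n (s≤s z≤n) (s≤s z≤n) (s≤s z≤n) = ℕₚ.≤ᵇ⇒≤ _ _ _
        four z≤n (s≤s z≤n) z≤n z≤n (s≤s z≤n) = ℕₚ.≤ᵇ⇒≤ _ _ _
        four z≤n (s≤s z≤n) z≤n (s≤s z≤n) (s≤s z≤n) = ℕₚ.≤ᵇ⇒≤ _ _ _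
        four z≤n (s≤s z≤n) (s≤s z≤n) z≤n (s≤s z≤n) = ℕₚ.≤ᵇ⇒≤ _ _ _
        four z≤n (s≤s z≤n) (s≤s z≤n) (s≤s z≤n) (s≤s z≤n) = ℕₚ.≤ᵇ⇒≤ _ _ _
        four (s≤s z≤n) z≤n z≤n z≤n (s≤s z≤n) = ℕₚ.≤ᵇ⇒≤ _ _ _
        four (s≤s z≤n) z≤n z≤n (s≤s z≤n) (s≤s z≤n) = ℕₚ.≤ᵇ⇒≤ _ _ _
        four (s≤s z≤n) z≤n (s≤s z≤n) z≤n (s≤s z≤n) = ℕₚ.≤ᵇ⇒≤ _ _ _
        four (s≤s z≤n) z≤n (s≤s z≤n) (s≤s z≤n) (s≤s z≤n) = ℕₚ.≤ᵇ⇒≤ _ _ _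
        four (s≤s z≤n) (s≤s z≤n) z≤n z≤n (s≤s z≤n) = ℕₚ.≤ᵇ⇒≤ _ _ _
        four (s≤s z≤n) (s≤s z≤n) z≤n (s≤s z≤n) (s≤s z≤n) = ℕₚ.≤ᵇ⇒≤ _ _ _
        four (s≤s z≤n) (s≤s z≤n) (s≤s z≤n) z≤n (s≤s z≤n) = ℕₚ.≤ᵇ⇒≤ _ _ _
        four (s≤s z≤n) (s≤s z≤n) (s≤s z≤n) (s≤s z≤n) (s≤s z≤n) = ℕₚ.≤ᵇ⇒≤ _ _ _

        coz≤1 : ∀ a → coz a ≤ 1
        coz≤1 a = ℕₚ.m∸n≤m 1 (nz a)

        -- The four sections have at least θ q^N vectors each. The points witness that the
        -- hyperplanes are distinct, so the six pairwise intersections have q^N vectors each, and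
        -- `four` contradicts `sparse`.
        no-four : ∀ {x₁ x₂ x₃ x₄} ((l₁ , _) : DenseHyperplane x₁) ((l₂ , _) : DenseHyperplane x₂)
          ((l₃ , _) : DenseHyperplane x₃) ((l₄ , _) : DenseHyperplane x₄) →
          dot l₁ x₂ ≢ 0# → dot l₁ x₃ ≢ 0# → dot l₂ x₃ ≢ 0# → dot l₁ x₄ ≢ 0# → dot l₂ x₄ ≢ 0# → dot l₃ x₄ ≢ 0# → ⊥
        no-four (l₁ , n₁ , e₁ , d₁) (l₂ , n₂ , e₂ , d₂) (l₃ , n₃ , e₃ , d₃) (l₄ , n₄ , e₄ , d₄) h₁₂ h₁₃ h₂₃ h₁₄ h₂₄ h₃₄ =
          ℕₚ.<⇒≱ sparse (begin
            4 ℕ.* (θ ℕ.* R)   ≡⟨ lem₁ (θ ℕ.* R) ⟩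
            θ ℕ.* R ℕ.+ θ ℕ.* R ℕ.+ θ ℕ.* R ℕ.+ θ ℕ.* R   ≤⟨ ℕₚ.+-mono-≤ (ℕₚ.+-mono-≤ (ℕₚ.+-mono-≤ d₁ d₂) d₃) d₄ ⟩
            ΣV (h l₁) ℕ.+ ΣV (h l₂) ℕ.+ ΣV (h l₃) ℕ.+ ΣV (h l₄)
              ≡⟨ trans (ΣV-∙ _ _) (cong (ℕ._+ ΣV (h l₄)) (trans (ΣV-∙ _ _) (cong (ℕ._+ ΣV (h l₃)) (ΣV-∙ _ _)))) ⟨
            ΣV (λ v → h l₁ v ℕ.+ h l₂ v ℕ.+ h l₃ v ℕ.+ h l₄ v)
              ≤⟨ ΣV-mono (λ v → four (coz≤1 (dot l₁ v)) (coz≤1 (dot l₂ v)) (coz≤1 (dot l₃ v)) (coz≤1 (dot l₄ v)) (nz≤1 (c v))) ⟩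
            ΣV (λ v → nz (c v) ℕ.+ (p l₁ l₂ v ℕ.+ p l₁ l₃ v ℕ.+ p l₁ l₄ v ℕ.+ p l₂ l₃ v ℕ.+ p l₂ l₄ v ℕ.+ p l₃ l₄ v))
              ≡⟨ trans (ΣV-∙ _ _) (cong (W ℕ.+_) (trans (ΣV-∙ _ _) (cong₂ ℕ._+_ (trans (ΣV-∙ _ _) (cong₂ ℕ._+_ (trans (ΣV-∙ _ _) (cong₂ ℕ._+_ (trans (ΣV-∙ _ _) (cong₂ ℕ._+_ (trans (ΣV-∙ _ _) (cong₂ ℕ._+_
                   (Σ-two-hyperplanes {l₁ = l₁} n₂ h₁₂ e₂) (Σ-two-hyperplanes {l₁ = l₁} n₃ h₁₃ e₃))) (Σ-two-hyperplanes {l₁ = l₁} n₄ h₁₄ e₄))) (Σ-two-hyperplanes {l₁ = l₂} n₃ h₂₃ e₃))) (Σ-two-hyperplanes {l₁ = l₂} n₄ h₂₄ e₄))) (Σ-two-hyperplanes {l₁ = l₃} n₄ h₃₄ e₄)))) ⟩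
            W ℕ.+ (R ℕ.+ R ℕ.+ R ℕ.+ R ℕ.+ R ℕ.+ R)   ≡⟨ cong (W ℕ.+_) (lem₂ R) ⟩
            W ℕ.+ 6 ℕ.* R   ∎)
          where
          open ℕₚ.≤-Reasoning
          R = q ℕ.^ N
          h : Vec F (suc (suc N)) → Vec F (suc (suc N)) → ℕ
          h l v = coz (dot l v) ℕ.* nz (c v)
          p : Vec F (suc (suc N)) → Vec F (suc (suc N)) → Vec F (suc (suc N)) → ℕ
          p l l′ v = coz (dot l v) ℕ.* coz (dot l′ v)
          lem₁ : ∀ x → 4 ℕ.* x ≡ x ℕ.+ x ℕ.+ x ℕ.+ x
          lem₁ = solve-∀
          lem₂ : ∀ x → x ℕ.+ x ℕ.+ x ℕ.+ x ℕ.+ x ℕ.+ x ≡ 6 ℕ.* x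
          lem₂ = solve-∀

        ≢𝟎 : ∀ {l x : Vec F (suc (suc N))} → dot l x ≢ 0# → x ≢ 𝟎
        ≢𝟎 {l} h e = h (trans (cong (dot l) e) (dot-𝟎ʳ l))

        nonzero? : ∀ (a : F) → Dec (a ≢ 0#)
        nonzero? a = ¬? (a ≟ 0#)

        stable : ∀ {a : F} → ¬ (a ≢ 0#) → a ≡ 0#
        stable {a} h with a ≟ 0#
        ... | yes e = e
        ... | no n = ⊥-elim (h n)

      -- Greedy choice: a support vector outside the hyperplanes found so far lies on a new dense
      -- hyperplane, and it is kept as the witness that this one is distinct from the earlier ones.
      cover : TripleCover L
      cover with findV (λ v → ¬? (v ≟V 𝟎) ×-dec nonzero? (c v))
      ... | inj₂ none = few (cover₁ (1# ∷ 𝟎) (λ e → 1≢0 (cong head e)) (λ v cv≢0 → at v cv≢0))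
        where
        at : ∀ v → c v ≢ 0# → dot (1# ∷ 𝟎) v ≡ 0#
        at v cv≢0 with v ≟V 𝟎
        ... | yes e = trans (cong (dot (1# ∷ 𝟎)) e) (dot-𝟎ʳ {suc (suc N)} (1# ∷ 𝟎))
        ... | no n = ⊥-elim (none v (n , cv≢0))
      ... | inj₁ (x₁ , x₁≢𝟎 , cx₁) with dense-hyperplane x₁ x₁≢𝟎 cx₁
      ...   | H₁@(l₁ , n₁ , e₁ , _) with findV (λ v → nonzero? (c v) ×-dec nonzero? (dot l₁ v))
      ...     | inj₂ none = few (cover₁ l₁ n₁ (λ v cv → stable (λ h → none v (cv , h))))
      ...     | inj₁ (x₂ , cx₂ , h₁₂) with dense-hyperplane x₂ (≢𝟎 {l₁} h₁₂) cx₂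
      ...       | H₂@(l₂ , n₂ , e₂ , _) with findV (λ v → nonzero? (c v) ×-dec nonzero? (dot l₁ v) ×-dec nonzero? (dot l₂ v))
      ...         | inj₂ none = few (cover₂ l₁ l₂ x₂ n₂ h₁₂ e₂ at)
        where
        at : ∀ v → c v ≢ 0# → dot l₁ v ≡ 0# ⊎ dot l₂ v ≡ 0#
        at v cv with dot l₁ v ≟ 0#
        ... | yes e = inj₁ e
        ... | no n = inj₂ (stable (λ h → none v (cv , n , h)))
      ...         | inj₁ (x₃ , cx₃ , h₁₃ , h₂₃) with dense-hyperplane x₃ (≢𝟎 {l₁} h₁₃) cx₃
      ...           | H₃@(l₃ , n₃ , e₃ , _) = triple l₁ l₂ l₃ x₂ x₃ n₂ n₃ h₁₂ e₂ h₁₃ h₂₃ e₃ at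
        where
        at : ∀ v → c v ≢ 0# → dot l₁ v ≡ 0# ⊎ dot l₂ v ≡ 0# ⊎ dot l₃ v ≡ 0#
        at v cv with dot l₁ v ≟ 0# | dot l₂ v ≟ 0#
        ... | yes e | _ = inj₁ e
        ... | no _ | yes e = inj₂ (inj₁ e)
        ... | no h₁₄ | no h₂₄ = inj₂ (inj₂ (stable (λ h₃₄ → no-four H₁ H₂ H₃ (dense-hyperplane v (≢𝟎 {l₁} h₁₄) cv) h₁₂ h₁₃ h₂₃ h₁₄ h₂₄ h₃₄)))

-- Periodicity of words supported on at most three hyperplanes

module Rigidity {q : ℕ} (𝔽 : FinField q) (p h : ℕ) (pr : Prime p) (q≡pʰ : q ≡ p ℕ.^ h) where
  open Covers 𝔽 public

  instance
    p-nonZero : NonZero p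
    p-nonZero = prime⇒nonZero pr

  ⟦^⟧ : ∀ m k → ⟦ m ℕ.^ k ⟧ ≡ ⟦ m ⟧ ^ k
  ⟦^⟧ m zero = +-identityʳ 1#
  ⟦^⟧ m (suc k) = trans (⟦⟧-* m (m ℕ.^ k)) (cong (⟦ m ⟧ *_) (⟦^⟧ m k))

  ⟦p⟧≡0 : ⟦ p ⟧ ≡ 0#
  ⟦p⟧≡0 = root h (trans (sym (⟦^⟧ p h)) (trans (cong ⟦_⟧ (sym q≡pʰ)) ⟦q⟧≡0))
    where
    root : ∀ k → ⟦ p ⟧ ^ k ≡ 0# → ⟦ p ⟧ ≡ 0#
    root zero e = ⊥-elim (1≢0 e)
    root (suc k) e with *-zero-cases e
    ... | inj₁ e′ = e′
    ... | inj₂ e′ = root k e′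

  ⟦%⟧ : ∀ n → ⟦ n ⟧ ≡ ⟦ n % p ⟧
  ⟦%⟧ n = trans (cong ⟦_⟧ (m≡m%n+[m/n]*n n p)) (trans (⟦⟧-+ (n % p) _) (trans (cong (⟦ n % p ⟧ +_)
    (trans (⟦⟧-* (n / p) p) (trans (cong (⟦ n / p ⟧ *_) ⟦p⟧≡0) (zeroʳ _)))) (+-identityʳ _)))

  private
    -- By Bézout some integer combination of `n` and `p` is 1, so their images cannot both be zero.
    ⟦<p⟧≢0 : ∀ n → 0 < n → n < p → ⟦ n ⟧ ≢ 0#
    ⟦<p⟧≢0 n 0<n n<p e = 1≢0 (trans (sym (+-identityʳ 1#)) (one (coprime-Bézout (prime⇒coprime pr {{ℕ.>-nonZero 0<n}} n<p))))
      where
      times0 : ∀ {m} x → ⟦ m ⟧ ≡ 0# → ⟦ x ℕ.* m ⟧ ≡ 0#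
      times0 {m} x h = trans (⟦⟧-* x m) (trans (cong (⟦ x ⟧ *_) h) (zeroʳ _))
      one : Bézout.Identity 1 p n → ⟦ 1 ⟧ ≡ 0#
      one (Bézout.+- x y eq) = trans (sym (+-identityʳ _)) (trans (cong (⟦ 1 ⟧ +_) (sym (times0 y e))) (trans (sym (⟦⟧-+ 1 (y ℕ.* n))) (trans (cong ⟦_⟧ eq) (times0 x ⟦p⟧≡0))))
      one (Bézout.-+ x y eq) = trans (sym (+-identityʳ _)) (trans (cong (⟦ 1 ⟧ +_) (sym (times0 x ⟦p⟧≡0))) (trans (sym (⟦⟧-+ 1 (x ℕ.* p))) (trans (cong ⟦_⟧ eq) (times0 y e))))

    ⟦⟧-less : ∀ {m n} → m < n → n < p → ⟦ m ⟧ ≢ ⟦ n ⟧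
    ⟦⟧-less {m} {n} m<n n<p e = ⟦<p⟧≢0 (n ∸ m) (ℕₚ.m<n⇒0<n∸m m<n) (ℕₚ.≤-<-trans (ℕₚ.m∸n≤m n m) n<p)
      (+-cancelˡ ⟦ m ⟧ (trans (sym (⟦⟧-+ m (n ∸ m))) (trans (cong ⟦_⟧ (ℕₚ.m+[n∸m]≡n (ℕₚ.<⇒≤ m<n))) (trans (sym e) (sym (+-identityʳ _))))))

  ⟦⟧-injective : ∀ {m n} → m < p → n < p → ⟦ m ⟧ ≡ ⟦ n ⟧ → m ≡ n
  ⟦⟧-injective {m} {n} m<p n<p e with ℕₚ.<-cmp m n
  ... | tri< m<n _ _ = ⊥-elim (⟦⟧-less m<n n<p e)
  ... | tri≈ _ m≡n _ = m≡n
  ... | tri> _ _ n<m = ⊥-elim (⟦⟧-less n<m m<p (sym e))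

  ⟦⟧-cong-% : ∀ {m n} → ⟦ m ⟧ ≡ ⟦ n ⟧ → m % p ≡ n % p
  ⟦⟧-cong-% {m} {n} e = ⟦⟧-injective (m%n<n m p) (m%n<n n p) (trans (sym (⟦%⟧ m)) (trans e (⟦%⟧ n)))

  -- The first q = p natural numbers have distinct images, so an element outside would give q + 1
  -- distinct elements of the field.
  prime-field : h ≡ 1 → ∀ r → ∃ λ n → r ≡ ⟦ n ⟧
  prime-field refl r with Finₚ.any? (λ (i : Fin q) → r ≟ ⟦ toℕ i ⟧)
  ... | yes (i , e) = toℕ i , e
  ... | no none = ⊥-elim (clash (Finₚ.pigeonhole (ℕₚ.n<1+n q) f))
    where
    q≡p : q ≡ p
    q≡p = trans q≡pʰ (ℕₚ.*-identityʳ p)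
    f : Fin (suc q) → Fin q
    f zero = r
    f (suc i) = ⟦ toℕ i ⟧
    <p : ∀ (i : Fin q) → toℕ i < p
    <p i = subst (toℕ i <_) q≡p (Finₚ.toℕ<n i)
    clash : (∃ λ i → ∃ λ j → toℕ i < toℕ j × f i ≡ f j) → ⊥
    clash (zero , suc j , _ , e) = none (j , e)
    clash (suc i , suc j , s≤s i<j , e) = ℕₚ.<⇒≢ i<j (⟦⟧-injective (<p i) (<p j) e)

  dot₂ : ∀ {n} (l x : Vec F n) r y → dot l (x ⊕ r · y) ≡ dot l x + r * dot l y
  dot₂ l x r y = trans (dot-⊕ʳ l x (r · y)) (cong (dot l x +_) (dot-·ʳ l r y))

  module _ {N} (L : Combination N) (l₁ l₂ l₃ : Vec F N)
           (on : ∀ v → code L v ≢ 0# → dot l₁ v ≡ 0# ⊎ dot l₂ v ≡ 0# ⊎ dot l₃ v ≡ 0#) where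
    private
      c = code L

    off-zero : ∀ v → dot l₁ v ≢ 0# → dot l₂ v ≢ 0# → dot l₃ v ≢ 0# → c v ≡ 0#
    off-zero v h₁ h₂ h₃ with c v ≟ 0#
    ... | yes e = e
    ... | no n with on v n
    ...   | inj₁ e = ⊥-elim (h₁ e)
    ...   | inj₂ (inj₁ e) = ⊥-elim (h₂ e)
    ...   | inj₂ (inj₂ e) = ⊥-elim (h₃ e)

    -- The value at x depends only on which of the forms vanish there: move along a direction d
    -- leaving at once all the hyperplanes through x and none of the others.
    independent⇒periodic : (∀ x → ∃ λ d → dot l₁ d ≡ δ (dot l₁ x) × dot l₂ d ≡ δ (dot l₂ x) × dot l₃ d ≡ δ (dot l₃ x)) → Periodic c
    independent⇒periodic sel = record { l₁ = l₁ ; l₂ = l₂ ; l₃ = l₃ ; period = period }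
      where
      avoid : ∀ a t → t ≢ 0# → a + t * δ a ≢ 0#
      avoid a t t≢0 e with a ≟ 0#
      ... | yes refl = t≢0 (trans (solve 1 (λ t → t := :0 :+ t :* :1) refl t) e)
      ... | no n = n (trans (solve 2 (λ a t → a := a :+ t :* :0) refl a t) e)
      value : ∀ x d → dot l₁ d ≡ δ (dot l₁ x) → dot l₂ d ≡ δ (dot l₂ x) → dot l₃ d ≡ δ (dot l₃ x) → c x + c d ≡ c 𝟎
      value x d e₁ e₂ e₃ = trans (cong (_+ c d) (sym (trans (∑F-single 0# offline) (cong c (⊕-0· x d))))) (line-sum L x d)
        where
        offline : ∀ t → t ≢ 0# → c (x ⊕ t · d) ≡ 0#
        offline t t≢0 = off-zero _ (at l₁ e₁) (at l₂ e₂) (at l₃ e₃)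
          where
          at : ∀ l → dot l d ≡ δ (dot l x) → dot l (x ⊕ t · d) ≢ 0#
          at l e z = avoid (dot l x) t t≢0 (trans (cong (λ w → dot l x + t * w) (sym e)) (trans (sym (dot₂ l x t d)) z))
      period : ∀ x z → dot l₁ z ≡ 0# → dot l₂ z ≡ 0# → dot l₃ z ≡ 0# → c (x ⊕ z) ≡ c x
      period x z z₁ z₂ z₃ with sel x
      ... | d , e₁ , e₂ , e₃ = +-cancelˡ (c d) (trans (+-comm (c d) _) (trans (trans (value (x ⊕ z) d (same l₁ z₁ e₁) (same l₂ z₂ e₂) (same l₃ z₃ e₃)) (sym (value x d e₁ e₂ e₃))) (+-comm _ (c d))))
        where
        same : ∀ l → dot l z ≡ 0# → dot l d ≡ δ (dot l x) → dot l d ≡ δ (dot l (x ⊕ z))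
        same l z₀ e = trans e (cong δ (sym (trans (dot-⊕ʳ l x z) (trans (cong (dot l x +_) z₀) (+-identityʳ _)))))

    -- Three distinct hyperplanes through a common subspace of codimension two. The pair `e₁`, `e₂`
    -- is dual to `l₁`, `l₂`, and e₁ + θ e₂ lies on none of the three hyperplanes.
    module Pencil (e₁ e₂ : Vec F N) (l₁e₁ : dot l₁ e₁ ≡ 1#) (l₂e₁ : dot l₂ e₁ ≡ 0#) (l₁e₂ : dot l₁ e₂ ≡ 0#) (l₂e₂ : dot l₂ e₂ ≡ 1#)
                  (α β : F) (α≢0 : α ≢ 0#) (β≢0 : β ≢ 0#) (l₃≡ : ∀ v → dot l₃ v ≡ α * dot l₁ v + β * dot l₂ v)
                  (θ : F) (θ≢0 : θ ≢ 0#) (θ-generic : α + β * θ ≢ 0#) where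

      InK : Vec F N → Set
      InK z = dot l₁ z ≡ 0# × dot l₂ z ≡ 0#

      K-⊕ : ∀ {x y} → InK x → InK y → InK (x ⊕ y)
      K-⊕ {x} {y} (a , b) (c , d) = trans (dot-⊕ʳ l₁ x y) (trans (cong₂ _+_ a c) (+-identityˡ 0#)) , trans (dot-⊕ʳ l₂ x y) (trans (cong₂ _+_ b d) (+-identityˡ 0#))

      K-· : ∀ r {x} → InK x → InK (r · x)
      K-· r {x} (a , b) = trans (dot-·ʳ l₁ r x) (trans (cong (r *_) a) (zeroʳ r)) , trans (dot-·ʳ l₂ r x) (trans (cong (r *_) b) (zeroʳ r))

      K-𝟎 : InK 𝟎
      K-𝟎 = dot-𝟎ʳ l₁ , dot-𝟎ʳ l₂

      -- Lies on the third hyperplane and, α and β being nonzero, on neither of the others.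
      P₃ : Vec F N
      P₃ = β · e₁ ⊕ (- α) · e₂

      -- The word on each hyperplane as a function on the common subspace; by homogeneity it
      -- determines the word on that hyperplane off the subspace. The first uses `e₂`, at which `l₁`
      -- vanishes.
      f₁ f₂ f₃ : Vec F N → F
      f₁ z = c (e₂ ⊕ z)
      f₂ z = c (e₁ ⊕ z)
      f₃ z = c (P₃ ⊕ z)

      private
        at-e₁ : ∀ {z} → InK z → dot l₁ (e₁ ⊕ z) ≡ 1# × dot l₂ (e₁ ⊕ z) ≡ 0#
        at-e₁ {z} (a , b) = trans (dot-⊕ʳ l₁ e₁ z) (trans (cong₂ _+_ l₁e₁ a) (+-identityʳ 1#)) , trans (dot-⊕ʳ l₂ e₁ z) (trans (cong₂ _+_ l₂e₁ b) (+-identityʳ 0#))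
        at-e₂ : ∀ {z} → InK z → dot l₁ (e₂ ⊕ z) ≡ 0# × dot l₂ (e₂ ⊕ z) ≡ 1#
        at-e₂ {z} (a , b) = trans (dot-⊕ʳ l₁ e₂ z) (trans (cong₂ _+_ l₁e₂ a) (+-identityʳ 0#)) , trans (dot-⊕ʳ l₂ e₂ z) (trans (cong₂ _+_ l₂e₂ b) (+-identityʳ 1#))

        t₀ : F
        t₀ = - (β ⁻¹ * α)

        0≢t₀ : 0# ≢ t₀
        0≢t₀ e = *-≢0 (⁻¹-≢0 β≢0) α≢0 (trans (sym (-‿involutive _)) (trans (cong -_ (sym e)) -0#≈0#))

      -- The transversal through e₂ ⊕ z₁ and e₁ ⊕ z₂ meets the third hyperplane in one more point.
      collinear : ∀ {z₁ z₂} → InK z₁ → InK z₂ → f₁ z₁ + f₂ z₂ + f₃ (β · z₂ ⊕ (- α) · z₁) ≡ c 𝟎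
      collinear {z₁} {z₂} k₁ k₂ = trans (trans (solve 3 (λ a b d → a :+ b :+ d := b :+ d :+ a) refl _ _ _)
          (cong (_+ f₁ z₁) (sym (trans (∑F-double (λ t → c (A ⊕ t · B)) 0≢t₀ off) (cong₂ _+_ (cong c (⊕-0· A B)) third))))) (line-sum L A B)
        where
        A = e₁ ⊕ z₂
        B = e₂ ⊕ z₁
        lt : ∀ t → dot l₁ (A ⊕ t · B) ≡ 1# × dot l₂ (A ⊕ t · B) ≡ t
        lt t = trans (dot₂ l₁ A t B) (trans (cong₂ (λ u w → u + t * w) (proj₁ (at-e₁ k₂)) (proj₁ (at-e₂ k₁))) (solve 1 (λ t → :1 :+ t :* :0 := :1) refl t)) ,
               trans (dot₂ l₂ A t B) (trans (cong₂ (λ u w → u + t * w) (proj₂ (at-e₁ k₂)) (proj₂ (at-e₂ k₁))) (solve 1 (λ t → :0 :+ t :* :1 := t) refl t))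
        off : ∀ t → t ≢ 0# → t ≢ t₀ → c (A ⊕ t · B) ≡ 0#
        off t t≢0 t≢t₀ = off-zero _ (λ e → 1≢0 (trans (sym (proj₁ (lt t))) e)) (λ e → t≢0 (trans (sym (proj₂ (lt t))) e))
          (λ e → t≢t₀ (*-cancelˡ β≢0 (begin
            β * t                       ≡⟨ solve 3 (λ a b t → b :* t := (a :* :1 :+ b :* t) :- a) refl α β t ⟩
            (α * 1# + β * t) - α        ≡⟨ cong (_- α) (trans (cong₂ (λ u w → α * u + β * w) (sym (proj₁ (lt t))) (sym (proj₂ (lt t)))) (trans (sym (l₃≡ _)) e)) ⟩
            0# - α                      ≡⟨ solve 1 (λ a → :0 :- a := :- (:1 :* a)) refl α ⟩
            - (1# * α)                  ≡⟨ cong (λ w → - (w * α)) (⁻¹-inverseʳ β≢0) ⟨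
            - (β * β ⁻¹ * α)            ≡⟨ solve 3 (λ b i a → :- (b :* i :* a) := b :* :- (i :* a)) refl β (β ⁻¹) α ⟩
            β * t₀                      ∎)))
          where open ≡-Reasoning
        third : c (A ⊕ t₀ · B) ≡ f₃ (β · z₂ ⊕ (- α) · z₁)
        third = trans (sym (code-· L β≢0 _)) (cong c (lem e₁ e₂ z₁ z₂))
          where
          lem : ∀ {n} (e e′ z z′ : Vec F n) → β · ((e ⊕ z′) ⊕ t₀ · (e′ ⊕ z)) ≡ (β · e ⊕ (- α) · e′) ⊕ (β · z′ ⊕ (- α) · z)
          lem [] [] [] [] = refl
          lem (e ∷ es) (f ∷ fs) (z ∷ zs) (w ∷ ws) = cong₂ _∷_ (trans
            (solve 7 (λ b i a e f z w → b :* ((e :+ w) :+ :- (i :* a) :* (f :+ z)) := (b :* e :+ :- (b :* i :* a) :* f) :+ (b :* w :+ :- (b :* i :* a) :* z)) refl β (β ⁻¹) α e f z w)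
            (cong (λ u → (β * e + - u * f) + (β * w + - u * z)) (trans (cong (_* α) (⁻¹-inverseʳ β≢0)) (*-identityˡ α)))) (lem es fs zs ws)

      private
        g₁ g₂ : Vec F N → F
        g₁ v = f₁ ((- (α ⁻¹)) · v)
        g₂ u = f₂ ((β ⁻¹) · u)

        relation : ∀ {u v} → InK u → InK v → g₁ v + g₂ u + f₃ (u ⊕ v) ≡ c 𝟎
        relation {u} {v} ku kv = trans (cong (λ w → g₁ v + g₂ u + f₃ w) (sym (lem u v))) (collinear (K-· _ kv) (K-· _ ku))
          where
          lem : ∀ {n} (u v : Vec F n) → β · (β ⁻¹ · u) ⊕ (- α) · ((- (α ⁻¹)) · v) ≡ u ⊕ v
          lem [] [] = refl
          lem (u ∷ us) (v ∷ vs) = cong₂ _∷_ (trans (solve 6 (λ b i u a j v → b :* (i :* u) :+ :- a :* (:- j :* v) := b :* i :* u :+ a :* j :* v) refl β (β ⁻¹) u α (α ⁻¹) v)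
            (trans (cong₂ (λ x y → x * u + y * v) (⁻¹-inverseʳ β≢0) (⁻¹-inverseʳ α≢0)) (cong₂ _+_ (*-identityˡ u) (*-identityˡ v)))) (lem us vs)

      -- The defect of periodicity, measured inside the third hyperplane.
      D : Vec F N → F
      D z = f₃ z - f₃ 𝟎

      D-𝟎 : D 𝟎 ≡ 0#
      D-𝟎 = -‿inverseʳ _

      -- `relation` is Pexider's form of Cauchy's functional equation. Adding its instances at (u,
      -- v) and (0, 0) and subtracting those at (u, 0) and (0, v) eliminates `g₁` and `g₂`.
      D-+ : ∀ {u v} → InK u → InK v → D (u ⊕ v) ≡ D u + D v
      D-+ {u} {v} ku kv = begin
        f₃ (u ⊕ v) - f₃ 𝟎
          ≡⟨ solve 4 (λ x y z w → x :- w := (y :- w) :+ (z :- w) :+ (x :+ w :- y :- z)) refl (f₃ (u ⊕ v)) (f₃ u) (f₃ v) (f₃ 𝟎) ⟩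
        D u + D v + (f₃ (u ⊕ v) + f₃ 𝟎 - f₃ u - f₃ v)
          ≡⟨ cong (D u + D v +_) cocycle ⟩
        D u + D v + 0#   ≡⟨ +-identityʳ _ ⟩
        D u + D v        ∎
        where
        open ≡-Reasoning
        r₁ = relation ku kv
        r₂ = relation K-𝟎 K-𝟎
        r₃ = relation ku K-𝟎
        r₄ = relation K-𝟎 kv
        cocycle : f₃ (u ⊕ v) + f₃ 𝟎 - f₃ u - f₃ v ≡ 0#
        cocycle = begin
          f₃ (u ⊕ v) + f₃ 𝟎 - f₃ u - f₃ v
            ≡⟨ solve 8 (λ a b a′ b′ x y z w → x :+ w :- y :- z := (a :+ b :+ x) :+ (a′ :+ b′ :+ w) :- (a′ :+ b :+ y) :- (a :+ b′ :+ z)) refl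
                 (g₁ v) (g₂ u) (g₁ 𝟎) (g₂ 𝟎) (f₃ (u ⊕ v)) (f₃ u) (f₃ v) (f₃ 𝟎) ⟩
          (g₁ v + g₂ u + f₃ (u ⊕ v)) + (g₁ 𝟎 + g₂ 𝟎 + f₃ 𝟎) - (g₁ 𝟎 + g₂ u + f₃ u) - (g₁ v + g₂ 𝟎 + f₃ v)
            ≡⟨ cong₂ _-_ (cong₂ _-_ (cong₂ _+_ r₁ (trans (cong (λ w → g₁ 𝟎 + g₂ 𝟎 + f₃ w) (sym (⊕-identityʳ 𝟎))) r₂))
                 (trans (cong (λ w → g₁ 𝟎 + g₂ u + f₃ w) (sym (⊕-identityʳ u))) r₃)) (trans (cong (λ w → g₁ v + g₂ 𝟎 + f₃ w) (sym (⊕-identityˡ v))) r₄) ⟩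
          c 𝟎 + c 𝟎 - c 𝟎 - c 𝟎   ≡⟨ solve 1 (λ a → a :+ a :- a :- a := :0) refl (c 𝟎) ⟩
          0#                      ∎

      -- A vector on exactly one hyperplane is scaled to `e₂`, `e₁` or `P₃` plus a vector of the
      -- common subspace. This rescales `z`, hence the condition on all its multiples. `collinear`
      -- with one argument fixed passes the invariance of `f₃` on to `f₁` and `f₂`.
      period : ∀ z → InK z → (∀ r → D (r · z) ≡ 0#) → ∀ x → c (x ⊕ z) ≡ c x
      period z kz Dz x = go (dot l₁ x ≟ 0#) (dot l₂ x ≟ 0#) (dot l₃ x ≟ 0#)
        where
        a = dot l₁ x
        b = dot l₂ x
        f₃-inv : ∀ r {w} → InK w → f₃ (w ⊕ r · z) ≡ f₃ w
        f₃-inv r {w} kw = x-y≡0⇒x≡y (trans (solve 3 (λ x y o → x :- y := (x :- o) :- (y :- o)) refl _ _ (f₃ 𝟎))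
          (trans (cong (_- D w) (trans (D-+ kw (K-· r kz)) (trans (cong (D w +_) (Dz r)) (+-identityʳ _)))) (-‿inverseʳ _)))
        f₁-inv : ∀ r {w} → InK w → f₁ (w ⊕ r · z) ≡ f₁ w
        f₁-inv r {w} kw = +-cancelˡ (f₂ 𝟎) (trans (+-comm (f₂ 𝟎) _) (trans (x-y≡0⇒x≡y (trans
            (solve 5 (λ u v f h k → u :+ f :- (v :+ f) := (u :+ f :+ h) :- (v :+ f :+ k) :- (h :- k)) refl (f₁ (w ⊕ r · z)) (f₁ w) (f₂ 𝟎) _ _)
            (trans (cong₂ (λ s t → s - t - (f₃ (β · 𝟎 ⊕ (- α) · (w ⊕ r · z)) - f₃ (β · 𝟎 ⊕ (- α) · w))) (collinear (K-⊕ kw (K-· r kz)) K-𝟎) (collinear kw K-𝟎))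
              (trans (cong (λ s → c 𝟎 - c 𝟎 - (s - f₃ (β · 𝟎 ⊕ (- α) · w))) (trans (cong f₃ (lem 𝟎 w z)) (f₃-inv (- α * r) (K-⊕ (K-· β K-𝟎) (K-· (- α) kw)))))
                (solve 2 (λ o s → o :- o :- (s :- s) := :0) refl (c 𝟎) _))))) (+-comm _ (f₂ 𝟎))))
          where
          lem : ∀ {n} (o w z : Vec F n) → β · o ⊕ (- α) · (w ⊕ r · z) ≡ (β · o ⊕ (- α) · w) ⊕ (- α * r) · z
          lem [] [] [] = refl
          lem (o ∷ os) (w ∷ ws) (z ∷ zs) = cong₂ _∷_ (solve 6 (λ b o a w r z → b :* o :+ :- a :* (w :+ r :* z) := (b :* o :+ :- a :* w) :+ (:- a :* r) :* z) refl β o α w r z) (lem os ws zs)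
        f₂-inv : ∀ r {w} → InK w → f₂ (w ⊕ r · z) ≡ f₂ w
        f₂-inv r {w} kw = +-cancelˡ (f₁ 𝟎) (x-y≡0⇒x≡y (trans
            (solve 5 (λ u v f h k → f :+ u :- (f :+ v) := (f :+ u :+ h) :- (f :+ v :+ k) :- (h :- k)) refl (f₂ (w ⊕ r · z)) (f₂ w) (f₁ 𝟎) _ _)
            (trans (cong₂ (λ s t → s - t - (f₃ (β · (w ⊕ r · z) ⊕ (- α) · 𝟎) - f₃ (β · w ⊕ (- α) · 𝟎))) (collinear K-𝟎 (K-⊕ kw (K-· r kz))) (collinear K-𝟎 kw))
              (trans (cong (λ s → c 𝟎 - c 𝟎 - (s - f₃ (β · w ⊕ (- α) · 𝟎))) (trans (cong f₃ (lem 𝟎 w z)) (f₃-inv (β * r) (K-⊕ (K-· β kw) (K-· (- α) K-𝟎)))))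
                (solve 2 (λ o s → o :- o :- (s :- s) := :0) refl (c 𝟎) _)))))
          where
          lem : ∀ {n} (o w z : Vec F n) → β · (w ⊕ r · z) ⊕ (- α) · o ≡ (β · w ⊕ (- α) · o) ⊕ (β * r) · z
          lem [] [] [] = refl
          lem (o ∷ os) (w ∷ ws) (z ∷ zs) = cong₂ _∷_ (solve 6 (λ b o a w r z → b :* (w :+ r :* z) :+ :- a :* o := (b :* w :+ :- a :* o) :+ (b :* r) :* z) refl β o α w r z) (lem os ws zs)
        -- Translate along z inside the hyperplane through s · e.
        shifted : ∀ s e (f : Vec F N → F) → s ≢ 0# → (∀ w → f w ≡ c (e ⊕ w)) → (∀ r {w} → InK w → f (w ⊕ r · z) ≡ f w) →
          InK (s ⁻¹ · x ⊕ (- 1#) · e) → c (x ⊕ z) ≡ c x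
        shifted s e f s≢0 f≡ f-inv kw = begin
          c (x ⊕ z)                ≡⟨ code-· L (⁻¹-≢0 s≢0) (x ⊕ z) ⟨
          c (s ⁻¹ · (x ⊕ z))       ≡⟨ cong c (lem x z e) ⟩
          c (e ⊕ (w ⊕ s ⁻¹ · z))   ≡⟨ f≡ _ ⟨
          f (w ⊕ s ⁻¹ · z)         ≡⟨ f-inv (s ⁻¹) kw ⟩
          f w                      ≡⟨ f≡ w ⟩
          c (e ⊕ w)                ≡⟨ cong c (lem′ x e) ⟨
          c (s ⁻¹ · x)             ≡⟨ code-· L (⁻¹-≢0 s≢0) x ⟩
          c x                      ∎
          where
          open ≡-Reasoning
          w = s ⁻¹ · x ⊕ (- 1#) · e
          lem : ∀ {n} (x z e : Vec F n) → s ⁻¹ · (x ⊕ z) ≡ e ⊕ ((s ⁻¹ · x ⊕ (- 1#) · e) ⊕ s ⁻¹ · z)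
          lem [] [] [] = refl
          lem (x ∷ xs) (z ∷ zs) (e ∷ es) = cong₂ _∷_ (solve 4 (λ i x z e → i :* (x :+ z) := e :+ ((i :* x :+ (:- :1) :* e) :+ i :* z)) refl (s ⁻¹) x z e) (lem xs zs es)
          lem′ : ∀ {n} (x e : Vec F n) → s ⁻¹ · x ≡ e ⊕ (s ⁻¹ · x ⊕ (- 1#) · e)
          lem′ [] [] = refl
          lem′ (x ∷ xs) (e ∷ es) = cong₂ _∷_ (solve 3 (λ i x e → i :* x := e :+ (i :* x :+ (:- :1) :* e)) refl (s ⁻¹) x e) (lem′ xs es)
        dot-w : ∀ l s e → dot l (s ⁻¹ · x ⊕ (- 1#) · e) ≡ s ⁻¹ * dot l x - dot l e
        dot-w l s e = trans (dot₂ l (s ⁻¹ · x) (- 1#) e) (trans (cong (_+ - 1# * dot l e) (dot-·ʳ l (s ⁻¹) x)) (solve 2 (λ u w → u :+ (:- :1) :* w := u :- w) refl _ _))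
        sx : ∀ l → dot l z ≡ 0# → dot l (x ⊕ z) ≡ dot l x
        sx l e = trans (dot-⊕ʳ l x z) (trans (cong (dot l x +_) e) (+-identityʳ _))
        l₃z : dot l₃ z ≡ 0#
        l₃z = trans (l₃≡ z) (trans (cong₂ (λ u w → α * u + β * w) (proj₁ kz) (proj₂ kz)) (solve 2 (λ a b → a :* :0 :+ b :* :0 := :0) refl α β))
        -- The direction e₁ + θ e₂ leaves all three hyperplanes at once, so `y` is the only point of
        -- its line that can lie in the support, and the direction is a zero of the word.
        inK-value : ∀ {y} → InK y → c y ≡ c 𝟎
        inK-value {y} (k₁ , k₂) = trans (sym (+-identityʳ _)) (trans (cong₂ _+_ (sym (trans (∑F-single 0# offline) (cong c (⊕-0· y d)))) (sym d-off)) (line-sum L y d))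
          where
          d = e₁ ⊕ θ · e₂
          d₁ : dot l₁ d ≡ 1#
          d₁ = trans (dot₂ l₁ e₁ θ e₂) (trans (cong₂ (λ u w → u + θ * w) l₁e₁ l₁e₂) (solve 1 (λ t → :1 :+ t :* :0 := :1) refl θ))
          d₂ : dot l₂ d ≡ θ
          d₂ = trans (dot₂ l₂ e₁ θ e₂) (trans (cong₂ (λ u w → u + θ * w) l₂e₁ l₂e₂) (solve 1 (λ t → :0 :+ t :* :1 := t) refl θ))
          d₃ : dot l₃ d ≡ α + β * θ
          d₃ = trans (l₃≡ d) (trans (cong₂ (λ u w → α * u + β * w) d₁ d₂) (cong (_+ β * θ) (*-identityʳ α)))
          d-off : c d ≡ 0#
          d-off = off-zero d (λ e → 1≢0 (trans (sym d₁) e)) (λ e → θ≢0 (trans (sym d₂) e)) (λ e → θ-generic (trans (sym d₃) e))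
          offline : ∀ t → t ≢ 0# → c (y ⊕ t · d) ≡ 0#
          offline t t≢0 = off-zero _ (at l₁ k₁ d₁ 1≢0) (at l₂ k₂ d₂ θ≢0) (at l₃ (trans (l₃≡ y) (trans (cong₂ (λ u w → α * u + β * w) k₁ k₂) (solve 2 (λ a b → a :* :0 :+ b :* :0 := :0) refl α β))) d₃ θ-generic)
            where
            at : ∀ l {s} → dot l y ≡ 0# → dot l d ≡ s → s ≢ 0# → dot l (y ⊕ t · d) ≢ 0#
            at l ly ld s≢0 e = *-≢0 t≢0 s≢0 (trans (trans (cong (t *_) (sym ld)) (trans (sym (+-identityˡ _)) (cong (_+ t * dot l d) (sym ly)))) (trans (sym (dot₂ l y t d)) e))
        go : Dec (a ≡ 0#) → Dec (b ≡ 0#) → Dec (dot l₃ x ≡ 0#) → c (x ⊕ z) ≡ c x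
        go (yes a≡0) (yes b≡0) _ = trans (inK-value (K-⊕ (a≡0 , b≡0) kz)) (sym (inK-value (a≡0 , b≡0)))
        go (yes a≡0) (no b≢0) _ = shifted b e₂ f₁ b≢0 (λ w → refl) f₁-inv
          (trans (dot-w l₁ b e₂) (trans (cong₂ (λ u w → b ⁻¹ * u - w) a≡0 l₁e₂) (solve 1 (λ i → i :* :0 :- :0 := :0) refl (b ⁻¹))) ,
           trans (dot-w l₂ b e₂) (trans (cong₂ _-_ (⁻¹-inverseˡ b≢0) l₂e₂) (-‿inverseʳ 1#)))
        go (no a≢0) (yes b≡0) _ = shifted a e₁ f₂ a≢0 (λ w → refl) f₂-inv
          (trans (dot-w l₁ a e₁) (trans (cong₂ _-_ (⁻¹-inverseˡ a≢0) l₁e₁) (-‿inverseʳ 1#)) ,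
           trans (dot-w l₂ a e₁) (trans (cong₂ (λ u w → a ⁻¹ * u - w) b≡0 l₂e₁) (solve 1 (λ i → i :* :0 :- :0 := :0) refl (a ⁻¹))))
        go (no a≢0) (no b≢0) (no l₃≢0) = trans (off-zero _ (λ e → a≢0 (trans (sym (sx l₁ (proj₁ kz))) e)) (λ e → b≢0 (trans (sym (sx l₂ (proj₂ kz))) e)) (λ e → l₃≢0 (trans (sym (sx l₃ l₃z)) e)))
          (sym (off-zero x a≢0 b≢0 l₃≢0))
        go (no a≢0) (no b≢0) (yes l₃≡0) = shifted s P₃ f₃ s≢0 (λ w → refl) f₃-inv
          (trans (dot-w l₁ s P₃) (trans (cong₂ _-_ i₁ (trans (dotP l₁) (trans (cong₂ (λ u w → β * u + - α * w) l₁e₁ l₁e₂) (solve 2 (λ a b → b :* :1 :+ :- a :* :0 := b) refl α β)))) (-‿inverseʳ β)) ,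
           trans (dot-w l₂ s P₃) (trans (cong₂ _-_ i₂ (trans (dotP l₂) (trans (cong₂ (λ u w → β * u + - α * w) l₂e₁ l₂e₂) (solve 2 (λ a b → b :* :0 :+ :- a :* :1 := :- a) refl α β)))) (-‿inverseʳ (- α))))
          where
          s = a * β ⁻¹
          s≢0 : s ≢ 0#
          s≢0 = *-≢0 a≢0 (⁻¹-≢0 β≢0)
          dotP : ∀ l → dot l P₃ ≡ β * dot l e₁ + - α * dot l e₂
          dotP l = trans (dot₂ l (β · e₁) (- α) e₂) (cong (_+ - α * dot l e₂) (dot-·ʳ l β e₁))
          sβ : s * β ≡ a
          sβ = trans (*-assoc a (β ⁻¹) β) (trans (cong (a *_) (⁻¹-inverseˡ β≢0)) (*-identityʳ a))
          i₁ : s ⁻¹ * a ≡ β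
          i₁ = trans (cong (s ⁻¹ *_) (sym sβ)) (trans (sym (*-assoc _ s β)) (trans (cong (_* β) (⁻¹-inverseˡ s≢0)) (*-identityˡ β)))
          i₂ : s ⁻¹ * b ≡ - α
          i₂ = *-cancelˡ s≢0 (*-cancelˡ β≢0 (begin
            β * (s * (s ⁻¹ * b))   ≡⟨ cong (β *_) (trans (sym (*-assoc s _ b)) (trans (cong (_* b) (⁻¹-inverseʳ s≢0)) (*-identityˡ b))) ⟩
            β * b                  ≡⟨ solve 3 (λ al a b → b := (al :* a :+ b) :- al :* a) refl α a (β * b) ⟩
            α * a + β * b - α * a  ≡⟨ cong (_- α * a) (trans (sym (l₃≡ x)) l₃≡0) ⟩
            0# - α * a             ≡⟨ cong (λ w → 0# - α * w) (sym sβ) ⟩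
            0# - α * (s * β)       ≡⟨ solve 3 (λ al s b → :0 :- al :* (s :* b) := b :* (s :* :- al)) refl α s β ⟩
            β * (s * - α)          ∎))
            where open ≡-Reasoning

      D-⟦⟧ : ∀ n {z} → InK z → D (⟦ n ⟧ · z) ≡ ⟦ n ⟧ * D z
      D-⟦⟧ zero {z} kz = trans (cong D (·-zeroˡ z)) (trans D-𝟎 (sym (zeroˡ _)))
      D-⟦⟧ (suc n) {z} kz = trans (cong D (·-distribʳ 1# ⟦ n ⟧ z)) (trans (D-+ (K-· 1# kz) (K-· ⟦ n ⟧ kz))
        (trans (cong₂ _+_ (trans (cong D (·-identity z)) (sym (*-identityˡ _))) (D-⟦⟧ n kz)) (sym (distribʳ _ _ _))))

      private
        proj : Vec F N → Vec F N
        proj v = v ⊕ (- dot l₁ v) · e₁ ⊕ (- dot l₂ v) · e₂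

        dot₃ : ∀ l v → dot l (proj v) ≡ dot l v + - dot l₁ v * dot l e₁ + - dot l₂ v * dot l e₂
        dot₃ l v = trans (dot₂ l _ (- dot l₂ v) e₂) (cong (_+ - dot l₂ v * dot l e₂) (dot₂ l v (- dot l₁ v) e₁))

        proj-K : ∀ v → InK (proj v)
        proj-K v = trans (dot₃ l₁ v) (trans (cong₂ (λ x y → dot l₁ v + - dot l₁ v * x + - dot l₂ v * y) l₁e₁ l₁e₂) (solve 2 (λ a b → a :+ :- a :* :1 :+ :- b :* :0 := :0) refl _ _)) ,
                   trans (dot₃ l₂ v) (trans (cong₂ (λ x y → dot l₂ v + - dot l₁ v * x + - dot l₂ v * y) l₂e₁ l₂e₂) (solve 2 (λ a b → b :+ :- a :* :0 :+ :- b :* :1 := :0) refl _ _))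

        proj-⊕ : ∀ x y → proj (x ⊕ y) ≡ proj x ⊕ proj y
        proj-⊕ x y = trans (cong₂ (λ s t → (x ⊕ y) ⊕ (- s) · e₁ ⊕ (- t) · e₂) (dot-⊕ʳ l₁ x y) (dot-⊕ʳ l₂ x y)) (lem x y e₁ e₂ _ _ _ _)
          where
          lem : ∀ {n} (x y e f : Vec F n) a b c d → (x ⊕ y) ⊕ (- (a + b)) · e ⊕ (- (c + d)) · f ≡ (x ⊕ (- a) · e ⊕ (- c) · f) ⊕ (y ⊕ (- b) · e ⊕ (- d) · f)
          lem [] [] [] [] a b c d = refl
          lem (x ∷ xs) (y ∷ ys) (e ∷ es) (f ∷ fs) a b c d = cong₂ _∷_ (solve 8 (λ x y e f a b c d → (x :+ y) :+ (:- (a :+ b)) :* e :+ (:- (c :+ d)) :* f := (x :+ (:- a) :* e :+ (:- c) :* f) :+ (y :+ (:- b) :* e :+ (:- d) :* f)) refl x y e f a b c d) (lem xs ys es fs a b c d)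

        proj-· : ∀ r x → proj (r · x) ≡ r · proj x
        proj-· r x = trans (cong₂ (λ s t → r · x ⊕ (- s) · e₁ ⊕ (- t) · e₂) (dot-·ʳ l₁ r x) (dot-·ʳ l₂ r x)) (lem x e₁ e₂ _ _)
          where
          lem : ∀ {n} (x e f : Vec F n) a c → r · x ⊕ (- (r * a)) · e ⊕ (- (r * c)) · f ≡ r · (x ⊕ (- a) · e ⊕ (- c) · f)
          lem [] [] [] a c = refl
          lem (x ∷ xs) (e ∷ es) (f ∷ fs) a c = cong₂ _∷_ (solve 6 (λ r x e f a c → r :* x :+ (:- (r :* a)) :* e :+ (:- (r :* c)) :* f := r :* (x :+ (:- a) :* e :+ (:- c) :* f)) refl r x e f a c) (lem xs es fs a c)

        proj-id : ∀ {z} → InK z → proj z ≡ z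
        proj-id {z} (k₁ , k₂) = trans (cong₂ (λ s t → z ⊕ (- s) · e₁ ⊕ (- t) · e₂) k₁ k₂) (lem z e₁ e₂)
          where
          lem : ∀ {n} (x e f : Vec F n) → x ⊕ (- 0#) · e ⊕ (- 0#) · f ≡ x
          lem [] [] [] = refl
          lem (x ∷ xs) (e ∷ es) (f ∷ fs) = cong₂ _∷_ (solve 3 (λ x e f → x :+ (:- :0) :* e :+ (:- :0) :* f := x) refl x e f) (lem xs es fs)

      -- Every scalar is a sum of ones, so the additive function `D` is linear. Composed with the
      -- projection to the common subspace it becomes the third form.
      prime⇒periodic : (∀ r → ∃ λ n → r ≡ ⟦ n ⟧) → Periodic c
      prime⇒periodic nat = record { l₁ = l₁ ; l₂ = l₂ ; l₃ = rep (λ v → D (proj v))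
        ; period = λ x z z₁ z₂ z₃ → period z (z₁ , z₂) (λ r → begin
            D (r · z)             ≡⟨ D-· r (z₁ , z₂) ⟩
            r * D z               ≡⟨ cong (λ w → r * D w) (proj-id (z₁ , z₂)) ⟨
            r * D (proj z)        ≡⟨ cong (r *_) (trans (sym (dot-rep functional z)) z₃) ⟩
            r * 0#                ≡⟨ zeroʳ r ⟩
            0#                    ∎) x }
        where
        open ≡-Reasoning
        D-· : ∀ r {z} → InK z → D (r · z) ≡ r * D z
        D-· r {z} kz with nat r
        ... | n , refl = D-⟦⟧ n kz
        functional : IsFunctional (λ v → D (proj v))
        functional = record
          { +-homo = λ x y → trans (cong D (proj-⊕ x y)) (D-+ (proj-K x) (proj-K y))
          ; ·-homo = λ r x → trans (cong D (proj-· r x)) (D-· r (proj-K x)) }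

      private
        -- The values of the word lie in the prime field, so a nonzero value of `D` can be scaled to
        -- 1 by a scalar from the prime field. Along the resulting z′ the word satisfies v(t + 1) =
        -- v(t) + 1. Hence it takes each of the `p` values equally often, and has exactly q / p
        -- zeros on this line.
        module Nonzero (values : ∀ v → ∃ λ n → c v ≡ ⟦ n ⟧) {z} (kz : InK z) (Dz≢0 : D z ≢ 0#) where
          Dz-nat : ∃ λ k → D z ≡ ⟦ k ⟧
          Dz-nat with values (P₃ ⊕ z) | values (P₃ ⊕ 𝟎)
          -- The factor p - 1 represents -1 among the natural numbers.
          ... | n , e | m , e′ = n ℕ.+ (p ∸ 1) ℕ.* m , trans (cong₂ _-_ e e′) (sym (begin
              ⟦ n ℕ.+ (p ∸ 1) ℕ.* m ⟧              ≡⟨ trans (⟦⟧-+ n _) (cong (⟦ n ⟧ +_) (⟦⟧-* (p ∸ 1) m)) ⟩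
              ⟦ n ⟧ + ⟦ p ∸ 1 ⟧ * ⟦ m ⟧            ≡⟨ solve 3 (λ n q m → n :+ q :* m := n :+ (:1 :+ q) :* m :- m) refl ⟦ n ⟧ ⟦ p ∸ 1 ⟧ ⟦ m ⟧ ⟩
              ⟦ n ⟧ + ⟦ suc (p ∸ 1) ⟧ * ⟦ m ⟧ - ⟦ m ⟧  ≡⟨ cong (λ w → ⟦ n ⟧ + w * ⟦ m ⟧ - ⟦ m ⟧) (trans (cong ⟦_⟧ (ℕₚ.suc-pred p)) ⟦p⟧≡0) ⟩
              ⟦ n ⟧ + 0# * ⟦ m ⟧ - ⟦ m ⟧           ≡⟨ solve 2 (λ n m → n :+ :0 :* m :- m := n :- m) refl ⟦ n ⟧ ⟦ m ⟧ ⟩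
              ⟦ n ⟧ - ⟦ m ⟧                        ∎))
            where open ≡-Reasoning
          k = proj₁ Dz-nat
          -- The inverse of `⟦ k ⟧` written as its power with exponent q - 2: as the image of a
          -- natural number it commutes with the additive `D`.
          s = k ℕ.^ (q-1 ∸ 1)
          z′ = ⟦ s ⟧ · z
          kz′ : InK z′
          kz′ = K-· ⟦ s ⟧ kz
          Dz′ : D z′ ≡ 1#
          Dz′ = begin
            D z′                       ≡⟨ D-⟦⟧ s kz ⟩
            ⟦ s ⟧ * D z                ≡⟨ cong₂ _*_ (⟦^⟧ k (q-1 ∸ 1)) (proj₂ Dz-nat) ⟩
            ⟦ k ⟧ ^ (q-1 ∸ 1) * ⟦ k ⟧  ≡⟨ *-comm _ _ ⟩
            ⟦ k ⟧ ^ suc (q-1 ∸ 1)      ≡⟨ cong (⟦ k ⟧ ^_) (ℕₚ.m+[n∸m]≡n 0<q-1) ⟩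
            ⟦ k ⟧ ^ q-1                ≡⟨ fermat (λ e → Dz≢0 (trans (proj₂ Dz-nat) e)) ⟩
            1#                         ∎
            where open ≡-Reasoning
          v : F → F
          v t = f₃ (t · z′)
          v-suc : ∀ t → v (t + 1#) ≡ v t + 1#
          v-suc t = x-y≡0⇒x≡y (trans (solve 3 (λ a b o → a :- (b :+ :1) := (a :- o) :- ((b :- o) :+ :1)) refl (v (t + 1#)) (v t) (f₃ 𝟎))
            (trans (cong (_- (D (t · z′) + 1#)) (trans (cong D (·-distribʳ t 1# z′)) (trans (D-+ (K-· t kz′) (K-· 1# kz′)) (cong (D (t · z′) +_) (trans (cong D (·-identity z′)) Dz′))))) (-‿inverseʳ _)))
          count : F → ℕ
          count a = ∑ {q} (λ t → coz (v t - a))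
          count-suc : ∀ a → count (1# + a) ≡ count a
          count-suc a = trans (sym (∑-shift 1# (λ t → coz (v t - (1# + a))))) (∑-cong {q} (λ t → cong coz (trans (cong (_- (1# + a)) (v-suc t)) (solve 2 (λ u a → u :+ :1 :- (:1 :+ a) := u :- a) refl (v t) a))))
          count-⟦⟧ : ∀ m → count ⟦ m ⟧ ≡ count 0#
          count-⟦⟧ zero = refl
          count-⟦⟧ (suc m) = trans (count-suc ⟦ m ⟧) (count-⟦⟧ m)
          one : ∀ t → ∑ {p} (λ m → coz (v t - ⟦ toℕ m ⟧)) ≡ 1
          one t with values (P₃ ⊕ t · z′)
          ... | n , e = trans (ℕSum.∑-single m₀ (λ m m≢ → coz-≢0 (λ d → m≢ (Finₚ.toℕ-injective (trans (⟦⟧-injective (Finₚ.toℕ<n m) (Finₚ.toℕ<n m₀)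
                (trans (sym (x-y≡0⇒x≡y d)) vm₀)) refl))))) (coz-0 (trans (cong (_- ⟦ toℕ m₀ ⟧) vm₀) (-‿inverseʳ _)))
            where
            m₀ = fromℕ< (m%n<n n p)
            vm₀ : v t ≡ ⟦ toℕ m₀ ⟧
            vm₀ = trans e (trans (⟦%⟧ n) (cong ⟦_⟧ (sym (Finₚ.toℕ-fromℕ< (m%n<n n p)))))
          p*count : p ℕ.* count 0# ≡ q
          p*count = trans (sym (∑-const p (count 0#))) (trans (∑-cong {p} (λ m → sym (count-⟦⟧ (toℕ m)))) (trans (∑-comm {p} {q} (λ m t → coz (v t - ⟦ toℕ m ⟧)))
            (trans (∑-cong {q} one) (trans (∑-const q 1) (ℕₚ.*-identityʳ q)))))
          complement : lineWeight L P₃ z′ ℕ.+ count 0# ≡ q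
          complement = trans (sym (∑-∙ {q} _ _)) (trans (∑-cong {q} (λ t → trans (cong (λ w → nz (v t) ℕ.+ coz w) (solve 1 (λ a → a :- :0 := a) refl (v t))) (ℕₚ.m+[n∸m]≡n (nz≤1 (v t)))))
            (trans (∑-const q 1) (ℕₚ.*-identityʳ q)))

      -- Since `D` cannot take a nonzero value, it vanishes and the whole common subspace consists
      -- of periods; `l₂` is listed twice.
      no-half⇒periodic : (∀ v → ∃ λ n → c v ≡ ⟦ n ⟧) → (∀ x d Z → lineWeight L x d ℕ.+ Z ≡ q → p ℕ.* Z ≡ q → ⊥) → Periodic c
      no-half⇒periodic values none = record { l₁ = l₁ ; l₂ = l₂ ; l₃ = l₂ ; period = λ x z z₁ z₂ _ → period z (z₁ , z₂) (λ r → D≡0 (K-· r (z₁ , z₂))) x }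
        where
        D≡0 : ∀ {z} → InK z → D z ≡ 0#
        D≡0 {z} kz with D z ≟ 0#
        ... | yes e = e
        ... | no n = ⊥-elim (none _ _ _ (Nonzero.complement values kz n) (Nonzero.p*count values kz n))

  code-value : ∀ {N} (L : List (ℕ × Vec F N)) x → ∃ λ n → code (castList L) x ≡ ⟦ n ⟧
  code-value [] x = 0 , refl
  code-value ((α , a) ∷ L) x with code-value L x | dot a x ≟ 0#
  ... | n , e | yes _ = α ℕ.+ n , trans (cong₂ _+_ (*-identityʳ _) e) (sym (⟦⟧-+ α n))
  ... | n , e | no _ = n , trans (cong₂ _+_ (zeroʳ _) e) (+-identityˡ _)

  private
    -- At most two elements are excluded: 0 and the root of α + β θ.
    generic : 3 ≤ q → ∀ α β → β ≢ 0# → ∃ λ θ → θ ≢ 0# × α + β * θ ≢ 0#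
    generic 3≤q α β β≢0 with Finₚ.any? (λ θ → ¬? (θ ≟ 0#) ×-dec ¬? (α + β * θ ≟ 0#))
    ... | yes r = r
    ... | no none = ⊥-elim (ℕₚ.<⇒≱ 3≤q (begin
        q                                          ≡⟨ trans (∑-const q 1) (ℕₚ.*-identityʳ q) ⟨
        ∑ {q} (λ _ → 1)                            ≤⟨ ∑-mono {q} pt ⟩
        ∑ {q} (λ θ → coz (0# + θ * 1#) ℕ.+ coz (α + θ * β))  ≡⟨ ∑-∙ {q} _ _ ⟩
        ∑ {q} (λ θ → coz (0# + θ * 1#)) ℕ.+ ∑ {q} (λ θ → coz (α + θ * β)) ≡⟨ cong₂ ℕ._+_ (∑-coz 0# 1≢0) (∑-coz α β≢0) ⟩
        2                                          ∎))
      where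
      open ℕₚ.≤-Reasoning
      pt : ∀ θ → 1 ≤ coz (0# + θ * 1#) ℕ.+ coz (α + θ * β)
      pt θ with θ ≟ 0# | α + β * θ ≟ 0#
      ... | yes e | _ = ℕₚ.≤-trans (ℕₚ.≤-reflexive (sym (coz-0 (trans (solve 1 (λ t → :0 :+ t :* :1 := t) refl θ) e)))) (ℕₚ.m≤m+n _ _)
      ... | no _ | yes e = ℕₚ.≤-trans (ℕₚ.≤-reflexive (sym (coz-0 (trans (cong (α +_) (*-comm θ β)) e)))) (ℕₚ.m≤n+m _ (coz (0# + θ * 1#)))
      ... | no n | no n′ = ⊥-elim (none (θ , n , n′))

    record DualPair {N} (l₁ l₂ : Vec F N) : Set where
      field
        e₁ e₂ : Vec F N
        l₁e₁ : dot l₁ e₁ ≡ 1#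
        l₂e₁ : dot l₂ e₁ ≡ 0#
        l₁e₂ : dot l₁ e₂ ≡ 0#
        l₂e₂ : dot l₂ e₂ ≡ 1#

    dualPair : ∀ {N} {l₁ l₂ x₂ : Vec F N} → l₂ ≢ 𝟎 → dot l₁ x₂ ≢ 0# → dot l₂ x₂ ≡ 0# → DualPair l₁ l₂
    dualPair {l₁ = l₁} {l₂} {x₂} l₂≢𝟎 h₁ h₂ = record
      { e₁ = e₁ ; e₂ = u ⊕ (- dot l₁ u) · e₁ ; l₁e₁ = l₁e₁ ; l₂e₁ = l₂e₁
      ; l₁e₂ = trans (dot₂ l₁ u _ e₁) (trans (cong (λ w → dot l₁ u + - dot l₁ u * w) l₁e₁) (solve 1 (λ a → a :+ :- a :* :1 := :0) refl _))
      ; l₂e₂ = trans (dot₂ l₂ u _ e₁) (trans (cong₂ (λ v w → v + - dot l₁ u * w) (proj₂ (unit-vector l₂≢𝟎)) l₂e₁) (solve 1 (λ a → :1 :+ :- a :* :0 := :1) refl _)) }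
      where
      u = proj₁ (unit-vector l₂≢𝟎)
      e₁ = dot l₁ x₂ ⁻¹ · x₂
      l₁e₁ : dot l₁ e₁ ≡ 1#
      l₁e₁ = trans (dot-·ʳ l₁ _ x₂) (⁻¹-inverseˡ h₁)
      l₂e₁ : dot l₂ e₁ ≡ 0#
      l₂e₁ = trans (dot-·ʳ l₂ _ x₂) (trans (cong (_ *_) h₂) (zeroʳ _))

  cover⇒periodic : ∀ {N} (L : Combination N) → Cover L → Periodic (code L)
  cover⇒periodic L (cover₁ l l≢𝟎 on) = independent⇒periodic L l l l (λ v n → inj₁ (on v n))
    (λ x → let e , le = unit-vector l≢𝟎; d = δ (dot l x) · e; ld = trans (dot-·ʳ l (δ (dot l x)) e) (trans (cong (δ (dot l x) *_) le) (*-identityʳ _)) in d , ld , ld , ld)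
  cover⇒periodic L (cover₂ l₁ l₂ x₂ n₂ h₁₂ e₂₂ on) = independent⇒periodic L l₁ l₂ l₂ on′ sel
    where
    open DualPair (dualPair {l₁ = l₁} {l₂} {x₂} n₂ h₁₂ e₂₂)
    on′ : ∀ v → code L v ≢ 0# → dot l₁ v ≡ 0# ⊎ dot l₂ v ≡ 0# ⊎ dot l₂ v ≡ 0#
    on′ v n with on v n
    ... | inj₁ e = inj₁ e
    ... | inj₂ e = inj₂ (inj₁ e)
    sel : ∀ x → ∃ λ d → dot l₁ d ≡ δ (dot l₁ x) × dot l₂ d ≡ δ (dot l₂ x) × dot l₂ d ≡ δ (dot l₂ x)
    sel x = b₁ · e₁ ⊕ b₂ · e₂ , trans (at l₁) (trans (cong₂ (λ u w → b₁ * u + b₂ * w) l₁e₁ l₁e₂) (solve 2 (λ a b → a :* :1 :+ b :* :0 := a) refl b₁ b₂)) , second , second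
      where
      b₁ = δ (dot l₁ x)
      b₂ = δ (dot l₂ x)
      at : ∀ l → dot l (b₁ · e₁ ⊕ b₂ · e₂) ≡ b₁ * dot l e₁ + b₂ * dot l e₂
      at l = trans (dot₂ l (b₁ · e₁) b₂ e₂) (cong (_+ b₂ * dot l e₂) (dot-·ʳ l b₁ e₁))
      second : dot l₂ (b₁ · e₁ ⊕ b₂ · e₂) ≡ b₂
      second = trans (at l₂) (trans (cong₂ (λ u w → b₁ * u + b₂ * w) l₂e₁ l₂e₂) (solve 2 (λ a b → a :* :0 :+ b :* :1 := b) refl b₁ b₂))

  -- Either `l₃` is independent of `l₁` and `l₂`, and a direction with any prescribed values of the
  -- three forms exists, or the hyperplanes form a pencil. In the second case the witness `x₃`,
  -- which lies on the third hyperplane only, makes both coefficients of `l₃` nonzero.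
  triple⇒periodic : 3 ≤ q → ∀ {N} (L : List (ℕ × Vec F N)) → TripleCover (castList L) →
    h ≡ 1 ⊎ (∀ x d Z → lineWeight (castList L) x d ℕ.+ Z ≡ q → p ℕ.* Z ≡ q → ⊥) → Periodic (code (castList L))
  triple⇒periodic 3≤q L (few cov) _ = cover⇒periodic (castList L) cov
  triple⇒periodic 3≤q L (triple l₁ l₂ l₃ x₂ x₃ n₂ n₃ h₁₂ e₂₂ h₁₃ h₂₃ e₃₃ on) case
    with findV (λ v → ¬? (dot l₃ v ≟ dot l₃ (DualPair.e₁ dp) * dot l₁ v + dot l₃ (DualPair.e₂ dp) * dot l₂ v))
    where dp = dualPair {l₁ = l₁} {l₂} {x₂} n₂ h₁₂ e₂₂
  ... | inj₁ (v , n) = independent⇒periodic (castList L) l₁ l₂ l₃ on sel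
    where
    open DualPair (dualPair {l₁ = l₁} {l₂} {x₂} n₂ h₁₂ e₂₂)
    α = dot l₃ e₁
    β = dot l₃ e₂
    w = v ⊕ (- dot l₁ v) · e₁ ⊕ (- dot l₂ v) · e₂
    lw : ∀ l → dot l w ≡ dot l v + - dot l₁ v * dot l e₁ + - dot l₂ v * dot l e₂
    lw l = trans (dot₂ l _ (- dot l₂ v) e₂) (cong (_+ - dot l₂ v * dot l e₂) (dot₂ l v (- dot l₁ v) e₁))
    l₁w : dot l₁ w ≡ 0#
    l₁w = trans (lw l₁) (trans (cong₂ (λ x y → dot l₁ v + - dot l₁ v * x + - dot l₂ v * y) l₁e₁ l₁e₂) (solve 2 (λ a b → a :+ :- a :* :1 :+ :- b :* :0 := :0) refl _ _))
    l₂w : dot l₂ w ≡ 0#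
    l₂w = trans (lw l₂) (trans (cong₂ (λ x y → dot l₂ v + - dot l₁ v * x + - dot l₂ v * y) l₂e₁ l₂e₂) (solve 2 (λ a b → b :+ :- a :* :0 :+ :- b :* :1 := :0) refl _ _))
    l₃w≢0 : dot l₃ w ≢ 0#
    l₃w≢0 e = n (x-y≡0⇒x≡y (trans (solve 5 (λ u a b x y → u :- (x :* a :+ y :* b) := u :+ :- a :* x :+ :- b :* y) refl (dot l₃ v) (dot l₁ v) (dot l₂ v) α β) (trans (sym (lw l₃)) e)))
    e₃ = dot l₃ w ⁻¹ · w
    l₃e₃ : dot l₃ e₃ ≡ 1#
    l₃e₃ = trans (dot-·ʳ l₃ _ w) (⁻¹-inverseˡ l₃w≢0)
    l₁e₃ : dot l₁ e₃ ≡ 0#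
    l₁e₃ = trans (dot-·ʳ l₁ _ w) (trans (cong (dot l₃ w ⁻¹ *_) l₁w) (zeroʳ _))
    l₂e₃ : dot l₂ e₃ ≡ 0#
    l₂e₃ = trans (dot-·ʳ l₂ _ w) (trans (cong (dot l₃ w ⁻¹ *_) l₂w) (zeroʳ _))
    sel : ∀ x → ∃ λ d → dot l₁ d ≡ δ (dot l₁ x) × dot l₂ d ≡ δ (dot l₂ x) × dot l₃ d ≡ δ (dot l₃ x)
    sel x = d , trans (at l₁) (trans (cong₂ _+_ (cong₂ (λ u w → b₁ * u + b₂ * w) l₁e₁ l₁e₂) (cong (s *_) l₁e₃)) (solve 3 (λ a b s → a :* :1 :+ b :* :0 :+ s :* :0 := a) refl b₁ b₂ s)) ,
        trans (at l₂) (trans (cong₂ _+_ (cong₂ (λ u w → b₁ * u + b₂ * w) l₂e₁ l₂e₂) (cong (s *_) l₂e₃)) (solve 3 (λ a b s → a :* :0 :+ b :* :1 :+ s :* :0 := b) refl b₁ b₂ s)) ,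
        trans (at l₃) (trans (cong (λ z → b₁ * α + b₂ * β + s * z) l₃e₃) (solve 2 (λ t u → t :+ (u :- t) :* :1 := u) refl (b₁ * α + b₂ * β) b₃))
      where
      b₁ = δ (dot l₁ x)
      b₂ = δ (dot l₂ x)
      b₃ = δ (dot l₃ x)
      -- The multiple of `e₃` that corrects the value of `l₃` and leaves the other two forms
      -- unchanged.
      s = b₃ - (b₁ * α + b₂ * β)
      d = b₁ · e₁ ⊕ b₂ · e₂ ⊕ s · e₃
      at : ∀ l → dot l d ≡ b₁ * dot l e₁ + b₂ * dot l e₂ + s * dot l e₃
      at l = trans (dot₂ l _ s e₃) (cong (_+ s * dot l e₃) (trans (dot₂ l (b₁ · e₁) b₂ e₂) (cong (_+ b₂ * dot l e₂) (dot-·ʳ l b₁ e₁))))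
  ... | inj₂ none = finish case
    where
    open DualPair (dualPair {l₁ = l₁} {l₂} {x₂} n₂ h₁₂ e₂₂)
    α = dot l₃ e₁
    β = dot l₃ e₂
    l₃≡ : ∀ v → dot l₃ v ≡ α * dot l₁ v + β * dot l₂ v
    l₃≡ v with dot l₃ v ≟ α * dot l₁ v + β * dot l₂ v
    ... | yes e = e
    ... | no n = ⊥-elim (none v n)
    both-zero : α ≡ 0# → β ≡ 0# → ⊥
    both-zero α≡0 β≡0 = 1≢0 (trans (sym (proj₂ (unit-vector n₃))) (trans (l₃≡ _) (trans (cong₂ (λ a b → a * _ + b * _) α≡0 β≡0) (solve 2 (λ a b → :0 :* a :+ :0 :* b := :0) refl _ _))))
    at-x₃ : α * dot l₁ x₃ + β * dot l₂ x₃ ≡ 0#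
    at-x₃ = trans (sym (l₃≡ x₃)) e₃₃
    α≢0 : α ≢ 0#
    α≢0 α≡0 with *-zero-cases {β} {dot l₂ x₃} (trans (solve 3 (λ b y x → b :* y := :0 :* x :+ b :* y) refl β (dot l₂ x₃) (dot l₁ x₃)) (trans (cong (λ a → a * dot l₁ x₃ + β * dot l₂ x₃) (sym α≡0)) at-x₃))
    ... | inj₁ β≡0 = both-zero α≡0 β≡0
    ... | inj₂ e = h₂₃ e
    β≢0 : β ≢ 0#
    β≢0 β≡0 with *-zero-cases {α} {dot l₁ x₃} (trans (solve 3 (λ b y x → b :* y := b :* y :+ :0 :* x) refl α (dot l₁ x₃) (dot l₂ x₃)) (trans (cong (λ b → α * dot l₁ x₃ + b * dot l₂ x₃) (sym β≡0)) at-x₃))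
    ... | inj₁ α≡0 = both-zero α≡0 β≡0
    ... | inj₂ e = h₁₃ e
    θ = generic 3≤q α β β≢0
    module P = Pencil (castList L) l₁ l₂ l₃ on e₁ e₂ l₁e₁ l₂e₁ l₁e₂ l₂e₂ α β α≢0 β≢0 l₃≡ (proj₁ θ) (proj₁ (proj₂ θ)) (proj₂ (proj₂ θ))
    finish : h ≡ 1 ⊎ (∀ x d Z → lineWeight (castList L) x d ℕ.+ Z ≡ q → p ℕ.* Z ≡ q → ⊥) → Periodic (code (castList L))
    finish (inj₁ h≡1) = P.prime⇒periodic (prime-field h≡1)
    finish (inj₂ none′) = P.no-half⇒periodic (code-value L) none′

-- Weights of polynomials of low degree on affine charts

module SmallWeight {q : ℕ} (𝔽 : FinField q) where
  open Covers 𝔽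

  -- Degree at most m (q - 1) - K, expressed by orthogonality to all products of fewer than K affine functions.
  Van : ∀ {m} → ℕ → (Vec F m → F) → Set
  Van {m} K f = ∀ (A : List (Vec F (suc m))) → length A < K → ΣF (λ t → f t * prod A (1# ∷ t)) ≡ 0#

  private
    lin : ∀ {m} → F → Vec F (suc (suc m))
    lin y = (- y) ∷ 1# ∷ 𝟎

    dot-lin : ∀ {m} y x (t : Vec F m) → dot (lin y) (1# ∷ x ∷ t) ≡ x - y
    dot-lin y x t = trans (cong (λ w → - y * 1# + (1# * x + w)) (dot-𝟎ˡ t)) (solve 2 (λ y x → :- y :* :1 :+ (:1 :* x :+ :0) := x :- y) refl y x)

    lift : ∀ {m} → Vec F (suc m) → Vec F (suc (suc m))
    lift (b ∷ v) = b ∷ 0# ∷ v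

    prod-lift : ∀ {m} (A : List (Vec F (suc m))) x t → prod (map lift A) (1# ∷ x ∷ t) ≡ prod A (1# ∷ t)
    prod-lift [] x t = refl
    prod-lift ((b ∷ v) ∷ A) x t = cong₂ _*_ (cong (b * 1# +_) (trans (cong (_+ dot v t) (zeroˡ x)) (+-identityˡ _))) (prod-lift A x t)

    lag : List F → F → F
    lag [] x = 1#
    lag (y ∷ Y) x = (x - y) * lag Y x

    lag-zero : ∀ {Y y} → y ∈ Y → lag Y y ≡ 0#
    lag-zero {y′ ∷ Y} (here refl) = trans (cong (_* lag Y y′) (-‿inverseʳ y′)) (zeroˡ _)
    lag-zero {y′ ∷ Y} {y} (there y∈) = trans (cong ((y - y′) *_) (lag-zero y∈)) (zeroʳ _)

    lag-≢0 : ∀ {Y a} → All (a ≢_) Y → lag Y a ≢ 0#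
    lag-≢0 [] = 1≢0
    lag-≢0 (n ∷ ns) = *-≢0 (λ e → n (x-y≡0⇒x≡y e)) (lag-≢0 ns)

    prod-lag : ∀ {m} Y x (t : Vec F m) → prod (map lin Y) (1# ∷ x ∷ t) ≡ lag Y x
    prod-lag [] x t = refl
    prod-lag (y ∷ Y) x t = cong₂ _*_ (dot-lin y x t) (prod-lag Y x t)

    sliceList : ∀ {m} → List F → List (Vec F (suc m)) → List (Vec F (suc (suc m)))
    sliceList Y A = map lin Y ++ map lift A

    length-sliceList : ∀ {m} Y (A : List (Vec F (suc m))) → length (sliceList Y A) ≡ length Y ℕ.+ length A
    length-sliceList Y A = trans (Lₚ.length-++ (map lin Y)) (cong₂ ℕ._+_ (Lₚ.length-map lin Y) (Lₚ.length-map lift A))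

    -- If the slices outside Y ∪ {a} vanish, Π (x₀ - y) over y ∈ Y isolates the slice at a.
    slice-zero : ∀ {m} (f : Vec F (suc m) → F) a Y → All (a ≢_) Y → (∀ y → y ≢ a → y ∈ Y ⊎ (∀ t → f (y ∷ t) ≡ 0#)) →
      ∀ A → ΣF (λ s → f s * prod (sliceList Y A) (1# ∷ s)) ≡ 0# → ΣF (λ t → f (a ∷ t) * prod A (1# ∷ t)) ≡ 0#
    slice-zero f a Y a∉Y cov A e = *-cancelˡ (lag-≢0 a∉Y) (trans (sym (trans (ΣF-∷ _) (trans (∑F-single a off) (trans (ΣF-cong (at a)) (ΣF-*ˡ (lag Y a) _))))) (trans e (sym (zeroʳ _))))
      where
      at : ∀ y t → f (y ∷ t) * prod (sliceList Y A) (1# ∷ y ∷ t) ≡ lag Y y * (f (y ∷ t) * prod A (1# ∷ t))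
      at y t = trans (cong (f (y ∷ t) *_) (trans (prod-++ (map lin Y) (map lift A) _) (cong₂ _*_ (prod-lag Y y t) (prod-lift A y t))))
        (solve 3 (λ f l p → f :* (l :* p) := l :* (f :* p)) refl _ _ _)
      off : ∀ y → y ≢ a → ΣF (λ t → f (y ∷ t) * prod (sliceList Y A) (1# ∷ y ∷ t)) ≡ 0#
      off y y≢a with cov y y≢a
      ... | inj₁ y∈ = ΣF-zero (λ t → trans (at y t) (trans (cong (_* (f (y ∷ t) * prod A (1# ∷ t))) (lag-zero y∈)) (zeroˡ _)))
      ... | inj₂ z = ΣF-zero (λ t → trans (cong (_* prod (sliceList Y A) (1# ∷ y ∷ t)) (z t)) (zeroˡ _))

    -- Each slice that has to be cancelled takes one linear factor out of the budget `K`.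
    van-slice : ∀ {m K} {f : Vec F (suc m) → F} → Van K f → ∀ a Y → All (a ≢_) Y → (∀ y → y ≢ a → y ∈ Y ⊎ (∀ t → f (y ∷ t) ≡ 0#)) →
      Van (K ∸ length Y) (λ t → f (a ∷ t))
    van-slice {K = K} {f} van a Y a∉Y cov A h = slice-zero f a Y a∉Y cov A (van (sliceList Y A) (subst (_< K) (sym (length-sliceList Y A)) (lem (length Y) (length A) K h)))
      where
      lem : ∀ y a K → a < K ∸ y → y ℕ.+ a < K
      lem y a K h = subst (y ℕ.+ a <_) (ℕₚ.m+[n∸m]≡n {y} {K} (ℕₚ.<⇒≤ (ℕₚ.m∸n≢0⇒n<m {K} {y} (λ e → ℕₚ.<⇒≱ h (ℕₚ.≤-trans (ℕₚ.≤-reflexive e) z≤n))))) (ℕₚ.+-monoʳ-< y h)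

    rest : F → List F
    rest a = remove a (allFin q)

    -- Negative degree: isolating one point takes q - 1 factors in each coordinate, m (q - 1) in
    -- all.
    van-zero : ∀ m {K} {f : Vec F m → F} → Van K f → m ℕ.* q-1 < K → ∀ x → f x ≡ 0#
    van-zero zero {f = f} van h [] = trans (sym (*-identityʳ _)) (trans (sym (ΣF-[] _)) (van [] h))
    van-zero (suc m) {K} {f} van h (a ∷ x) = van-zero m (van-slice {f = f} van a (rest a) (All.map (λ n e → n (sym e)) (Allₚ.all-filter (λ i → ¬? (i ≟ a)) (allFin q)))
        (λ y y≢a → inj₁ (∈-filter⁺ (λ i → ¬? (i ≟ a)) (∈-allFin y) y≢a)))
        (subst (λ l → m ℕ.* q-1 < K ∸ l) (sym len) (ℕₚ.m+n≤o⇒m≤o∸n (suc (m ℕ.* q-1)) (subst (_≤ K) (cong suc (ℕₚ.+-comm q-1 (m ℕ.* q-1))) h))) x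
      where
      len : length (rest a) ≡ q-1
      len = sym (cong (_∸ 1) (trans (sym (length-allFin q)) (length-remove (allFin q) (Uniqueₚ.allFin⁺ q) (∈-allFin a))))

  module Slices {m} (f : Vec F (suc m) → F) where
    -- A 0/1 flag taken in the field, so that `length-filter-tabulate` counts the slices.
    sliceNonzero : F → F
    sliceNonzero a with anyV? (λ t → ¬? (f (a ∷ t) ≟ 0#))
    ... | yes _ = 1#
    ... | no _ = 0#

    slice≢0 : ∀ {a} → sliceNonzero a ≢ 0# → ∃ λ t → f (a ∷ t) ≢ 0#
    slice≢0 {a} n with anyV? (λ t → ¬? (f (a ∷ t) ≟ 0#))
    ... | yes p = p
    ... | no _ = ⊥-elim (n refl)

    slice≡0 : ∀ {a} → sliceNonzero a ≡ 0# → ∀ t → f (a ∷ t) ≡ 0#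
    slice≡0 {a} e t with anyV? (λ t → ¬? (f (a ∷ t) ≟ 0#))
    ... | yes _ = ⊥-elim (1≢0 e)
    ... | no n with f (a ∷ t) ≟ 0#
    ...   | yes z = z
    ...   | no n′ = ⊥-elim (n (t , n′))

    slices : List F
    slices = filter (λ a → ¬? (sliceNonzero a ≟ 0#)) (allFin q)

    slices-unique : Unique slices
    slices-unique = Uniqueₚ.filter⁺ _ (Uniqueₚ.allFin⁺ q)

    ∈-slices : ∀ {a} → sliceNonzero a ≢ 0# → a ∈ slices
    ∈-slices {a} n = ∈-filter⁺ (λ a → ¬? (sliceNonzero a ≟ 0#)) (∈-allFin a) n

    ∈-slices′ : ∀ {a} t → f (a ∷ t) ≢ 0# → a ∈ slices
    ∈-slices′ {a} t n = ∈-slices (λ e → n (slice≡0 e t))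

    others : F → List F
    others a = remove a slices

    length-others : ∀ {a} → a ∈ slices → length slices ≡ suc (length (others a))
    length-others a∈ = length-remove slices slices-unique a∈

    a∉others : ∀ a → All (a ≢_) (others a)
    a∉others a = All.map (λ n e → n (sym e)) (Allₚ.all-filter (λ i → ¬? (i ≟ a)) slices)

    others-cover : ∀ a y → y ≢ a → y ∈ others a ⊎ (∀ t → f (y ∷ t) ≡ 0#)
    others-cover a y y≢a with sliceNonzero y ≟ 0#
    ... | yes e = inj₂ (slice≡0 e)
    ... | no n = inj₁ (∈-filter⁺ (λ i → ¬? (i ≟ a)) (∈-slices n) y≢a)

    slices≤q : length slices ≤ q
    slices≤q = ℕₚ.≤-trans (Lₚ.length-filter _ (allFin q)) (ℕₚ.≤-reflexive (length-allFin q))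

    slices-weight : ∀ {B} → (∀ a → a ∈ slices → B ≤ q ℕ.* ΣV (λ t → nz (f (a ∷ t)))) → length slices ℕ.* B ≤ q ℕ.* ΣV (λ s → nz (f s))
    slices-weight {B} h = begin
      length slices ℕ.* B                            ≡⟨ cong (ℕ._* B) (length-filter-tabulate (λ i → i) sliceNonzero) ⟩
      ∑ {q} (λ a → nz (sliceNonzero a)) ℕ.* B        ≡⟨ trans (ℕₚ.*-comm _ B) (sym (∑-*ˡ {q} B _)) ⟩
      ∑ {q} (λ a → B ℕ.* nz (sliceNonzero a))        ≤⟨ ∑-mono {q} pt ⟩
      ∑ {q} (λ a → q ℕ.* ΣV (λ t → nz (f (a ∷ t))))  ≡⟨ trans (∑-*ˡ {q} q _) (cong (q ℕ.*_) (sym (ΣV-∷ _))) ⟩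
      q ℕ.* ΣV (λ s → nz (f s))                      ∎
      where
      open ℕₚ.≤-Reasoning
      pt : ∀ a → B ℕ.* nz (sliceNonzero a) ≤ q ℕ.* ΣV (λ t → nz (f (a ∷ t)))
      pt a with sliceNonzero a ≟ 0#
      ... | yes e = ℕₚ.≤-trans (ℕₚ.≤-reflexive (ℕₚ.*-zeroʳ B)) z≤n
      ... | no n = ℕₚ.≤-trans (ℕₚ.≤-reflexive (ℕₚ.*-identityʳ B)) (h a (∈-slices n))

  -- The minimum weight (q - r) q^(m - 1) of a polynomial of degree at most r < q, by slicing along
  -- the first coordinate. With `n` nonzero slices and j = q - n others, a nonzero slice has degree
  -- at most r - j, and n (q - r + j) exceeds (q - r) q by (r - j) j.
  van-weight : ∀ m {K r} {f : Vec F m → F} → Van K f → m ℕ.* q-1 ≤ K ℕ.+ r → ∀ x → f x ≢ 0# →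
    (q ∸ r) ℕ.* q ℕ.^ m ≤ q ℕ.* ΣV (λ t → nz (f t))
  van-weight zero {r = r} {f} van h [] n = ℕₚ.≤-trans (ℕₚ.≤-reflexive (ℕₚ.*-identityʳ (q ∸ r))) (ℕₚ.≤-trans (ℕₚ.m∸n≤m q r)
    (ℕₚ.≤-reflexive (sym (trans (cong (q ℕ.*_) (trans (ΣV-[] _) (nz-1 n))) (ℕₚ.*-identityʳ q)))))
  van-weight (suc m) {K} {r} {f} van h (a₀ ∷ x₀) fx≢0 = ℕₚ.≤-trans convex (slices-weight per-slice)
    where
    open Slices f
    n = length slices
    j = q ∸ n
    n+j : n ℕ.+ j ≡ q
    n+j = ℕₚ.m+[n∸m]≡n slices≤q
    van-a : ∀ a → Van (K ∸ length (others a)) (λ t → f (a ∷ t))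
    van-a a = van-slice {f = f} van a (others a) (a∉others a) (others-cover a)
    q-1≡ : ∀ {a} → a ∈ slices → q-1 ≡ length (others a) ℕ.+ j
    q-1≡ a∈ = ℕₚ.suc-injective (trans (sym q≡1+q-1) (trans (sym n+j) (cong (ℕ._+ j) (length-others a∈))))
    budget : ∀ {a} → a ∈ slices → m ℕ.* q-1 ℕ.+ j ≤ K ∸ length (others a) ℕ.+ r
    budget {a} a∈ = ℕₚ.+-cancelˡ-≤ (length (others a)) _ _ (begin
      y ℕ.+ (m ℕ.* q-1 ℕ.+ j)         ≡⟨ lem y (m ℕ.* q-1) j ⟩
      y ℕ.+ j ℕ.+ m ℕ.* q-1           ≡⟨ cong (ℕ._+ m ℕ.* q-1) (q-1≡ a∈) ⟨
      suc m ℕ.* q-1                   ≤⟨ h ⟩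
      K ℕ.+ r                         ≤⟨ ℕₚ.+-monoˡ-≤ r (ℕₚ.m≤n+m∸n K y) ⟩
      y ℕ.+ (K ∸ y) ℕ.+ r             ≡⟨ ℕₚ.+-assoc y (K ∸ y) r ⟩
      y ℕ.+ (K ∸ y ℕ.+ r)             ∎)
      where
      open ℕₚ.≤-Reasoning
      y = length (others a)
      lem : ∀ y b j → y ℕ.+ (b ℕ.+ j) ≡ y ℕ.+ j ℕ.+ b
      lem = solve-∀
    -- With more than `r` zero slices the others would have negative degree and vanish too.
    j≤r : j ≤ r
    j≤r with j ℕₚ.≤? r
    ... | yes p = p
    ... | no p = ⊥-elim (fx≢0 (van-zero m (van-a a₀) (ℕₚ.+-cancelʳ-< r _ _ (ℕₚ.<-≤-trans (ℕₚ.+-monoʳ-< (m ℕ.* q-1) (ℕₚ.≰⇒> p)) (budget (∈-slices′ x₀ fx≢0)))) x₀))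
    i = r ∸ j
    per-slice : ∀ a → a ∈ slices → (q ∸ i) ℕ.* q ℕ.^ m ≤ q ℕ.* ΣV (λ t → nz (f (a ∷ t)))
    per-slice a a∈ with slice≢0 (proj₂ (∈-filter⁻ (λ a → ¬? (sliceNonzero a ≟ 0#)) {xs = allFin q} a∈))
    ... | t , n = van-weight m {r = i} (van-a a) (ℕₚ.+-cancelʳ-≤ j _ _ (ℕₚ.≤-trans (budget a∈) (ℕₚ.≤-reflexive
            (trans (cong (K ∸ length (others a) ℕ.+_) (sym (ℕₚ.m∸n+n≡m j≤r))) (sym (ℕₚ.+-assoc _ i j)))))) t n
    convex : (q ∸ r) ℕ.* (q ℕ.* q ℕ.^ m) ≤ n ℕ.* ((q ∸ i) ℕ.* q ℕ.^ m)
    convex = ℕₚ.≤-trans (ℕₚ.≤-reflexive (sym (ℕₚ.*-assoc (q ∸ r) q _))) (ℕₚ.≤-trans (ℕₚ.*-monoˡ-≤ (q ℕ.^ m) core) (ℕₚ.≤-reflexive (ℕₚ.*-assoc n (q ∸ i) _)))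
      where
      core : (q ∸ r) ℕ.* q ≤ n ℕ.* (q ∸ i)
      core with i ℕₚ.≤? n
      ... | no p = ℕₚ.≤-trans (ℕₚ.≤-reflexive (cong (ℕ._* q) (ℕₚ.m≤n⇒m∸n≡0 (ℕₚ.≤-trans (ℕₚ.≤-reflexive (sym n+j)) (ℕₚ.≤-trans (ℕₚ.+-monoˡ-≤ j (ℕₚ.<⇒≤ (ℕₚ.≰⇒> p))) (ℕₚ.≤-reflexive (ℕₚ.m∸n+n≡m j≤r))))))) z≤n
      ... | yes p = subst₂ _≤_ (cong₂ ℕ._*_ (sym q∸r) q≡) (sym (cong₂ ℕ._*_ (sym (ℕₚ.m+[n∸m]≡n p)) q∸i)) (ℕₚ.≤-trans (ℕₚ.m≤m+n _ (i ℕ.* j)) (ℕₚ.≤-reflexive (lem i u j)))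
        where
        u = n ∸ i
        q≡ : i ℕ.+ u ℕ.+ j ≡ q
        q≡ = trans (cong (ℕ._+ j) (ℕₚ.m+[n∸m]≡n p)) n+j
        q∸r : q ∸ r ≡ u
        q∸r = trans (cong₂ _∸_ (trans (sym q≡) (lem₀ i u j)) (sym (ℕₚ.m∸n+n≡m j≤r))) (ℕₚ.m+n∸n≡m u (i ℕ.+ j))
          where
          lem₀ : ∀ i u j → i ℕ.+ u ℕ.+ j ≡ u ℕ.+ (i ℕ.+ j)
          lem₀ = solve-∀
        q∸i : q ∸ i ≡ u ℕ.+ j
        q∸i = trans (cong (_∸ i) (trans (sym q≡) (trans (ℕₚ.+-assoc i u j) (ℕₚ.+-comm i _)))) (ℕₚ.m+n∸n≡m (u ℕ.+ j) i)
        lem : ∀ i u j → u ℕ.* (i ℕ.+ u ℕ.+ j) ℕ.+ i ℕ.* j ≡ (i ℕ.+ u) ℕ.* (u ℕ.+ j)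
        lem = solve-∀

  module _ {N} (L : Combination N) where
    private
      c = code L

    -- At infinity of the chart v ⊕ U the code is constant on U, so its restriction to the chart drops in degree.
    flat-weight : ∀ {m} (us : Vec (Vec F N) (suc m)) v → (∀ t → c (comb t us) ≡ c 𝟎) → ∀ x → c (v ⊕ comb x us) ≢ 0# →
      2 ℕ.* q ℕ.^ suc m ≤ q ℕ.* ΣV (λ t → nz (c (v ⊕ comb t us)))
    flat-weight {m} us v flat x n = subst (λ z → z ℕ.* q ℕ.^ suc m ≤ q ℕ.* ΣV (λ t → nz (c (v ⊕ comb t us)))) two
      (van-weight (suc m) {suc (m ℕ.* q-1)} {q-1 ∸ 1} van (ℕₚ.≤-reflexive (trans (ℕₚ.+-comm q-1 (m ℕ.* q-1)) (trans (cong (m ℕ.* q-1 ℕ.+_) (sym (ℕₚ.m+[n∸m]≡n 0<q-1))) (ℕₚ.+-suc (m ℕ.* q-1) (q-1 ∸ 1))))) x n)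
      where
      two : q ∸ (q-1 ∸ 1) ≡ 2
      two = trans (cong (_∸ (q-1 ∸ 1)) (trans q≡1+q-1 (cong suc (sym (ℕₚ.m+[n∸m]≡n 0<q-1))))) (ℕₚ.m+n∸n≡m 2 (q-1 ∸ 1))
      van : Van (suc (m ℕ.* q-1)) (λ t → c (v ⊕ comb t us))
      van A (s≤s h) with ℕₚ.m≤n⇒m<n∨m≡n h
      ... | inj₁ h′ = Σ-code-affine L v us A (subst (length A ℕ.+ q-1 <_) (ℕₚ.+-comm (m ℕ.* q-1) q-1) (ℕₚ.+-monoˡ-< q-1 h′))
      ... | inj₂ e = trans (Σ-code-infinity L v us A e) (trans (ΣF-cong (λ t → cong (_* prod (map tail A) t) (flat t))) (trans (ΣF-*ˡ (c 𝟎) _)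
          (trans (cong (c 𝟎 *_) (trans (ΣF-cong (λ t → sym (prod-0∷ (map tail A) 1# t))) (Σ-prod (suc m) (map (0# ∷_) (map tail A))
            (subst (_< suc m ℕ.* q-1) (sym (trans (Lₚ.length-map _ (map tail A)) (trans (Lₚ.length-map tail A) e))) (ℕₚ.m<n+m (m ℕ.* q-1) 0<q-1))))) (zeroʳ _))))

    -- The chart at `v` is cut into slices by the coordinate along `w`. The condition `inf` says
    -- that at infinity the word lives on the span of `us`, the common direction of the slices.
    module PencilWeight {m} (us : Vec (Vec F N) m) (w v : Vec F N) (inf : ∀ y t → y ≢ 0# → c (comb (y ∷ t) (w ∷ us)) ≡ 0#) where
      f : Vec F (suc m) → F
      f s = c (v ⊕ comb s (w ∷ us))

      open Slices f public

      private
        n = length slices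

      -- Isolating one of n slices takes n - 1 factors and by itself gives a slice of degree at most
      -- n - 1. One more degree is saved: in the borderline case the sum moves to infinity, where
      -- the leading parts of these factors vanish on the span of `us` and the word vanishes
      -- elsewhere. As n ≥ 2 there is such a factor.
      pencil-weight : ∀ {m′} → m ≡ suc m′ → 2 ≤ n → n ℕ.* ((q ℕ.+ 2 ∸ n) ℕ.* q ℕ.^ m) ≤ q ℕ.* ΣV (λ s → nz (f s))
      pencil-weight {m′} refl 2≤n = slices-weight per-slice
        where
        j = q ∸ n
        per-slice : ∀ a → a ∈ slices → (q ℕ.+ 2 ∸ n) ℕ.* q ℕ.^ m ≤ q ℕ.* ΣV (λ t → nz (f (a ∷ t)))
        per-slice a a∈ with slice≢0 (proj₂ (∈-filter⁻ (λ a → ¬? (sliceNonzero a ≟ 0#)) {xs = allFin q} a∈))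
        ... | t , nonzero = subst (λ z → z ℕ.* q ℕ.^ m ≤ q ℕ.* ΣV (λ t → nz (f (a ∷ t)))) r≡ (van-weight m {suc (m′ ℕ.* q-1 ℕ.+ j)} {n ∸ 2} van budget t nonzero)
          where
          y = length (others a)
          n≡ : n ≡ suc y
          n≡ = length-others a∈
          1≤y : 1 ≤ y
          1≤y = ℕₚ.≤-pred (subst (2 ≤_) n≡ 2≤n)
          y+j : y ℕ.+ j ≡ q-1
          y+j = ℕₚ.suc-injective (trans (cong (ℕ._+ j) (sym n≡)) (trans (ℕₚ.m+[n∸m]≡n slices≤q) q≡1+q-1))
          r≡ : q ∸ (n ∸ 2) ≡ q ℕ.+ 2 ∸ n
          r≡ = trans (sym (ℕₚ.[m+n]∸[m+o]≡n∸o 2 q (n ∸ 2))) (cong₂ _∸_ (ℕₚ.+-comm 2 q) (ℕₚ.m+[n∸m]≡n 2≤n))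
          budget : m ℕ.* q-1 ≤ suc (m′ ℕ.* q-1 ℕ.+ j) ℕ.+ (n ∸ 2)
          budget = ℕₚ.≤-reflexive (trans (cong (ℕ._+ m′ ℕ.* q-1) (trans (sym y+j) (cong (ℕ._+ j) (trans (sym (ℕₚ.m+[n∸m]≡n 1≤y)) (cong (λ z → 1 ℕ.+ (z ∸ 2)) (sym n≡)))))) (lem (n ∸ 2) j (m′ ℕ.* q-1)))
            where
            lem : ∀ a j b → 1 ℕ.+ a ℕ.+ j ℕ.+ b ≡ suc (b ℕ.+ j) ℕ.+ a
            lem = solve-∀
          van : Van (suc (m′ ℕ.* q-1 ℕ.+ j)) (λ t → f (a ∷ t))
          van A (s≤s h) = slice-zero f a (others a) (a∉others a) (others-cover a) A total
            where
            B = sliceList (others a) A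
            len : length B ≤ m ℕ.* q-1
            len = subst₂ _≤_ (sym (length-sliceList (others a) A)) (trans (lem y (m′ ℕ.* q-1) j) (cong (ℕ._+ m′ ℕ.* q-1) y+j)) (ℕₚ.+-monoʳ-≤ y h)
              where
              lem : ∀ y b j → y ℕ.+ (b ℕ.+ j) ≡ y ℕ.+ j ℕ.+ b
              lem = solve-∀
            total : ΣF (λ s → f s * prod B (1# ∷ s)) ≡ 0#
            total with ℕₚ.m≤n⇒m<n∨m≡n len
            ... | inj₁ h′ = Σ-code-affine L v (w ∷ us) B (subst (length B ℕ.+ q-1 <_) (ℕₚ.+-comm (m ℕ.* q-1) q-1) (ℕₚ.+-monoˡ-< q-1 h′))
            ... | inj₂ e = trans (Σ-code-infinity L v (w ∷ us) B e) (ΣF-zero term)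
              where
              lead : ∀ Y → 1 ≤ length Y → ∀ t → prod (map tail (sliceList Y A)) (0# ∷ t) ≡ 0#
              lead (y ∷ Y) _ t = trans (cong (_* prod (map tail (sliceList Y A)) (0# ∷ t)) (trans (cong₂ _+_ (zeroʳ 1#) (dot-𝟎ˡ t)) (+-identityˡ 0#))) (zeroˡ _)
              term : ∀ s → c (comb s (w ∷ us)) * prod (map tail B) s ≡ 0#
              term (y ∷ t) with y ≟ 0#
              ... | no y≢0 = trans (cong (_* prod (map tail B) (y ∷ t)) (inf y t y≢0)) (zeroˡ _)
              ... | yes refl = trans (cong (c (comb (0# ∷ t) (w ∷ us)) *_) (lead (others a) 1≤y t)) (zeroʳ _)

-- Words of small weight lie on at most two hyperplanes

module SmallCover {q : ℕ} (𝔽 : FinField q) where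
  open Covers 𝔽
  open SmallWeight 𝔽

  -- `small₀` means fewer than (2 q + 1) q^M points. The threshold in `small` is larger by q^M
  -- vectors; it leaves room for the zero vector and is what the averaging over charts uses.
  module _ {M} (L : Combination (suc (suc (suc M)))) (3≤q : 3 ≤ q)
    (small : weight L ℕ.+ q ℕ.^ suc M < 2 ℕ.* q ℕ.^ suc (suc M))
    (small₀ : code L 𝟎 ≡ 0# → weight L < q-1 ℕ.* ((2 ℕ.* q ℕ.+ 1) ℕ.* q ℕ.^ M)) where
    private
      N : ℕ
      N = suc (suc (suc M))
      c = code L
      W = weight L
      V = Vec F (suc (suc (suc M)))

      Σ-translates : ∀ {k} (us : Vec V k) → ΣV (λ v → ΣV (λ s → nz (c (v ⊕ comb s us)))) ≡ q ℕ.^ k ℕ.* W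
      Σ-translates {k} us = trans (ΣV-comm (λ v s → nz (c (v ⊕ comb s us)))) (trans (ΣV-cong (λ s → ΣV-shift (comb s us) (λ v → nz (c v)))) (ΣV-const k W))

      Σ-span : ∀ {k} (us : Vec V k) → ΣV (spanCount us) ≡ q ℕ.^ k
      Σ-span {k} us = trans (ΣV-cong (λ z → sym (ℕₚ.*-identityʳ _))) (trans (Σ-spanCount us (λ _ → 1)) (trans (ΣV-const k 1) (ℕₚ.*-identityʳ _)))

      0<qᵏ : ∀ k → 0 < q ℕ.^ k
      0<qᵏ k = ℕₚ.m^n>0 q k

      -- Every vector is counted in q^k of the translates. The term with `e` compensates for
      -- translates by vectors of the span itself.
      averaging : ∀ {k} (us : Vec V k) b e → (∀ v → b ≤ ΣV (λ s → nz (c (v ⊕ comb s us))) ℕ.+ e ℕ.* spanCount us v) →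
        q ℕ.^ N ℕ.* b ≤ q ℕ.^ k ℕ.* (W ℕ.+ e)
      averaging {k} us b e pt = begin
        q ℕ.^ N ℕ.* b                               ≡⟨ ΣV-const N b ⟨
        ΣV {m = N} (λ v → b)                        ≤⟨ ΣV-mono pt ⟩
        ΣV (λ v → ΣV (λ s → nz (c (v ⊕ comb s us))) ℕ.+ e ℕ.* spanCount us v)
          ≡⟨ trans (ΣV-∙ _ _) (cong₂ ℕ._+_ (Σ-translates us) (trans (ΣV-*ˡ e _) (cong (e ℕ.*_) (Σ-span us)))) ⟩
        q ℕ.^ k ℕ.* W ℕ.+ e ℕ.* q ℕ.^ k             ≡⟨ lem (q ℕ.^ k) W e ⟩
        q ℕ.^ k ℕ.* (W ℕ.+ e)                       ∎
        where
        open ℕₚ.≤-Reasoning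
        lem : ∀ x W e → x ℕ.* W ℕ.+ e ℕ.* x ≡ x ℕ.* (W ℕ.+ e)
        lem = solve-∀

      module Nonzero (c₀≢0 : c 𝟎 ≢ 0#) where

        -- On the span of `w ∷ us` the word is `c 𝟎` times the incidence function of the span of
        -- `us`: it looks like one hyperplane. This picture is enlarged one dimension at a time.
        record Flag (m : ℕ) : Set where
          field
            us : Vec V m
            w : V
            indep : Indep (w ∷ us)
            flat : ∀ t → c (comb t us) ≡ c 𝟎
            inf : ∀ y t → y ≢ 0# → c (comb (y ∷ t) (w ∷ us)) ≡ 0#

        module Extend {m} (m≤ : m ≤ suc M) (fl : Flag m) where
          open Flag fl
          module PW (v : V) = PencilWeight L us w v inf

          -- For 2 ≤ n ≤ q the number n (q + 2 - n) is at least 2 q, with equality at both ends.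
          -- When `us` is empty a slice is a single vector and the bound is immediate.
          two-slices : ∀ v → 2 ≤ length (PW.slices v) → 2 ℕ.* q ℕ.^ m ≤ ΣV (λ s → nz (PW.f v s))
          two-slices v 2≤n = go m refl
            where
            open PW v
            n = length slices
            S = ΣV (λ s → nz (f s))
            go : ∀ k → m ≡ k → 2 ℕ.* q ℕ.^ m ≤ S
            go zero refl = ℕₚ.≤-trans 2≤n (ℕₚ.*-cancelˡ-≤ q (ℕₚ.≤-trans (ℕₚ.≤-reflexive (ℕₚ.*-comm q n)) (slices-weight per)))
              where
              per : ∀ a → a ∈ slices → q ≤ q ℕ.* ΣV (λ t → nz (f (a ∷ t)))
              per a a∈ with slice≢0 (λ e → absurd e a∈)
                where
                absurd : ∀ {a} → sliceNonzero a ≡ 0# → a ∈ slices → ⊥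
                absurd e a∈ = proj₂ (∈-filter⁻ (λ a → ¬? (sliceNonzero a ≟ 0#)) {xs = allFin q} a∈) e
              ... | t , nonzero = ℕₚ.≤-trans (ℕₚ.≤-reflexive (sym (ℕₚ.*-identityʳ q))) (ℕₚ.*-monoʳ-≤ q (ℕₚ.≤-trans (ℕₚ.≤-reflexive (sym (nz-1 nonzero))) (ΣV-term (λ t → nz (f (a ∷ t))) t)))
            go (suc k) e = ℕₚ.*-cancelˡ-≤ q (ℕₚ.≤-trans bound (pencil-weight e 2≤n))
              where
              a = n ∸ 2
              b = q ∸ n
              n≡ : 2 ℕ.+ a ≡ n
              n≡ = ℕₚ.m+[n∸m]≡n 2≤n
              q≡ : n ℕ.+ b ≡ q
              q≡ = ℕₚ.m+[n∸m]≡n slices≤q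
              bound : q ℕ.* (2 ℕ.* q ℕ.^ m) ≤ n ℕ.* ((q ℕ.+ 2 ∸ n) ℕ.* q ℕ.^ m)
              bound = ℕₚ.≤-trans (ℕₚ.≤-reflexive (lem₁ q (q ℕ.^ m))) (ℕₚ.≤-trans (ℕₚ.*-monoˡ-≤ (q ℕ.^ m) core) (ℕₚ.≤-reflexive (ℕₚ.*-assoc n _ (q ℕ.^ m))))
                where
                lem₁ : ∀ q x → q ℕ.* (2 ℕ.* x) ≡ 2 ℕ.* q ℕ.* x
                lem₁ = solve-∀
                core : 2 ℕ.* q ≤ n ℕ.* (q ℕ.+ 2 ∸ n)
                core = subst₂ _≤_ (cong (2 ℕ.*_) (trans (cong (ℕ._+ b) n≡) q≡)) (sym (cong₂ ℕ._*_ (sym n≡) q+2))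
                    (ℕₚ.≤-trans (ℕₚ.m≤m+n _ (a ℕ.* b)) (ℕₚ.≤-reflexive (lem₂ a b)))
                  where
                  q+2 : q ℕ.+ 2 ∸ n ≡ b ℕ.+ 2
                  q+2 = trans (cong (_∸ n) (trans (cong (ℕ._+ 2) (sym q≡)) (lem₃ n b))) (ℕₚ.m+n∸n≡m (b ℕ.+ 2) n)
                    where
                    lem₃ : ∀ n b → n ℕ.+ b ℕ.+ 2 ≡ b ℕ.+ 2 ℕ.+ n
                    lem₃ = solve-∀
                  lem₂ : ∀ a b → 2 ℕ.* (2 ℕ.+ a ℕ.+ b) ℕ.+ a ℕ.* b ≡ (2 ℕ.+ a) ℕ.* (b ℕ.+ 2)
                  lem₂ = solve-∀

          -- If every chart outside the span had two nonzero slices, averaging would give W + q^m ≥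
          -- 2 q^(M + 2). A chart inside the span is the span itself and has at least the q^m
          -- support vectors on `us`.
          light : ∃ λ v → ¬ InSpan v (w ∷ us) × length (PW.slices v) < 2
          light with findV (λ v → ¬? (inSpan? v (w ∷ us)) ×-dec (length (PW.slices v) ℕₚ.<? 2))
          ... | inj₁ p = p
          ... | inj₂ none = ⊥-elim (ℕₚ.<⇒≱ small (ℕₚ.≤-trans bound (ℕₚ.+-monoʳ-≤ W (ℕₚ.^-monoʳ-≤ q m≤))))
            where
            x = q ℕ.^ m
            pt : ∀ v → 2 ℕ.* x ≤ ΣV (λ s → nz (c (v ⊕ comb s (w ∷ us)))) ℕ.+ x ℕ.* spanCount (w ∷ us) v
            pt v with inSpan? v (w ∷ us)
            ... | no v∉ = ℕₚ.≤-trans (two-slices v (ℕₚ.≮⇒≥ (λ h → none v (v∉ , h)))) (ℕₚ.m≤m+n _ _)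
            ... | yes p@(s₀ , refl) = ℕₚ.≤-trans (ℕₚ.≤-reflexive (lem x)) (ℕₚ.+-mono-≤ self (ℕₚ.*-monoʳ-≤ x (1≤spanCount p)))
              where
              lem : ∀ x → 2 ℕ.* x ≡ x ℕ.+ x ℕ.* 1
              lem = solve-∀
              self : x ≤ ΣV (λ s → nz (c (comb s₀ (w ∷ us) ⊕ comb s (w ∷ us))))
              self = begin
                x                                                     ≡⟨ trans (ΣV-const m 1) (ℕₚ.*-identityʳ x) ⟨
                ΣV {m = m} (λ t → 1)                                  ≡⟨ ΣV-cong (λ t → nz-1 (λ e → c₀≢0 (trans (sym (flat t)) (trans (cong c (sym (trans (cong (_⊕ comb t us) (·-zeroˡ w)) (⊕-identityˡ _)))) e)))) ⟨
                ΣV (λ t → nz (c (comb (0# ∷ t) (w ∷ us))))            ≤⟨ ∑-term (λ y → ΣV (λ t → nz (c (comb (y ∷ t) (w ∷ us))))) 0# ⟩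
                ∑ {q} (λ y → ΣV (λ t → nz (c (comb (y ∷ t) (w ∷ us)))))   ≡⟨ ΣV-∷ _ ⟨
                ΣV (λ s → nz (c (comb s (w ∷ us))))                   ≡⟨ ΣV-shift s₀ (λ s → nz (c (comb s (w ∷ us)))) ⟨
                ΣV (λ s → nz (c (comb (s ⊕ s₀) (w ∷ us))))            ≡⟨ ΣV-cong (λ s → cong (λ z → nz (c z)) (trans (cong (λ z → comb z (w ∷ us)) (⊕-comm s s₀)) (comb-⊕ s₀ s (w ∷ us)))) ⟩
                ΣV (λ s → nz (c (comb s₀ (w ∷ us) ⊕ comb s (w ∷ us))))    ∎
                where open ℕₚ.≤-Reasoning
            bound : 2 ℕ.* q ℕ.^ suc (suc M) ≤ W ℕ.+ x
            bound = ℕₚ.*-cancelˡ-≤ (q ℕ.* x) {{ℕ.>-nonZero (0<qᵏ (suc m))}} (ℕₚ.≤-trans (ℕₚ.≤-reflexive (lem q x (q ℕ.^ suc (suc M)))) (averaging (w ∷ us) (2 ℕ.* x) x pt))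
              where
              lem : ∀ q x y → q ℕ.* x ℕ.* (2 ℕ.* y) ≡ q ℕ.* y ℕ.* (2 ℕ.* x)
              lem = solve-∀

          -- The word vanishes at `w`, so along each line in direction `w` its values add up to c 𝟎
          -- ≠ 0. Hence there is exactly one nonzero slice, the word is constant on it, and v + a w
          -- is the new vector of the flat part.
          extend-by : ∀ v → ¬ InSpan v (w ∷ us) → length (PW.slices v) < 2 → Flag (suc m)
          extend-by v v∉ = build (PW.slices v) refl
            where
            open PW v using (f; slices; sliceNonzero; slice≡0; ∈-slices)
            at : ∀ y t → f (y ∷ t) ≡ c ((v ⊕ comb t us) ⊕ y · w)
            at y t = cong c (lem v (y · w) (comb t us))
              where
              lem : ∀ {n} (a b d : Vec F n) → a ⊕ (b ⊕ d) ≡ (a ⊕ d) ⊕ b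
              lem a b d = trans (cong (a ⊕_) (⊕-comm b d)) (sym (⊕-assoc a d b))
            cw : c w ≡ 0#
            cw = trans (cong c (sym (trans (cong₂ _⊕_ (·-identity w) (comb-𝟎 us)) (⊕-identityʳ w)))) (inf 1# 𝟎 1≢0)
            sum : ∀ t → ∑F {q} (λ y → f (y ∷ t)) ≡ c 𝟎
            sum t = trans (∑F-cong {q} (λ y → at y t)) (trans (sym (+-identityʳ _)) (trans (cong (∑F {q} (λ y → c ((v ⊕ comb t us) ⊕ y · w)) +_) (sym cw)) (line-sum L (v ⊕ comb t us) w)))
            zero-slice : ∀ {y} → ¬ (y ∈ slices) → ∀ t → f (y ∷ t) ≡ 0#
            zero-slice {y} y∉ with sliceNonzero y ≟ 0#
            ... | yes e = slice≡0 e
            ... | no n = ⊥-elim (y∉ (∈-slices n))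
            build : ∀ l → slices ≡ l → length l < 2 → Flag (suc m)
            build [] e _ = ⊥-elim (c₀≢0 (trans (sym (sum 𝟎)) (trans (∑F-cong {q} (λ y → zero-slice (λ y∈ → empty (subst (y ∈_) e y∈)) 𝟎)) (∑F-0 q))))
              where
              empty : ∀ {y : F} → ¬ (y ∈ [])
              empty ()
            build (a ∷ b ∷ l) e (s≤s (s≤s ()))
            build (a ∷ []) e _ = record { us = v′ ∷ us ; w = w ; indep = indep′ ; flat = flat′ ; inf = inf′ }
              where
              v′ = v ⊕ a · w
              off : ∀ {y} → y ≢ a → ∀ t → f (y ∷ t) ≡ 0#
              off {y} y≢a = zero-slice (λ y∈ → single (subst (y ∈_) e y∈))
                where
                single : ¬ (y ∈ a ∷ [])
                single (here y≡a) = y≢a y≡a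
              val : ∀ t → f (a ∷ t) ≡ c 𝟎
              val t = trans (sym (∑F-single a (λ y y≢a → off y≢a t))) (sum t)
              flat′ : ∀ s → c (comb s (v′ ∷ us)) ≡ c 𝟎
              flat′ (r ∷ t) with r ≟ 0#
              ... | yes refl = trans (cong c (trans (cong (_⊕ comb t us) (·-zeroˡ v′)) (⊕-identityˡ _))) (flat t)
              ... | no r≢0 = trans (cong c (lem v w (comb t us))) (trans (code-· L r≢0 _) (trans (cong (λ z → c (v ⊕ (a · w ⊕ z))) (sym (comb-· (r ⁻¹) t us))) (val (r ⁻¹ · t))))
                where
                lem : ∀ {n} (v w u : Vec F n) → r · (v ⊕ a · w) ⊕ u ≡ r · (v ⊕ (a · w ⊕ r ⁻¹ · u))
                lem [] [] [] = refl
                lem (v ∷ vs) (w ∷ ws) (u ∷ us) = cong₂ _∷_ (trans (cong (r * (v + a * w) +_) (sym (*-identityˡ u))) (trans (cong (λ z → r * (v + a * w) + z * u) (sym (⁻¹-inverseʳ r≢0)))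
                  (solve 6 (λ r v a w i u → r :* (v :+ a :* w) :+ r :* i :* u := r :* (v :+ (a :* w :+ i :* u))) refl r v a w (r ⁻¹) u))) (lem vs ws us)
              inf′ : ∀ y s → y ≢ 0# → c (comb (y ∷ s) (w ∷ v′ ∷ us)) ≡ 0#
              inf′ y (r ∷ t) y≢0 with r ≟ 0#
              ... | yes refl = trans (cong (λ z → c (y · w ⊕ z)) (trans (cong (_⊕ comb t us) (·-zeroˡ v′)) (⊕-identityˡ _))) (inf y t y≢0)
              ... | no r≢0 = trans (cong c (lem v w (comb t us))) (trans (code-· L r≢0 _) (trans (cong (λ z → c (v ⊕ ((a + r ⁻¹ * y) · w ⊕ z))) (sym (comb-· (r ⁻¹) t us))) (off ne (r ⁻¹ · t))))
                where
                ne : a + r ⁻¹ * y ≢ a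
                ne e′ = *-≢0 (⁻¹-≢0 r≢0) y≢0 (+-cancelˡ a (trans e′ (sym (+-identityʳ a))))
                lem : ∀ {n} (v w u : Vec F n) → y · w ⊕ (r · (v ⊕ a · w) ⊕ u) ≡ r · (v ⊕ ((a + r ⁻¹ * y) · w ⊕ r ⁻¹ · u))
                lem [] [] [] = refl
                lem (v ∷ vs) (w ∷ ws) (u ∷ us) = cong₂ _∷_ (trans (cong₂ (λ p q → p + (r * (v + a * w) + q)) (sym (*-identityˡ (y * w))) (sym (*-identityˡ u)))
                  (trans (cong (λ z → z * (y * w) + (r * (v + a * w) + z * u)) (sym (⁻¹-inverseʳ r≢0)))
                  (solve 7 (λ r v a w i u y → r :* i :* (y :* w) :+ (r :* (v :+ a :* w) :+ r :* i :* u) := r :* (v :+ ((a :+ i :* y) :* w :+ i :* u))) refl r v a w (r ⁻¹) u y))) (lem vs ws us)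
              indep′ : Indep (w ∷ v′ ∷ us)
              indep′ (y ∷ r ∷ t) e′ = lem₂ (indep-∷ indep v∉ (r ∷ (y + r * a) ∷ t) (trans (lem v w (comb t us)) e′))
                where
                lem : ∀ {n} (v w u : Vec F n) → r · v ⊕ ((y + r * a) · w ⊕ u) ≡ y · w ⊕ (r · (v ⊕ a · w) ⊕ u)
                lem [] [] [] = refl
                lem (v ∷ vs) (w ∷ ws) (u ∷ us) = cong₂ _∷_ (solve 6 (λ r v y a w u → r :* v :+ ((y :+ r :* a) :* w :+ u) := y :* w :+ (r :* (v :+ a :* w) :+ u)) refl r v y a w u) (lem vs ws us)
                lem₂ : r ∷ (y + r * a) ∷ t ≡ 𝟎 → y ∷ r ∷ t ≡ 𝟎
                lem₂ z = cong₂ _∷_ (trans (solve 3 (λ y r a → y := (y :+ r :* a) :- r :* a) refl y r a) (trans (cong₂ (λ p s → p - s * a) (cong (λ l → head (tail l)) z) (cong head z)) (solve 1 (λ a → :0 :- :0 :* a := :0) refl a)))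
                  (cong₂ _∷_ (cong head z) (cong (λ l → tail (tail l)) z))

          extended : Flag (suc m)
          extended = extend-by (proj₁ light) (proj₁ (proj₂ light)) (proj₂ (proj₂ light))

        start : Flag 0
        start with findV (λ v → c v ≟ 0#)
        ... | inj₁ (w , cw) = record { us = [] ; w = w
              ; indep = indep-∷ indep-[] (λ { ([] , e) → c₀≢0 (trans (cong c e) cw) })
              ; flat = λ { [] → refl }
              ; inf = λ { y [] y≢0 → trans (cong c (⊕-identityʳ _)) (trans (code-· L y≢0 w) cw) } }
        ... | inj₂ none = ⊥-elim (ℕₚ.<⇒≱ small (ℕₚ.≤-trans (ℕₚ.*-monoˡ-≤ (q ℕ.^ suc (suc M)) (ℕₚ.≤-trans (s≤s (s≤s z≤n)) 3≤q)) (ℕₚ.≤-trans (ℕₚ.≤-reflexive (sym all)) (ℕₚ.m≤m+n W _))))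
          where
          all : W ≡ q ℕ.^ N
          all = trans (ΣV-cong (λ v → nz-1 (none v))) (trans (ΣV-const N 1) (ℕₚ.*-identityʳ _))

        flag : ∀ m → m ≤ suc (suc M) → Flag m
        flag zero _ = start
        flag (suc m) (s≤s m≤) = Extend.extended m≤ (flag m (ℕₚ.m≤n⇒m≤1+n m≤))

        cover-flag : Flag (suc (suc M)) → Cover L
        cover-flag fl = cover₁ l (proj₁ (proj₂ ann)) on
          where
          open Flag fl
          ann = annihilator us ℕₚ.≤-refl
          l = proj₁ ann
          on : ∀ v → c v ≢ 0# → dot l v ≡ 0#
          on v cv with inSpan? v (w ∷ us)
          ... | no v∉ = ⊥-elim (ℕₚ.<-irrefl refl (indep-bound (indep-∷ indep v∉)))
          ... | yes ((y ∷ t) , e) with y ≟ 0#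
          ...   | no y≢0 = ⊥-elim (cv (trans (cong c (sym e)) (inf y t y≢0)))
          ...   | yes refl = trans (cong (dot l) (trans (sym e) (trans (cong (_⊕ comb t us) (·-zeroˡ w)) (⊕-identityˡ _)))) (dot-annihilator l (proj₂ (proj₂ ann)) t)

        cover-nonzero : Cover L
        cover-nonzero = cover-flag (flag (suc (suc M)) ℕₚ.≤-refl)

      module Zero (c₀≡0 : c 𝟎 ≡ 0#) where

        ZeroSpace : ℕ → V → Set
        ZeroSpace m x = ∃ λ (us : Vec V m) → Indep us × InSpan x us × (∀ t → c (comb t us) ≡ 0#)

        -- If all translates of the zero space outside it met the support, each would carry 2 q^m
        -- nonzero values by `flat-weight`, and averaging would contradict `small`.
        extend : ∀ {m x} → m ≤ M → ZeroSpace (suc m) x → ZeroSpace (suc (suc m)) x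
        extend {m} {x} m≤M (us , ind , (t₀ , t₀≡) , zero-on) with findV (λ v → ¬? (inSpan? v us) ×-dec ¬? (anyV? (λ t → ¬? (c (v ⊕ comb t us) ≟ 0#))))
        ... | inj₁ (v , v∉ , none) = (v ∷ us) , indep-∷ ind v∉ , (0# ∷ t₀ , trans (cong (_⊕ comb t₀ us) (·-zeroˡ v)) (trans (⊕-identityˡ _) t₀≡)) , zero-on′
          where
          vanish : ∀ t → c (v ⊕ comb t us) ≡ 0#
          vanish t with c (v ⊕ comb t us) ≟ 0#
          ... | yes e = e
          ... | no n = ⊥-elim (none (t , n))
          zero-on′ : ∀ s → c (comb s (v ∷ us)) ≡ 0#
          zero-on′ (r ∷ t) with r ≟ 0#
          ... | yes refl = trans (cong c (trans (cong (_⊕ comb t us) (·-zeroˡ v)) (⊕-identityˡ _))) (zero-on t)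
          ... | no r≢0 = trans (sym (code-· L (⁻¹-≢0 r≢0) _)) (trans (cong c (trans (·-distribˡ (r ⁻¹) (r · v) _) (cong₂ _⊕_
                (trans (·-assoc (r ⁻¹) r v) (trans (cong (_· v) (⁻¹-inverseˡ r≢0)) (·-identity v))) (sym (comb-· (r ⁻¹) t us))))) (vanish (r ⁻¹ · t)))
        ... | inj₂ none = ⊥-elim (ℕₚ.<⇒≱ small (ℕₚ.≤-trans bound (ℕₚ.+-monoʳ-≤ W (ℕₚ.≤-trans (ℕₚ.*-mono-≤ (ℕₚ.≤-trans (s≤s (s≤s z≤n)) 3≤q) (ℕₚ.^-monoʳ-≤ q m≤M)) ℕₚ.≤-refl))))
          where
          y = q ℕ.^ m
          pt : ∀ v → 2 ℕ.* y ≤ ΣV (λ t → nz (c (v ⊕ comb t us))) ℕ.+ 2 ℕ.* y ℕ.* spanCount us v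
          pt v with inSpan? v us
          ... | yes p = ℕₚ.≤-trans (ℕₚ.≤-trans (ℕₚ.≤-reflexive (sym (ℕₚ.*-identityʳ (2 ℕ.* y)))) (ℕₚ.*-monoʳ-≤ (2 ℕ.* y) (1≤spanCount p))) (ℕₚ.m≤n+m _ _)
          ... | no v∉ with anyV? (λ t → ¬? (c (v ⊕ comb t us) ≟ 0#))
          ...   | no h = ⊥-elim (none v (v∉ , h))
          ...   | yes (t , n) = ℕₚ.≤-trans (ℕₚ.*-cancelˡ-≤ q (ℕₚ.≤-trans (ℕₚ.≤-reflexive (lem q y)) (flat-weight L us v (λ t → trans (zero-on t) (sym c₀≡0)) t n))) (ℕₚ.m≤m+n _ _)
            where
            lem : ∀ q y → q ℕ.* (2 ℕ.* y) ≡ 2 ℕ.* (q ℕ.* y)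
            lem = solve-∀
          bound : 2 ℕ.* q ℕ.^ suc (suc M) ≤ W ℕ.+ 2 ℕ.* y
          bound = ℕₚ.*-cancelˡ-≤ (q ℕ.* y) {{ℕ.>-nonZero (0<qᵏ (suc m))}} (ℕₚ.≤-trans (ℕₚ.≤-reflexive (lem q y (q ℕ.^ suc (suc M)))) (averaging us (2 ℕ.* y) (2 ℕ.* y) pt))
            where
            lem : ∀ q x y → q ℕ.* x ℕ.* (2 ℕ.* y) ≡ q ℕ.* y ℕ.* (2 ℕ.* x)
            lem = solve-∀

        zeroSpace : ∀ x → x ≢ 𝟎 → c x ≡ 0# → ∀ m → m ≤ suc M → ZeroSpace (suc m) x
        zeroSpace x x≢𝟎 cx zero _ = (x ∷ []) , indep-∷ indep-[] (λ { ([] , e) → x≢𝟎 (sym e) }) , (1# ∷ [] , trans (⊕-identityʳ _) (·-identity x)) , zero-on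
          where
          zero-on : ∀ s → c (comb s (x ∷ [])) ≡ 0#
          zero-on (r ∷ []) with r ≟ 0#
          ... | yes refl = trans (cong c (trans (⊕-identityʳ _) (·-zeroˡ x))) c₀≡0
          ... | no r≢0 = trans (cong c (⊕-identityʳ _)) (trans (code-· L r≢0 x) cx)
        zeroSpace x x≢𝟎 cx (suc m) (s≤s m≤) = extend m≤ (zeroSpace x x≢𝟎 cx m (ℕₚ.m≤n⇒m≤1+n m≤))

        ZeroHyperplane : V → Set
        ZeroHyperplane x = ∃ λ l → l ≢ 𝟎 × dot l x ≡ 0# × (∀ v → dot l v ≡ 0# → c v ≡ 0#)

        annihilate : ∀ {x} → ZeroSpace (suc (suc M)) x → ZeroHyperplane x
        annihilate (us , ind , (t , t≡) , zero-on) with annihilator us ℕₚ.≤-refl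
        ... | l , l≢𝟎 , lus = l , l≢𝟎 , trans (cong (dot l) (sym t≡)) (dot-annihilator l lus t) ,
              λ v lv → let s , e = hyperplane-span ind l≢𝟎 lus v lv in trans (cong c (sym e)) (zero-on s)

        zeroHyperplane : ∀ x → x ≢ 𝟎 → c x ≡ 0# → ZeroHyperplane x
        zeroHyperplane x x≢𝟎 cx = annihilate (zeroSpace x x≢𝟎 cx (suc M) ℕₚ.≤-refl)

        -- The complement of a hyperplane has (q - 1) q^(M + 2) vectors, at least twice q^(M + 2) as
        -- q ≥ 3.
        large : ∀ (l : V) → l ≢ 𝟎 → (∀ v → dot l v ≢ 0# → c v ≢ 0#) → ⊥
        large l l≢𝟎 h = ℕₚ.<⇒≱ small (ℕₚ.≤-trans (ℕₚ.+-cancelʳ-≤ x (2 ℕ.* x) W (ℕₚ.≤-trans (ℕₚ.≤-reflexive (lem x)) (ℕₚ.≤-trans (ℕₚ.*-monoˡ-≤ x 3≤q) total))) (ℕₚ.m≤m+n W _))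
          where
          x = q ℕ.^ suc (suc M)
          lem : ∀ x → 2 ℕ.* x ℕ.+ x ≡ 3 ℕ.* x
          lem = solve-∀
          pt : ∀ v → 1 ≤ nz (c v) ℕ.+ coz (dot l v)
          pt v with dot l v ≟ 0#
          ... | yes _ = ℕₚ.m≤n+m 1 (nz (c v))
          ... | no n = ℕₚ.≤-trans (ℕₚ.≤-reflexive (sym (nz-1 (h v n)))) (ℕₚ.m≤m+n _ _)
          total : q ℕ.^ N ≤ W ℕ.+ x
          total = ℕₚ.≤-trans (ℕₚ.≤-reflexive (sym (trans (ΣV-const N 1) (ℕₚ.*-identityʳ _)))) (ℕₚ.≤-trans (ΣV-mono pt) (ℕₚ.≤-reflexive (trans (ΣV-∙ _ _) (cong (W ℕ.+_) (Σ-hyperplane l≢𝟎)))))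

        first : ∃ λ x → x ≢ 𝟎 × c x ≡ 0#
        first with findV (λ v → ¬? (v ≟V 𝟎) ×-dec (c v ≟ 0#))
        ... | inj₁ p = p
        ... | inj₂ none = ⊥-elim (large (1# ∷ 𝟎) (λ e → 1≢0 (cong head e)) (λ v n cv → none v ((λ e → n (trans (cong (dot (1# ∷ 𝟎)) e) (dot-𝟎ʳ {N} (1# ∷ 𝟎)))) , cv)))

        dots-≡𝟎 : ∀ {k} a (ws : Vec V k) → (∀ t → dot a (comb t ws) ≡ 0#) → dots a ws ≡ 𝟎
        dots-≡𝟎 a [] h = refl
        dots-≡𝟎 a (z ∷ ws) h = cong₂ _∷_ (trans (cong (dot a) (sym (trans (cong₂ _⊕_ (·-identity z) (comb-𝟎 ws)) (⊕-identityʳ z)))) (h (1# ∷ 𝟎)))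
          (dots-≡𝟎 a ws (λ t → trans (cong (dot a) (sym (trans (cong (_⊕ comb t ws) (·-zeroˡ z)) (⊕-identityˡ _)))) (h (0# ∷ t))))

        not-in : ∀ {k} a z (ws : Vec V k) → dots a ws ≡ 𝟎 → dot a z ≡ 1# → ¬ InSpan z ws
        not-in a z ws h az (t , e) = 1≢0 (trans (sym az) (trans (cong (dot a) (sym e)) (dot-annihilator a h t)))

        -- The word vanishes on two hyperplanes, and `us` spans their intersection. In the chart l =
        -- 1 the coordinate along `w` is the value of l′, so the slice at a is the trace of the
        -- hyperplane l′ = a l, which is `slope a`.
        module Second (l l′ v w : V) (us : Vec V (suc M)) (l≢𝟎 : l ≢ 𝟎) (lv : dot l v ≡ 1#) (l′v : dot l′ v ≡ 0#) (lw : dot l w ≡ 0#) (l′w : dot l′ w ≡ 1#)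
                      (lus : dots l us ≡ 𝟎) (l′us : dots l′ us ≡ 𝟎) (ind : Indep us)
                      (l-zero : ∀ v → dot l v ≡ 0# → c v ≡ 0#) (l′-zero : ∀ v → dot l′ v ≡ 0# → c v ≡ 0#) where
          spans : ∀ z → dot l z ≡ 0# → dot l′ z ≡ 0# → InSpan z us
          spans z lz l′z with inSpan? z us
          ... | yes p = p
          ... | no z∉ = ⊥-elim (ℕₚ.<-irrefl refl (indep-bound (indep-∷ (indep-∷ (indep-∷ ind z∉) (not-in l′ w (z ∷ us) (cong₂ _∷_ l′z l′us) l′w)) (not-in l v (w ∷ z ∷ us) (cong₂ _∷_ lw (cong₂ _∷_ lz lus)) lv))))
          ind₃ : Indep (v ∷ w ∷ us)
          ind₃ = indep-∷ (indep-∷ ind (not-in l′ w us l′us l′w)) (not-in l v (w ∷ us) (cong₂ _∷_ lw lus) lv)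
          inf : ∀ y t → y ≢ 0# → c (comb (y ∷ t) (w ∷ us)) ≡ 0#
          inf y t _ = l-zero _ (dot-annihilator l (cong₂ _∷_ lw lus) (y ∷ t))
          open PencilWeight L us w v inf

          0∉slices : ¬ (0# ∈ slices)
          0∉slices h = proj₂ (∈-filter⁻ (λ a → ¬? (sliceNonzero a ≟ 0#)) {xs = allFin q} h) z
            where
            z : sliceNonzero 0# ≡ 0#
            z with sliceNonzero 0# ≟ 0#
            ... | yes e = e
            ... | no n with slice≢0 n
            ...   | t , nonzero = ⊥-elim (nonzero (l′-zero _ (trans (dot-⊕ʳ l′ v _) (trans (cong₂ _+_ l′v (trans (cong (dot l′) (trans (cong (_⊕ comb t us) (·-zeroˡ w)) (⊕-identityˡ _))) (dot-annihilator l′ l′us t))) (+-identityˡ 0#)))))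

          ws : ℕ
          ws = ΣV (λ s → nz (f s))

          total : q-1 ℕ.* ws ≤ W
          total = ℕₚ.+-cancelʳ-≤ ws _ _ (begin
            q-1 ℕ.* ws ℕ.+ ws              ≡⟨ ℕₚ.+-comm _ ws ⟩
            suc q-1 ℕ.* ws                 ≡⟨ cong (ℕ._* ws) q≡1+q-1 ⟨
            q ℕ.* ws                       ≤⟨ ℕₚ.m≤n+m (q ℕ.* ws) _ ⟩
            G 0# ℕ.+ q ℕ.* ws              ≡⟨ ∑-two 0# G refl scaled ⟨
            ∑ {q} G ℕ.+ ws                 ≡⟨ cong (ℕ._+ ws) (ΣV-∷ _) ⟨
            ΣV (λ s → nz (c (comb s (v ∷ w ∷ us)))) ℕ.+ ws
              ≡⟨ cong (ℕ._+ ws) (Σ-spanCount (v ∷ w ∷ us) (λ z → nz (c z))) ⟨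
            ΣV (λ z → spanCount (v ∷ w ∷ us) z ℕ.* nz (c z)) ℕ.+ ws   ≤⟨ ℕₚ.+-monoˡ-≤ ws (ΣV-mono (λ z → ℕₚ.≤-trans (ℕₚ.*-monoˡ-≤ (nz (c z)) (ℕₚ.≤-trans (spanCount≤coz {l = 𝟎} ind₃ (dots-≡𝟎 𝟎 (v ∷ w ∷ us) (λ t → dot-𝟎ˡ (comb t (v ∷ w ∷ us)))) z) (ℕₚ.m∸n≤m 1 (nz (dot 𝟎 z))))) (ℕₚ.≤-reflexive (ℕₚ.*-identityˡ _)))) ⟩
            W ℕ.+ ws                       ∎)
            where
            open ℕₚ.≤-Reasoning
            G : F → ℕ
            G r = ΣV (λ s → nz (c (r · v ⊕ comb s (w ∷ us))))
            scaled : ∀ r → r ≢ 0# → G r ≡ ws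
            scaled r r≢0 = trans (sym (ΣV-scale r≢0 _)) (ΣV-cong (λ s → cong nz (trans (cong c (trans (cong (r · v ⊕_) (comb-· r s (w ∷ us))) (sym (·-distribˡ r v _)))) (code-· L r≢0 _))))

          -- The slice at 0 lies in the zero hyperplane of l′, so the number n of slices is below q.
          -- For 3 ≤ n ≤ q - 1 the factor n (q + 2 - n) is at least 3 (q - 1), hence at least 2 q +
          -- 1, against `small₀`.
          at-most-two : length slices ≤ 2
          at-most-two with length slices ℕₚ.≤? 2
          ... | yes p = p
          ... | no p = ⊥-elim (ℕₚ.<⇒≱ (small₀ c₀≡0) (ℕₚ.≤-trans (ℕₚ.*-monoʳ-≤ q-1 heavy) total))
            where
            n = length slices
            3≤n : 3 ≤ n
            3≤n = ℕₚ.≰⇒> p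
            n<q : n < q
            n<q = ℕₚ.≤∧≢⇒< slices≤q (λ e → 0∉slices (full e))
              where
              full : n ≡ q → 0# ∈ slices
              full e = subst (0# ∈_) (sym (Lₚ.filter-complete (λ a → ¬? (sliceNonzero a ≟ 0#)) {xs = allFin q} (trans e (sym (length-allFin q))))) (∈-allFin 0#)
            a = n ∸ 3
            b = q ∸ suc n
            n≡ : 3 ℕ.+ a ≡ n
            n≡ = ℕₚ.m+[n∸m]≡n 3≤n
            q≡ : suc n ℕ.+ b ≡ q
            q≡ = ℕₚ.m+[n∸m]≡n n<q
            heavy : (2 ℕ.* q ℕ.+ 1) ℕ.* q ℕ.^ M ≤ ws
            heavy = ℕₚ.*-cancelˡ-≤ q (ℕₚ.≤-trans (ℕₚ.≤-trans (ℕₚ.≤-reflexive (lem q (2 ℕ.* q ℕ.+ 1) (q ℕ.^ M))) (ℕₚ.≤-trans (ℕₚ.*-monoˡ-≤ (q ℕ.* q ℕ.^ M) core) (ℕₚ.≤-reflexive (ℕₚ.*-assoc n (q ℕ.+ 2 ∸ n) _)))) (pencil-weight refl (ℕₚ.≤-trans (s≤s (s≤s z≤n)) 3≤n)))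
              where
              lem : ∀ q y x → q ℕ.* (y ℕ.* x) ≡ y ℕ.* (q ℕ.* x)
              lem = solve-∀
              q+2 : q ℕ.+ 2 ∸ n ≡ b ℕ.+ 3
              q+2 = trans (cong (_∸ n) (trans (cong (ℕ._+ 2) (sym q≡)) (lem₃ n b))) (ℕₚ.m+n∸n≡m (b ℕ.+ 3) n)
                where
                lem₃ : ∀ n b → suc n ℕ.+ b ℕ.+ 2 ≡ b ℕ.+ 3 ℕ.+ n
                lem₃ = solve-∀
              core : 2 ℕ.* q ℕ.+ 1 ≤ n ℕ.* (q ℕ.+ 2 ∸ n)
              core = subst₂ _≤_ (cong (λ z → 2 ℕ.* z ℕ.+ 1) (trans (cong (λ z → suc z ℕ.+ b) n≡) q≡)) (sym (cong₂ ℕ._*_ (sym n≡) q+2))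
                (ℕₚ.≤-trans (ℕₚ.m≤m+n _ (a ℕ.+ b ℕ.+ a ℕ.* b)) (ℕₚ.≤-reflexive (lem₂ a b)))
                where
                lem₂ : ∀ a b → 2 ℕ.* (suc (3 ℕ.+ a) ℕ.+ b) ℕ.+ 1 ℕ.+ (a ℕ.+ b ℕ.+ a ℕ.* b) ≡ (3 ℕ.+ a) ℕ.* (b ℕ.+ 3)
                lem₂ = solve-∀

          locate : ∀ z → c z ≢ 0# → ∃ λ y → y ∈ slices × dot l′ z ≡ y * dot l z
          locate z cz = y , ∈-slices′ (proj₁ sp) (λ e → cz (trans (sym (code-· L (⁻¹-≢0 r≢0) z)) (trans (cong c (trans (lem (r ⁻¹ · z) v (y · w)) (cong (λ s → v ⊕ (y · w ⊕ s)) (sym (proj₂ sp))))) e))) ,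
              trans (sym (*-identityˡ _)) (trans (cong (_* dot l′ z) (sym (⁻¹-inverseʳ r≢0))) (solve 3 (λ r i a → r :* i :* a := i :* a :* r) refl r (r ⁻¹) (dot l′ z)))
            where
            r = dot l z
            r≢0 : r ≢ 0#
            r≢0 e = cz (l-zero z e)
            y = r ⁻¹ * dot l′ z
            k = (r ⁻¹ · z ⊕ (- 1#) · v) ⊕ (- 1#) · (y · w)
            dot-k : ∀ a → dot a k ≡ r ⁻¹ * dot a z + - 1# * dot a v + - 1# * (y * dot a w)
            dot-k a = trans (dot-⊕ʳ a _ _) (cong₂ _+_ (trans (dot-⊕ʳ a _ _) (cong₂ _+_ (dot-·ʳ a _ z) (dot-·ʳ a _ v))) (trans (dot-·ʳ a _ (y · w)) (cong (- 1# *_) (dot-·ʳ a y w))))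
            sp : InSpan k us
            sp = spans k (trans (dot-k l) (trans (cong₂ _+_ (cong₂ (λ s t → s + - 1# * t) (⁻¹-inverseˡ r≢0) lv) (cong (λ t → - 1# * (y * t)) lw)) (solve 1 (λ y → :1 :+ (:- :1) :* :1 :+ (:- :1) :* (y :* :0) := :0) refl y)))
              (trans (dot-k l′) (trans (cong₂ _+_ (cong (λ t → y + - 1# * t) l′v) (cong (λ t → - 1# * (y * t)) l′w)) (solve 1 (λ y → y :+ (:- :1) :* :0 :+ (:- :1) :* (y :* :1) := :0) refl y)))
            lem : ∀ {n} (s v t : Vec F n) → s ≡ v ⊕ (t ⊕ ((s ⊕ (- 1#) · v) ⊕ (- 1#) · t))
            lem [] [] [] = refl
            lem (s ∷ ss) (v ∷ vs) (t ∷ ts) = cong₂ _∷_ (solve 3 (λ s v t → s := v :+ (t :+ ((s :+ (:- :1) :* v) :+ (:- :1) :* t))) refl s v t) (lem ss vs ts)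

          slope : F → V
          slope a = l′ ⊕ (- a) · l

          dot-slope : ∀ a z → dot (slope a) z ≡ dot l′ z - a * dot l z
          dot-slope a z = trans (dot-⊕ˡ l′ _ z) (cong (dot l′ z +_) (trans (dot-·ˡ (- a) l z) (sym (-‿distribˡ-* a _))))

          slope-≢𝟎 : ∀ a → slope a ≢ 𝟎
          slope-≢𝟎 a e = 1≢0 (trans (trans (solve 1 (λ a → :1 := :1 :- a :* :0) refl a) (cong₂ (λ s t → s - a * t) (sym l′w) (sym lw))) (trans (sym (dot-slope a w)) (trans (cong (λ s → dot s w) e) (dot-𝟎ˡ w))))

          slope-zero : ∀ {y} z → dot l′ z ≡ y * dot l z → dot (slope y) z ≡ 0#
          slope-zero {y} z e = trans (dot-slope y z) (trans (cong (_- y * dot l z) e) (-‿inverseʳ _))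

          cover-two : Cover L
          cover-two = build slices slices-unique at-most-two (λ z cz → locate z cz)
            where
            build : ∀ ys → Unique ys → length ys ≤ 2 → (∀ z → c z ≢ 0# → ∃ λ y → y ∈ ys × dot l′ z ≡ y * dot l z) → Cover L
            build [] _ _ loc = cover₁ l l≢𝟎 (λ z cz → none (proj₁ (proj₂ (loc z cz))))
              where
              none : ∀ {y z} → y ∈ [] → dot l z ≡ 0#
              none ()
            build (a ∷ []) _ _ loc = cover₁ (slope a) (slope-≢𝟎 a) on
              where
              on : ∀ z → c z ≢ 0# → dot (slope a) z ≡ 0#
              on z cz with loc z cz
              ... | y , here refl , e = slope-zero z e
            build (a ∷ b ∷ []) ((a≢b ∷ []) ∷ _) _ loc = cover₂ (slope a) (slope b) x₂ (slope-≢𝟎 b)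
                (λ e → a≢b (sym (x-y≡0⇒x≡y (trans (sym (at a)) e)))) (trans (at b) (-‿inverseʳ b)) on
              where
              x₂ = v ⊕ b · w
              at : ∀ d → dot (slope d) x₂ ≡ b - d
              at d = trans (dot-slope d x₂) (trans (cong₂ (λ s t → s - d * t)
                (trans (dot-⊕ʳ l′ v _) (trans (cong₂ _+_ l′v (trans (dot-·ʳ l′ b w) (cong (b *_) l′w))) (solve 1 (λ b → :0 :+ b :* :1 := b) refl b)))
                (trans (dot-⊕ʳ l v _) (trans (cong₂ _+_ lv (trans (dot-·ʳ l b w) (cong (b *_) lw))) (solve 1 (λ b → :1 :+ b :* :0 := :1) refl b)))) (cong (λ s → b - s) (*-identityʳ d)))
              on : ∀ z → c z ≢ 0# → dot (slope a) z ≡ 0# ⊎ dot (slope b) z ≡ 0#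
              on z cz with loc z cz
              ... | y , here refl , e = inj₁ (slope-zero z e)
              ... | y , there (here refl) , e = inj₂ (slope-zero z e)
            build (a ∷ b ∷ d ∷ ys) _ (s≤s (s≤s ())) _

        cover-pair : ∀ {l l′ x : V} → l ≢ 𝟎 → l′ ≢ 𝟎 → dot l x ≢ 0# → dot l′ x ≡ 0# →
          (∀ v → dot l v ≡ 0# → c v ≡ 0#) → (∀ v → dot l′ v ≡ 0# → c v ≡ 0#) → Cover L
        cover-pair {l} {l′} {x} l≢𝟎 l′≢𝟎 lx l′x l-zero l′-zero =
            Second.cover-two l l′ v w us l≢𝟎 lv l′v lw l′w (dots-≡𝟎 l us lι) (dots-≡𝟎 l′ us l′ι) ind l-zero l′-zero
          where
          v w u : V
          v = dot l x ⁻¹ · x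
          u = proj₁ (unit-vector l′≢𝟎)
          w = u ⊕ (- dot l u) · v
          lv : dot l v ≡ 1#
          lv = trans (dot-·ʳ l _ x) (⁻¹-inverseˡ lx)
          l′v : dot l′ v ≡ 0#
          l′v = trans (dot-·ʳ l′ _ x) (trans (cong (dot l x ⁻¹ *_) l′x) (zeroʳ _))
          dot-w : ∀ a → dot a w ≡ dot a u + - dot l u * dot a v
          dot-w a = trans (dot-⊕ʳ a u _) (cong (dot a u +_) (dot-·ʳ a (- dot l u) v))
          lw : dot l w ≡ 0#
          lw = trans (dot-w l) (trans (cong (λ z → dot l u + - dot l u * z) lv) (solve 1 (λ a → a :+ :- a :* :1 := :0) refl _))
          l′w : dot l′ w ≡ 1#
          l′w = trans (dot-w l′) (trans (cong₂ (λ y z → y + - dot l u * z) (proj₂ (unit-vector l′≢𝟎)) l′v) (solve 1 (λ a → :1 :+ :- a :* :0 := :1) refl _))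
          module K₁ = Kernel (kernel l)
          l″ = rep (λ y → dot l′ (K₁.ι y))
          module K₂ = Kernel (kernel l″)
          ι : Vec F (suc M) → V
          ι y = K₁.ι (K₂.ι y)
          ι-linear : IsLinear ι
          ι-linear = ∘-linear K₁.ι-linear K₂.ι-linear
          us : Vec V (suc M)
          us = columns ι
          lι : ∀ y → dot l (comb y us) ≡ 0#
          lι y = trans (cong (dot l) (comb-columns ι-linear y)) (K₁.lι _)
          l′ι : ∀ y → dot l′ (comb y us) ≡ 0#
          l′ι y = trans (cong (dot l′) (comb-columns ι-linear y)) (trans (sym (dot-rep (dot-linear K₁.ι-linear l′) _)) (K₂.lι y))
          ind : Indep us
          ind t e = trans (sym (K₂.ρι t)) (trans (cong K₂.ρ (trans (sym (K₁.ρι _)) (cong K₁.ρ (trans (sym (comb-columns ι-linear t)) e))))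
            (trans (cong K₂.ρ (IsLinear.𝟎-homo K₁.ρ-linear)) (IsLinear.𝟎-homo K₂.ρ-linear)))

        cover-second : ∀ {l x₂} → l ≢ 𝟎 → (∀ v → dot l v ≡ 0# → c v ≡ 0#) → dot l x₂ ≢ 0# → ZeroHyperplane x₂ → Cover L
        cover-second l≢𝟎 l-zero lx₂ (l′ , l′≢𝟎 , l′x₂ , l′-zero) = cover-pair l≢𝟎 l′≢𝟎 lx₂ l′x₂ l-zero l′-zero

        cover-first : ∀ {x₁} → ZeroHyperplane x₁ → Cover L
        cover-first (l , l≢𝟎 , _ , l-zero) with findV (λ v → ¬? (dot l v ≟ 0#) ×-dec (c v ≟ 0#))
        ... | inj₂ none = ⊥-elim (large l l≢𝟎 (λ v n cv → none v (n , cv)))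
        ... | inj₁ (x₂ , lx₂ , cx₂) = cover-second l≢𝟎 l-zero lx₂ (zeroHyperplane x₂ (λ e → lx₂ (trans (cong (dot l) e) (dot-𝟎ʳ l))) cx₂)

        cover-zero : Cover L
        cover-zero = cover-first (zeroHyperplane (proj₁ first) (proj₁ (proj₂ first)) (proj₂ (proj₂ first)))

    -- The invariant `c 𝟎` separates the cases: if it is nonzero a single hyperplane results,
    -- otherwise at most two.
    small-cover : Cover L
    small-cover with c 𝟎 ≟ 0#
    ... | yes e = Zero.cover-zero e
    ... | no n = Nonzero.cover-nonzero n

-- From numerical conditions on the weight to periodicity

module Classification {q : ℕ} (𝔽 : FinField q) (p h : ℕ) (pr : Prime p) (q≡pʰ : q ≡ p ℕ.^ h) (1≤h : 1 ≤ h) where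
  open Rigidity 𝔽 p h pr q≡pʰ public
  open SmallCover 𝔽 using (small-cover)

  -- An affine line has two points, so the law of lines says that the word minus its value at `𝟎` is
  -- additive, hence linear over the field with two elements.
  binary⇒periodic : q ≡ 2 → ∀ {N} (L : Combination N) → Periodic (code L)
  binary⇒periodic q≡2 L = record { l₁ = rep D ; l₂ = rep D ; l₃ = rep D ; period = λ x z z₁ _ _ → begin
      c (x ⊕ z)                ≡⟨ solve 2 (λ a o → a := (a :- o) :+ o) refl (c (x ⊕ z)) (c 𝟎) ⟩
      D (x ⊕ z) + c 𝟎          ≡⟨ cong (_+ c 𝟎) (trans (D-+ x z) (trans (cong (D x +_) (trans (sym (dot-rep functional z)) z₁)) (+-identityʳ _))) ⟩
      D x + c 𝟎                ≡⟨ solve 2 (λ a o → (a :- o) :+ o := a) refl (c x) (c 𝟎) ⟩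
      c x                      ∎ }
    where
    open ≡-Reasoning
    c = code L
    D : Vec F _ → F
    D x = c x - c 𝟎
    third : ∀ {n} → n ≡ 2 → (a b i : Fin n) → a ≢ b → i ≢ a → i ≢ b → ⊥
    third refl zero zero _ h _ _ = h refl
    third refl (suc zero) (suc zero) _ h _ _ = h refl
    third refl zero (suc zero) zero _ h _ = h refl
    third refl zero (suc zero) (suc zero) _ _ h = h refl
    third refl (suc zero) zero zero _ _ h = h refl
    third refl (suc zero) zero (suc zero) _ h _ = h refl
    0≢1 : 0# ≢ 1#
    0≢1 e = 1≢0 (sym e)
    two≡0 : 1# + 1# ≡ 0#
    two≡0 = trans (cong (1# +_) (sym (+-identityʳ 1#))) (trans (cong ⟦_⟧ (sym q≡2)) ⟦q⟧≡0)
    sum : ∀ x y → c x + c (x ⊕ y) + c y ≡ c 𝟎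
    sum x y = trans (cong (_+ c y) (sym (trans (∑F-double (λ t → c (x ⊕ t · y)) 0≢1 (λ i i≢0 i≢1 → ⊥-elim (third q≡2 0# 1# i 0≢1 i≢0 i≢1)))
      (cong₂ _+_ (cong c (⊕-0· x y)) (cong (λ z → c (x ⊕ z)) (·-identity y)))))) (line-sum L x y)
    D-+ : ∀ x y → D (x ⊕ y) ≡ D x + D y
    D-+ x y = x-y≡0⇒x≡y (trans (solve 4 (λ a b s o → (s :- o) :- ((a :- o) :+ (b :- o)) := (a :+ s :+ b) :- o :- (:1 :+ :1) :* (a :+ b :- o)) refl (c x) (c y) (c (x ⊕ y)) (c 𝟎))
      (trans (cong₂ (λ u w → u - c 𝟎 - w * (c x + c y - c 𝟎)) (sum x y) two≡0) (solve 2 (λ o r → o :- o :- :0 :* r := :0) refl (c 𝟎) _)))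
    D-· : ∀ r x → D (r · x) ≡ r * D x
    D-· r x with r ≟ 0#
    ... | yes refl = trans (cong D (·-zeroˡ x)) (trans (-‿inverseʳ _) (sym (zeroˡ _)))
    ... | no r≢0 with r ≟ 1#
    ...   | yes refl = trans (cong D (·-identity x)) (sym (*-identityˡ _))
    ...   | no r≢1 = ⊥-elim (third q≡2 0# 1# r 0≢1 r≢0 r≢1)
    functional : IsFunctional D
    functional = record { +-homo = D-+ ; ·-homo = D-· }

  -- `w` stands for the weight in points; W is (q - 1) w, plus 1 when the word is nonzero at `𝟎`.
  module _ {M} (L : List (ℕ × Vec F (suc (suc (suc M))))) (w : ℕ)
    (upper : weight (castList L) ≤ q-1 ℕ.* w ℕ.+ 1)
    (upper₀ : code (castList L) 𝟎 ≡ 0# → weight (castList L) ≤ q-1 ℕ.* w)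
    (lower : q-1 ℕ.* w ≤ weight (castList L)) where
    private
      c = code (castList L)
      W = weight (castList L)
      Q = q ℕ.^ M

    small⇒periodic : 3 ≤ q → w < (2 ℕ.* q ℕ.+ 1) ℕ.* Q → Periodic c
    small⇒periodic 3≤q w< = cover⇒periodic (castList L) (small-cover (castList L) 3≤q small small₀)
      where
      open ℕₚ.≤-Reasoning
      r = q-1
      bound : q-1 ℕ.* w ℕ.+ r ≤ q-1 ℕ.* ((2 ℕ.* q ℕ.+ 1) ℕ.* Q)
      bound = ℕₚ.≤-trans (ℕₚ.≤-reflexive (trans (ℕₚ.+-comm (q-1 ℕ.* w) r) (sym (ℕₚ.*-suc q-1 w)))) (ℕₚ.*-monoʳ-≤ q-1 w<)
      small₀ : c 𝟎 ≡ 0# → W < q-1 ℕ.* ((2 ℕ.* q ℕ.+ 1) ℕ.* Q)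
      small₀ e = ℕₚ.≤-<-trans (upper₀ e) (ℕₚ.<-≤-trans (ℕₚ.m<m+n (q-1 ℕ.* w) 0<q-1) bound)
      small : W ℕ.+ q ℕ.* Q < 2 ℕ.* (q ℕ.* (q ℕ.* Q))
      small = begin-strict
        W ℕ.+ q ℕ.* Q                                       ≤⟨ ℕₚ.+-monoˡ-≤ (q ℕ.* Q) upper ⟩
        q-1 ℕ.* w ℕ.+ 1 ℕ.+ q ℕ.* Q                         ≤⟨ ℕₚ.+-monoˡ-≤ (q ℕ.* Q) (ℕₚ.+-monoʳ-≤ (q-1 ℕ.* w) 0<q-1) ⟩
        q-1 ℕ.* w ℕ.+ r ℕ.+ q ℕ.* Q                         ≤⟨ ℕₚ.+-monoˡ-≤ (q ℕ.* Q) bound ⟩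
        q-1 ℕ.* ((2 ℕ.* q ℕ.+ 1) ℕ.* Q) ℕ.+ q ℕ.* Q         ≡⟨ cong (λ z → q-1 ℕ.* ((2 ℕ.* z ℕ.+ 1) ℕ.* Q) ℕ.+ z ℕ.* Q) q≡1+q-1 ⟩
        q-1 ℕ.* ((2 ℕ.* suc q-1 ℕ.+ 1) ℕ.* Q) ℕ.+ suc q-1 ℕ.* Q   <⟨ ℕₚ.m<m+n _ (ℕₚ.m^n>0 q M) ⟩
        q-1 ℕ.* ((2 ℕ.* suc q-1 ℕ.+ 1) ℕ.* Q) ℕ.+ suc q-1 ℕ.* Q ℕ.+ Q ≡⟨ lem q-1 Q ⟩
        2 ℕ.* (suc q-1 ℕ.* (suc q-1 ℕ.* Q))                 ≡⟨ cong (λ z → 2 ℕ.* (z ℕ.* (z ℕ.* Q))) q≡1+q-1 ⟨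
        2 ℕ.* (q ℕ.* (q ℕ.* Q))                             ∎
        where
        lem : ∀ r Q → r ℕ.* ((2 ℕ.* suc r ℕ.+ 1) ℕ.* Q) ℕ.+ suc r ℕ.* Q ℕ.+ Q ≡ 2 ℕ.* (suc r ℕ.* (suc r ℕ.* Q))
        lem = solve-∀

    private
      -- When q is not prime, an additive function on a line would have q / p zeros, which is intermediate.
      no-half : ∀ k → k ≤ 3 → 10 ≤ q → h ≢ 1 → Dichotomy k (castList L) → ∀ x d Z → lineWeight (castList L) x d ℕ.+ Z ≡ q → p ℕ.* Z ≡ q → ⊥
      no-half k k≤3 10≤q h≢1 D x d Z e pZ = ℕₚ.<⇒≱ 10≤q (ℕₚ.≤-trans (ℕₚ.≤-trans (ℕₚ.≤-reflexive (sym pZ)) (ℕₚ.*-monoˡ-≤ Z (p≤Z h h≢1 1≤h q≡pʰ))) (ℕₚ.*-mono-≤ Z≤3 Z≤3))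
        where
        s = lineWeight (castList L) x d
        1<p : 1 < p
        1<p = ℕ.nonTrivial⇒n>1 p {{prime⇒nonTrivial pr}}
        p≤Z : ∀ h → h ≢ 1 → 1 ≤ h → q ≡ p ℕ.^ h → p ≤ Z
        p≤Z (suc zero) h≢1 _ _ = ⊥-elim (h≢1 refl)
        p≤Z (suc (suc h)) _ _ e = ℕₚ.≤-trans (ℕₚ.m≤m*n p (p ℕ.^ h) {{ℕₚ.m^n≢0 p h}}) (ℕₚ.≤-reflexive (sym (ℕₚ.*-cancelˡ-≡ Z (p ℕ.^ suc h) p (trans pZ e))))
        Z≤s : Z ≤ s
        Z≤s = ℕₚ.+-cancelʳ-≤ Z Z s (ℕₚ.≤-trans (ℕₚ.≤-reflexive (lem Z)) (ℕₚ.≤-trans (ℕₚ.*-monoˡ-≤ Z 1<p) (ℕₚ.≤-reflexive (trans pZ (sym e)))))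
          where
          lem : ∀ Z → Z ℕ.+ Z ≡ 2 ℕ.* Z
          lem = solve-∀
        Z≤3 : Z ≤ 3
        Z≤3 with D x d
        ... | inj₁ s≤k = ℕₚ.≤-trans Z≤s (ℕₚ.≤-trans s≤k k≤3)
        ... | inj₂ q≤ = ℕₚ.≤-trans (ℕₚ.+-cancelˡ-≤ s Z k (ℕₚ.≤-trans (ℕₚ.≤-reflexive e) q≤)) k≤3

    -- `B` bounds 2 w in units of q^M, the factor 2 clearing the halves in the weight bound.
    -- `sparse` is the condition that four sections of density θ / q exceed the weight.
    module Middle (k′ g θ r₁ r₂ B : ℕ) (q≡ : q ≡ 1 ℕ.+ suc k′ ℕ.+ g) (k≤3 : suc k′ ≤ 3) (k<g : suc k′ < g) (10≤q : 10 ≤ q)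
      (D : Dichotomy (suc k′) (castList L)) (0<θ : 0 < θ) (θ<q : θ < q) (0<r₁ : 0 < r₁) (0<r₂ : 0 < r₂)
      (w≤ : 2 ℕ.* w ≤ B ℕ.* Q)
      (ratio : r₁ ℕ.* W ℕ.+ r₂ ℕ.* (k′ ℕ.* (q ℕ.* (q ℕ.* Q)) ℕ.+ q ℕ.* Q) ≤ r₂ ℕ.* W)
      (sparse : q-1 ℕ.* B ℕ.+ 2 ℕ.+ 12 ℕ.* q < 8 ℕ.* (θ ℕ.* q))
      (improve : ∀ {m} (K : Combination m) → Dichotomy (suc k′) K → 0 < weight K →
         θ ℕ.* (r₂ ℕ.+ g ℕ.* r₁) ℕ.* q ℕ.^ m ≤ q ℕ.* q ℕ.* r₂ ℕ.* weight K → θ ℕ.* q ℕ.^ m ≤ q ℕ.* weight K) where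

      private
        sparse′ : W ℕ.+ 6 ℕ.* (q ℕ.* Q) < 4 ℕ.* (θ ℕ.* (q ℕ.* Q))
        sparse′ = ℕₚ.*-cancelˡ-< 2 _ _ (begin-strict
          2 ℕ.* (W ℕ.+ 6 ℕ.* (q ℕ.* Q))                               ≤⟨ ℕₚ.*-monoʳ-≤ 2 (ℕₚ.+-monoˡ-≤ _ upper) ⟩
          2 ℕ.* (q-1 ℕ.* w ℕ.+ 1 ℕ.+ 6 ℕ.* (q ℕ.* Q))                 ≡⟨ lem₁ q-1 w q Q ⟩
          q-1 ℕ.* (2 ℕ.* w) ℕ.+ 2 ℕ.* 1 ℕ.+ 12 ℕ.* q ℕ.* Q            ≤⟨ ℕₚ.+-monoˡ-≤ (12 ℕ.* q ℕ.* Q) (ℕₚ.+-mono-≤ (ℕₚ.*-monoʳ-≤ q-1 w≤) (ℕₚ.*-monoʳ-≤ 2 (ℕₚ.m^n>0 q M))) ⟩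
          q-1 ℕ.* (B ℕ.* Q) ℕ.+ 2 ℕ.* Q ℕ.+ 12 ℕ.* q ℕ.* Q            ≡⟨ lem₂ q-1 B q Q ⟩
          (q-1 ℕ.* B ℕ.+ 2 ℕ.+ 12 ℕ.* q) ℕ.* Q                        <⟨ ℕₚ.*-monoˡ-< Q {{ℕ.>-nonZero (ℕₚ.m^n>0 q M)}} sparse ⟩
          8 ℕ.* (θ ℕ.* q) ℕ.* Q                                       ≡⟨ lem₃ θ q Q ⟩
          2 ℕ.* (4 ℕ.* (θ ℕ.* (q ℕ.* Q)))                             ∎)
          where
          open ℕₚ.≤-Reasoning
          lem₁ : ∀ r w q Q → 2 ℕ.* (r ℕ.* w ℕ.+ 1 ℕ.+ 6 ℕ.* (q ℕ.* Q)) ≡ r ℕ.* (2 ℕ.* w) ℕ.+ 2 ℕ.* 1 ℕ.+ 12 ℕ.* q ℕ.* Q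
          lem₁ = solve-∀
          lem₂ : ∀ r B q Q → r ℕ.* (B ℕ.* Q) ℕ.+ 2 ℕ.* Q ℕ.+ 12 ℕ.* q ℕ.* Q ≡ (r ℕ.* B ℕ.+ 2 ℕ.+ 12 ℕ.* q) ℕ.* Q
          lem₂ = solve-∀
          lem₃ : ∀ θ q Q → 8 ℕ.* (θ ℕ.* q) ℕ.* Q ≡ 2 ℕ.* (4 ℕ.* (θ ℕ.* (q ℕ.* Q)))
          lem₃ = solve-∀

        hypothesis : h ≡ 1 ⊎ (∀ x d Z → lineWeight (castList L) x d ℕ.+ Z ≡ q → p ℕ.* Z ≡ q → ⊥)
        hypothesis with h ℕₚ.≟ 1
        ... | yes e = inj₁ e
        ... | no n = inj₂ (no-half (suc k′) k≤3 10≤q n D)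

      middle⇒periodic : Periodic c
      middle⇒periodic = triple⇒periodic (ℕₚ.≤-trans (s≤s (s≤s (s≤s z≤n))) 10≤q) L
        (Chain.Dense.cover k′ g q≡ k<g (castList L) D θ r₁ r₂ θ<q 0<θ ratio 0<r₁ 0<r₂ improve sparse′) hypothesis

    -- For k = 2 the loss of a step is at most (q^2 + q) q^M, roughly half of the (q - 1) (2 q + 1)
    -- q^M vectors that are available here.
    ratio₂ : ∀ r₁ d → (r₁ ℕ.+ d) ℕ.* (q ℕ.* q ℕ.+ q) ≤ d ℕ.* (q-1 ℕ.* (2 ℕ.* q ℕ.+ 1)) → (2 ℕ.* q ℕ.+ 1) ℕ.* Q ≤ w →
      r₁ ℕ.* W ℕ.+ (r₁ ℕ.+ d) ℕ.* (1 ℕ.* (q ℕ.* (q ℕ.* Q)) ℕ.+ q ℕ.* Q) ≤ (r₁ ℕ.+ d) ℕ.* W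
    ratio₂ r₁ d h w≥ = begin
      r₁ ℕ.* W ℕ.+ (r₁ ℕ.+ d) ℕ.* (1 ℕ.* (q ℕ.* (q ℕ.* Q)) ℕ.+ q ℕ.* Q)   ≡⟨ cong (r₁ ℕ.* W ℕ.+_) (lem₁ (r₁ ℕ.+ d) q Q) ⟩
      r₁ ℕ.* W ℕ.+ (r₁ ℕ.+ d) ℕ.* (q ℕ.* q ℕ.+ q) ℕ.* Q                   ≤⟨ ℕₚ.+-monoʳ-≤ (r₁ ℕ.* W) (ℕₚ.*-monoˡ-≤ Q h) ⟩
      r₁ ℕ.* W ℕ.+ d ℕ.* (q-1 ℕ.* (2 ℕ.* q ℕ.+ 1)) ℕ.* Q                  ≡⟨ cong (r₁ ℕ.* W ℕ.+_) (lem₂ d q-1 (2 ℕ.* q ℕ.+ 1) Q) ⟩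
      r₁ ℕ.* W ℕ.+ d ℕ.* (q-1 ℕ.* ((2 ℕ.* q ℕ.+ 1) ℕ.* Q))                ≤⟨ ℕₚ.+-monoʳ-≤ (r₁ ℕ.* W) (ℕₚ.*-monoʳ-≤ d (ℕₚ.≤-trans (ℕₚ.*-monoʳ-≤ q-1 w≥) lower)) ⟩
      r₁ ℕ.* W ℕ.+ d ℕ.* W                                                ≡⟨ ℕₚ.*-distribʳ-+ W r₁ d ⟨
      (r₁ ℕ.+ d) ℕ.* W                                                    ∎
      where
      open ℕₚ.≤-Reasoning
      lem₁ : ∀ r q Q → r ℕ.* (1 ℕ.* (q ℕ.* (q ℕ.* Q)) ℕ.+ q ℕ.* Q) ≡ r ℕ.* (q ℕ.* q ℕ.+ q) ℕ.* Q
      lem₁ = solve-∀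
      lem₂ : ∀ d r x Q → d ℕ.* (r ℕ.* x) ℕ.* Q ≡ d ℕ.* (r ℕ.* (x ℕ.* Q))
      lem₂ = solve-∀

    dichotomy-from : ∀ k g B → q ≡ 1 ℕ.+ k ℕ.+ g → 2 ℕ.* w ≤ B ℕ.* Q → q-1 ℕ.* (q-1 ℕ.* B ℕ.+ 2) < 2 ℕ.* (q ℕ.* q ℕ.* (suc k ℕ.* g)) → Dichotomy k (castList L)
    dichotomy-from k g B q≡ w≤ h = dichotomy (castList L) k g q≡ (begin-strict
      q ℕ.* W                                    ≡⟨ cong (ℕ._* W) q≡1+q-1 ⟩
      W ℕ.+ q-1 ℕ.* W                            <⟨ ℕₚ.+-monoʳ-< W core ⟩
      W ℕ.+ q ℕ.* (q ℕ.* Q) ℕ.* (suc k ℕ.* g)    ∎)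
      where
      open ℕₚ.≤-Reasoning
      core : q-1 ℕ.* W < q ℕ.* (q ℕ.* Q) ℕ.* (suc k ℕ.* g)
      core = ℕₚ.*-cancelˡ-< 2 _ _ (begin-strict
        2 ℕ.* (q-1 ℕ.* W)                             ≤⟨ ℕₚ.*-monoʳ-≤ 2 (ℕₚ.*-monoʳ-≤ q-1 upper) ⟩
        2 ℕ.* (q-1 ℕ.* (q-1 ℕ.* w ℕ.+ 1))             ≡⟨ lem₁ q-1 w ⟩
        q-1 ℕ.* (q-1 ℕ.* (2 ℕ.* w) ℕ.+ 2 ℕ.* 1)       ≤⟨ ℕₚ.*-monoʳ-≤ q-1 (ℕₚ.+-mono-≤ (ℕₚ.*-monoʳ-≤ q-1 w≤) (ℕₚ.*-monoʳ-≤ 2 (ℕₚ.m^n>0 q M))) ⟩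
        q-1 ℕ.* (q-1 ℕ.* (B ℕ.* Q) ℕ.+ 2 ℕ.* Q)       ≡⟨ lem₂ q-1 B Q ⟩
        q-1 ℕ.* (q-1 ℕ.* B ℕ.+ 2) ℕ.* Q               <⟨ ℕₚ.*-monoˡ-< Q {{ℕ.>-nonZero (ℕₚ.m^n>0 q M)}} h ⟩
        2 ℕ.* (q ℕ.* q ℕ.* (suc k ℕ.* g)) ℕ.* Q       ≡⟨ lem₃ q (suc k ℕ.* g) Q ⟩
        2 ℕ.* (q ℕ.* (q ℕ.* Q) ℕ.* (suc k ℕ.* g))     ∎)
        where
        lem₁ : ∀ r w → 2 ℕ.* (r ℕ.* (r ℕ.* w ℕ.+ 1)) ≡ r ℕ.* (r ℕ.* (2 ℕ.* w) ℕ.+ 2 ℕ.* 1)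
        lem₁ = solve-∀
        lem₂ : ∀ r B Q → r ℕ.* (r ℕ.* (B ℕ.* Q) ℕ.+ 2 ℕ.* Q) ≡ r ℕ.* (r ℕ.* B ℕ.+ 2) ℕ.* Q
        lem₂ = solve-∀
        lem₃ : ∀ q x Q → 2 ℕ.* (q ℕ.* q ℕ.* x) ℕ.* Q ≡ 2 ℕ.* (q ℕ.* (q ℕ.* Q) ℕ.* x)
        lem₃ = solve-∀

    module Improve (k g θ : ℕ) (q≡ : q ≡ 1 ℕ.+ k ℕ.+ g) (s : ℕ) (q≡θ+s : q ≡ θ ℕ.+ s) where
      -- `boot` yields density C / (A + C), which is at least θ / q as soon as θ A ≤ (q - θ) C; here
      -- s = q - θ.
      improve₁ : ∀ a b e → a ℕ.* (k ℕ.+ g) ≡ k ℕ.* b ℕ.+ e → 0 < (1 ℕ.+ g) ℕ.* e →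
        θ ℕ.* (a ℕ.* k ℕ.* (k ℕ.+ g)) ≤ s ℕ.* ((1 ℕ.+ g) ℕ.* e) →
        ∀ {m} (K : Combination m) → Dichotomy k K → 0 < weight K → a ℕ.* q ℕ.^ m ≤ b ℕ.* weight K → θ ℕ.* q ℕ.^ m ≤ q ℕ.* weight K
      improve₁ a b e eq 0<C θ≤ {m} K D 0<s h = ℕₚ.*-cancelˡ-≤ C {{ℕ.>-nonZero 0<C}} (begin
        C ℕ.* (θ ℕ.* q ℕ.^ m)                                  ≡⟨ lem C θ (q ℕ.^ m) ⟩
        θ ℕ.* (C ℕ.* q ℕ.^ m)                                  ≤⟨ ℕₚ.*-monoʳ-≤ θ (Long.boot k g q≡ K D a b e 0<s h eq) ⟩
        θ ℕ.* ((A ℕ.+ C) ℕ.* weight K)                         ≡⟨ ℕₚ.*-assoc θ (A ℕ.+ C) (weight K) ⟨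
        θ ℕ.* (A ℕ.+ C) ℕ.* weight K                           ≡⟨ cong (ℕ._* weight K) (ℕₚ.*-distribˡ-+ θ A C) ⟩
        (θ ℕ.* A ℕ.+ θ ℕ.* C) ℕ.* weight K                     ≤⟨ ℕₚ.*-monoˡ-≤ (weight K) (ℕₚ.+-monoˡ-≤ (θ ℕ.* C) θ≤) ⟩
        (s ℕ.* C ℕ.+ θ ℕ.* C) ℕ.* weight K                     ≡⟨ lem′ s θ C (weight K) ⟩
        C ℕ.* ((θ ℕ.+ s) ℕ.* weight K)                         ≡⟨ cong (λ z → C ℕ.* (z ℕ.* weight K)) q≡θ+s ⟨
        C ℕ.* (q ℕ.* weight K)                                 ∎)
        where
        open ℕₚ.≤-Reasoning
        C = (1 ℕ.+ g) ℕ.* e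
        A = a ℕ.* k ℕ.* (k ℕ.+ g)
        lem : ∀ a b c → a ℕ.* (b ℕ.* c) ≡ b ℕ.* (a ℕ.* c)
        lem = solve-∀
        lem′ : ∀ s t a b → (s ℕ.* a ℕ.+ t ℕ.* a) ℕ.* b ≡ a ℕ.* ((t ℕ.+ s) ℕ.* b)
        lem′ = solve-∀

-- Polynomial inequalities for orders from 29 on

-- Inequalities are proved by displaying the difference `x`, which leaves an identity for the ring
-- solver.
≤-from : ∀ {m n} x → m ℕ.+ x ≡ n → m ≤ n
≤-from {m} x e = ℕₚ.≤-trans (ℕₚ.m≤m+n m x) (ℕₚ.≤-reflexive e)

-- Here q = 29 + d. The parameters depending on d are variables constrained by equations, since unfolding them would expand large unary numbers.
module LargeOrder where
  open ℕₚ.≤-Reasoning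

  order≡ : ∀ d → 29 ℕ.+ d ≡ 22 ℕ.+ d ℕ.+ 7
  order≡ = solve-∀

  ratio₂-large : ∀ d {g} → g ≡ 26 ℕ.+ d → 4 ℕ.* ((3 ℕ.+ g) ℕ.* (3 ℕ.+ g) ℕ.+ (3 ℕ.+ g)) ≤ 3 ℕ.* ((2 ℕ.+ g) ℕ.* (2 ℕ.* (3 ℕ.+ g) ℕ.+ 1))
  ratio₂-large d refl = ≤-from (1476 ℕ.+ 109 ℕ.* d ℕ.+ 2 ℕ.* (d ℕ.* d)) (lem d)
    where
    lem : ∀ d → 4 ℕ.* ((29 ℕ.+ d) ℕ.* (29 ℕ.+ d) ℕ.+ (29 ℕ.+ d)) ℕ.+ (1476 ℕ.+ 109 ℕ.* d ℕ.+ 2 ℕ.* (d ℕ.* d)) ≡ 3 ℕ.* ((28 ℕ.+ d) ℕ.* (2 ℕ.* (29 ℕ.+ d) ℕ.+ 1))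
    lem = solve-∀

  -- With θ = q - 7 and B = 8 q - 66 the quadratic terms cancel and the difference of the two sides
  -- is 6 q - 68.
  sparse-large : ∀ d {r θ B} → r ≡ 28 ℕ.+ d → θ ≡ 22 ℕ.+ d → B ≡ 166 ℕ.+ 8 ℕ.* d → r ℕ.* B ℕ.+ 2 ℕ.+ 12 ℕ.* suc r < 8 ℕ.* (θ ℕ.* suc r)
  sparse-large d refl refl refl = ≤-from (105 ℕ.+ 6 ℕ.* d) (lem d)
    where
    lem : ∀ d → suc ((28 ℕ.+ d) ℕ.* (166 ℕ.+ 8 ℕ.* d) ℕ.+ 2 ℕ.+ 12 ℕ.* (29 ℕ.+ d)) ℕ.+ (105 ℕ.+ 6 ℕ.* d) ≡ 8 ℕ.* ((22 ℕ.+ d) ℕ.* (29 ℕ.+ d))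
    lem = solve-∀

  -- The last summand is the excess `e` of `boot` for k = 2. In terms of the order, X = q^2 - 1, Y =
  -- q^2 - 9 and 13 + d = q - 16.
  excess₂ : ∀ d {g θ X Y} → g ≡ 26 ℕ.+ d → θ ≡ 22 ℕ.+ d → X ≡ (30 ℕ.+ d) ℕ.* (28 ℕ.+ d) → Y ≡ 832 ℕ.+ 58 ℕ.* d ℕ.+ d ℕ.* d →
    θ ℕ.* (4 ℕ.+ g ℕ.* 1) ℕ.* (2 ℕ.+ g) ≡ 2 ℕ.* ((3 ℕ.+ g) ℕ.* (3 ℕ.+ g) ℕ.* 4) ℕ.+ (Y ℕ.+ (13 ℕ.+ d) ℕ.* X)
  excess₂ d {g} {θ} {X} {Y} g≡ θ≡ X≡ Y≡ = begin-equality
    θ ℕ.* (4 ℕ.+ g ℕ.* 1) ℕ.* (2 ℕ.+ g)                              ≡⟨ lem₁ θ g ⟩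
    θ ℕ.* ((4 ℕ.+ g) ℕ.* (2 ℕ.+ g))                                  ≡⟨ cong₂ ℕ._*_ θ≡ (core₁ g≡ Y≡) ⟩
    (22 ℕ.+ d) ℕ.* (Y ℕ.+ 8)                                         ≡⟨ lem₃ d Y ⟩
    2 ℕ.* ((Y ℕ.+ 9) ℕ.* 4) ℕ.+ (Y ℕ.+ (13 ℕ.+ d) ℕ.* (Y ℕ.+ 8))     ≡⟨ cong₂ (λ u v → 2 ℕ.* (u ℕ.* 4) ℕ.+ (Y ℕ.+ (13 ℕ.+ d) ℕ.* v)) (core₂ g≡ Y≡) (core₃ X≡ Y≡) ⟨
    2 ℕ.* ((3 ℕ.+ g) ℕ.* (3 ℕ.+ g) ℕ.* 4) ℕ.+ (Y ℕ.+ (13 ℕ.+ d) ℕ.* X)   ∎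
    where
    lem₁ : ∀ t g → t ℕ.* (4 ℕ.+ g ℕ.* 1) ℕ.* (2 ℕ.+ g) ≡ t ℕ.* ((4 ℕ.+ g) ℕ.* (2 ℕ.+ g))
    lem₁ = solve-∀
    lem₂ : ∀ d → (30 ℕ.+ d) ℕ.* (28 ℕ.+ d) ≡ 832 ℕ.+ 58 ℕ.* d ℕ.+ d ℕ.* d ℕ.+ 8
    lem₂ = solve-∀
    lem₃ : ∀ d Y → (22 ℕ.+ d) ℕ.* (Y ℕ.+ 8) ≡ 2 ℕ.* ((Y ℕ.+ 9) ℕ.* 4) ℕ.+ (Y ℕ.+ (13 ℕ.+ d) ℕ.* (Y ℕ.+ 8))
    lem₃ = solve-∀
    lem₄ : ∀ d → (29 ℕ.+ d) ℕ.* (29 ℕ.+ d) ≡ 832 ℕ.+ 58 ℕ.* d ℕ.+ d ℕ.* d ℕ.+ 9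
    lem₄ = solve-∀
    core₁ : ∀ {g Y} → g ≡ 26 ℕ.+ d → Y ≡ 832 ℕ.+ 58 ℕ.* d ℕ.+ d ℕ.* d → (4 ℕ.+ g) ℕ.* (2 ℕ.+ g) ≡ Y ℕ.+ 8
    core₁ refl refl = lem₂ d
    core₂ : ∀ {g Y} → g ≡ 26 ℕ.+ d → Y ≡ 832 ℕ.+ 58 ℕ.* d ℕ.+ d ℕ.* d → (3 ℕ.+ g) ℕ.* (3 ℕ.+ g) ≡ Y ℕ.+ 9
    core₂ refl refl = lem₄ d
    core₃ : ∀ {X Y} → X ≡ (30 ℕ.+ d) ℕ.* (28 ℕ.+ d) → Y ≡ 832 ℕ.+ 58 ℕ.* d ℕ.+ d ℕ.* d → X ≡ Y ℕ.+ 8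
    core₃ refl refl = lem₂ d

  -- After discarding `Y` and cancelling X the claim is 2 θ^2 ≤ 7 (q - 2) (q - 16).
  gain₂ : ∀ d {g θ X} Y → g ≡ 26 ℕ.+ d → θ ≡ 22 ℕ.+ d → X ≡ (30 ℕ.+ d) ℕ.* (28 ℕ.+ d) →
    θ ℕ.* (θ ℕ.* (4 ℕ.+ g ℕ.* 1) ℕ.* 2 ℕ.* (2 ℕ.+ g)) ≤ 7 ℕ.* ((1 ℕ.+ g) ℕ.* (Y ℕ.+ (13 ℕ.+ d) ℕ.* X))
  gain₂ d {g} {θ} {X} Y g≡ θ≡ refl = begin
    θ ℕ.* (θ ℕ.* (4 ℕ.+ g ℕ.* 1) ℕ.* 2 ℕ.* (2 ℕ.+ g))             ≡⟨ lem₁ θ g ⟩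
    2 ℕ.* (θ ℕ.* θ) ℕ.* ((4 ℕ.+ g) ℕ.* (2 ℕ.+ g))                 ≡⟨ cong (λ z → 2 ℕ.* (θ ℕ.* θ) ℕ.* ((4 ℕ.+ z) ℕ.* (2 ℕ.+ z))) g≡ ⟩
    2 ℕ.* (θ ℕ.* θ) ℕ.* X                                         ≤⟨ ℕₚ.*-monoˡ-≤ X θ²≤ ⟩
    7 ℕ.* ((1 ℕ.+ g) ℕ.* (13 ℕ.+ d)) ℕ.* X                        ≡⟨ lem₂ (1 ℕ.+ g) (13 ℕ.+ d) X ⟩
    7 ℕ.* ((1 ℕ.+ g) ℕ.* ((13 ℕ.+ d) ℕ.* X))                      ≤⟨ ℕₚ.*-monoʳ-≤ 7 (ℕₚ.*-monoʳ-≤ (1 ℕ.+ g) (ℕₚ.m≤n+m ((13 ℕ.+ d) ℕ.* X) Y)) ⟩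
    7 ℕ.* ((1 ℕ.+ g) ℕ.* (Y ℕ.+ (13 ℕ.+ d) ℕ.* X))                ∎
    where
    lem₁ : ∀ t g → t ℕ.* (t ℕ.* (4 ℕ.+ g ℕ.* 1) ℕ.* 2 ℕ.* (2 ℕ.+ g)) ≡ 2 ℕ.* (t ℕ.* t) ℕ.* ((4 ℕ.+ g) ℕ.* (2 ℕ.+ g))
    lem₁ = solve-∀
    lem₂ : ∀ x y z → 7 ℕ.* (x ℕ.* y) ℕ.* z ≡ 7 ℕ.* (x ℕ.* (y ℕ.* z))
    lem₂ = solve-∀
    lem₃ : ∀ d → 2 ℕ.* ((22 ℕ.+ d) ℕ.* (22 ℕ.+ d)) ℕ.+ (1489 ℕ.+ 192 ℕ.* d ℕ.+ 5 ℕ.* (d ℕ.* d)) ≡ 7 ℕ.* ((27 ℕ.+ d) ℕ.* (13 ℕ.+ d))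
    lem₃ = solve-∀
    θ²≤ : 2 ℕ.* (θ ℕ.* θ) ≤ 7 ℕ.* ((1 ℕ.+ g) ℕ.* (13 ℕ.+ d))
    θ²≤ = subst₂ (λ t g → 2 ℕ.* (t ℕ.* t) ≤ 7 ℕ.* ((1 ℕ.+ g) ℕ.* (13 ℕ.+ d))) (sym θ≡) (sym g≡) (≤-from (1489 ℕ.+ 192 ℕ.* d ℕ.+ 5 ℕ.* (d ℕ.* d)) (lem₃ d))

  -- For k = 3 the numerator 4 + g is the order itself, so a factor q splits off; Y is θ (q - 1) -
  -- 12 q.
  excess₃ : ∀ d {g θ Y} → g ≡ 25 ℕ.+ d → θ ≡ 22 ℕ.+ d → Y ≡ 268 ℕ.+ 38 ℕ.* d ℕ.+ d ℕ.* d →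
    θ ℕ.* (4 ℕ.+ g ℕ.* 1) ℕ.* (3 ℕ.+ g) ≡ 3 ℕ.* ((4 ℕ.+ g) ℕ.* (4 ℕ.+ g) ℕ.* 4) ℕ.+ (4 ℕ.+ g) ℕ.* Y
  excess₃ d {g} {θ} {Y} g≡ θ≡ Y≡ = begin-equality
    θ ℕ.* (4 ℕ.+ g ℕ.* 1) ℕ.* (3 ℕ.+ g)              ≡⟨ lem₁ θ g ⟩
    (4 ℕ.+ g) ℕ.* (θ ℕ.* (3 ℕ.+ g))                  ≡⟨ cong ((4 ℕ.+ g) ℕ.*_) (core g≡ θ≡ Y≡) ⟩
    (4 ℕ.+ g) ℕ.* (12 ℕ.* (4 ℕ.+ g) ℕ.+ Y)           ≡⟨ lem₂ (4 ℕ.+ g) Y ⟩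
    3 ℕ.* ((4 ℕ.+ g) ℕ.* (4 ℕ.+ g) ℕ.* 4) ℕ.+ (4 ℕ.+ g) ℕ.* Y   ∎
    where
    lem₁ : ∀ t g → t ℕ.* (4 ℕ.+ g ℕ.* 1) ℕ.* (3 ℕ.+ g) ≡ (4 ℕ.+ g) ℕ.* (t ℕ.* (3 ℕ.+ g))
    lem₁ = solve-∀
    lem₂ : ∀ x y → x ℕ.* (12 ℕ.* x ℕ.+ y) ≡ 3 ℕ.* (x ℕ.* x ℕ.* 4) ℕ.+ x ℕ.* y
    lem₂ = solve-∀
    lem₃ : ∀ d → (22 ℕ.+ d) ℕ.* (28 ℕ.+ d) ≡ 12 ℕ.* (29 ℕ.+ d) ℕ.+ (268 ℕ.+ 38 ℕ.* d ℕ.+ d ℕ.* d)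
    lem₃ = solve-∀
    core : ∀ {g θ Y} → g ≡ 25 ℕ.+ d → θ ≡ 22 ℕ.+ d → Y ≡ 268 ℕ.+ 38 ℕ.* d ℕ.+ d ℕ.* d → θ ℕ.* (3 ℕ.+ g) ≡ 12 ℕ.* (4 ℕ.+ g) ℕ.+ Y
    core refl refl refl = lem₃ d

  gain₃ : ∀ d {g θ Y} → g ≡ 25 ℕ.+ d → θ ≡ 22 ℕ.+ d → Y ≡ 268 ℕ.+ 38 ℕ.* d ℕ.+ d ℕ.* d →
    θ ℕ.* (θ ℕ.* (4 ℕ.+ g ℕ.* 1) ℕ.* 3 ℕ.* (3 ℕ.+ g)) ≤ 7 ℕ.* ((1 ℕ.+ g) ℕ.* ((4 ℕ.+ g) ℕ.* Y))
  -- The factor 4 prepares the exchange 12 (q - 1) ≤ 13 (q - 3), after which 13 θ^2 ≤ 28 Y remains.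
  gain₃ d {g} {θ} {Y} g≡ θ≡ Y≡ = ℕₚ.*-cancelˡ-≤ 4 (begin
    4 ℕ.* (θ ℕ.* (θ ℕ.* (4 ℕ.+ g ℕ.* 1) ℕ.* 3 ℕ.* (3 ℕ.+ g)))   ≡⟨ lem₁ θ g ⟩
    θ ℕ.* θ ℕ.* (4 ℕ.+ g) ℕ.* (12 ℕ.* (3 ℕ.+ g))                ≤⟨ ℕₚ.*-monoʳ-≤ (θ ℕ.* θ ℕ.* (4 ℕ.+ g)) (core₁ g≡) ⟩
    θ ℕ.* θ ℕ.* (4 ℕ.+ g) ℕ.* (13 ℕ.* (1 ℕ.+ g))                ≡⟨ lem₂ θ (4 ℕ.+ g) (1 ℕ.+ g) ⟩
    13 ℕ.* (θ ℕ.* θ) ℕ.* ((1 ℕ.+ g) ℕ.* (4 ℕ.+ g))              ≤⟨ ℕₚ.*-monoˡ-≤ ((1 ℕ.+ g) ℕ.* (4 ℕ.+ g)) (core₂ θ≡ Y≡) ⟩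
    28 ℕ.* Y ℕ.* ((1 ℕ.+ g) ℕ.* (4 ℕ.+ g))                      ≡⟨ lem₃ (4 ℕ.+ g) (1 ℕ.+ g) Y ⟩
    4 ℕ.* (7 ℕ.* ((1 ℕ.+ g) ℕ.* ((4 ℕ.+ g) ℕ.* Y)))             ∎)
    where
    lem₁ : ∀ t g → 4 ℕ.* (t ℕ.* (t ℕ.* (4 ℕ.+ g ℕ.* 1) ℕ.* 3 ℕ.* (3 ℕ.+ g))) ≡ t ℕ.* t ℕ.* (4 ℕ.+ g) ℕ.* (12 ℕ.* (3 ℕ.+ g))
    lem₁ = solve-∀
    lem₂ : ∀ t x y → t ℕ.* t ℕ.* x ℕ.* (13 ℕ.* y) ≡ 13 ℕ.* (t ℕ.* t) ℕ.* (y ℕ.* x)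
    lem₂ = solve-∀
    lem₃ : ∀ x y z → 28 ℕ.* z ℕ.* (y ℕ.* x) ≡ 4 ℕ.* (7 ℕ.* (y ℕ.* (x ℕ.* z)))
    lem₃ = solve-∀
    lem₄ : ∀ d → 12 ℕ.* (28 ℕ.+ d) ℕ.+ (2 ℕ.+ d) ≡ 13 ℕ.* (26 ℕ.+ d)
    lem₄ = solve-∀
    lem₅ : ∀ d → 13 ℕ.* ((22 ℕ.+ d) ℕ.* (22 ℕ.+ d)) ℕ.+ (1212 ℕ.+ 492 ℕ.* d ℕ.+ 15 ℕ.* (d ℕ.* d)) ≡ 28 ℕ.* (268 ℕ.+ 38 ℕ.* d ℕ.+ d ℕ.* d)
    lem₅ = solve-∀
    core₁ : ∀ {g} → g ≡ 25 ℕ.+ d → 12 ℕ.* (3 ℕ.+ g) ≤ 13 ℕ.* (1 ℕ.+ g)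
    core₁ refl = ≤-from (2 ℕ.+ d) (lem₄ d)
    core₂ : ∀ {θ Y} → θ ≡ 22 ℕ.+ d → Y ≡ 268 ℕ.+ 38 ℕ.* d ℕ.+ d ℕ.* d → 13 ℕ.* (θ ℕ.* θ) ≤ 28 ℕ.* Y
    core₂ refl refl = ≤-from (1212 ℕ.+ 492 ℕ.* d ℕ.+ 15 ℕ.* (d ℕ.* d)) (lem₅ d)

  dichotomy₃-large : ∀ d {q g B} → 0 < q → g ≡ 25 ℕ.+ d → B ≡ 166 ℕ.+ 8 ℕ.* d → (q ∸ 1) ℕ.* ((q ∸ 1) ℕ.* B ℕ.+ 2) < 2 ℕ.* (q ℕ.* q ℕ.* (4 ℕ.* g))
  dichotomy₃-large d {q} {g} {B} 0<q refl refl = begin-strict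
    (q ∸ 1) ℕ.* ((q ∸ 1) ℕ.* B ℕ.+ 2)        ≤⟨ ℕₚ.*-mono-≤ (ℕₚ.m∸n≤m q 1) (ℕₚ.+-monoˡ-≤ 2 (ℕₚ.*-monoˡ-≤ B (ℕₚ.m∸n≤m q 1))) ⟩
    -- The slack is 8 g - B = 34, so even with q - 1 enlarged to q the inequality holds.
    q ℕ.* (q ℕ.* B ℕ.+ 2)                    <⟨ ℕₚ.*-monoʳ-< q {{ℕ.>-nonZero 0<q}} (ℕₚ.+-monoʳ-< (q ℕ.* B) 2<34q) ⟩
    q ℕ.* (q ℕ.* B ℕ.+ q ℕ.* 34)             ≡⟨ lem q d ⟩
    2 ℕ.* (q ℕ.* q ℕ.* (4 ℕ.* g))            ∎
    where
    2<34q : 2 < q ℕ.* 34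
    2<34q = ℕₚ.≤-trans (ℕₚ.≤ᵇ⇒≤ 3 34 _) (ℕₚ.m≤n*m 34 q {{ℕ.>-nonZero 0<q}})
    lem : ∀ q d → q ℕ.* (q ℕ.* (166 ℕ.+ 8 ℕ.* d) ℕ.+ q ℕ.* 34) ≡ 2 ℕ.* (q ℕ.* q ℕ.* (4 ℕ.* (25 ℕ.+ d)))
    lem = solve-∀

  -- The hypothesis is that W is too large for the gap with k = 2, so that W is at least about 3 q
  -- X. Then the loss 2 q X + X of a step with k = 3 is at most three quarters of W.
  ratio₃-large : ∀ d {q g W X} → q ≡ 4 ℕ.+ g → g ≡ 25 ℕ.+ d → W ℕ.+ q ℕ.* X ℕ.* (3 ℕ.* (1 ℕ.+ g)) ≤ q ℕ.* W →
    1 ℕ.* W ℕ.+ 4 ℕ.* (2 ℕ.* (q ℕ.* X) ℕ.+ X) ≤ 4 ℕ.* W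
  ratio₃-large d {q} {g} {W} {X} refl g≡ h = ℕₚ.*-cancelˡ-≤ (3 ℕ.+ g) (begin
    (3 ℕ.+ g) ℕ.* (1 ℕ.* W ℕ.+ 4 ℕ.* (2 ℕ.* (q ℕ.* X) ℕ.+ X))         ≤⟨ core g≡ ⟩
    (3 ℕ.+ g) ℕ.* W ℕ.+ 3 ℕ.* (q ℕ.* X ℕ.* (3 ℕ.* (1 ℕ.+ g)))         ≤⟨ ℕₚ.+-monoʳ-≤ ((3 ℕ.+ g) ℕ.* W) (ℕₚ.*-monoʳ-≤ 3 (ℕₚ.+-cancelˡ-≤ W _ _ h)) ⟩
    (3 ℕ.+ g) ℕ.* W ℕ.+ 3 ℕ.* ((3 ℕ.+ g) ℕ.* W)                       ≡⟨ lem₁ (3 ℕ.+ g) W ⟩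
    (3 ℕ.+ g) ℕ.* (4 ℕ.* W)                                           ∎)
    where
    lem₁ : ∀ x W → x ℕ.* W ℕ.+ 3 ℕ.* (x ℕ.* W) ≡ x ℕ.* (4 ℕ.* W)
    lem₁ = solve-∀
    lem₂ : ∀ d W X → (28 ℕ.+ d) ℕ.* (1 ℕ.* W ℕ.+ 4 ℕ.* (2 ℕ.* ((29 ℕ.+ d) ℕ.* X) ℕ.+ X)) ℕ.+ (178 ℕ.+ 35 ℕ.* d ℕ.+ d ℕ.* d) ℕ.* X ≡ (28 ℕ.+ d) ℕ.* W ℕ.+ 3 ℕ.* ((29 ℕ.+ d) ℕ.* X ℕ.* (3 ℕ.* (26 ℕ.+ d)))
    lem₂ = solve-∀
    core : ∀ {g} → g ≡ 25 ℕ.+ d → (3 ℕ.+ g) ℕ.* (1 ℕ.* W ℕ.+ 4 ℕ.* (2 ℕ.* ((4 ℕ.+ g) ℕ.* X) ℕ.+ X)) ≤ (3 ℕ.+ g) ℕ.* W ℕ.+ 3 ℕ.* ((4 ℕ.+ g) ℕ.* X ℕ.* (3 ℕ.* (1 ℕ.+ g)))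
    core refl = ≤-from ((178 ℕ.+ 35 ℕ.* d ℕ.+ d ℕ.* d) ℕ.* X) (lem₂ d W X)

-- Square-root bounds and the cases of the order

square-cancel-≤ : ∀ {m n} → m ℕ.* m ≤ n ℕ.* n → m ≤ n
square-cancel-≤ {m} {n} h with m ℕₚ.≤? n
... | yes p = p
... | no ¬p = ⊥-elim (ℕₚ.<⇒≱ (ℕₚ.*-mono-< n<m n<m) h)
  where
  n<m = ℕₚ.≰⇒> ¬p

-- An integer r below the root of 4 β q gives r Q ≤ R, and R + 2 W = (2 α q + g) Q = (r + G) Q.
sqrt-bound : ∀ {α β g M q W} → SqrtBound α β g (2 ℕ.+ M) q W → ∀ r G → pos (2 ℕ.* α ℕ.* q) ℤ.+ g ≡ pos (r ℕ.+ G) →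
  r ℕ.* r ≤ 4 ℕ.* β ℕ.* q → 2 ℕ.* W ≤ G ℕ.* q ℕ.^ M
sqrt-bound {α} {β} {g} {M} {q} {W} (0≤R , h) r G e r²≤ = ℕₚ.+-cancelˡ-≤ (r ℕ.* Q) _ _ (begin
  r ℕ.* Q ℕ.+ 2 ℕ.* W      ≤⟨ ℕₚ.+-monoˡ-≤ (2 ℕ.* W) rQ≤ρ ⟩
  ρ ℕ.+ 2 ℕ.* W            ≡⟨ total ⟩
  (r ℕ.+ G) ℕ.* Q          ≡⟨ ℕₚ.*-distribʳ-+ Q r G ⟩
  r ℕ.* Q ℕ.+ G ℕ.* Q      ∎)
  where
  open ℕₚ.≤-Reasoning
  Q = q ℕ.^ M
  R = (pos (2 ℕ.* α ℕ.* q) ℤ.+ g) ℤ.* pos Q ℤ.- pos (2 ℕ.* W)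
  ρ = ℤ.∣ R ∣
  ρ≡ : pos ρ ≡ R
  ρ≡ = ℤₚ.0≤i⇒+∣i∣≡i 0≤R
  total : ρ ℕ.+ 2 ℕ.* W ≡ (r ℕ.+ G) ℕ.* Q
  total = ℤₚ.+-injective (trans (cong (ℤ._+ pos (2 ℕ.* W)) ρ≡) (trans (ℤₚ.+-assoc ((pos (2 ℕ.* α ℕ.* q) ℤ.+ g) ℤ.* pos Q) (ℤ.- pos (2 ℕ.* W)) (pos (2 ℕ.* W)))
    (trans (cong (λ z → (pos (2 ℕ.* α ℕ.* q) ℤ.+ g) ℤ.* pos Q ℤ.+ z) (ℤₚ.+-inverseˡ (pos (2 ℕ.* W)))) (trans (ℤₚ.+-identityʳ _) (trans (cong (ℤ._* pos Q) e) (sym (ℤₚ.pos-* (r ℕ.+ G) Q)))))))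
  h′ : 4 ℕ.* β ℕ.* q ℕ.* Q ℕ.* Q ≤ ρ ℕ.* ρ
  h′ = ℤₚ.drop‿+≤+ (ℤₚ.≤-trans h (ℤₚ.≤-reflexive (trans (sym (cong₂ ℤ._*_ ρ≡ ρ≡)) (sym (ℤₚ.pos-* ρ ρ)))))
  rQ≤ρ : r ℕ.* Q ≤ ρ
  rQ≤ρ = square-cancel-≤ (begin
    r ℕ.* Q ℕ.* (r ℕ.* Q)            ≡⟨ lem r Q ⟩
    r ℕ.* r ℕ.* (Q ℕ.* Q)            ≤⟨ ℕₚ.*-monoˡ-≤ (Q ℕ.* Q) r²≤ ⟩
    4 ℕ.* β ℕ.* q ℕ.* (Q ℕ.* Q)      ≡⟨ ℕₚ.*-assoc (4 ℕ.* β ℕ.* q) Q Q ⟨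
    4 ℕ.* β ℕ.* q ℕ.* Q ℕ.* Q        ≤⟨ h′ ⟩
    ρ ℕ.* ρ                          ∎)
    where
    lem : ∀ r Q → r ℕ.* Q ℕ.* (r ℕ.* Q) ≡ r ℕ.* r ℕ.* (Q ℕ.* Q)
    lem = solve-∀

pattern 10+ n = suc (suc (suc (suc (suc (suc (suc (suc (suc (suc n)))))))))

prime-∣-^ : ∀ {r p} h → Prime r → Prime p → r ∣ p ℕ.^ h → r ≡ p
prime-∣-^ zero r-prime _ (divides m e) = ⊥-elim (ℕₚ.<⇒≢ (ℕ.nonTrivial⇒n>1 _ {{prime⇒nonTrivial r-prime}}) (sym (ℕₚ.m*n≡1⇒n≡1 m _ (sym e))))
prime-∣-^ {r} {p} (suc h) r-prime p-prime r∣ with euclidsLemma p (p ℕ.^ h) r-prime r∣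
... | inj₂ r∣pʰ = prime-∣-^ h r-prime p-prime r∣pʰ
... | inj₁ r∣p with prime⇒irreducible p-prime r∣p
...   | inj₁ r≡1 = ⊥-elim (ℕₚ.<⇒≢ (ℕ.nonTrivial⇒n>1 _ {{prime⇒nonTrivial r-prime}}) (sym r≡1))
...   | inj₂ r≡p = r≡p

not-prime-power : ∀ {p h q} r s → Prime r → Prime s → r ≢ s → Prime p → q ≡ p ℕ.^ h → r ∣ q → s ∣ q → ⊥
not-prime-power {h = h} r s pr ps r≢s pp refl r∣ s∣ = r≢s (trans (prime-∣-^ h pr pp r∣) (sym (prime-∣-^ h ps pp s∣)))

module Cases {q : ℕ} (𝔽 : FinField q) (p h : ℕ) (pr : Prime p) (q≡pʰ : q ≡ p ℕ.^ h) (1≤h : 1 ≤ h) where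
  open Classification 𝔽 p h pr q≡pʰ 1≤h public
  open LargeOrder

  module _ {M} (L : List (ℕ × Vec F (suc (suc (suc M))))) (w : ℕ)
    (upper : weight (castList L) ≤ q-1 ℕ.* w ℕ.+ 1)
    (upper₀ : code (castList L) 𝟎 ≡ 0# → weight (castList L) ≤ q-1 ℕ.* w)
    (lower : q-1 ℕ.* w ≤ weight (castList L)) where
    private
      c = code (castList L)
      W = weight (castList L)
      Q = q ℕ.^ M

    -- Weights below (2 q + 1) q^M belong to `small⇒periodic`. From there on the same threshold is
    -- the lower bound required by `ratio₂`, and the chain runs with k = 2.
    two-secants⇒periodic : ∀ g θ r₁ d B → q ≡ 3 ℕ.+ g → 7 ≤ g → Dichotomy 2 (castList L) → 0 < θ → θ < 3 ℕ.+ g → 0 < r₁ → 2 ℕ.* w ≤ B ℕ.* Q →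
      (r₁ ℕ.+ d) ℕ.* ((3 ℕ.+ g) ℕ.* (3 ℕ.+ g) ℕ.+ (3 ℕ.+ g)) ≤ d ℕ.* ((2 ℕ.+ g) ℕ.* (2 ℕ.* (3 ℕ.+ g) ℕ.+ 1)) →
      (2 ℕ.+ g) ℕ.* B ℕ.+ 2 ℕ.+ 12 ℕ.* (3 ℕ.+ g) < 8 ℕ.* (θ ℕ.* (3 ℕ.+ g)) →
      (∀ {m} (K : Combination m) → Dichotomy 2 K → 0 < weight K →
        θ ℕ.* ((r₁ ℕ.+ d) ℕ.+ g ℕ.* r₁) ℕ.* q ℕ.^ m ≤ (3 ℕ.+ g) ℕ.* (3 ℕ.+ g) ℕ.* (r₁ ℕ.+ d) ℕ.* weight K → θ ℕ.* q ℕ.^ m ≤ q ℕ.* weight K) →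
      Periodic c
    two-secants⇒periodic g θ r₁ d B e 7≤g D 0<θ θ<q 0<r₁ w≤ ratio sparse improve with ℕₚ.<-≤-connex w ((2 ℕ.* q ℕ.+ 1) ℕ.* Q)
    ... | inj₁ w< = small⇒periodic L w upper upper₀ lower (ℕₚ.≤-trans (ℕₚ.m≤m+n 3 g) (ℕₚ.≤-reflexive (sym e))) w<
    ... | inj₂ w≥ = Middle.middle⇒periodic L w upper upper₀ lower 1 g θ r₁ (r₁ ℕ.+ d) B e (s≤s (s≤s z≤n)) (ℕₚ.≤-trans (s≤s (s≤s (s≤s z≤n))) 7≤g)
        (ℕₚ.≤-trans (ℕₚ.+-monoʳ-≤ 3 7≤g) (ℕₚ.≤-reflexive (sym e))) D 0<θ (subst (θ <_) (sym e) θ<q) 0<r₁ (ℕₚ.≤-trans 0<r₁ (ℕₚ.m≤m+n r₁ d)) w≤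
        (ratio₂ L w upper upper₀ lower r₁ d (subst (λ z → (r₁ ℕ.+ d) ℕ.* (z ℕ.* z ℕ.+ z) ≤ d ℕ.* ((z ∸ 1) ℕ.* (2 ℕ.* z ℕ.+ 1))) (sym e) ratio) w≥)
        (subst (λ z → (z ∸ 1) ℕ.* B ℕ.+ 2 ℕ.+ 12 ℕ.* z < 8 ℕ.* (θ ℕ.* z)) (sym e) sparse)
        (λ {m} K DK 0<K hK → improve K DK 0<K (subst (λ z → θ ℕ.* ((r₁ ℕ.+ d) ℕ.+ g ℕ.* r₁) ℕ.* q ℕ.^ m ≤ z ℕ.* z ℕ.* (r₁ ℕ.+ d) ℕ.* weight K) e hK))

    dichotomy₂-from : ∀ g B → q ≡ 3 ℕ.+ g → 2 ℕ.* w ≤ B ℕ.* Q → (2 ℕ.+ g) ℕ.* ((2 ℕ.+ g) ℕ.* B ℕ.+ 2) < 2 ℕ.* ((3 ℕ.+ g) ℕ.* (3 ℕ.+ g) ℕ.* (3 ℕ.* g)) → Dichotomy 2 (castList L)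
    dichotomy₂-from g B e w≤ h = dichotomy-from L w upper upper₀ lower 2 g B e w≤ (subst (λ z → (z ∸ 1) ℕ.* ((z ∸ 1) ℕ.* B ℕ.+ 2) < 2 ℕ.* (z ℕ.* z ℕ.* (3 ℕ.* g))) (sym e) h)

    private
      lt : ∀ {m n} {t : Bool.T (m <ᵇ n)} → m < n
      lt {m} {n} {t} = ℕₚ.<ᵇ⇒< m n t
      le : ∀ {m n} {t : Bool.T (m ≤ᵇ n)} → m ≤ n
      le {m} {n} {t} = ℕₚ.≤ᵇ⇒≤ m n t

    -- θ / q is the density that one bootstrap step gives to the covering hyperplanes, and e the excess driving that step.
    one-boot : ∀ g θ s r₁ d e B → q ≡ 3 ℕ.+ g → {_ : Bool.T (3 ℕ.+ g ≡ᵇ θ ℕ.+ s)} → {_ : Bool.T (6 <ᵇ g)} → 2 ℕ.* w ≤ B ℕ.* Q → {_ : Bool.T (0 <ᵇ θ)} → {_ : Bool.T (θ <ᵇ 3 ℕ.+ g)} → {_ : Bool.T (0 <ᵇ r₁)} →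
      {_ : Bool.T ((2 ℕ.+ g) ℕ.* ((2 ℕ.+ g) ℕ.* B ℕ.+ 2) <ᵇ 2 ℕ.* ((3 ℕ.+ g) ℕ.* (3 ℕ.+ g) ℕ.* (3 ℕ.* g)))} →
      {_ : Bool.T ((r₁ ℕ.+ d) ℕ.* ((3 ℕ.+ g) ℕ.* (3 ℕ.+ g) ℕ.+ (3 ℕ.+ g)) ≤ᵇ d ℕ.* ((2 ℕ.+ g) ℕ.* (2 ℕ.* (3 ℕ.+ g) ℕ.+ 1)))} →
      {_ : Bool.T ((2 ℕ.+ g) ℕ.* B ℕ.+ 2 ℕ.+ 12 ℕ.* (3 ℕ.+ g) <ᵇ 8 ℕ.* (θ ℕ.* (3 ℕ.+ g)))} →
      let a = θ ℕ.* ((r₁ ℕ.+ d) ℕ.+ g ℕ.* r₁); b = (3 ℕ.+ g) ℕ.* (3 ℕ.+ g) ℕ.* (r₁ ℕ.+ d) in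
      {_ : Bool.T (a ℕ.* (2 ℕ.+ g) ≡ᵇ 2 ℕ.* b ℕ.+ e)} → {_ : Bool.T (0 <ᵇ (1 ℕ.+ g) ℕ.* e)} →
      {_ : Bool.T (θ ℕ.* (a ℕ.* 2 ℕ.* (2 ℕ.+ g)) ≤ᵇ s ℕ.* ((1 ℕ.+ g) ℕ.* e))} →
      Periodic c
    one-boot g θ s r₁ d e B q≡ {t₀} {t₁} w≤ {t₂} {t₃} {t₄} {t₅} {t₆} {t₇} {t₈} {t₉} {t₁₀} =
      two-secants⇒periodic g θ r₁ d B q≡ (lt {t = t₁}) (dichotomy₂-from g B q≡ w≤ (lt {t = t₅})) (lt {t = t₂}) (lt {t = t₃}) (lt {t = t₄}) w≤ (le {t = t₆}) (lt {t = t₇})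
        (Improve.improve₁ L w upper upper₀ lower 2 g θ q≡ s (trans q≡ (ℕₚ.≡ᵇ⇒≡ (3 ℕ.+ g) (θ ℕ.+ s) t₀)) (θ ℕ.* ((r₁ ℕ.+ d) ℕ.+ g ℕ.* r₁)) ((3 ℕ.+ g) ℕ.* (3 ℕ.+ g) ℕ.* (r₁ ℕ.+ d)) e (ℕₚ.≡ᵇ⇒≡ _ _ t₈) (lt {t = t₉}) (le {t = t₁₀}))

    -- One bootstrap step lifts the density 416 / 1452 only to 11304 / 19624, short of 8 / 11; a
    -- second step from there passes it.
    eleven⇒periodic : q ≡ 11 → 2 ℕ.* w ≤ 49 ℕ.* Q → Periodic c
    eleven⇒periodic q≡ w≤ = two-secants⇒periodic 8 8 5 7 49 q≡ le (dichotomy₂-from 8 49 q≡ w≤ lt) lt lt lt w≤ le lt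
      (λ K D 0<K h → Improve.improve₁ L w upper upper₀ lower 2 8 8 q≡ 3 q≡ 11304 19624 73792 refl lt le K D 0<K
         (Long.boot 2 8 q≡ K D 416 1452 1256 0<K h refl))

    private
      large₂⇒periodic : ∀ d {g θ B X Y} → g ≡ 26 ℕ.+ d → θ ≡ 22 ℕ.+ d → B ≡ 166 ℕ.+ 8 ℕ.* d → X ≡ (30 ℕ.+ d) ℕ.* (28 ℕ.+ d) → Y ≡ 832 ℕ.+ 58 ℕ.* d ℕ.+ d ℕ.* d →
        q ≡ 3 ℕ.+ g → q ≡ θ ℕ.+ 7 → 7 ≤ g → 0 < θ → 0 < Y → 2 ℕ.* w ≤ B ℕ.* Q →
        q ℕ.* W < W ℕ.+ q ℕ.* (q ℕ.* Q) ℕ.* (3 ℕ.* g) → Periodic c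
      large₂⇒periodic d {g} {θ} {B} {X} {Y} g≡ θ≡ B≡ X≡ Y≡ q≡ q≡′ 7≤g 0<θ 0<Y w≤ h =
        two-secants⇒periodic g θ 1 3 B q≡ 7≤g (dichotomy (castList L) 2 g q≡ h) 0<θ (subst (θ <_) (trans (sym q≡′) q≡) (ℕₚ.m<m+n θ (s≤s z≤n))) (s≤s z≤n) w≤
          (ratio₂-large d g≡) (sparse-large d (cong (2 ℕ.+_) g≡) θ≡ B≡)
          (Improve.improve₁ L w upper upper₀ lower 2 g θ q≡ 7 q≡′ (θ ℕ.* (4 ℕ.+ g ℕ.* 1)) ((3 ℕ.+ g) ℕ.* (3 ℕ.+ g) ℕ.* 4) (Y ℕ.+ (13 ℕ.+ d) ℕ.* X) (excess₂ d g≡ θ≡ X≡ Y≡)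
            (ℕₚ.≤-trans 0<Y (ℕₚ.≤-trans (ℕₚ.m≤m+n Y ((13 ℕ.+ d) ℕ.* X)) (ℕₚ.m≤n*m _ (1 ℕ.+ g)))) (gain₂ d Y g≡ θ≡ X≡))

      large₃⇒periodic : ∀ d {g θ B Y} → g ≡ 25 ℕ.+ d → θ ≡ 22 ℕ.+ d → B ≡ 166 ℕ.+ 8 ℕ.* d → Y ≡ 268 ℕ.+ 38 ℕ.* d ℕ.+ d ℕ.* d →
        q ≡ 4 ℕ.+ g → q ≡ θ ℕ.+ 7 → 6 ≤ g → 0 < θ → 0 < Y → 2 ℕ.* w ≤ B ℕ.* Q →
        W ℕ.+ q ℕ.* (q ℕ.* Q) ℕ.* (3 ℕ.* (1 ℕ.+ g)) ≤ q ℕ.* W → Periodic c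
      large₃⇒periodic d {g} {θ} {B} {Y} g≡ θ≡ B≡ Y≡ q≡ q≡′ 6≤g 0<θ 0<Y w≤ h =
        Middle.middle⇒periodic L w upper upper₀ lower 2 g θ 1 4 B q≡ (s≤s (s≤s (s≤s z≤n))) (ℕₚ.≤-trans (s≤s (s≤s (s≤s (s≤s z≤n)))) 6≤g)
          (ℕₚ.≤-trans (ℕₚ.+-monoʳ-≤ 4 6≤g) (ℕₚ.≤-reflexive (sym q≡)))
          (dichotomy-from L w upper upper₀ lower 3 g B q≡ w≤ (dichotomy₃-large d (ℕₚ.≤-trans (s≤s z≤n) (ℕₚ.≤-reflexive (sym q≡))) g≡ B≡))
          0<θ (subst (θ <_) (sym q≡′) (ℕₚ.m<m+n θ (s≤s z≤n))) (s≤s z≤n) (s≤s z≤n) w≤ (ratio₃-large d q≡ g≡ h)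
          (subst (λ z → (z ∸ 1) ℕ.* B ℕ.+ 2 ℕ.+ 12 ℕ.* z < 8 ℕ.* (θ ℕ.* z)) (sym q≡) (sparse-large d (cong (3 ℕ.+_) g≡) θ≡ B≡))
          (Improve.improve₁ L w upper upper₀ lower 3 g θ q≡ 7 q≡′ (θ ℕ.* (4 ℕ.+ g ℕ.* 1)) (q ℕ.* q ℕ.* 4) ((4 ℕ.+ g) ℕ.* Y)
            (trans (excess₃ d g≡ θ≡ Y≡) (cong (λ z → 3 ℕ.* (z ℕ.* z ℕ.* 4) ℕ.+ (4 ℕ.+ g) ℕ.* Y) (sym q≡)))
            (ℕₚ.≤-trans 0<Y (ℕₚ.≤-trans (ℕₚ.m≤n*m Y (4 ℕ.+ g)) (ℕₚ.m≤n*m _ (1 ℕ.+ g)))) (gain₃ d g≡ θ≡ Y≡))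

    -- Divides the weights by whether the gap holds with k = 2. If W is too large for that, it is
    -- large enough for the wider margin k = 3.
    large⇒periodic : ∀ d → q ≡ 29 ℕ.+ d → 2 ℕ.* w ≤ (166 ℕ.+ 8 ℕ.* d) ℕ.* Q → Periodic c
    large⇒periodic d q≡ w≤ with ℕₚ.<-≤-connex (q ℕ.* W) (W ℕ.+ q ℕ.* (q ℕ.* Q) ℕ.* (3 ℕ.* (26 ℕ.+ d)))
    ... | inj₁ h = large₂⇒periodic d refl refl refl refl refl q≡ (trans q≡ (order≡ d)) (ℕₚ.≤-trans le (ℕₚ.m≤m+n 26 d)) (s≤s z≤n) (s≤s z≤n) w≤ h
    ... | inj₂ h = large₃⇒periodic d refl refl refl refl q≡ (trans q≡ (order≡ d)) (ℕₚ.≤-trans le (ℕₚ.m≤m+n 25 d)) (s≤s z≤n) (s≤s z≤n) w≤ h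

    private
      composite : ∀ r s {tr : True (prime? r)} {ts : True (prime? s)} → r ≢ s → ∀ {m} → q ≡ m → r ∣ m → s ∣ m → Periodic c
      composite r s {tr} {ts} r≢s refl r∣ s∣ = ⊥-elim (not-prime-power {h = h} r s (toWitness {a? = prime? r} tr) (toWitness {a? = prime? s} ts) r≢s pr q≡pʰ r∣ s∣)

      small : ∀ m → q ≡ m → {_ : Bool.T (2 <ᵇ m)} → w ≤ 2 ℕ.* m ℕ.^ suc M → Periodic c
      small m refl {t} w≤ = small⇒periodic L w upper upper₀ lower (ℕₚ.<ᵇ⇒< 2 m t) (begin-strict
        w                            ≤⟨ w≤ ⟩
        2 ℕ.* (q ℕ.* Q)              <⟨ ℕₚ.m<m+n _ (ℕₚ.m^n>0 q M) ⟩
        2 ℕ.* (q ℕ.* Q) ℕ.+ Q        ≡⟨ lem q Q ⟩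
        (2 ℕ.* q ℕ.+ 1) ℕ.* Q        ∎)
        where
        open ℕₚ.≤-Reasoning
        instance
          q≢0′ : NonZero q
          q≢0′ = ℕ.≢-nonZero q≢0
        lem : ∀ q Q → 2 ℕ.* (q ℕ.* Q) ℕ.+ Q ≡ (2 ℕ.* q ℕ.+ 1) ℕ.* Q
        lem = solve-∀

      narrow : ∀ m G → q ≡ m → 2 ℕ.* w ≤ G ℕ.* m ℕ.^ M → {_ : Bool.T (2 <ᵇ m)} → {_ : Bool.T (G <ᵇ 4 ℕ.* m ℕ.+ 2)} → Periodic c
      narrow m G refl w≤ {t} {u} = small⇒periodic L w upper upper₀ lower (ℕₚ.<ᵇ⇒< 2 m t) (ℕₚ.*-cancelˡ-< 2 _ _ (begin-strict
        2 ℕ.* w                            ≤⟨ w≤ ⟩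
        G ℕ.* Q                            <⟨ ℕₚ.*-monoˡ-< Q {{ℕ.>-nonZero (ℕₚ.m^n>0 q {{ℕ.≢-nonZero q≢0}} M)}} (ℕₚ.<ᵇ⇒< G (4 ℕ.* q ℕ.+ 2) u) ⟩
        (4 ℕ.* q ℕ.+ 2) ℕ.* Q              ≡⟨ lem q Q ⟩
        2 ℕ.* ((2 ℕ.* q ℕ.+ 1) ℕ.* Q)      ∎))
        where
        open ℕₚ.≤-Reasoning
        lem : ∀ q Q → (4 ℕ.* q ℕ.+ 2) ℕ.* Q ≡ 2 ℕ.* ((2 ℕ.* q ℕ.+ 1) ℕ.* Q)
        lem = solve-∀

      at : ∀ G {m} → q ≡ m → 2 ℕ.* w ≤ G ℕ.* m ℕ.^ M → 2 ℕ.* w ≤ G ℕ.* Q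
      at G e = subst (λ z → 2 ℕ.* w ≤ G ℕ.* z ℕ.^ M) (sym e)

      raise : ∀ {G G′} → G ≤ G′ → 2 ℕ.* w ≤ G ℕ.* Q → 2 ℕ.* w ≤ G′ ℕ.* Q
      raise G≤ w≤ = ℕₚ.≤-trans w≤ (ℕₚ.*-monoˡ-≤ Q G≤)

      -- The last two numbers given to sqrt-bound are an integer r ≤ √(4 β q) and the G with 2 w ≤ G q^M that it yields.
      by-order : ∀ m → q ≡ m → WithinBound (2 ℕ.+ M) m w → Periodic c
      by-order 0 e b = ⊥-elim (q≢0 e)
      by-order 1 e b = ⊥-elim (ℕₚ.<⇒≢ 0<q-1 (sym (cong (_∸ 1) e)))
      by-order 2 e b = binary⇒periodic e (castList L)
      by-order 3 e b = small 3 e b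
      by-order 4 e b = small 4 e b
      by-order 5 e b = small 5 e b
      by-order 6 e b = small 6 e b
      -- 29 is below 4 q + 2 = 30, so order 7 still belongs to the case of two hyperplanes.
      by-order 7 e b = narrow 7 29 e (sqrt-bound {3} {6} {ℤ.- (pos 1)} {M} {7} {w} b 12 29 refl le)
      by-order 8 e b = small 8 e b
      by-order 9 e b = small 9 e b
      by-order 10 e b = composite 2 5 (λ ()) e (divides 5 refl) (divides 2 refl)
      by-order 11 e b = eleven⇒periodic e (at 49 e (sqrt-bound {3} {6} {ℤ.- (pos 1)} {M} {11} {w} b 16 49 refl le))
      by-order 12 e b = composite 2 3 (λ ()) e (divides 6 refl) (divides 4 refl)
      by-order 13 e b = one-boot 10 9 4 7 9 3880 60 e (at 60 e (sqrt-bound {3} {6} {ℤ.- (pos 1)} {M} {13} {w} b 17 60 refl le))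
      by-order 14 e b = composite 2 7 (λ ()) e (divides 7 refl) (divides 2 refl)
      by-order 15 e b = composite 3 5 (λ ()) e (divides 5 refl) (divides 3 refl)
      by-order 16 e b = small 16 e b
      by-order 17 e b = one-boot 14 12 5 4 5 7278 81 e (at 81 e (sqrt-bound {3} {6} {ℤ.- (pos 1)} {M} {17} {w} b 20 81 refl le))
      by-order 18 e b = composite 2 3 (λ ()) e (divides 9 refl) (divides 6 refl)
      by-order 19 e b = one-boot 16 14 5 4 5 11898 102 e (at 102 e (sqrt-bound {3} {6} {pos 9} {M} {19} {w} b 21 102 refl le))
      by-order 20 e b = composite 2 5 (λ ()) e (divides 10 refl) (divides 4 refl)
      by-order (10+ (10+ 1)) e b = composite 3 7 (λ ()) e (divides 7 refl) (divides 3 refl)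
      by-order (10+ (10+ 2)) e b = composite 2 11 (λ ()) e (divides 11 refl) (divides 2 refl)
      by-order (10+ (10+ 3)) e b = one-boot 20 17 6 4 5 23764 124 e (at 124 e (sqrt-bound {4} {8} {ℤ.- (pos 33)} {M} {23} {w} b 27 124 refl le))
      by-order (10+ (10+ 4)) e b = composite 2 3 (λ ()) e (divides 12 refl) (divides 8 refl)
      by-order (10+ (10+ 5)) e b = small 25 e b
      by-order (10+ (10+ 6)) e b = composite 2 13 (λ ()) e (divides 13 refl) (divides 2 refl)
      by-order (10+ (10+ 7)) e b = small 27 e b
      by-order (10+ (10+ 8)) e b = composite 2 7 (λ ()) e (divides 14 refl) (divides 4 refl)
      by-order (10+ (10+ 9)) e b = large⇒periodic 0 e (raise {164} {166 ℕ.+ 8 ℕ.* 0} le (at 164 e (sqrt-bound {4} {16} {ℤ.- (pos 25)} {M} {29} {w} b 43 164 refl le)))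
      by-order (10+ (10+ (10+ 0))) e b = composite 2 3 (λ ()) e (divides 15 refl) (divides 10 refl)
      by-order (10+ (10+ (10+ 1))) e b = large⇒periodic 2 e (raise {180} {166 ℕ.+ 8 ℕ.* 2} le (at 180 e (sqrt-bound {4} {16} {ℤ.- (pos 25)} {M} {31} {w} b 43 180 refl le)))
      by-order (10+ (10+ (10+ 2))) e b = large⇒periodic 3 e (raise {188} {166 ℕ.+ 8 ℕ.* 3} le (at 188 e (sqrt-bound {4} {16} {ℤ.- (pos 25)} {M} {32} {w} b 43 188 refl le)))
      by-order (10+ (10+ (10+ 3))) e b = composite 3 11 (λ ()) e (divides 11 refl) (divides 3 refl)
      by-order (10+ (10+ (10+ 4))) e b = composite 2 17 (λ ()) e (divides 17 refl) (divides 2 refl)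
      by-order (10+ (10+ (10+ 5))) e b = composite 5 7 (λ ()) e (divides 7 refl) (divides 5 refl)
      by-order (10+ (10+ (10+ 6))) e b = composite 2 3 (λ ()) e (divides 18 refl) (divides 12 refl)
      -- Among the orders from 37 on only 49 and 121 have bounds of their own, at d = 12 and d = 84.
      by-order (10+ (10+ (10+ (suc (suc (suc (suc (suc (suc (suc d)))))))))) e b with d ≡ᵇ 12 | d ≡ᵇ 84
      ... | true | _ = small (37 ℕ.+ d) e b
      -- For 121 the crude root 10 suffices, since the leading term 3 q is far below 4 q.
      ... | false | true = large⇒periodic (8 ℕ.+ d) e (raise {221 ℕ.+ 6 ℕ.* d} {166 ℕ.+ 8 ℕ.* (8 ℕ.+ d)} (≤-from (9 ℕ.+ 2 ℕ.* d) (lem₁ d)) (at (221 ℕ.+ 6 ℕ.* d) {37 ℕ.+ d} e (sqrt-bound {3} {6} {pos 9} {M} {37 ℕ.+ d} {w} b 10 (221 ℕ.+ 6 ℕ.* d) (cong pos (lem₂ d))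
          (ℕₚ.≤-trans le (ℕₚ.*-monoʳ-≤ 24 (ℕₚ.m≤m+n 37 d))))))
        where
        lem₁ : ∀ d → 221 ℕ.+ 6 ℕ.* d ℕ.+ (9 ℕ.+ 2 ℕ.* d) ≡ 166 ℕ.+ 8 ℕ.* (8 ℕ.+ d)
        lem₁ = solve-∀
        lem₂ : ∀ d → 2 ℕ.* 3 ℕ.* (37 ℕ.+ d) ℕ.+ 9 ≡ 10 ℕ.+ (221 ℕ.+ 6 ℕ.* d)
        lem₂ = solve-∀
      -- 34 is the integer part of the root of 32 times 37 and serves all larger orders too. It
      -- gives 2 w ≤ (8 q - 67) q^M, one unit inside 8 q - 66.
      ... | false | false = large⇒periodic (8 ℕ.+ d) e (raise {229 ℕ.+ 8 ℕ.* d} {166 ℕ.+ 8 ℕ.* (8 ℕ.+ d)} (≤-from 1 (lem₁ d)) (at (229 ℕ.+ 8 ℕ.* d) {37 ℕ.+ d} e (sqrt-bound {4} {8} {ℤ.- (pos 33)} {M} {37 ℕ.+ d} {w} b 34 (229 ℕ.+ 8 ℕ.* d) (cong (λ z → pos z ℤ.+ ℤ.- (pos 33)) (lem₂ d))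
          (ℕₚ.≤-trans le (ℕₚ.*-monoʳ-≤ 32 (ℕₚ.m≤m+n 37 d))))))
        where
        lem₁ : ∀ d → 229 ℕ.+ 8 ℕ.* d ℕ.+ 1 ≡ 166 ℕ.+ 8 ℕ.* (8 ℕ.+ d)
        lem₁ = solve-∀
        lem₂ : ∀ d → 2 ℕ.* 4 ℕ.* (37 ℕ.+ d) ≡ 33 ℕ.+ (34 ℕ.+ (229 ℕ.+ 8 ℕ.* d))
        lem₂ = solve-∀

    bounded⇒periodic : WithinBound (2 ℕ.+ M) q w → Periodic c
    bounded⇒periodic = by-order q refl

-- Counting normalised vectors

listSum : ∀ {A : Set} → (A → ℕ) → List A → ℕ
listSum f [] = 0
listSum f (x ∷ xs) = f x ℕ.+ listSum f xs

listSum-++ : ∀ {A : Set} (f : A → ℕ) xs ys → listSum f (xs ++ ys) ≡ listSum f xs ℕ.+ listSum f ys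
listSum-++ f [] ys = refl
listSum-++ f (x ∷ xs) ys = trans (cong (f x ℕ.+_) (listSum-++ f xs ys)) (sym (ℕₚ.+-assoc (f x) _ _))

listSum-map : ∀ {A B : Set} (f : B → ℕ) (g : A → B) xs → listSum f (map g xs) ≡ listSum (λ x → f (g x)) xs
listSum-map f g [] = refl
listSum-map f g (x ∷ xs) = cong (f (g x) ℕ.+_) (listSum-map f g xs)

listSum-concatMap : ∀ {A B : Set} (f : B → ℕ) (g : A → List B) xs → listSum f (concatMap g xs) ≡ listSum (λ x → listSum f (g x)) xs
listSum-concatMap f g [] = refl
listSum-concatMap f g (x ∷ xs) = trans (listSum-++ f (g x) (concatMap g xs)) (cong (listSum f (g x) ℕ.+_) (listSum-concatMap f g xs))

listSum-tabulate : ∀ {A : Set} {n} (f : A → ℕ) (g : Fin n → A) → listSum f (tabulate g) ≡ ∑ (λ i → f (g i))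
listSum-tabulate {n = zero} f g = sym (∑-nil _)
listSum-tabulate {n = suc n} f g = trans (cong (f (g zero) ℕ.+_) (listSum-tabulate f (λ i → g (suc i)))) (sym (∑-suc _))

indicator : Bool → ℕ
indicator b = if b then 1 else 0

indicator-¬? : ∀ {A : Set} {n} (A? : Dec A) → (A → n ≡ 0) → (¬ A → n ≡ 1) → indicator (does (¬? A?)) ≡ n
indicator-¬? (yes a) h₀ h₁ = sym (h₀ a)
indicator-¬? (no ¬a) h₀ h₁ = sym (h₁ ¬a)

length-filter² : ∀ {A : Set} (N : A → Bool) {P : A → Set} (P? : Decidable P) xs →
  length (filter P? (filter (λ x → N x Bool.≟ true) xs)) ≡ listSum (λ x → indicator (N x) ℕ.* indicator (does (P? x))) xs
length-filter² N P? [] = refl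
length-filter² N P? (x ∷ xs) with N x
... | false = length-filter² N P? xs
... | true with does (P? x)
...   | false = length-filter² N P? xs
...   | true = cong suc (length-filter² N P? xs)

module Projective {q : ℕ} (𝔽 : FinField q) where
  open Counting 𝔽

  -- The sum of G over the vectors whose first nonzero coordinate is 1.
  normSum : ∀ {k} → (Vec F k → ℕ) → ℕ
  normSum {zero} G = 0
  normSum {suc k} G = ΣV (λ v → G (1# ∷ v)) ℕ.+ normSum (λ v → G (0# ∷ v))

  -- Every nonzero vector is a nonzero multiple of exactly one vector with first nonzero coordinate
  -- 1; the zero vector is left over.
  ΣV-homogeneous : ∀ {k} (G : Vec F k → ℕ) → (∀ {r} → r ≢ 0# → ∀ x → G (r · x) ≡ G x) → ΣV G ≡ q-1 ℕ.* normSum G ℕ.+ G 𝟎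
  ΣV-homogeneous {zero} G h = trans (ΣV-[] G) (cong (ℕ._+ G []) (sym (ℕₚ.*-zeroʳ q-1)))
  ΣV-homogeneous {suc k} G h = trans (ΣV-∷ G) (ℕₚ.+-cancelʳ-≡ T _ _ (begin
      ∑ S ℕ.+ T                                    ≡⟨ ∑-two 0# S (ΣV-homogeneous (λ v → G (0# ∷ v)) homogeneous₀) (λ a a≢0 → homogeneous₁ a≢0) ⟩
      (q-1 ℕ.* N ℕ.+ G 𝟎) ℕ.+ q ℕ.* T              ≡⟨ cong (λ z → (q-1 ℕ.* N ℕ.+ G 𝟎) ℕ.+ z ℕ.* T) q≡1+q-1 ⟩
      (q-1 ℕ.* N ℕ.+ G 𝟎) ℕ.+ (T ℕ.+ q-1 ℕ.* T)    ≡⟨ lem q-1 N T (G 𝟎) ⟩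
      q-1 ℕ.* (T ℕ.+ N) ℕ.+ G 𝟎 ℕ.+ T              ∎))
    where
    open ≡-Reasoning
    S : F → ℕ
    S a = ΣV (λ v → G (a ∷ v))
    T N : ℕ
    T = S 1#
    N = normSum (λ v → G (0# ∷ v))
    homogeneous₀ : ∀ {r} → r ≢ 0# → ∀ x → G (0# ∷ r · x) ≡ G (0# ∷ x)
    homogeneous₀ {r} r≢0 x = trans (cong (λ z → G (z ∷ r · x)) (sym (zeroʳ r))) (h r≢0 (0# ∷ x))
    homogeneous₁ : ∀ {a} → a ≢ 0# → S a ≡ T
    homogeneous₁ {a} a≢0 = trans (sym (ΣV-scale a≢0 (λ v → G (a ∷ v)))) (ΣV-cong (λ v → trans (cong (λ z → G (z ∷ a · v)) (sym (*-identityʳ a))) (h a≢0 (1# ∷ v))))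
    lem : ∀ r N T o → (r ℕ.* N ℕ.+ o) ℕ.+ (T ℕ.+ r ℕ.* T) ≡ r ℕ.* (T ℕ.+ N) ℕ.+ o ℕ.+ T
    lem = solve-∀

-- Transfer between an arbitrary field of order q and its model on `Fin q`

module Transfer {q : ℕ} (𝕂 : FiniteField q) where
  private
    module K = FiniteField 𝕂
    module P = PG 𝕂
  open K using (enum; enum-inj; enum-surj) renaming (_≈_ to infix 4 _≈_)

  index : K.Carrier → Fin q
  index x = proj₁ (enum-surj x)

  enum-index : ∀ x → enum (index x) ≈ x
  enum-index x = proj₂ (enum-surj x)

  index-enum : ∀ i → index (enum i) ≡ i
  index-enum i = enum-inj _ _ (enum-index (enum i))

  index-cong : ∀ {x y} → x ≈ y → index x ≡ index y
  index-cong {x} {y} e = enum-inj _ _ (K.trans (enum-index x) (K.trans e (K.sym (enum-index y))))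

  enum-cong : ∀ {i j} → i ≡ j → enum i ≈ enum j
  enum-cong refl = K.refl

  private
    raw : RawRing 0ℓ 0ℓ
    raw = record
      { Carrier = Fin q ; _≈_ = _≡_
      ; _+_ = λ i j → index (enum i K.+ enum j) ; _*_ = λ i j → index (enum i K.* enum j) ; -_ = λ i → index (K.- enum i)
      ; 0# = index K.0# ; 1# = index K.1# }

    monomorphism : IsRingMonomorphism raw K.rawRing enum
    monomorphism = record
      { isRingHomomorphism = record
        { isSemiringHomomorphism = record
          { isNearSemiringHomomorphism = record
            { +-isMonoidHomomorphism = record
              { isMagmaHomomorphism = record { isRelHomomorphism = record { cong = enum-cong } ; homo = λ _ _ → enum-index _ }
              ; ε-homo = enum-index _ }
            ; *-homo = λ _ _ → enum-index _ }
          ; 1#-homo = enum-index _ }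
        ; -‿homo = λ _ → enum-index _ }
      ; injective = λ {i} {j} → enum-inj i j }

  -- The structure pulled back along `enum`: a ring monomorphism reflects the commutative ring laws,
  -- so only inverses and 1 ≠ 0 are supplied by hand.
  𝔽 : FinField q
  𝔽 = record
    { _+_ = RawRing._+_ raw ; _*_ = RawRing._*_ raw ; -_ = RawRing.-_ raw ; 0# = RawRing.0# raw ; 1# = RawRing.1# raw
    ; isCommutativeRing = RingMonomorphism.isCommutativeRing monomorphism K.isCommutativeRing
    ; 1≢0 = λ e → K.1≉0 (K.trans (K.sym (enum-index _)) (K.trans (enum-cong e) (enum-index _)))
    ; inv = λ x x≢0 → let y , xy = K.inverse (enum x) (λ e → x≢0 (trans (sym (index-enum x)) (index-cong e))) in
        index y , index-cong (K.trans (K.*-cong K.refl (enum-index y)) xy) }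

  open Counting 𝔽
  open Projective 𝔽

  enum-0 : enum 0# ≈ K.0#
  enum-0 = enum-index K.0#

  enum-≈0 : ∀ {a} → enum a ≈ K.0# → a ≡ 0#
  enum-≈0 {a} e = trans (sym (index-enum a)) (index-cong e)

  coordinates : ∀ {k} → P.Vect k → Vec F k
  coordinates {zero} x = []
  coordinates {suc k} x = index (x zero) ∷ coordinates (λ i → x (suc i))

  -- The empty vector is read off allVecs, since two absurd lambdas are not definitionally equal.
  vect : ∀ {k} → Vec F k → P.Vect k
  vect [] = List.lookup (P.allVecs 0) zero
  vect (a ∷ v) = P.cons (enum a) (vect v)

  coordinates-cong : ∀ {k} {x y : P.Vect k} → (∀ i → x i ≈ y i) → coordinates x ≡ coordinates y
  coordinates-cong {zero} h = refl
  coordinates-cong {suc k} h = cong₂ _∷_ (index-cong (h zero)) (coordinates-cong (λ i → h (suc i)))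

  coordinates-vect : ∀ {k} (v : Vec F k) → coordinates (vect v) ≡ v
  coordinates-vect [] = refl
  coordinates-vect (a ∷ v) = cong₂ _∷_ (index-enum a) (coordinates-vect v)

  coordinates-0 : ∀ {k} → coordinates {k} (λ _ → K.0#) ≡ 𝟎
  coordinates-0 {zero} = refl
  coordinates-0 {suc k} = cong (0# ∷_) coordinates-0

  coordinates≡𝟎⇒≈0 : ∀ {k} (x : P.Vect k) → coordinates x ≡ 𝟎 → ∀ i → x i ≈ K.0#
  coordinates≡𝟎⇒≈0 x e zero = K.trans (K.sym (enum-index (x zero))) (K.trans (enum-cong (cong head e)) enum-0)
  coordinates≡𝟎⇒≈0 x e (suc i) = coordinates≡𝟎⇒≈0 (λ j → x (suc j)) (cong tail e) i

  ≈0⇒coordinates≡𝟎 : ∀ {k} {x : P.Vect k} → (∀ i → x i ≈ K.0#) → coordinates x ≡ 𝟎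
  ≈0⇒coordinates≡𝟎 h = trans (coordinates-cong h) coordinates-0

  enum-dot : ∀ {k} (a x : P.Vect k) → enum (dot (coordinates a) (coordinates x)) ≈ P.dot a x
  enum-dot {zero} a x = enum-0
  enum-dot {suc k} a x = K.trans (enum-index _) (K.+-cong (K.trans (enum-index _) (K.*-cong (enum-index _) (enum-index _))) (enum-dot (λ i → a (suc i)) (λ i → x (suc i))))

  vect-⊕ : ∀ {k} (x y : Vec F k) i → vect (x ⊕ y) i ≈ vect x i K.+ vect y i
  vect-⊕ (a ∷ x) (b ∷ y) zero = enum-index _
  vect-⊕ (a ∷ x) (b ∷ y) (suc i) = vect-⊕ x y i

  vect-· : ∀ {k} r (x : Vec F k) i → vect (r · x) i ≈ enum r K.* vect x i
  vect-· r (a ∷ x) zero = enum-index _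
  vect-· r (a ∷ x) (suc i) = vect-· r x i

  vect-𝟎 : ∀ {k} i → vect (𝟎 {k}) i ≈ K.0#
  vect-𝟎 {suc k} zero = enum-0
  vect-𝟎 {suc k} (suc i) = vect-𝟎 {k} i

  vect-comb : ∀ {m k} (t : Fin m → K.Carrier) (us : Vec (Vec F k) m) i →
    vect (comb (coordinates t) us) i ≈ P.sumF m (λ j → t j K.* vect (lookup us j) i)
  vect-comb t [] i = vect-𝟎 i
  vect-comb t (u ∷ us) i = K.trans (vect-⊕ (index (t zero) · u) _ i)
    (K.+-cong (K.trans (vect-· (index (t zero)) u i) (K.*-cong (enum-index _) K.refl)) (vect-comb (λ j → t (suc j)) us i))

  indep⇒linIndep : ∀ {m k} {us : Vec (Vec F k) m} → Indep us → P.LinIndep (λ j → vect (lookup us j))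
  indep⇒linIndep {us = us} indep t h = coordinates≡𝟎⇒≈0 t (indep (coordinates t)
    (trans (sym (coordinates-vect _)) (≈0⇒coordinates≡𝟎 (λ i → K.trans (vect-comb t us i) (h i)))))

  dots≡𝟎⇒dot≈0 : ∀ {m k} (a : Vec F k) (us : Vec (Vec F k) m) → dots a us ≡ 𝟎 → ∀ j → P.dot (vect a) (vect (lookup us j)) ≈ K.0#
  dots≡𝟎⇒dot≈0 a (u ∷ us) e zero = K.trans (K.sym (enum-dot (vect a) (vect u)))
    (K.trans (enum-cong (trans (cong₂ dot (coordinates-vect a) (coordinates-vect u)) (cong head e))) enum-0)
  dots≡𝟎⇒dot≈0 a (u ∷ us) e (suc j) = dots≡𝟎⇒dot≈0 a us (cong tail e) j

  incidence-δ : ∀ {k} (a x : P.Vect k) → ⟦ P.incidence a x ⟧ ≡ δ (dot (coordinates a) (coordinates x))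
  incidence-δ a x with P.dot a x K.≟ K.0#
  ... | yes e = trans (+-identityʳ 1#) (sym (δ-0 (enum-≈0 (K.trans (enum-dot a x) e))))
  ... | no n = sym (δ-≢0 (λ e → n (K.trans (K.sym (enum-dot a x)) (K.trans (enum-cong e) enum-0))))

  combination : ∀ {n} → P.Combination n → List (ℕ × Vec F (suc n))
  combination = map (λ (α , a) → α , coordinates a)

  fromCombination : ∀ {n} → List (ℕ × Vec F (suc n)) → P.Combination n
  fromCombination = map (λ (α , a) → α , vect a)

  combination-from : ∀ {n} (L : List (ℕ × Vec F (suc n))) → combination (fromCombination L) ≡ L
  combination-from [] = refl
  combination-from ((α , a) ∷ L) = cong₂ _∷_ (cong (α ,_) (coordinates-vect a)) (combination-from L)

  total : ∀ {n} → P.Combination n → P.Vect (suc n) → ℕ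
  total L x = foldr (λ t s → proj₁ t ℕ.* P.incidence (proj₂ t) x ℕ.+ s) 0 L

  ⟦total⟧ : ∀ {n} (L : P.Combination n) x → ⟦ total L x ⟧ ≡ code (castList (combination L)) (coordinates x)
  ⟦total⟧ [] x = refl
  ⟦total⟧ ((α , a) ∷ L) x = trans (⟦⟧-+ (α ℕ.* P.incidence a x) (total L x))
    (cong₂ _+_ (trans (⟦⟧-* α _) (cong (⟦ α ⟧ *_) (incidence-δ a x))) (⟦total⟧ L x))

  listSum-allVecs : ∀ k (g : P.Vect k → ℕ) → listSum g (P.allVecs k) ≡ ΣV (λ v → g (vect v))
  listSum-allVecs zero g = trans (ℕₚ.+-identityʳ _) (sym (ΣV-[] _))
  listSum-allVecs (suc k) g = begin
    listSum g (concatMap (λ a → map (P.cons a) (P.allVecs k)) (map enum (allFin q)))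
      ≡⟨ listSum-concatMap g (λ a → map (P.cons a) (P.allVecs k)) (map enum (allFin q)) ⟩
    listSum (λ a → listSum g (map (P.cons a) (P.allVecs k))) (map enum (allFin q))
      ≡⟨ listSum-map _ enum (allFin q) ⟩
    listSum (λ i → listSum g (map (P.cons (enum i)) (P.allVecs k))) (allFin q)
      ≡⟨ listSum-tabulate {n = q} (λ i → listSum g (map (P.cons (enum i)) (P.allVecs k))) (λ i → i) ⟩
    ∑ {q} (λ i → listSum g (map (P.cons (enum i)) (P.allVecs k)))
      ≡⟨ ∑-cong {q} (λ i → trans (listSum-map g (P.cons (enum i)) (P.allVecs k)) (listSum-allVecs k (λ v → g (P.cons (enum i) v)))) ⟩
    ∑ {q} (λ i → ΣV (λ v → g (P.cons (enum i) (vect v))))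
      ≡⟨ ΣV-∷ (λ v → g (vect v)) ⟨
    ΣV (λ v → g (vect v)) ∎
    where open ≡-Reasoning

  private
    norm : ∀ {k} → Vec F k → ℕ
    norm v = indicator (P.normalized (vect v))

    norm-0 : ∀ {k} (v : Vec F k) → norm (0# ∷ v) ≡ norm v
    norm-0 v with enum 0# K.≟ K.0#
    ... | yes _ = refl
    ... | no n = ⊥-elim (n enum-0)

    norm-1 : ∀ {k} (v : Vec F k) → norm (1# ∷ v) ≡ 1
    norm-1 v with enum 1# K.≟ K.0#
    ... | yes e = ⊥-elim (1≢0 (enum-≈0 e))
    ... | no _ with enum 1# K.≟ K.1#
    ...   | yes _ = refl
    ...   | no n = ⊥-elim (n (enum-index K.1#))

    norm-other : ∀ {k} a (v : Vec F k) → a ≢ 1# → a ≢ 0# → norm (a ∷ v) ≡ 0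
    norm-other a v a≢1 a≢0 with enum a K.≟ K.0#
    ... | yes e = ⊥-elim (a≢0 (enum-≈0 e))
    ... | no _ with enum a K.≟ K.1#
    ...   | yes e = ⊥-elim (a≢1 (trans (sym (index-enum a)) (index-cong e)))
    ...   | no _ = refl

  Σ-norm : ∀ {k} (H : Vec F k → ℕ) → ΣV (λ v → norm v ℕ.* H v) ≡ normSum H
  Σ-norm {zero} H = ΣV-[] _
  Σ-norm {suc k} H = trans (ΣV-∷ _) (trans (ℕSum.∑-double {q} (λ a → ΣV (λ v → norm (a ∷ v) ℕ.* H (a ∷ v))) 1≢0
      (λ a a≢1 a≢0 → ℕSum.ΣV-zero (λ v → cong (ℕ._* H (a ∷ v)) (norm-other a v a≢1 a≢0))))
    (cong₂ ℕ._+_ (ΣV-cong (λ v → trans (cong (ℕ._* H (1# ∷ v)) (norm-1 v)) (ℕₚ.*-identityˡ _)))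
      (trans (ΣV-cong (λ v → cong (ℕ._* H (0# ∷ v)) (norm-0 v))) (Σ-norm (λ v → H (0# ∷ v))))))

  module _ (p h : ℕ) (pr : Prime p) (q≡pʰ : q ≡ p ℕ.^ h) (1≤h : 1 ≤ h) .{{_ : NonZero p}} where
    open Cases 𝔽 p h pr q≡pʰ 1≤h using (⟦%⟧; ⟦⟧-cong-%; bounded⇒periodic)

    module _ {n} (L : P.Combination n) where
      private
        c = code (castList (combination L))
        W = weight (castList (combination L))
        w = P.wt n p L

        value : ∀ v → ⟦ total L (vect v) ⟧ ≡ c v
        value v = trans (⟦total⟧ L (vect v)) (cong c (coordinates-vect v))

        0<p : 0 < p
        0<p = ℕₚ.<-trans (s≤s z≤n) (ℕ.nonTrivial⇒n>1 p {{prime⇒nonTrivial pr}})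

        -- The total of the coefficients is 0 modulo `p` exactly when its image in the field is 0,
        -- because `⟦⟧-cong-%` reads residues off the image.
        support : ∀ v → indicator (does (¬? (P.eval p L (vect v) ℕₚ.≟ 0))) ≡ nz (c v)
        support v = indicator-¬? (P.eval p L (vect v) ℕₚ.≟ 0)
          (λ e → nz-0 (trans (sym (value v)) (trans (⟦%⟧ (total L (vect v))) (cong ⟦_⟧ e))))
          (λ n → nz-1 (λ e → n (trans (⟦⟧-cong-% {total L (vect v)} {0} (trans (value v) e)) (m<n⇒m%n≡m {p} {0} {{ℕ.>-nonZero 0<p}} 0<p))))

      wt-normSum : w ≡ normSum (λ v → nz (c v))
      wt-normSum = trans (length-filter² P.normalized (λ x → ¬? (P.eval p L x ℕ.≟ 0)) (P.allVecs (suc n)))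
        (trans (listSum-allVecs (suc n) _) (trans (ΣV-cong (λ v → cong (norm v ℕ.*_) (support v))) (Σ-norm (λ v → nz (c v)))))

      weight≡ : W ≡ q-1 ℕ.* w ℕ.+ nz (c 𝟎)
      weight≡ = trans (ΣV-homogeneous (λ v → nz (c v)) (λ r≢0 x → cong nz (code-· (castList (combination L)) r≢0 x)))
        (cong (λ z → q-1 ℕ.* z ℕ.+ nz (c 𝟎)) (sym wt-normSum))

      upper : W ≤ q-1 ℕ.* w ℕ.+ 1
      upper = ℕₚ.≤-trans (ℕₚ.≤-reflexive weight≡) (ℕₚ.+-monoʳ-≤ (q-1 ℕ.* w) (nz≤1 (c 𝟎)))

      upper₀ : c 𝟎 ≡ 0# → W ≤ q-1 ℕ.* w
      upper₀ e = ℕₚ.≤-reflexive (trans weight≡ (trans (cong (q-1 ℕ.* w ℕ.+_) (nz-0 e)) (ℕₚ.+-identityʳ _)))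

      lower : q-1 ℕ.* w ≤ W
      lower = ℕₚ.≤-trans (ℕₚ.m≤m+n (q-1 ℕ.* w) (nz (c 𝟎))) (ℕₚ.≤-reflexive (sym weight≡))

      Cone : ℕ → Set
      Cone M = Σ (Fin M → P.Vect (suc n)) λ κ → P.LinIndep κ
        × Σ (P.Combination n) λ L′ → P.AllHyperplanes L′
          × All (λ t → ∀ j → P.dot (proj₂ t) (κ j) ≈ K.0#) L′
          × (∀ x → P.eval p L x ≡ P.eval p L′ x)

      transfer-cone : ∀ {M} → (∃ λ (κ : Vec (Vec F (suc n)) M) → Indep κ ×
        ∃ λ (L′ : List (ℕ × Vec F (suc n))) → All (λ t → proj₂ t ≢ 𝟎) L′ × All (λ t → dots (proj₂ t) κ ≡ 𝟎) L′
          × (∀ x → c x ≡ code (castList L′) x)) → Cone M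
      transfer-cone (κ , indep , L′ , nonzero , contains , same) =
        (λ j → vect (lookup κ j)) , indep⇒linIndep indep , fromCombination L′ ,
        Allₚ.map⁺ (All.map (λ {t} t≢𝟎 h → t≢𝟎 (trans (sym (coordinates-vect (proj₂ t))) (≈0⇒coordinates≡𝟎 h))) nonzero) ,
        Allₚ.map⁺ (All.map (λ {t} e → dots≡𝟎⇒dot≈0 (proj₂ t) κ e) contains) ,
        (λ x → ⟦⟧-cong-% {total L x} {total (fromCombination L′) x} (trans (⟦total⟧ L x) (trans (same (coordinates x))
          (sym (trans (⟦total⟧ (fromCombination L′) x) (cong (λ K → code (castList K) (coordinates x)) (combination-from L′)))))))

-- The cone over the given field

module Conclusion {q : ℕ} (𝕂 : FiniteField q) (p h : ℕ) (pr : Prime p) (q≡pʰ : q ≡ p ℕ.^ h) (1≤h : 1 ≤ h) .{{_ : NonZero p}} {M : ℕ}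
  (L : PG.Combination 𝕂 (suc (suc M))) where
  open Transfer 𝕂
  open Cases 𝔽 p h pr q≡pʰ 1≤h using (bounded⇒periodic; periodic⇒cone)

  cone : WithinBound (suc (suc M)) q (PG.wt 𝕂 (suc (suc M)) p L) → Cone p h pr q≡pʰ 1≤h L M
  cone bound = transfer-cone p h pr q≡pʰ 1≤h L (periodic⇒cone (combination L) (bounded⇒periodic (combination L) (PG.wt 𝕂 (suc (suc M)) p L)
    (upper p h pr q≡pʰ 1≤h L) (upper₀ p h pr q≡pʰ 1≤h L) (lower p h pr q≡pʰ 1≤h L) bound))

open import Data.Nat using (_^_)

theorem3p4 : (n p h q : ℕ) → 3 ≤ n → Prime p → 1 ≤ h → q ≡ p ^ h → .{{_ : NonZero p}}
    → (F : FiniteField q)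
    → (L : PG.Combination F n) → PG.AllHyperplanes F L → WithinBound n q (PG.wt F n p L)
    → Σ (Fin (n ∸ 2) → PG.Vect F (suc n)) λ κ → PG.LinIndep F κ
      × Σ (PG.Combination F n) λ L' → PG.AllHyperplanes F L'
        × All (λ t → ∀ j → FiniteField._≈_ F (PG.dot F (proj₂ t) (κ j)) (FiniteField.0# F)) L'
        × (∀ x → PG.normalized F x ≡ true → PG.eval F p L x ≡ PG.eval F p L' x)
-- With n = M + 2, the subspace κ of projective dimension n - 3 is spanned by `M` vectors.
theorem3p4 (suc (suc M)) p h q _ p-prime 1≤h q≡pʰ F L _ bound =
  conclude (Conclusion.cone F p h p-prime q≡pʰ 1≤h L bound)
  where
  conclude : Transfer.Cone F p h p-prime q≡pʰ 1≤h L M → _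
  conclude (κ , indep , L′ , nonzero , contains , same) = κ , indep , L′ , nonzero , contains , λ x _ → same x
theorem3p4 1 p h q (s≤s ())
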